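{- Let $(f_n(\bar x,\bar\epsilon))\in\mathsf{VP}^0_{\mathsf{nb}}$, where $\bar\epsilon$ is a tuple of $q(n)$ variables for some polynomial $q$. Let $$g_n(\bar x)=\sum_{\bar\epsilon\in\{0,1\}^{q(n)}}f_n(\bar x,\bar\epsilon)\quad\text{and}\quad h_n(\bar x)=\prod_{\bar\epsilon\in\{0,1\}^{q(n)}}f_n(\bar x,\bar\epsilon).$$ If $\mathsf{VNP}^0=\mathsf{VP}^0$, then $(g_n)$ and $(h_n)$ are in $\mathsf{VP}^0_{\mathsf{nb}}$.
   Context: Arithmetic circuits have inputs that are indeterminates or constants and gates $+,-,\times$; size is the number of gates. A constant-free circuit uses only the constant $1$. The formal degree of a circuit is defined inductively: inputs have formal degree $1$, a $+$ or $-$ gate has the maximum of the formal degrees of its inputs, a $\times$ gate has the sum; the formal degree of the circuit is that of its output gate. $\mathsf{VP}^0_{\mathsf{nb}}$: families $(f_n)$ of polynomials (with a number of variables polynomial in $n$) computed by constant-free circuits of size polynomial in $n$, with no degree bound. $\mathsf{VP}^0$: families computed by constant-free circuits of size and formal degree polynomial in $n$. $\mathsf{VNP}^0$: families $(f_n(\bar x))$ such that $f_n(\bar x)=\sum_{\bar\epsilon\in\{0,1\}^{p(n)}}g_n(\bar x,\bar\epsilon)$ for some $(g_n(\bar x,\bar y))\in\mathsf{VP}^0$ and polynomial $p$ with $|\bar y|=p(n)$. -}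

module Defs where

open import Data.Nat using (ℕ; zero; suc; _+_; _*_; _^_; _≤_; _⊔_)
open import Data.Fin using (Fin; zero; suc; splitAt)
open import Data.Bool using (Bool; true; false; if_then_else_)
open import Data.Vec using (Vec; []; _∷_; lookup)
open import Data.List using (List; []; _∷_; map; _++_; foldr)
open import Data.Sum using (_⊎_; inj₁; inj₂)
open import Data.Product using (Σ; ∃; ∃-syntax; _×_; _,_)

-- Polynomials with integer coefficients in n indeterminates x₀ … x_{n-1}:
-- ℤ[x] is the free commutative ring on the indeterminates, i.e. terms
-- modulo the congruence generated by the commutative-ring axioms.

infixl 6 _⊕_
infixl 7 _⊗_

data Poly (n : ℕ) : Set where
  var  : Fin n → Poly n
  𝟘 𝟙  : Poly n
  _⊕_  : Poly n → Poly n → Poly n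
  _⊗_  : Poly n → Poly n → Poly n
  ⊖_   : Poly n → Poly n

infix 4 _≈_

data _≈_ {n : ℕ} : Poly n → Poly n → Set where
  ≈-refl  : ∀ {a} → a ≈ a
  ≈-sym   : ∀ {a b} → a ≈ b → b ≈ a
  ≈-trans : ∀ {a b c} → a ≈ b → b ≈ c → a ≈ c
  ⊕-cong  : ∀ {a b c d} → a ≈ b → c ≈ d → a ⊕ c ≈ b ⊕ d
  ⊗-cong  : ∀ {a b c d} → a ≈ b → c ≈ d → a ⊗ c ≈ b ⊗ d
  ⊖-cong  : ∀ {a b} → a ≈ b → ⊖ a ≈ ⊖ b
  ⊕-assoc : ∀ a b c → (a ⊕ b) ⊕ c ≈ a ⊕ (b ⊕ c)
  ⊕-comm  : ∀ a b → a ⊕ b ≈ b ⊕ a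
  ⊕-idˡ   : ∀ a → 𝟘 ⊕ a ≈ a
  ⊖-invˡ  : ∀ a → (⊖ a) ⊕ a ≈ 𝟘
  ⊗-assoc : ∀ a b c → (a ⊗ b) ⊗ c ≈ a ⊗ (b ⊗ c)
  ⊗-comm  : ∀ a b → a ⊗ b ≈ b ⊗ a
  ⊗-idˡ   : ∀ a → 𝟙 ⊗ a ≈ a
  distribʳ : ∀ a b c → (a ⊕ b) ⊗ c ≈ (a ⊗ c) ⊕ (b ⊗ c)

subst : ∀ {n m} → (Fin n → Poly m) → Poly n → Poly m
subst σ (var i) = σ i
subst σ 𝟘 = 𝟘
subst σ 𝟙 = 𝟙
subst σ (a ⊕ b) = subst σ a ⊕ subst σ b
subst σ (a ⊗ b) = subst σ a ⊗ subst σ b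
subst σ (⊖ a) = ⊖ subst σ a

instantiate : ∀ {a b} → Poly (a + b) → Vec Bool b → Poly a
instantiate {a} f ε = subst σ f
  where
  σ : Fin (a + _) → Poly a
  σ i with splitAt a i
  ... | inj₁ j = var j
  ... | inj₂ j = if lookup ε j then 𝟙 else 𝟘

cube : (k : ℕ) → List (Vec Bool k)
cube zero = [] ∷ []
cube (suc k) = map (true ∷_) (cube k) ++ map (false ∷_) (cube k)

Σpoly : ∀ {n} → List (Poly n) → Poly n
Σpoly = foldr _⊕_ 𝟘

Πpoly : ∀ {n} → List (Poly n) → Poly n
Πpoly = foldr _⊗_ 𝟙

boolSum : ∀ {a b} → Poly (a + b) → Poly a
boolSum {b = b} f = Σpoly (map (instantiate f) (cube b))

boolProd : ∀ {a b} → Poly (a + b) → Poly a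
boolProd {b = b} f = Πpoly (map (instantiate f) (cube b))

-- Constant-free arithmetic circuits (straight-line programs).
-- Inputs: indeterminates or the constant 1.  Gates: +, -, ×.
-- A circuit with k gates: gate i may use inputs and earlier gates.
-- (de Bruijn style: in `C ▷ g`, `g` refers to gates of C by Fin k,
--  and in the resulting circuit the newest gate is `zero`.)

data Input (n : ℕ) : Set where
  x   : Fin n → Input n
  one : Input n

Wire : ℕ → ℕ → Set
Wire n k = Input n ⊎ Fin k

data Op : Set where
  plus minus times : Op

record Gate (n k : ℕ) : Set where
  constructor gate
  field
    op  : Op
    lhs : Wire n k
    rhs : Wire n k

infixl 5 _▷_

data Gates (n : ℕ) : ℕ → Set where
  ∅   : Gates n 0
  _▷_ : ∀ {k} → Gates n k → Gate n k → Gates n (suc k)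

record Circuit (n : ℕ) : Set where
  constructor circuit
  field
    size   : ℕ
    gates  : Gates n size
    output : Wire n size
open Circuit public

inputVal : ∀ {n} → Input n → Poly n
inputVal (x i) = var i
inputVal one = 𝟙

opVal : ∀ {n} → Op → Poly n → Poly n → Poly n
opVal plus a b = a ⊕ b
opVal minus a b = a ⊕ (⊖ b)
opVal times a b = a ⊗ b

wireVal : ∀ {n k} → (Fin k → Poly n) → Wire n k → Poly n
wireVal v (inj₁ i) = inputVal i
wireVal v (inj₂ j) = v j

gateVals : ∀ {n k} → Gates n k → Fin k → Poly n
gateVals (C ▷ gate o l r) zero = opVal o (wireVal (gateVals C) l) (wireVal (gateVals C) r)
gateVals (C ▷ g) (suc j) = gateVals C j

eval : ∀ {n} → Circuit n → Poly n
eval C = wireVal (gateVals (gates C)) (output C)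

opDeg : Op → ℕ → ℕ → ℕ
opDeg plus a b = a ⊔ b
opDeg minus a b = a ⊔ b
opDeg times a b = a + b

wireDeg : ∀ {n k} → (Fin k → ℕ) → Wire n k → ℕ
wireDeg d (inj₁ i) = 1
wireDeg d (inj₂ j) = d j

gateDegs : ∀ {n k} → Gates n k → Fin k → ℕ
gateDegs (C ▷ gate o l r) zero = opDeg o (wireDeg (gateDegs C) l) (wireDeg (gateDegs C) r)
gateDegs (C ▷ g) (suc j) = gateDegs C j

formalDegree : ∀ {n} → Circuit n → ℕ
formalDegree C = wireDeg (gateDegs (gates C)) (output C)

PolyBounded : (ℕ → ℕ) → Set
PolyBounded s = ∃[ c ] ((n : ℕ) → s n ≤ c + n ^ c)

record Family : Set where
  constructor family
  field
    nvars : ℕ → ℕ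
    poly  : (n : ℕ) → Poly (nvars n)
open Family public

VP0nb : Family → Set
VP0nb F = PolyBounded (nvars F) ×
  Σ ((n : ℕ) → Circuit (nvars F n)) λ C → (((n : ℕ) → eval (C n) ≈ poly F n) ×
          PolyBounded (λ n → size (C n)))

VP0 : Family → Set
VP0 F = PolyBounded (nvars F) ×
  Σ ((n : ℕ) → Circuit (nvars F n)) λ C → (((n : ℕ) → eval (C n) ≈ poly F n) ×
          PolyBounded (λ n → size (C n)) ×
          PolyBounded (λ n → formalDegree (C n)))

VNP0 : Family → Set
VNP0 F = ∃[ p ] (PolyBounded p ×
  Σ ((n : ℕ) → Poly (nvars F n + p n)) λ g →
    VP0 (family (λ n → nvars F n + p n) g) ×
    ((n : ℕ) → poly F n ≈ boolSum {nvars F n} {p n} (g n)))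

VNP0≡VP0 : Set
VNP0≡VP0 = (F : Family) → (VNP0 F → VP0 F) × (VP0 F → VNP0 F)

-- Call a function from boolean words to ℕ feasible if it is computed by polynomial-size formulas that may sum
-- over booleans.  If VNP⁰ = VP⁰, such a formula has a polynomial-size circuit, and this circuit is simulated
-- modulo a power of two by summing over the words carried by its gates.  So the binary digits of a feasible
-- function are feasible, and the class is closed under exponential sums, comparison, division, and evaluation of
-- circuits modulo p; discrete logarithms to a primitive root add exponential products modulo primes.
--
-- Kronecker substitution packs the coefficients of g or h into one integer N with exponentially many digits.
-- Its residues modulo small primes are feasible, and its digits are recovered from them by Chinese remaindering,
-- with 2 ^ −i approximated by products of fractions (D − 1) / 2 D where D is a large product of small odd primes.
-- The digits of N being feasible, the sum over all positions of digit times monomial is a VNP⁰ polynomial with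
-- the repeated squares of the variables and of 2 substituted into it, hence has a polynomial-size circuit.

module Submission where

open import Defs
open import Data.Bool using (Bool; true; false; if_then_else_; not)
open import Data.Empty using (⊥; ⊥-elim)
open import Data.Unit using (⊤; tt)
open import Data.Nat hiding (_/_; _%_; less; greater; equal; compare; parity)
open import Data.Nat.Properties hiding (_≟_)
open import Data.Nat.Divisibility using (_∣_; divides; ∣-trans; ∣-refl; ∣m⇒∣m*n; ∣n⇒∣m*n; ∣m∣n⇒∣m+n; ∣m+n∣m⇒∣n; ∣⇒≤; _∣?_; *-monoʳ-∣; *-monoˡ-∣; *-cancelˡ-∣; 1∣_; _∣0)
import Data.Nat.DivMod as DM
open import Data.Nat.Primality using (Prime; prime?; prime[2]; euclidsLemma; prime⇒irreducible; irreducible⇒prime; prime⇒nonZero; prime⇒nonTrivial)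
open import Data.Nat.Coprimality using (Coprime; coprime-divisor)
open import Data.Nat.Induction using (<-rec)
import Data.Nat.Tactic.RingSolver as NS
open import Data.Integer using (ℤ; -[1+_]; 0ℤ; 1ℤ) renaming (+_ to pos)
import Data.Integer as ℤ
import Data.Integer.Properties as ℤₚ
import Data.Integer.DivMod as ℤD
import Data.Integer.Tactic.RingSolver as ZS
open import Data.Fin using (Fin; zero; suc; _↑ˡ_; _↑ʳ_; splitAt; toℕ; fromℕ<)
open import Data.Fin.Properties using (splitAt-↑ˡ; splitAt-↑ʳ; splitAt⁻¹-↑ˡ; splitAt⁻¹-↑ʳ; toℕ-↑ˡ; toℕ-↑ʳ; toℕ<n; toℕ-fromℕ<; pigeonhole)
open import Data.Vec using (Vec; []; _∷_; lookup; tabulate; replicate)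
import Data.Vec as Vec
import Data.Vec.Properties as Vecₚ
open import Data.List using (List; []; _∷_; map; length) renaming (_++_ to _++ₗ_)
open import Data.Maybe using (Maybe; just; nothing)
open import Data.Product using (Σ; ∃; ∃-syntax; _×_; _,_; proj₁; proj₂)
open import Data.Sum using (_⊎_; inj₁; inj₂)
open import Function using (_∘_)
open import Relation.Nullary using (¬_; Dec; yes; no)
open import Relation.Nullary.Decidable using (_×-dec_; ¬?)
open import Relation.Binary.PropositionalEquality using (_≡_; _≢_; refl; sym; trans; cong; cong₂; module ≡-Reasoning) renaming (subst to transport)
open import Relation.Binary using (tri<; tri≈; tri>)
open import Algebra using (CommutativeRing)
import Algebra.Properties.Ring as RingProperties
open import Level using (0ℓ)
import Data.List.Properties as Listₚ
open import Data.Nat.Primality.Factorisation using (factorise)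
open import Data.Nat.ListAction using (product)
open import Data.List.Relation.Unary.All using (All; []; _∷_)
import Data.List.Relation.Unary.All as Allₚ
import Data.List.Relation.Unary.All.Properties as AllPₚ

-- Two constraints shape the construction. Membership in VP⁰ bounds the formal degree, so the
-- hypothesis is fed only with expressions of polynomial tree size; monomials of exponential degree
-- enter as placeholder variables, and their repeated squares are substituted after the collapse.
-- Formulas count witnesses, so every value guessed by a sum must have exactly one accepted witness;
-- hence the least primitive root and the range bounds in many conditions. As N does not fit into a
-- word of polynomial length, it is read through the fraction N / 2 ^ i modulo 1, which Chinese
-- remaindering turns into a sum of terms c / p. An error of 1 / 64 then still shows the top digit,
-- except close to 0 and to 1 / 2, where the digit is inferred from the last position below at which
-- the error is harmless. Coefficients may be negative, so a constant is added to all of them; the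
-- polynomial this contributes factors, and is subtracted at the end.

≤-slack : ∀ {a b} k → a + k ≡ b → a ≤ b
≤-slack {a} k refl = m≤m+n a k

-- Polynomially bounded functions

PB : (ℕ → ℕ) → Set
-- The base 2 + n is at least 2 for every n, so a sum or a product of two bounds is absorbed by a
-- larger exponent, without a case distinction at n = 0 and n = 1.
PB s = ∃[ c ] ((n : ℕ) → s n ≤ (2 + n) ^ c)

pb-mono : ∀ {s t} → (∀ n → s n ≤ t n) → PB t → PB s
pb-mono h (c , p) = c , λ n → ≤-trans (h n) (p n)

pb-one : PB (λ _ → 1)
pb-one = 0 , λ _ → ≤-refl

pb-+ : ∀ {s t} → PB s → PB t → PB (λ n → s n + t n)
pb-+ {s} {t} (c , p) (d , q) = suc (c + d) , λ n → begin
  s n + t n                       ≤⟨ +-mono-≤ (p n) (q n) ⟩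
  (2 + n) ^ c + (2 + n) ^ d       ≤⟨ +-mono-≤ (^-monoʳ-≤ (2 + n) (m≤m+n c d)) (^-monoʳ-≤ (2 + n) (m≤n+m d c)) ⟩
  (2 + n) ^ (c + d) + (2 + n) ^ (c + d) ≡⟨ double ((2 + n) ^ (c + d)) ⟩
  2 * (2 + n) ^ (c + d)           ≤⟨ *-monoˡ-≤ ((2 + n) ^ (c + d)) (m≤m+n 2 n) ⟩
  (2 + n) * (2 + n) ^ (c + d)     ∎
  where
  open ≤-Reasoning
  double : ∀ a → a + a ≡ 2 * a
  double = NS.solve-∀

pb-* : ∀ {s t} → PB s → PB t → PB (λ n → s n * t n)
pb-* {s} {t} (c , p) (d , q) = c + d , λ n →
  ≤-trans (*-mono-≤ (p n) (q n)) (≤-reflexive (sym (^-distribˡ-+-* (2 + n) c d)))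

pb-const : ∀ k → PB (λ _ → k)
pb-const zero = pb-mono (λ _ → z≤n) pb-one
pb-const (suc k) = pb-+ pb-one (pb-const k)

fromPolyBounded : ∀ {s} → PolyBounded s → PB s
fromPolyBounded {s} (c , p) = pb-mono p (pb-+ (pb-const c) (c , λ n → ^-monoˡ-≤ c (m≤n+m n 2)))

toPolyBounded : ∀ {s} → PB s → PolyBounded s
toPolyBounded {s} (c , p) = C , λ n → ≤-trans (p n) (bound n)
  where
  -- The summand `3 ^ c` covers n = 0 and n = 1; the exponent `c + c` covers n ≥ 2, where 2 + n ≤ n
  -- * n.
  C = 3 ^ c + (c + c)
  bound : ∀ n → (2 + n) ^ c ≤ C + n ^ C
  bound 0 = ≤-trans (^-monoˡ-≤ c (s≤s (s≤s z≤n))) (≤-trans (m≤m+n (3 ^ c) (c + c)) (m≤m+n C (0 ^ C)))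
  bound 1 = ≤-trans (m≤m+n (3 ^ c) (c + c)) (m≤m+n C (1 ^ C))
  bound n@(suc (suc k)) = begin
    (2 + n) ^ c     ≤⟨ ^-monoˡ-≤ c (≤-slack {2 + n} (3 * k + k * k) (h k)) ⟩
    (n * n) ^ c     ≡⟨ sq c ⟩
    n ^ (c + c)     ≤⟨ ^-monoʳ-≤ n (m≤n+m (c + c) (3 ^ c)) ⟩
    n ^ C           ≤⟨ m≤n+m (n ^ C) C ⟩
    C + n ^ C       ∎
    where
    open ≤-Reasoning
    h : ∀ k → 2 + (2 + k) + (3 * k + k * k) ≡ (2 + k) * (2 + k)
    h = NS.solve-∀
    sq : ∀ c → (n * n) ^ c ≡ n ^ (c + c)
    sq zero = refl
    sq (suc c) = trans (cong (n * n *_) (sq c)) (trans (*-assoc n n (n ^ (c + c))) (cong (λ e → n * n ^ e) (sym (+-suc c c))))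

-- Indicators, sums and products over initial segments

data Ind (P : Set) : ℕ → Set where
  holds : P → Ind P 1
  fails : ¬ P → Ind P 0

-- Formulas yield numbers rather than truth values. As long as the number is 0 or 1, it can be
-- multiplied for a conjunction, added for a disjunction of exclusive cases, and used as a weight in
-- a sum.
ind-× : ∀ {P Q a b} → Ind P a → Ind Q b → Ind (P × Q) (a * b)
ind-× (holds p) (holds q) = holds (p , q)
ind-× (holds p) (fails q) = fails (q ∘ proj₂)
ind-× (fails p) _ = fails (p ∘ proj₁)

ind-map : ∀ {P Q a} → (P → Q) → (Q → P) → Ind P a → Ind Q a
ind-map f g (holds p) = holds (f p)
ind-map f g (fails p) = fails (p ∘ g)

ind-yes : ∀ {P a} → Ind P a → P → a ≡ 1
ind-yes (holds _) _ = refl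
ind-yes (fails ¬p) p = ⊥-elim (¬p p)

ind-no : ∀ {P a} → Ind P a → ¬ P → a ≡ 0
ind-no (holds p) ¬p = ⊥-elim (¬p p)
ind-no (fails _) _ = refl

ind-unique : ∀ {P a b} → Ind P a → Ind P b → a ≡ b
ind-unique (holds p) q = sym (ind-yes q p)
ind-unique (fails p) q = sym (ind-no q p)

ind-dec : ∀ {P a} → Ind P a → Dec P
ind-dec (holds p) = yes p
ind-dec (fails p) = no p

ind-cong : ∀ {P a b} → a ≡ b → Ind P a → Ind P b
ind-cong refl i = i

ι? : ∀ {P : Set} → Dec P → ℕ
ι? (yes _) = 1
ι? (no _) = 0

ind-ι? : ∀ {P : Set} (d : Dec P) → Ind P (ι? d)
ind-ι? (yes p) = holds p
ind-ι? (no p) = fails p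

le : ℕ → ℕ → ℕ
le zero b = 1
le (suc a) zero = 0
le (suc a) (suc b) = le a b

eq : ℕ → ℕ → ℕ
eq zero zero = 1
eq zero (suc b) = 0
eq (suc a) zero = 0
eq (suc a) (suc b) = eq a b

ind-le : ∀ a b → Ind (a ≤ b) (le a b)
ind-le zero b = holds z≤n
ind-le (suc a) zero = fails λ ()
ind-le (suc a) (suc b) = ind-map s≤s s≤s⁻¹ (ind-le a b)

ind-eq : ∀ a b → Ind (a ≡ b) (eq a b)
ind-eq zero zero = holds refl
ind-eq zero (suc b) = fails λ ()
ind-eq (suc a) zero = fails λ ()
ind-eq (suc a) (suc b) = ind-map (cong suc) suc-injective (ind-eq a b)

ind-¬ : ∀ {P a} → Ind P a → Ind (¬ P) (eq a 0)
ind-¬ (holds p) = fails (λ q → q p)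
ind-¬ (fails p) = holds p

ind-pos : ∀ a → Ind (1 ≤ a) (le 1 a)
ind-pos = ind-le 1

sumTo : ℕ → (ℕ → ℕ) → ℕ
sumTo zero f = 0
sumTo (suc n) f = sumTo n f + f n

prodTo : ℕ → (ℕ → ℕ) → ℕ
prodTo zero f = 1
prodTo (suc n) f = prodTo n f * f n

sumTo-cong : ∀ n {f g : ℕ → ℕ} → (∀ z → z < n → f z ≡ g z) → sumTo n f ≡ sumTo n g
sumTo-cong zero h = refl
sumTo-cong (suc n) h = cong₂ _+_ (sumTo-cong n (λ z lt → h z (m<n⇒m<1+n lt))) (h n ≤-refl)

prodTo-cong : ∀ n {f g : ℕ → ℕ} → (∀ z → z < n → f z ≡ g z) → prodTo n f ≡ prodTo n g
prodTo-cong zero h = refl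
prodTo-cong (suc n) h = cong₂ _*_ (prodTo-cong n (λ z lt → h z (m<n⇒m<1+n lt))) (h n ≤-refl)

sumTo-zero : ∀ n {f : ℕ → ℕ} → (∀ z → z < n → f z ≡ 0) → sumTo n f ≡ 0
sumTo-zero zero h = refl
sumTo-zero (suc n) h = cong₂ _+_ (sumTo-zero n (λ z lt → h z (m<n⇒m<1+n lt))) (h n ≤-refl)

sumTo-single : ∀ n {f : ℕ → ℕ} z₀ → z₀ < n → (∀ z → z < n → z ≢ z₀ → f z ≡ 0) → sumTo n f ≡ f z₀
sumTo-single (suc n) {f} z₀ lt h with z₀ ≟ n
... | yes refl = cong (_+ f n) (sumTo-zero n (λ z l → h z (m<n⇒m<1+n l) (<⇒≢ l)))
... | no ne = trans (cong₂ _+_ (sumTo-single n z₀ (≤∧≢⇒< (s≤s⁻¹ lt) ne) (λ z l → h z (m<n⇒m<1+n l)))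
                              (h n ≤-refl (ne ∘ sym)))
                    (+-identityʳ _)

sumTo-≤ : ∀ n {f : ℕ → ℕ} b → (∀ z → z < n → f z ≤ b) → sumTo n f ≤ n * b
sumTo-≤ zero b h = z≤n
sumTo-≤ (suc n) b h = ≤-trans (+-mono-≤ (sumTo-≤ n b (λ z lt → h z (m<n⇒m<1+n lt))) (h n ≤-refl))
                             (≤-reflexive (+-comm (n * b) b))

sumTo-*ʳ : ∀ n (f : ℕ → ℕ) a → sumTo n f * a ≡ sumTo n (λ z → f z * a)
sumTo-*ʳ zero f a = refl
sumTo-*ʳ (suc n) f a = trans (*-distribʳ-+ a (sumTo n f) (f n)) (cong (_+ f n * a) (sumTo-*ʳ n f a))

sumTo-add : ∀ n (f g : ℕ → ℕ) → sumTo n (λ z → f z + g z) ≡ sumTo n f + sumTo n g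
sumTo-add zero f g = refl
sumTo-add (suc n) f g = trans (cong (_+ (f n + g n)) (sumTo-add n f g)) (h (sumTo n f) (sumTo n g) (f n) (g n))
  where
  h : ∀ a b c d → a + b + (c + d) ≡ a + c + (b + d)
  h = NS.solve-∀

prodTo-mul : ∀ n (f g : ℕ → ℕ) → prodTo n (λ z → f z * g z) ≡ prodTo n f * prodTo n g
prodTo-mul zero f g = refl
prodTo-mul (suc n) f g = trans (cong (_* (f n * g n)) (prodTo-mul n f g)) (h (prodTo n f) (prodTo n g) (f n) (g n))
  where
  h : ∀ a b c d → a * b * (c * d) ≡ a * c * (b * d)
  h = NS.solve-∀

sumTo-member : ∀ n (f : ℕ → ℕ) z → z < n → f z ≤ sumTo n f
sumTo-member (suc n) f z lt with z ≟ n
... | yes refl = m≤n+m (f n) (sumTo n f)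
... | no ne = ≤-trans (sumTo-member n f z (≤∧≢⇒< (s≤s⁻¹ lt) ne)) (m≤m+n _ (f n))

sumTo-witness : ∀ n (f : ℕ → ℕ) → 1 ≤ sumTo n f → ∃[ z ] (z < n × 1 ≤ f z)
sumTo-witness (suc n) f p with f n in e
... | suc k = n , ≤-refl , ≤-trans (s≤s z≤n) (≤-reflexive (sym e))
... | zero with sumTo-witness n f (≤-trans p (≤-reflexive (+-identityʳ (sumTo n f))))
...   | z , lt , q = z , m<n⇒m<1+n lt , q

ind-positive : ∀ {P a} → Ind P a → 1 ≤ a → P
ind-positive (holds p) _ = p

ind-∃ : ∀ n {P : ℕ → Set} {f : ℕ → ℕ} → (∀ z → z < n → Ind (P z) (f z)) →
        Ind (∃[ z ] (z < n × P z)) (le 1 (sumTo n f))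
ind-∃ n {P} {f} h = ind-map to from (ind-pos (sumTo n f))
  where
  to : 1 ≤ sumTo n f → ∃[ z ] (z < n × P z)
  to p with sumTo-witness n f p
  ... | z , lt , q = z , lt , ind-positive (h z lt) q
  from : ∃[ z ] (z < n × P z) → 1 ≤ sumTo n f
  from (z , lt , p) = ≤-trans (≤-reflexive (sym (ind-yes (h z lt) p))) (sumTo-member n f z lt)

ind-∄ : ∀ n {P : ℕ → Set} {f : ℕ → ℕ} → (∀ z → z < n → Ind (P z) (f z)) →
        Ind (∀ z → z < n → ¬ P z) (eq (sumTo n f) 0)
ind-∄ n {P} {f} h = ind-map to from (ind-eq (sumTo n f) 0)
  where
  to : sumTo n f ≡ 0 → ∀ z → z < n → ¬ P z
  to e z lt p = 1+n≰n (≤-trans (≤-reflexive (sym (ind-yes (h z lt) p))) (≤-trans (sumTo-member n f z lt) (≤-reflexive e)))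
  from : (∀ z → z < n → ¬ P z) → sumTo n f ≡ 0
  from q = sumTo-zero n (λ z lt → ind-no (h z lt) (q z lt))

-- This is how a formula composes functions: a sum over all candidates guesses an intermediate
-- result, the indicator `g` admits one of them, and `F` continues with it. Uniqueness matters,
-- since every further candidate would be counted as well.
sumTo-select : ∀ n {P : ℕ → Set} {g : ℕ → ℕ} (F : ℕ → ℕ) z₀ → z₀ < n → P z₀ →
               (∀ z → z < n → P z → z ≡ z₀) → (∀ z → z < n → Ind (P z) (g z)) →
               sumTo n (λ z → g z * F z) ≡ F z₀
sumTo-select n F z₀ lt p₀ u h = trans
  (sumTo-single n z₀ lt (λ z l ne → cong (_* F z) (ind-no (h z l) (ne ∘ u z l))))
  (trans (cong (_* F z₀) (ind-yes (h z₀ lt) p₀)) (*-identityˡ (F z₀)))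

sumTo-double : ∀ n (F : ℕ → ℕ) → sumTo (2 * n) F ≡ sumTo n (λ z → F (1 + 2 * z)) + sumTo n (λ z → F (2 * z))
sumTo-double zero F = refl
sumTo-double (suc n) F = begin
  sumTo (2 * suc n) F                                ≡⟨ cong (λ k → sumTo k F) (h₁ n) ⟩
  sumTo (2 * n) F + F (2 * n) + F (1 + 2 * n)         ≡⟨ cong (λ a → a + F (2 * n) + F (1 + 2 * n)) (sumTo-double n F) ⟩
  a + b + F (2 * n) + F (1 + 2 * n)                   ≡⟨ h₂ a b (F (2 * n)) (F (1 + 2 * n)) ⟩
  a + F (1 + 2 * n) + (b + F (2 * n))                 ∎
  where
  open ≡-Reasoning
  a = sumTo n (λ z → F (1 + 2 * z))
  b = sumTo n (λ z → F (2 * z))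
  h₁ : ∀ n → 2 * suc n ≡ suc (suc (2 * n))
  h₁ = NS.solve-∀
  h₂ : ∀ a b c d → a + b + c + d ≡ a + d + (b + c)
  h₂ = NS.solve-∀

-- Binary words and sums over the Boolean cube

bit : Bool → ℕ
bit true = 1
bit false = 0

odd : ℕ → Bool
odd zero = false
odd (suc zero) = true
odd (suc (suc n)) = odd n

half : ℕ → ℕ
half zero = 0
half (suc zero) = 0
half (suc (suc n)) = suc (half n)

odd-half : ∀ n → bit (odd n) + 2 * half n ≡ n
odd-half zero = refl
odd-half (suc zero) = refl
odd-half (suc (suc n)) = trans (h (bit (odd n)) (half n)) (cong (λ a → suc (suc a)) (odd-half n))
  where
  h : ∀ a b → a + 2 * suc b ≡ suc (suc (a + 2 * b))
  h = NS.solve-∀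

odd-bit : ∀ b m → odd (bit b + 2 * m) ≡ b
odd-bit true zero = refl
odd-bit false zero = refl
odd-bit b (suc m) = trans (cong odd (h (bit b) m)) (odd-bit b m)
  where
  h : ∀ a m → a + 2 * suc m ≡ suc (suc (a + 2 * m))
  h = NS.solve-∀

half-bit : ∀ b m → half (bit b + 2 * m) ≡ m
half-bit true zero = refl
half-bit false zero = refl
half-bit b (suc m) = trans (cong half (h (bit b) m)) (cong suc (half-bit b m))
  where
  h : ∀ a m → a + 2 * suc m ≡ suc (suc (a + 2 * m))
  h = NS.solve-∀

val : ∀ {k} → Vec Bool k → ℕ
val [] = 0
val (b ∷ w) = bit b + 2 * val w

bits : ∀ k → ℕ → Vec Bool k
bits zero z = []
bits (suc k) z = odd z ∷ bits k (half z)

bit≤1 : ∀ b → bit b ≤ 1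
bit≤1 true = ≤-refl
bit≤1 false = z≤n

val< : ∀ {k} (w : Vec Bool k) → val w < 2 ^ k
val< [] = ≤-refl
val< {suc k} (b ∷ w) = begin-strict
  bit b + 2 * val w     ≤⟨ +-monoˡ-≤ (2 * val w) (bit≤1 b) ⟩
  1 + 2 * val w         <⟨ ≤-reflexive (h (val w)) ⟩
  2 * suc (val w)       ≤⟨ *-monoʳ-≤ 2 (val< w) ⟩
  2 * 2 ^ k             ∎
  where
  open ≤-Reasoning
  h : ∀ a → suc (1 + 2 * a) ≡ 2 * suc a
  h = NS.solve-∀

bits-val : ∀ {k} (w : Vec Bool k) → bits k (val w) ≡ w
bits-val [] = refl
bits-val {suc k} (b ∷ w) = cong₂ _∷_ (odd-bit b (val w)) (trans (cong (bits k) (half-bit b (val w))) (bits-val w))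

half-< : ∀ {z m} → z < 2 * m → half z < m
half-< {z} {m} lt = *-cancelˡ-< 2 (half z) m (≤-<-trans (m≤n+m (2 * half z) (bit (odd z))) (≤-<-trans (≤-reflexive (odd-half z)) lt))

val-bits : ∀ k z → z < 2 ^ k → val (bits k z) ≡ z
val-bits zero zero lt = refl
val-bits zero (suc z) (s≤s ())
val-bits (suc k) z lt = trans (cong (λ a → bit (odd z) + 2 * a) (val-bits k (half z) (half-< {z} lt))) (odd-half z)

sumB : ∀ k → (Vec Bool k → ℕ) → ℕ
sumB zero F = F []
sumB (suc k) F = sumB k (λ w → F (true ∷ w)) + sumB k (λ w → F (false ∷ w))

sumB-cong : ∀ k {F G : Vec Bool k → ℕ} → (∀ w → F w ≡ G w) → sumB k F ≡ sumB k G
sumB-cong zero h = h []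
sumB-cong (suc k) h = cong₂ _+_ (sumB-cong k (λ w → h (true ∷ w))) (sumB-cong k (λ w → h (false ∷ w)))

sumB-val : ∀ k (F : ℕ → ℕ) → sumB k (F ∘ val) ≡ sumTo (2 ^ k) F
sumB-val zero F = refl
sumB-val (suc k) F = trans (cong₂ _+_ (sumB-val k (λ z → F (1 + 2 * z))) (sumB-val k (λ z → F (2 * z))))
                          (sym (sumTo-double (2 ^ k) F))

sumB-++ : ∀ k l (F : Vec Bool (k + l) → ℕ) → sumB (k + l) F ≡ sumB k (λ u → sumB l (λ w → F (u Vec.++ w)))
sumB-++ zero l F = refl
sumB-++ (suc k) l F = cong₂ _+_ (sumB-++ k l (λ w → F (true ∷ w))) (sumB-++ k l (λ w → F (false ∷ w)))

sumB-+ : ∀ k (F G : Vec Bool k → ℕ) → sumB k (λ w → F w + G w) ≡ sumB k F + sumB k G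
sumB-+ zero F G = refl
sumB-+ (suc k) F G = trans (cong₂ _+_ (sumB-+ k _ _) (sumB-+ k _ _)) (h (sumB k _) (sumB k _) (sumB k _) (sumB k _))
  where
  h : ∀ a b c d → a + b + (c + d) ≡ a + c + (b + d)
  h = NS.solve-∀

sumB-*ˡ : ∀ k a (F : Vec Bool k → ℕ) → sumB k (λ w → a * F w) ≡ a * sumB k F
sumB-*ˡ zero a F = refl
sumB-*ˡ (suc k) a F = trans (cong₂ _+_ (sumB-*ˡ k a _) (sumB-*ˡ k a _)) (sym (*-distribˡ-+ a _ _))

sumB-*ʳ : ∀ k a (F : Vec Bool k → ℕ) → sumB k (λ w → F w * a) ≡ sumB k F * a
sumB-*ʳ k a F = trans (sumB-cong k (λ w → *-comm (F w) a)) (trans (sumB-*ˡ k a F) (*-comm a (sumB k F)))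

sumB-select : ∀ k {P : ℕ → Set} (G F : Vec Bool k → ℕ) z₀ → z₀ < 2 ^ k → P z₀ →
              (∀ z → P z → z ≡ z₀) → (∀ w → Ind (P (val w)) (G w)) →
              sumB k (λ w → G w * F w) ≡ F (bits k z₀)
sumB-select k {P} G F z₀ lt p₀ u h = begin
  sumB k (λ w → G w * F w)
    ≡⟨ sumB-cong k (λ w → sym (cong (λ v → G v * F v) (bits-val w))) ⟩
  sumB k (λ w → G (bits k (val w)) * F (bits k (val w)))
    ≡⟨ sumB-val k (λ z → G (bits k z) * F (bits k z)) ⟩
  sumTo (2 ^ k) (λ z → G (bits k z) * F (bits k z))
    ≡⟨ sumTo-select (2 ^ k) {P} (λ z → F (bits k z)) z₀ lt p₀ (λ z _ → u z)
         (λ z l → transport (λ a → Ind (P a) (G (bits k z))) (val-bits k z l) (h (bits k z))) ⟩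
  F (bits k z₀) ∎
  where open ≡-Reasoning

-- Evaluation of polynomials in commutative rings

polyRing : ℕ → CommutativeRing 0ℓ 0ℓ
polyRing n = record
  { Carrier = Poly n ; _≈_ = _≈_ ; _+_ = _⊕_ ; _*_ = _⊗_ ; -_ = ⊖_ ; 0# = 𝟘 ; 1# = 𝟙
  ; isCommutativeRing = record
    { isRing = record
      { +-isAbelianGroup = record
        { isGroup = record
          { isMonoid = record
            { isSemigroup = record
              { isMagma = record
                { isEquivalence = record { refl = ≈-refl ; sym = ≈-sym ; trans = ≈-trans }
                ; ∙-cong = ⊕-cong }
              ; assoc = ⊕-assoc }
            ; identity = ⊕-idˡ , λ a → ≈-trans (⊕-comm a 𝟘) (⊕-idˡ a) }
          ; inverse = ⊖-invˡ , λ a → ≈-trans (⊕-comm a (⊖ a)) (⊖-invˡ a)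
          ; ⁻¹-cong = ⊖-cong }
        ; comm = ⊕-comm }
      ; *-cong = ⊗-cong
      ; *-assoc = ⊗-assoc
      ; *-identity = ⊗-idˡ , λ a → ≈-trans (⊗-comm a 𝟙) (⊗-idˡ a)
      ; distrib = (λ a b c → ≈-trans (⊗-comm a (b ⊕ c))
                     (≈-trans (distribʳ b c a) (⊕-cong (⊗-comm b a) (⊗-comm c a))))
                , (λ a b c → distribʳ b c a) }
    ; *-comm = ⊗-comm } }

-- Used over ℤ for values of circuits, and over `polyRing`, where by `subst-ev` evaluation is
-- substitution; identities for sums over the cube are thus proved once for both.
module Evaluation (R : CommutativeRing 0ℓ 0ℓ) where
  open CommutativeRing R using (0#; 1#; -_; setoid) renaming
    ( Carrier to C; _≈_ to _≋_; _+_ to _+ᴿ_; _*_ to _*ᴿ_; refl to ≋-refl; sym to ≋-sym; trans to ≋-trans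
    ; +-cong to +ᴿ-cong; *-cong to *ᴿ-cong; -‿cong to -ᴿ-cong; +-assoc to +ᴿ-assoc; +-comm to +ᴿ-comm
    ; +-identityˡ to +ᴿ-idˡ; +-identityʳ to +ᴿ-idʳ; -‿inverseˡ to -ᴿ-invˡ; *-assoc to *ᴿ-assoc; *-comm to *ᴿ-comm
    ; *-identityˡ to *ᴿ-idˡ; *-identityʳ to *ᴿ-idʳ; distribʳ to ᴿ-distribʳ; distribˡ to ᴿ-distribˡ
    ; zeroˡ to ᴿ-zeroˡ; zeroʳ to ᴿ-zeroʳ; reflexive to ≋-reflexive ) public

  ev : ∀ {n} → (Fin n → C) → Poly n → C
  ev ρ (var i) = ρ i
  ev ρ 𝟘 = 0#
  ev ρ 𝟙 = 1#
  ev ρ (a ⊕ b) = ev ρ a +ᴿ ev ρ b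
  ev ρ (a ⊗ b) = ev ρ a *ᴿ ev ρ b
  ev ρ (⊖ a) = - ev ρ a

  ev-sound : ∀ {n} (ρ : Fin n → C) {P Q : Poly n} → P ≈ Q → ev ρ P ≋ ev ρ Q
  ev-sound ρ ≈-refl = ≋-refl
  ev-sound ρ (≈-sym p) = ≋-sym (ev-sound ρ p)
  ev-sound ρ (≈-trans p q) = ≋-trans (ev-sound ρ p) (ev-sound ρ q)
  ev-sound ρ (⊕-cong p q) = +ᴿ-cong (ev-sound ρ p) (ev-sound ρ q)
  ev-sound ρ (⊗-cong p q) = *ᴿ-cong (ev-sound ρ p) (ev-sound ρ q)
  ev-sound ρ (⊖-cong p) = -ᴿ-cong (ev-sound ρ p)
  ev-sound ρ (⊕-assoc a b c) = +ᴿ-assoc _ _ _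
  ev-sound ρ (⊕-comm a b) = +ᴿ-comm _ _
  ev-sound ρ (⊕-idˡ a) = +ᴿ-idˡ _
  ev-sound ρ (⊖-invˡ a) = -ᴿ-invˡ _
  ev-sound ρ (⊗-assoc a b c) = *ᴿ-assoc _ _ _
  ev-sound ρ (⊗-comm a b) = *ᴿ-comm _ _
  ev-sound ρ (⊗-idˡ a) = *ᴿ-idˡ _
  ev-sound ρ (distribʳ a b c) = ᴿ-distribʳ _ _ _

  ev-cong : ∀ {n} {ρ τ : Fin n → C} → (∀ i → ρ i ≋ τ i) → ∀ P → ev ρ P ≋ ev τ P
  ev-cong h (var i) = h i
  ev-cong h 𝟘 = ≋-refl
  ev-cong h 𝟙 = ≋-refl
  ev-cong h (a ⊕ b) = +ᴿ-cong (ev-cong h a) (ev-cong h b)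
  ev-cong h (a ⊗ b) = *ᴿ-cong (ev-cong h a) (ev-cong h b)
  ev-cong h (⊖ a) = -ᴿ-cong (ev-cong h a)

  ev-subst : ∀ {n m} (ρ : Fin m → C) (σ : Fin n → Poly m) P → ev ρ (subst σ P) ≡ ev (ev ρ ∘ σ) P
  ev-subst ρ σ (var i) = refl
  ev-subst ρ σ 𝟘 = refl
  ev-subst ρ σ 𝟙 = refl
  ev-subst ρ σ (a ⊕ b) = cong₂ _+ᴿ_ (ev-subst ρ σ a) (ev-subst ρ σ b)
  ev-subst ρ σ (a ⊗ b) = cong₂ _*ᴿ_ (ev-subst ρ σ a) (ev-subst ρ σ b)
  ev-subst ρ σ (⊖ a) = cong -_ (ev-subst ρ σ a)

  ιᵇ : Bool → C
  ιᵇ true = 1#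
  ιᵇ false = 0#

  ι : ℕ → C
  ι zero = 0#
  ι (suc n) = 1# +ᴿ ι n

  ιᵇ-bit : ∀ b → ιᵇ b ≋ ι (bit b)
  ιᵇ-bit true = ≋-sym (+ᴿ-idʳ 1#)
  ιᵇ-bit false = ≋-refl

  ι-+ : ∀ a b → ι (a + b) ≋ ι a +ᴿ ι b
  ι-+ zero b = ≋-sym (+ᴿ-idˡ (ι b))
  ι-+ (suc a) b = ≋-trans (+ᴿ-cong ≋-refl (ι-+ a b)) (≋-sym (+ᴿ-assoc 1# (ι a) (ι b)))

  ι-* : ∀ a b → ι (a * b) ≋ ι a *ᴿ ι b
  ι-* zero b = ≋-sym (ᴿ-zeroˡ (ι b))
  ι-* (suc a) b = ≋-trans (ι-+ b (a * b)) (≋-trans (+ᴿ-cong (≋-sym (*ᴿ-idˡ (ι b))) (ι-* a b))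
                    (≋-sym (ᴿ-distribʳ (ι b) 1# (ι a))))

  env⁺ : ∀ {a b} → (Fin a → C) → (Fin b → C) → Fin (a + b) → C
  env⁺ {a} ρ τ i with splitAt a i
  ... | inj₁ j = ρ j
  ... | inj₂ j = τ j

  env⁺-↑ˡ : ∀ {a b} (ρ : Fin a → C) (τ : Fin b → C) i → env⁺ ρ τ (i ↑ˡ b) ≡ ρ i
  env⁺-↑ˡ {a} {b} ρ τ i rewrite splitAt-↑ˡ a i b = refl

  env⁺-↑ʳ : ∀ {a b} (ρ : Fin a → C) (τ : Fin b → C) i → env⁺ ρ τ (a ↑ʳ i) ≡ τ i
  env⁺-↑ʳ {a} {b} ρ τ i rewrite splitAt-↑ʳ a b i = refl

  ev-instantiate : ∀ {a b} (ρ : Fin a → C) (ε : Vec Bool b) (P : Poly (a + b)) →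
                   ev ρ (instantiate {a} P ε) ≡ ev (env⁺ ρ (ιᵇ ∘ lookup ε)) P
  ev-instantiate {a} ρ ε (var i) with splitAt a i
  ... | inj₁ j = refl
  ... | inj₂ j with lookup ε j
  ...   | true = refl
  ...   | false = refl
  ev-instantiate ρ ε 𝟘 = refl
  ev-instantiate ρ ε 𝟙 = refl
  ev-instantiate ρ ε (P ⊕ Q) = cong₂ _+ᴿ_ (ev-instantiate ρ ε P) (ev-instantiate ρ ε Q)
  ev-instantiate ρ ε (P ⊗ Q) = cong₂ _*ᴿ_ (ev-instantiate ρ ε P) (ev-instantiate ρ ε Q)
  ev-instantiate ρ ε (⊖ P) = cong -_ (ev-instantiate ρ ε P)

  sumR prodR : ∀ k → (Vec Bool k → C) → C
  sumR zero F = F []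
  sumR (suc k) F = sumR k (λ w → F (true ∷ w)) +ᴿ sumR k (λ w → F (false ∷ w))
  prodR zero F = F []
  prodR (suc k) F = prodR k (λ w → F (true ∷ w)) *ᴿ prodR k (λ w → F (false ∷ w))

  sumR-cong : ∀ k {F G : Vec Bool k → C} → (∀ w → F w ≋ G w) → sumR k F ≋ sumR k G
  sumR-cong zero h = h []
  sumR-cong (suc k) h = +ᴿ-cong (sumR-cong k (λ w → h (true ∷ w))) (sumR-cong k (λ w → h (false ∷ w)))

  prodR-cong : ∀ k {F G : Vec Bool k → C} → (∀ w → F w ≋ G w) → prodR k F ≋ prodR k G
  prodR-cong zero h = h []
  prodR-cong (suc k) h = *ᴿ-cong (prodR-cong k (λ w → h (true ∷ w))) (prodR-cong k (λ w → h (false ∷ w)))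

  ι-sumB : ∀ k (F : Vec Bool k → ℕ) → ι (sumB k F) ≋ sumR k (ι ∘ F)
  ι-sumB zero F = ≋-refl
  ι-sumB (suc k) F = ≋-trans (ι-+ (sumB k _) (sumB k _)) (+ᴿ-cong (ι-sumB k _) (ι-sumB k _))

  sumR-*ˡ : ∀ k a (F : Vec Bool k → C) → sumR k (λ w → a *ᴿ F w) ≋ a *ᴿ sumR k F
  sumR-*ˡ zero a F = ≋-refl
  sumR-*ˡ (suc k) a F = ≋-trans (+ᴿ-cong (sumR-*ˡ k a _) (sumR-*ˡ k a _)) (≋-sym (ᴿ-distribˡ a _ _))

  sumR-*ʳ : ∀ k a (F : Vec Bool k → C) → sumR k (λ w → F w *ᴿ a) ≋ sumR k F *ᴿ a
  sumR-*ʳ k a F = ≋-trans (sumR-cong k (λ w → *ᴿ-comm (F w) a)) (≋-trans (sumR-*ˡ k a F) (*ᴿ-comm a _))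

  +ᴿ-interchange : ∀ a b c d → (a +ᴿ b) +ᴿ (c +ᴿ d) ≋ (a +ᴿ c) +ᴿ (b +ᴿ d)
  +ᴿ-interchange a b c d = ≋-trans (+ᴿ-assoc a b (c +ᴿ d)) (≋-trans (+ᴿ-cong ≋-refl
    (≋-trans (≋-sym (+ᴿ-assoc b c d)) (≋-trans (+ᴿ-cong (+ᴿ-comm b c) ≋-refl) (+ᴿ-assoc c b d))))
    (≋-sym (+ᴿ-assoc a c (b +ᴿ d))))

  *ᴿ-interchange : ∀ a b c d → (a *ᴿ b) *ᴿ (c *ᴿ d) ≋ (a *ᴿ c) *ᴿ (b *ᴿ d)
  *ᴿ-interchange a b c d = ≋-trans (*ᴿ-assoc a b (c *ᴿ d)) (≋-trans (*ᴿ-cong ≋-refl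
    (≋-trans (≋-sym (*ᴿ-assoc b c d)) (≋-trans (*ᴿ-cong (*ᴿ-comm b c) ≋-refl) (*ᴿ-assoc c b d))))
    (≋-sym (*ᴿ-assoc a c (b *ᴿ d))))

  sumR-+ : ∀ k (F G : Vec Bool k → C) → sumR k (λ w → F w +ᴿ G w) ≋ sumR k F +ᴿ sumR k G
  sumR-+ zero F G = ≋-refl
  sumR-+ (suc k) F G = ≋-trans (+ᴿ-cong (sumR-+ k _ _) (sumR-+ k _ _)) (+ᴿ-interchange _ _ _ _)

  sumR-++ : ∀ k l (F : Vec Bool (k + l) → C) → sumR (k + l) F ≋ sumR k (λ u → sumR l (λ w → F (u Vec.++ w)))
  sumR-++ zero l F = ≋-refl
  sumR-++ (suc k) l F = +ᴿ-cong (sumR-++ k l _) (sumR-++ k l _)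

  ev-Σpoly-++ : ∀ {n} (ρ : Fin n → C) ps qs → ev ρ (Σpoly (ps ++ₗ qs)) ≋ ev ρ (Σpoly ps) +ᴿ ev ρ (Σpoly qs)
  ev-Σpoly-++ ρ [] qs = ≋-sym (+ᴿ-idˡ _)
  ev-Σpoly-++ ρ (p ∷ ps) qs = ≋-trans (+ᴿ-cong ≋-refl (ev-Σpoly-++ ρ ps qs)) (≋-sym (+ᴿ-assoc _ _ _))

  ev-Πpoly-++ : ∀ {n} (ρ : Fin n → C) ps qs → ev ρ (Πpoly (ps ++ₗ qs)) ≋ ev ρ (Πpoly ps) *ᴿ ev ρ (Πpoly qs)
  ev-Πpoly-++ ρ [] qs = ≋-sym (*ᴿ-idˡ _)
  ev-Πpoly-++ ρ (p ∷ ps) qs = ≋-trans (*ᴿ-cong ≋-refl (ev-Πpoly-++ ρ ps qs)) (≋-sym (*ᴿ-assoc _ _ _))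

  ev-Σpoly-cube : ∀ {n} (ρ : Fin n → C) k (F : Vec Bool k → Poly n) →
                  ev ρ (Σpoly (map F (cube k))) ≋ sumR k (ev ρ ∘ F)
  ev-Σpoly-cube ρ zero F = +ᴿ-idʳ _
  ev-Σpoly-cube ρ (suc k) F
    rewrite Listₚ.map-++ F (map (true ∷_) (cube k)) (map (false ∷_) (cube k))
          | sym (Listₚ.map-∘ {g = F} {f = true ∷_} (cube k))
          | sym (Listₚ.map-∘ {g = F} {f = false ∷_} (cube k))
    = ≋-trans (ev-Σpoly-++ ρ (map _ (cube k)) (map _ (cube k)))
              (+ᴿ-cong (ev-Σpoly-cube ρ k _) (ev-Σpoly-cube ρ k _))

  ev-Πpoly-cube : ∀ {n} (ρ : Fin n → C) k (F : Vec Bool k → Poly n) →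
                  ev ρ (Πpoly (map F (cube k))) ≋ prodR k (ev ρ ∘ F)
  ev-Πpoly-cube ρ zero F = *ᴿ-idʳ _
  ev-Πpoly-cube ρ (suc k) F
    rewrite Listₚ.map-++ F (map (true ∷_) (cube k)) (map (false ∷_) (cube k))
          | sym (Listₚ.map-∘ {g = F} {f = true ∷_} (cube k))
          | sym (Listₚ.map-∘ {g = F} {f = false ∷_} (cube k))
    = ≋-trans (ev-Πpoly-++ ρ (map _ (cube k)) (map _ (cube k)))
              (*ᴿ-cong (ev-Πpoly-cube ρ k _) (ev-Πpoly-cube ρ k _))

  ev-boolSum : ∀ {a b} (ρ : Fin a → C) (P : Poly (a + b)) →
               ev ρ (boolSum {a} {b} P) ≋ sumR b (λ ε → ev (env⁺ ρ (ιᵇ ∘ lookup ε)) P)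
  ev-boolSum {a} {b} ρ P = ≋-trans (ev-Σpoly-cube ρ b (instantiate P))
    (sumR-cong b (λ ε → ≋-reflexive (ev-instantiate ρ ε P)))

  ev-boolProd : ∀ {a b} (ρ : Fin a → C) (P : Poly (a + b)) →
                ev ρ (boolProd {a} {b} P) ≋ prodR b (λ ε → ev (env⁺ ρ (ιᵇ ∘ lookup ε)) P)
  ev-boolProd {a} {b} ρ P = ≋-trans (ev-Πpoly-cube ρ b (instantiate P))
    (prodR-cong b (λ ε → ≋-reflexive (ev-instantiate ρ ε P)))

subst-ev : ∀ {n m} (σ : Fin n → Poly m) P → subst σ P ≡ Evaluation.ev (polyRing m) σ P
subst-ev σ (var i) = refl
subst-ev σ 𝟘 = refl
subst-ev σ 𝟙 = refl
subst-ev σ (a ⊕ b) = cong₂ _⊕_ (subst-ev σ a) (subst-ev σ b)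
subst-ev σ (a ⊗ b) = cong₂ _⊗_ (subst-ev σ a) (subst-ev σ b)
subst-ev σ (⊖ a) = cong ⊖_ (subst-ev σ a)

≡⇒≈ : ∀ {n} {P Q : Poly n} → P ≡ Q → P ≈ Q
≡⇒≈ refl = ≈-refl

subst-≈ : ∀ {n m} {σ τ : Fin n → Poly m} {P Q} → (∀ i → σ i ≈ τ i) → P ≈ Q → subst σ P ≈ subst τ Q
subst-≈ {m = m} {σ} {τ} {P} {Q} h p = ≈-trans (≡⇒≈ (subst-ev σ P)) (≈-trans (ev-cong h P)
  (≈-trans (ev-sound τ p) (≡⇒≈ (sym (subst-ev τ Q)))))
  where open Evaluation (polyRing m)

-- Straight-line programs

module _ {m k n : ℕ} (B : Gates m k) (σ : Fin n → Wire m k) where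

  shiftWire : ∀ l → Wire m k → Wire m (l + k)
  shiftWire l (inj₁ i) = inj₁ i
  shiftWire l (inj₂ j) = inj₂ (l ↑ʳ j)

  plugWire : ∀ l → Wire n l → Wire m (l + k)
  plugWire l (inj₁ (x i)) = shiftWire l (σ i)
  plugWire l (inj₁ one) = inj₁ one
  plugWire l (inj₂ j) = inj₂ (j ↑ˡ k)

  -- The gates of `B` are shared by all uses of their wires, so sizes add up even if a substituted
  -- value occurs many times. In an expression it would be copied.
  append : ∀ {l} → Gates n l → Gates m (l + k)
  append ∅ = B
  append {suc l} (G ▷ gate o a b) = append G ▷ gate o (plugWire l a) (plugWire l b)

  vals-base : ∀ {l} (G : Gates n l) j → gateVals (append G) (l ↑ʳ j) ≡ gateVals B j
  vals-base ∅ j = refl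
  vals-base (G ▷ gate o a b) j = vals-base G j

  degs-base : ∀ {l} (G : Gates n l) j → gateDegs (append G) (l ↑ʳ j) ≡ gateDegs B j
  degs-base ∅ j = refl
  degs-base (G ▷ gate o a b) j = degs-base G j

  wireVal-shift : ∀ {l} (G : Gates n l) w → wireVal (gateVals (append G)) (shiftWire l w) ≡ wireVal (gateVals B) w
  wireVal-shift G (inj₁ i) = refl
  wireVal-shift G (inj₂ j) = vals-base G j

  wireDeg-shift : ∀ {l} (G : Gates n l) w → wireDeg (gateDegs (append G)) (shiftWire l w) ≡ wireDeg (gateDegs B) w
  wireDeg-shift G (inj₁ i) = refl
  wireDeg-shift G (inj₂ j) = degs-base G j

  plugged : Poly n → Poly m
  plugged = subst (wireVal (gateVals B) ∘ σ)

  opVal-plugged : ∀ o P Q → opVal o (plugged P) (plugged Q) ≡ plugged (opVal o P Q)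
  opVal-plugged plus P Q = refl
  opVal-plugged minus P Q = refl
  opVal-plugged times P Q = refl

  vals-plug : ∀ {l} (G : Gates n l) j → gateVals (append G) (j ↑ˡ k) ≡ plugged (gateVals G j)
  wireVal-plug : ∀ {l} (G : Gates n l) w → wireVal (gateVals (append G)) (plugWire l w) ≡ plugged (wireVal (gateVals G) w)
  vals-plug (G ▷ gate o a b) zero = trans (cong₂ (opVal o) (wireVal-plug G a) (wireVal-plug G b)) (opVal-plugged o _ _)
  vals-plug (G ▷ gate o a b) (suc j) = vals-plug G j
  wireVal-plug G (inj₁ (x i)) = wireVal-shift G (σ i)
  wireVal-plug G (inj₁ one) = refl
  wireVal-plug G (inj₂ j) = vals-plug G j

  -- Formal degrees are preserved if each variable is replaced by a wire of degree one. This covers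
  -- placing two circuits with the same inputs side by side, as in `computes-op`.
  module _ (isInput : ∀ i → wireDeg (gateDegs B) (σ i) ≡ 1) where
    degs-plug : ∀ {l} (G : Gates n l) j → gateDegs (append G) (j ↑ˡ k) ≡ gateDegs G j
    wireDeg-plug : ∀ {l} (G : Gates n l) w → wireDeg (gateDegs (append G)) (plugWire l w) ≡ wireDeg (gateDegs G) w
    degs-plug (G ▷ gate o a b) zero = cong₂ (opDeg o) (wireDeg-plug G a) (wireDeg-plug G b)
    degs-plug (G ▷ gate o a b) (suc j) = degs-plug G j
    wireDeg-plug G (inj₁ (x i)) = trans (wireDeg-shift G (σ i)) (isInput i)
    wireDeg-plug G (inj₁ one) = refl
    wireDeg-plug G (inj₂ j) = degs-plug G j

record Computes {n} (P : Poly n) (s d : ℕ) : Set where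
  constructor computes
  field
    {len}  : ℕ
    code   : Gates n len
    out    : Wire n len
    value  : wireVal (gateVals code) out ≈ P
    size≤  : len ≤ s
    deg≤   : wireDeg (gateDegs code) out ≤ d

-- The formal degree is left open: repeated squaring makes it exponential, which `VP0nb` permits.
Easy : ∀ {n} → Poly n → ℕ → Set
Easy P s = ∃[ d ] Computes P s d

subst-var : ∀ {n} (P : Poly n) → subst var P ≡ P
subst-var (var i) = refl
subst-var 𝟘 = refl
subst-var 𝟙 = refl
subst-var (a ⊕ b) = cong₂ _⊕_ (subst-var a) (subst-var b)
subst-var (a ⊗ b) = cong₂ _⊗_ (subst-var a) (subst-var b)
subst-var (⊖ a) = cong ⊖_ (subst-var a)

opDeg-mono : ∀ o {a b c d} → a ≤ c → b ≤ d → opDeg o a b ≤ opDeg o c d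
opDeg-mono plus p q = ⊔-mono-≤ p q
opDeg-mono minus p q = ⊔-mono-≤ p q
opDeg-mono times p q = +-mono-≤ p q

opVal-cong : ∀ {n} o {a b c d : Poly n} → a ≈ c → b ≈ d → opVal o a b ≈ opVal o c d
opVal-cong plus p q = ⊕-cong p q
opVal-cong minus p q = ⊕-cong p (⊖-cong q)
opVal-cong times p q = ⊗-cong p q

computes-≈ : ∀ {n} {P Q : Poly n} {s d} → P ≈ Q → Computes P s d → Computes Q s d
computes-≈ h (computes G w v a b) = computes G w (≈-trans v h) a b

computes-≤ : ∀ {n} {P : Poly n} {s t d e} → s ≤ t → d ≤ e → Computes P s d → Computes P t e
computes-≤ h k (computes G w v a b) = computes G w v (≤-trans a h) (≤-trans b k)

computes-input : ∀ {n} (i : Input n) → Computes (inputVal i) 0 1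
computes-input i = computes ∅ (inj₁ i) ≈-refl z≤n ≤-refl

computes-op : ∀ {n} o {P Q : Poly n} {s t d e} → Computes P s d → Computes Q t e →
              Computes (opVal o P Q) (suc (s + t)) (opDeg o d e)
computes-op {n} o {P} {Q} {s} {t} (computes {k} G w v a b) (computes {l} H u v′ a′ b′) =
  computes (append G σ H ▷ gate o (shiftWire G σ l w) (plugWire G σ l u))
           (inj₂ zero)
           (opVal-cong o (≈-trans (≡⇒≈ (wireVal-shift G σ H w)) v)
             (≈-trans (≡⇒≈ (trans (wireVal-plug G σ H u) (subst-var _))) v′))
           (s≤s (≤-trans (+-mono-≤ a′ a) (≤-reflexive (+-comm t s))))
           (opDeg-mono o (≤-trans (≤-reflexive (wireDeg-shift G σ H w)) b)
             (≤-trans (≤-reflexive (wireDeg-plug G σ (λ _ → refl) H u)) b′))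
  where
  σ : Fin n → Wire n k
  σ i = inj₁ (x i)

easy-op : ∀ {n} o {P Q : Poly n} {s t} → Easy P s → Easy Q t → Easy (opVal o P Q) (suc (s + t))
easy-op o (_ , c) (_ , c′) = _ , computes-op o c c′

easy-≈ : ∀ {n} {P Q : Poly n} {s t} → P ≈ Q → s ≤ t → Easy P s → Easy Q t
easy-≈ h le (_ , c) = _ , computes-≤ le ≤-refl (computes-≈ h c)

easy-input : ∀ {n} (i : Input n) → Easy (inputVal i) 0
easy-input i = _ , computes-input i

-- Both operands are the same wire, so a square costs one gate, while `easy-op` would double the
-- size.
easy-square : ∀ {n} {P : Poly n} {s} → Easy P s → Easy (P ⊗ P) (suc s)
easy-square (_ , computes G w v a b) =
  _ , computes (G ▷ gate times w w) (inj₂ zero) (⊗-cong v v) (s≤s a) ≤-refl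

computes-zero : ∀ {n} → Computes {n} 𝟘 1 1
computes-zero = computes (∅ ▷ gate minus (inj₁ one) (inj₁ one)) (inj₂ zero)
  (≈-trans (⊕-comm 𝟙 (⊖ 𝟙)) (⊖-invˡ 𝟙)) ≤-refl ≤-refl

record Multi {n m} (σ : Fin n → Poly m) (s : ℕ) : Set where
  constructor multi
  field
    {len}  : ℕ
    code   : Gates m len
    outs   : Fin n → Wire m len
    value  : ∀ i → wireVal (gateVals code) (outs i) ≈ σ i
    size≤  : len ≤ s

multi-easy : ∀ {n m} (σ : Fin n → Poly m) s → (∀ i → Easy (σ i) s) → Multi σ (n * s)
multi-easy {zero} σ s h = multi ∅ (λ ()) (λ ()) z≤n
multi-easy {suc n} {m} σ s h with h zero | multi-easy (σ ∘ suc) s (h ∘ suc)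
... | _ , computes {k} G w v a _ | multi {l} H ws v′ a′ = multi (append G ρ H) outs value (≤-trans (+-mono-≤ a′ a) (≤-reflexive (+-comm (n * s) s)))
  where
  ρ : Fin m → Wire m k
  ρ i = inj₁ (x i)
  outs : Fin (suc n) → Wire m (l + k)
  outs zero = shiftWire G ρ l w
  outs (suc i) = plugWire G ρ l (ws i)
  value : ∀ i → wireVal (gateVals (append G ρ H)) (outs i) ≈ σ i
  value zero = ≈-trans (≡⇒≈ (wireVal-shift G ρ H w)) v
  value (suc i) = ≈-trans (≡⇒≈ (trans (wireVal-plug G ρ H (ws i)) (subst-var _))) (v′ i)

easy-subst : ∀ {n m} (σ : Fin n → Poly m) {Q : Poly n} {s t} → Easy Q t → (∀ i → Easy (σ i) s) → Easy (subst σ Q) (t + n * s)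
easy-subst σ {Q} {s} {t} (_ , computes H u v a _) h with multi-easy σ s h
... | multi {k} G ws v′ a′ =
  _ , computes (append G ws H) (plugWire G ws _ u)
        (≈-trans (≡⇒≈ (wireVal-plug G ws H u)) (subst-≈ v′ v)) (+-mono-≤ a a′) ≤-refl

treeSize : ∀ {n} → Poly n → ℕ
treeSize (var i) = 1
treeSize 𝟘 = 1
treeSize 𝟙 = 1
treeSize (a ⊕ b) = suc (treeSize a + treeSize b)
treeSize (a ⊗ b) = suc (treeSize a + treeSize b)
treeSize (⊖ a) = suc (treeSize a)

-- The formal degree of an expression is at most its number of nodes, because leaves have degree one
-- and `times` adds. The factor 2 in the size pays for negation, computed as (1 - 1) - a with two
-- gates.
computes-tree : ∀ {n} (P : Poly n) → Computes P (2 * treeSize P) (treeSize P)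
computes-tree (var i) = computes-≤ z≤n ≤-refl (computes-input (x i))
computes-tree 𝟘 = computes-≤ (s≤s z≤n) ≤-refl computes-zero
computes-tree 𝟙 = computes-≤ z≤n ≤-refl (computes-input one)
computes-tree (a ⊕ b) = computes-≤ (≤-slack 1 (h (treeSize a) (treeSize b)))
  (≤-trans (m⊔n≤m+n (treeSize a) (treeSize b)) (n≤1+n _)) (computes-op plus (computes-tree a) (computes-tree b))
  where
  h : ∀ a b → suc (2 * a + 2 * b) + 1 ≡ 2 * suc (a + b)
  h = NS.solve-∀
computes-tree (a ⊗ b) = computes-≤ (≤-slack 1 (h (treeSize a) (treeSize b)))
  (n≤1+n _) (computes-op times (computes-tree a) (computes-tree b))
  where
  h : ∀ a b → suc (2 * a + 2 * b) + 1 ≡ 2 * suc (a + b)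
  h = NS.solve-∀
computes-tree (⊖ a) = computes-≈ (⊕-idˡ (⊖ a)) (computes-≤ (≤-reflexive (h (treeSize a)))
  (⊔-lub (s≤s z≤n) (n≤1+n _)) (computes-op minus computes-zero (computes-tree a)))
  where
  h : ∀ a → suc (1 + 2 * a) ≡ 2 * suc a
  h = NS.solve-∀

-- Summation formulas

infixl 6 _∔_
infixl 7 _∙_

-- There is no subtraction, so values are natural numbers, and by `⟦⟧<2^fsize` they have at most
-- `fsize` binary digits.
data Fm (V : Set) : Set where
  lit : Bool → V → Fm V
  cst : Bool → Fm V
  _∔_ _∙_ : Fm V → Fm V → Fm V
  sum : Fm (Maybe V) → Fm V

xnor : Bool → Bool → Bool
xnor true b = b
xnor false b = not b

ext : ∀ {V : Set} → (V → Bool) → Bool → Maybe V → Bool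
ext ρ b nothing = b
ext ρ b (just v) = ρ v

⟦_⟧ : ∀ {V} → Fm V → (V → Bool) → ℕ
⟦ lit b v ⟧ ρ = bit (xnor b (ρ v))
⟦ cst b ⟧ ρ = bit b
⟦ φ ∔ ψ ⟧ ρ = ⟦ φ ⟧ ρ + ⟦ ψ ⟧ ρ
⟦ φ ∙ ψ ⟧ ρ = ⟦ φ ⟧ ρ * ⟦ ψ ⟧ ρ
⟦ sum φ ⟧ ρ = ⟦ φ ⟧ (ext ρ true) + ⟦ φ ⟧ (ext ρ false)

fsize : ∀ {V} → Fm V → ℕ
fsize (lit b v) = 1
fsize (cst b) = 1
fsize (φ ∔ ψ) = suc (fsize φ + fsize ψ)
fsize (φ ∙ ψ) = suc (fsize φ + fsize ψ)
fsize (sum φ) = suc (fsize φ)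

⟦⟧-cong : ∀ {V} (φ : Fm V) {ρ τ : V → Bool} → (∀ v → ρ v ≡ τ v) → ⟦ φ ⟧ ρ ≡ ⟦ φ ⟧ τ
⟦⟧-cong (lit b v) h = cong (bit ∘ xnor b) (h v)
⟦⟧-cong (cst b) h = refl
⟦⟧-cong (φ ∔ ψ) h = cong₂ _+_ (⟦⟧-cong φ h) (⟦⟧-cong ψ h)
⟦⟧-cong (φ ∙ ψ) h = cong₂ _*_ (⟦⟧-cong φ h) (⟦⟧-cong ψ h)
⟦⟧-cong (sum φ) h = cong₂ _+_ (⟦⟧-cong φ λ { nothing → refl ; (just v) → h v })
                              (⟦⟧-cong φ λ { nothing → refl ; (just v) → h v })

⟦⟧<2^fsize : ∀ {V} (φ : Fm V) ρ → ⟦ φ ⟧ ρ < 2 ^ fsize φ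
⟦⟧<2^fsize (lit b v) ρ = s≤s (bit≤1 _)
⟦⟧<2^fsize (cst b) ρ = s≤s (bit≤1 _)
⟦⟧<2^fsize (φ ∔ ψ) ρ = begin-strict
  ⟦ φ ⟧ ρ + ⟦ ψ ⟧ ρ              <⟨ +-mono-<-≤ (⟦⟧<2^fsize φ ρ) (<⇒≤ (⟦⟧<2^fsize ψ ρ)) ⟩
  2 ^ fsize φ + 2 ^ fsize ψ      ≤⟨ +-mono-≤ (^-monoʳ-≤ 2 (m≤m+n (fsize φ) (fsize ψ))) (^-monoʳ-≤ 2 (m≤n+m (fsize ψ) (fsize φ))) ⟩
  2 ^ (fsize φ + fsize ψ) + 2 ^ (fsize φ + fsize ψ) ≡⟨ cong (λ a → 2 ^ (fsize φ + fsize ψ) + a) (sym (+-identityʳ _)) ⟩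
  2 * 2 ^ (fsize φ + fsize ψ)    ∎
  where open ≤-Reasoning
⟦⟧<2^fsize (φ ∙ ψ) ρ = begin-strict
  ⟦ φ ⟧ ρ * ⟦ ψ ⟧ ρ              ≤⟨ *-mono-≤ (<⇒≤ (⟦⟧<2^fsize φ ρ)) (<⇒≤ (⟦⟧<2^fsize ψ ρ)) ⟩
  2 ^ fsize φ * 2 ^ fsize ψ      ≡⟨ sym (^-distribˡ-+-* 2 (fsize φ) (fsize ψ)) ⟩
  2 ^ (fsize φ + fsize ψ)        <⟨ ^-monoʳ-< 2 ≤-refl (n<1+n (fsize φ + fsize ψ)) ⟩
  2 * 2 ^ (fsize φ + fsize ψ)    ∎
  where open ≤-Reasoning
⟦⟧<2^fsize (sum φ) ρ = begin-strict
  ⟦ φ ⟧ (ext ρ true) + ⟦ φ ⟧ (ext ρ false) <⟨ +-mono-<-≤ (⟦⟧<2^fsize φ _) (<⇒≤ (⟦⟧<2^fsize φ _)) ⟩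
  2 ^ fsize φ + 2 ^ fsize φ      ≡⟨ cong (λ a → 2 ^ fsize φ + a) (sym (+-identityʳ _)) ⟩
  2 * 2 ^ fsize φ                ∎
  where open ≤-Reasoning

-- A variable is only ever replaced by a variable or a Boolean constant; such substitutions leave
-- the size of a formula unchanged.
Atom : Set → Set
Atom V = Bool ⊎ V

atom : ∀ {V : Set} → (V → Bool) → Atom V → Bool
atom ρ (inj₁ b) = b
atom ρ (inj₂ v) = ρ v

mapᴬ : ∀ {V W : Set} → (V → W) → Atom V → Atom W
mapᴬ f (inj₁ b) = inj₁ b
mapᴬ f (inj₂ v) = inj₂ (f v)

atom-map : ∀ {V W : Set} (f : V → W) (ρ : W → Bool) a → atom ρ (mapᴬ f a) ≡ atom (ρ ∘ f) a
atom-map f ρ (inj₁ b) = refl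
atom-map f ρ (inj₂ v) = refl

litᴬ : ∀ {V} → Bool → Atom V → Fm V
litᴬ b (inj₁ c) = cst (xnor b c)
litᴬ b (inj₂ v) = lit b v

⟦litᴬ⟧ : ∀ {V} b (a : Atom V) ρ → ⟦ litᴬ b a ⟧ ρ ≡ bit (xnor b (atom ρ a))
⟦litᴬ⟧ b (inj₁ c) ρ = refl
⟦litᴬ⟧ b (inj₂ v) ρ = refl

fsize-litᴬ : ∀ {V} b (a : Atom V) → fsize (litᴬ b a) ≡ 1
fsize-litᴬ b (inj₁ c) = refl
fsize-litᴬ b (inj₂ v) = refl

liftᴬ : ∀ {V W : Set} → (V → Atom W) → Maybe V → Atom (Maybe W)
liftᴬ f nothing = inj₂ nothing
liftᴬ f (just v) = mapᴬ just (f v)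

bind : ∀ {V W} → (V → Atom W) → Fm V → Fm W
bind f (lit b v) = litᴬ b (f v)
bind f (cst b) = cst b
bind f (φ ∔ ψ) = bind f φ ∔ bind f ψ
bind f (φ ∙ ψ) = bind f φ ∙ bind f ψ
bind f (sum φ) = sum (bind (liftᴬ f) φ)

fsize-bind : ∀ {V W} (f : V → Atom W) φ → fsize (bind f φ) ≡ fsize φ
fsize-bind f (lit b v) = fsize-litᴬ b (f v)
fsize-bind f (cst b) = refl
fsize-bind f (φ ∔ ψ) = cong suc (cong₂ _+_ (fsize-bind f φ) (fsize-bind f ψ))
fsize-bind f (φ ∙ ψ) = cong suc (cong₂ _+_ (fsize-bind f φ) (fsize-bind f ψ))
fsize-bind f (sum φ) = cong suc (fsize-bind (liftᴬ f) φ)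

⟦bind⟧ : ∀ {V W} (f : V → Atom W) φ ρ → ⟦ bind f φ ⟧ ρ ≡ ⟦ φ ⟧ (atom ρ ∘ f)
⟦bind⟧ f (lit b v) ρ = ⟦litᴬ⟧ b (f v) ρ
⟦bind⟧ f (cst b) ρ = refl
⟦bind⟧ f (φ ∔ ψ) ρ = cong₂ _+_ (⟦bind⟧ f φ ρ) (⟦bind⟧ f ψ ρ)
⟦bind⟧ f (φ ∙ ψ) ρ = cong₂ _*_ (⟦bind⟧ f φ ρ) (⟦bind⟧ f ψ ρ)
⟦bind⟧ {V} f (sum φ) ρ = cong₂ _+_ (step true) (step false)
  where
  step : ∀ b → ⟦ bind (liftᴬ f) φ ⟧ (ext ρ b) ≡ ⟦ φ ⟧ (ext (atom ρ ∘ f) b)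
  step b = trans (⟦bind⟧ (liftᴬ f) φ (ext ρ b))
    (⟦⟧-cong φ λ { nothing → refl ; (just v) → atom-map just (ext ρ b) (f v) })

envW : ∀ {k} {V : Set} → Vec Bool k → (V → Bool) → Fin k ⊎ V → Bool
envW w ρ (inj₁ i) = lookup w i
envW w ρ (inj₂ v) = ρ v

absorb : ∀ {V : Set} → Fin 0 ⊎ V → Atom V
absorb (inj₂ v) = inj₂ v

peel : ∀ {k} {V : Set} → Fin (suc k) ⊎ V → Atom (Maybe (Fin k ⊎ V))
peel (inj₁ zero) = inj₂ nothing
peel (inj₁ (suc i)) = inj₂ (just (inj₁ i))
peel (inj₂ v) = inj₂ (just (inj₂ v))

sumW : ∀ k {V} → Fm (Fin k ⊎ V) → Fm V
sumW zero φ = bind absorb φ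
sumW (suc k) φ = sumW k (sum (bind peel φ))

fsize-sumW : ∀ k {V} (φ : Fm (Fin k ⊎ V)) → fsize (sumW k φ) ≡ k + fsize φ
fsize-sumW zero φ = fsize-bind absorb φ
fsize-sumW (suc k) φ = trans (fsize-sumW k _) (trans (+-suc k _) (cong (λ a → suc (k + a)) (fsize-bind peel φ)))

⟦sumW⟧ : ∀ k {V} (φ : Fm (Fin k ⊎ V)) ρ → ⟦ sumW k φ ⟧ ρ ≡ sumB k (λ w → ⟦ φ ⟧ (envW w ρ))
⟦sumW⟧ zero φ ρ = trans (⟦bind⟧ absorb φ ρ) (⟦⟧-cong φ λ { (inj₁ ()) ; (inj₂ v) → refl })
⟦sumW⟧ (suc k) φ ρ = trans (⟦sumW⟧ k _ ρ) (trans
  (sumB-cong k (λ w → cong₂ _+_ (step true w) (step false w))) (sumB-+ k _ _))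
  where
  step : ∀ b w → ⟦ bind peel φ ⟧ (ext (envW w ρ) b) ≡ ⟦ φ ⟧ (envW (b ∷ w) ρ)
  step b w = trans (⟦bind⟧ peel φ _)
    (⟦⟧-cong φ λ { (inj₁ zero) → refl ; (inj₁ (suc i)) → refl ; (inj₂ v) → refl })

pow2F : ∀ {V} → ℕ → Fm V
pow2F zero = cst true
pow2F (suc k) = (cst true ∔ cst true) ∙ pow2F k

⟦pow2F⟧ : ∀ {V} k (ρ : V → Bool) → ⟦ pow2F k ⟧ ρ ≡ 2 ^ k
⟦pow2F⟧ zero ρ = refl
⟦pow2F⟧ (suc k) ρ = cong (2 *_) (⟦pow2F⟧ k ρ)

fsize-pow2F : ∀ {V} k → fsize (pow2F {V} k) ≡ 4 * k + 1
fsize-pow2F zero = refl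
fsize-pow2F {V} (suc k) = trans (cong (4 +_) (fsize-pow2F {V} k)) (h k)
  where
  h : ∀ k → 4 + (4 * k + 1) ≡ 4 * suc k + 1
  h = NS.solve-∀

valF : ∀ {k} {V} → Vec (Atom V) k → Fm V
valF [] = cst false
valF (a ∷ as) = litᴬ true a ∔ (cst true ∔ cst true) ∙ valF as

atoms : ∀ {k} {V : Set} → (V → Bool) → Vec (Atom V) k → ℕ
atoms ρ as = val (Vec.map (atom ρ) as)

⟦valF⟧ : ∀ {k} {V} (as : Vec (Atom V) k) ρ → ⟦ valF as ⟧ ρ ≡ atoms ρ as
⟦valF⟧ [] ρ = refl
⟦valF⟧ (a ∷ as) ρ = cong₂ _+_ (⟦litᴬ⟧ true a ρ) (cong (2 *_) (⟦valF⟧ as ρ))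

fsize-valF : ∀ {k} {V} (as : Vec (Atom V) k) → fsize (valF as) ≡ 6 * k + 1
fsize-valF [] = refl
fsize-valF {suc k} (a ∷ as) = trans (cong₂ (λ s t → suc (s + suc (3 + t))) (fsize-litᴬ true a) (fsize-valF as)) (h k)
  where
  h : ∀ k → suc (1 + suc (3 + (6 * k + 1))) ≡ 6 * suc k + 1
  h = NS.solve-∀

-- Prenex form, with the summation variables collected in one block.  In a sum φ ∔ ψ each summand is multiplied by the indicator that the other summand's variables all vanish.

bound : ∀ {V} → Fm V → ℕ
bound (lit b v) = 0
bound (cst b) = 0
bound (φ ∔ ψ) = bound φ + bound ψ
bound (φ ∙ ψ) = bound φ + bound ψ
bound (sum φ) = suc (bound φ)

maybe′ : ∀ {V : Set} {A : Set} → (V → A) → A → Maybe V → A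
maybe′ f a nothing = a
maybe′ f a (just v) = f v

allZero : ∀ {m} b → (Fin b → Poly m) → Poly m
allZero zero ε = 𝟙
allZero (suc b) ε = (𝟙 ⊕ ⊖ ε zero) ⊗ allZero b (ε ∘ suc)

matrix : ∀ {V m} (φ : Fm V) → (V → Poly m) → (Fin (bound φ) → Poly m) → Poly m
matrix (lit true v) σ ε = σ v
matrix (lit false v) σ ε = 𝟙 ⊕ ⊖ σ v
matrix (cst true) σ ε = 𝟙
matrix (cst false) σ ε = 𝟘
matrix (φ ∔ ψ) σ ε = matrix φ σ (ε ∘ (_↑ˡ bound ψ)) ⊗ allZero (bound ψ) (ε ∘ (bound φ ↑ʳ_))
                   ⊕ matrix ψ σ (ε ∘ (bound φ ↑ʳ_)) ⊗ allZero (bound φ) (ε ∘ (_↑ˡ bound ψ))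
matrix (φ ∙ ψ) σ ε = matrix φ σ (ε ∘ (_↑ˡ bound ψ)) ⊗ matrix ψ σ (ε ∘ (bound φ ↑ʳ_))
matrix (sum φ) σ ε = matrix φ (maybe′ σ (ε zero)) (ε ∘ suc)

bound≤fsize : ∀ {V} (φ : Fm V) → bound φ ≤ fsize φ
bound≤fsize (lit b v) = z≤n
bound≤fsize (cst b) = z≤n
bound≤fsize (φ ∔ ψ) = m≤n⇒m≤1+n (+-mono-≤ (bound≤fsize φ) (bound≤fsize ψ))
bound≤fsize (φ ∙ ψ) = m≤n⇒m≤1+n (+-mono-≤ (bound≤fsize φ) (bound≤fsize ψ))
bound≤fsize (sum φ) = s≤s (bound≤fsize φ)

treeSize-allZero : ∀ {m} b (ε : Fin b → Poly m) → (∀ i → treeSize (ε i) ≡ 1) → treeSize (allZero b ε) ≡ 5 * b + 1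
treeSize-allZero zero ε h = refl
treeSize-allZero (suc b) ε h = trans (cong₂ (λ s t → suc (suc (1 + suc s) + t)) (h zero) (treeSize-allZero b (ε ∘ suc) (h ∘ suc))) (l b)
  where
  l : ∀ b → suc (suc (1 + 2) + (5 * b + 1)) ≡ 5 * suc b + 1
  l = NS.solve-∀

-- An addition appends to each summand a test as long as the other summand's block of variables;
-- these linear terms at every node sum to a quadratic bound.
treeSize-matrix : ∀ {V m} (φ : Fm V) (σ : V → Poly m) ε → (∀ v → treeSize (σ v) ≡ 1) → (∀ i → treeSize (ε i) ≡ 1) →
                  treeSize (matrix φ σ ε) ≤ 5 * (fsize φ * fsize φ)
treeSize-matrix (lit true v) σ ε h k = ≤-trans (≤-reflexive (h v)) (s≤s z≤n)
treeSize-matrix (lit false v) σ ε h k = ≤-trans (≤-reflexive (cong (λ a → suc (1 + suc a)) (h v))) (s≤s (s≤s (s≤s (s≤s z≤n))))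
treeSize-matrix (cst true) σ ε h k = s≤s z≤n
treeSize-matrix (cst false) σ ε h k = s≤s z≤n
treeSize-matrix (φ ∔ ψ) σ ε h k = begin
  suc (suc (t + treeSize (allZero (bound ψ) _)) + suc (u + treeSize (allZero (bound φ) _)))
    ≡⟨ cong₂ (λ p q → suc (suc (t + p) + suc (u + q)))
         (treeSize-allZero (bound ψ) _ (λ i → k _)) (treeSize-allZero (bound φ) _ (λ i → k _)) ⟩
  suc (suc (t + (5 * bound ψ + 1)) + suc (u + (5 * bound φ + 1)))
    ≤⟨ s≤s (+-mono-≤ (s≤s (+-mono-≤ (treeSize-matrix φ σ _ h (λ i → k _)) (+-monoˡ-≤ 1 (*-monoʳ-≤ 5 (bound≤fsize ψ)))))
                     (s≤s (+-mono-≤ (treeSize-matrix ψ σ _ h (λ i → k _)) (+-monoˡ-≤ 1 (*-monoʳ-≤ 5 (bound≤fsize φ)))))) ⟩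
  suc (suc (5 * (a * a) + (5 * b + 1)) + suc (5 * (b * b) + (5 * a + 1)))
    ≤⟨ ≤-slack (5 * a + 5 * b + 10 * (a * b)) (l a b) ⟩
  5 * (suc (a + b) * suc (a + b)) ∎
  where
  open ≤-Reasoning
  a = fsize φ
  b = fsize ψ
  t = treeSize (matrix φ σ (ε ∘ (_↑ˡ bound ψ)))
  u = treeSize (matrix ψ σ (ε ∘ (bound φ ↑ʳ_)))
  l : ∀ a b → suc (suc (5 * (a * a) + (5 * b + 1)) + suc (5 * (b * b) + (5 * a + 1))) + (5 * a + 5 * b + 10 * (a * b))
            ≡ 5 * (suc (a + b) * suc (a + b))
  l = NS.solve-∀
treeSize-matrix (φ ∙ ψ) σ ε h k =
  ≤-trans (s≤s (+-mono-≤ (treeSize-matrix φ σ _ h (λ i → k _)) (treeSize-matrix ψ σ _ h (λ i → k _))))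
          (≤-slack (10 * a + 10 * b + 10 * (a * b) + 4) (l a b))
  where
  a = fsize φ
  b = fsize ψ
  l : ∀ a b → suc (5 * (a * a) + 5 * (b * b)) + (10 * a + 10 * b + 10 * (a * b) + 4) ≡ 5 * (suc (a + b) * suc (a + b))
  l = NS.solve-∀
treeSize-matrix (sum φ) σ ε h k = ≤-trans
  (treeSize-matrix φ _ _ (λ { nothing → k zero ; (just v) → h v }) (k ∘ suc))
  (*-monoʳ-≤ 5 (*-mono-≤ (n≤1+n (fsize φ)) (n≤1+n (fsize φ))))

zeroes : ∀ b → Vec Bool b → ℕ
zeroes zero e = 1
zeroes (suc b) (true ∷ e) = 0
zeroes (suc b) (false ∷ e) = zeroes b e

sum-zeroes : ∀ b → sumB b (zeroes b) ≡ 1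
sum-zeroes zero = refl
sum-zeroes (suc b) = cong₂ _+_ (sumB-*ˡ b 0 (λ _ → 0)) (sum-zeroes b)

leftᵛ : ∀ {A : Set} a {b} → Vec A (a + b) → Vec A a
leftᵛ zero e = []
leftᵛ (suc a) (c ∷ e) = c ∷ leftᵛ a e

rightᵛ : ∀ {A : Set} a {b} → Vec A (a + b) → Vec A b
rightᵛ zero e = e
rightᵛ (suc a) (c ∷ e) = rightᵛ a e

left-++ : ∀ {A : Set} {a b} (u : Vec A a) (w : Vec A b) → leftᵛ a (u Vec.++ w) ≡ u
left-++ [] w = refl
left-++ (c ∷ u) w = cong (c ∷_) (left-++ u w)

right-++ : ∀ {A : Set} {a b} (u : Vec A a) (w : Vec A b) → rightᵛ a (u Vec.++ w) ≡ w
right-++ [] w = refl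
right-++ (c ∷ u) w = right-++ u w

lookup-left : ∀ {A : Set} a {b} (e : Vec A (a + b)) i → lookup (leftᵛ a e) i ≡ lookup e (i ↑ˡ b)
lookup-left (suc a) (c ∷ e) zero = refl
lookup-left (suc a) (c ∷ e) (suc i) = lookup-left a e i

lookup-right : ∀ {A : Set} a {b} (e : Vec A (a + b)) i → lookup (rightᵛ a e) i ≡ lookup e (a ↑ʳ i)
lookup-right zero e i = refl
lookup-right (suc a) (c ∷ e) i = lookup-right a e i

-- The value of `matrix` at a Boolean point, as a natural number. The summation over the block is
-- done here in ℕ, and `ev-matrix` carries the values to any commutative ring.
mat : ∀ {V} (φ : Fm V) → (V → Bool) → Vec Bool (bound φ) → ℕ
mat (lit b v) s e = bit (xnor b (s v))
mat (cst b) s e = bit b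
mat (φ ∔ ψ) s e = mat φ s (leftᵛ (bound φ) e) * zeroes (bound ψ) (rightᵛ (bound φ) e)
                + mat ψ s (rightᵛ (bound φ) e) * zeroes (bound φ) (leftᵛ (bound φ) e)
mat (φ ∙ ψ) s e = mat φ s (leftᵛ (bound φ) e) * mat ψ s (rightᵛ (bound φ) e)
mat (sum φ) s (b ∷ e) = mat φ (ext s b) e

sum-mat : ∀ {V} (φ : Fm V) s → sumB (bound φ) (mat φ s) ≡ ⟦ φ ⟧ s
sum-mat (lit b v) s = refl
sum-mat (cst b) s = refl
sum-mat (φ ∔ ψ) s = begin
  sumB (a + b) (mat (φ ∔ ψ) s)
    ≡⟨ sumB-++ a b _ ⟩
  sumB a (λ u → sumB b (λ w → mat (φ ∔ ψ) s (u Vec.++ w)))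
    ≡⟨ sumB-cong a (λ u → sumB-cong b (λ w → cong₂ (λ u w → mat φ s u * zeroes b w + mat ψ s w * zeroes a u)
                                                (left-++ u w) (right-++ u w))) ⟩
  sumB a (λ u → sumB b (λ w → mat φ s u * zeroes b w + mat ψ s w * zeroes a u))
    ≡⟨ sumB-cong a (λ u → trans (sumB-+ b _ _) (cong₂ _+_
         (trans (sumB-*ˡ b (mat φ s u) _) (trans (cong (λ a → mat φ s u * a) (sum-zeroes b)) (*-identityʳ _)))
         (trans (sumB-*ʳ b (zeroes a u) _) (cong (λ b → b * zeroes a u) (sum-mat ψ s))))) ⟩
  sumB a (λ u → mat φ s u + ⟦ ψ ⟧ s * zeroes a u)
    ≡⟨ trans (sumB-+ a _ _) (cong₂ _+_ (sum-mat φ s)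
         (trans (sumB-*ˡ a (⟦ ψ ⟧ s) _) (trans (cong (λ a → ⟦ ψ ⟧ s * a) (sum-zeroes a)) (*-identityʳ _)))) ⟩
  ⟦ φ ⟧ s + ⟦ ψ ⟧ s ∎
  where
  open ≡-Reasoning
  a = bound φ
  b = bound ψ
sum-mat (φ ∙ ψ) s = begin
  sumB (a + b) (mat (φ ∙ ψ) s)
    ≡⟨ sumB-++ a b _ ⟩
  sumB a (λ u → sumB b (λ w → mat (φ ∙ ψ) s (u Vec.++ w)))
    ≡⟨ sumB-cong a (λ u → trans (sumB-cong b (λ w → cong₂ (λ u w → mat φ s u * mat ψ s w) (left-++ u w) (right-++ u w)))
         (trans (sumB-*ˡ b (mat φ s u) _) (cong (λ a → mat φ s u * a) (sum-mat ψ s)))) ⟩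
  sumB a (λ u → mat φ s u * ⟦ ψ ⟧ s)
    ≡⟨ trans (sumB-*ʳ a (⟦ ψ ⟧ s) _) (cong (λ a → a * ⟦ ψ ⟧ s) (sum-mat φ s)) ⟩
  ⟦ φ ⟧ s * ⟦ ψ ⟧ s ∎
  where
  open ≡-Reasoning
  a = bound φ
  b = bound ψ
sum-mat (sum φ) s = cong₂ _+_ (sum-mat φ (ext s true)) (sum-mat φ (ext s false))

module MatrixEvaluation (R : CommutativeRing 0ℓ 0ℓ) where
  open Evaluation R
  open RingProperties (CommutativeRing.ring R) using (-0#≈0#)

  1-ιᵇ : ∀ b {c} → c ≋ ιᵇ b → 1# +ᴿ (- c) ≋ ιᵇ (not b)
  1-ιᵇ true h = ≋-trans (+ᴿ-cong ≋-refl (-ᴿ-cong h)) (CommutativeRing.-‿inverseʳ R 1#)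
  1-ιᵇ false h = ≋-trans (+ᴿ-cong ≋-refl (≋-trans (-ᴿ-cong h) -0#≈0#)) (+ᴿ-idʳ 1#)

  module _ {m} (ρ : Fin m → C) where
    ev-allZero : ∀ b (ε : Fin b → Poly m) (e : Vec Bool b) → (∀ i → ev ρ (ε i) ≋ ιᵇ (lookup e i)) →
                 ev ρ (allZero b ε) ≋ ι (zeroes b e)
    ev-allZero zero ε e h = ιᵇ-bit true
    ev-allZero (suc b) ε (true ∷ e) h = ≋-trans (*ᴿ-cong (1-ιᵇ true (h zero)) ≋-refl) (ᴿ-zeroˡ _)
    ev-allZero (suc b) ε (false ∷ e) h = ≋-trans (*ᴿ-cong (1-ιᵇ false (h zero)) (ev-allZero b (ε ∘ suc) e (h ∘ suc))) (*ᴿ-idˡ _)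

    ev-matrix : ∀ {V} (φ : Fm V) (σ : V → Poly m) (ε : Fin (bound φ) → Poly m) s e →
                (∀ v → ev ρ (σ v) ≋ ιᵇ (s v)) → (∀ i → ev ρ (ε i) ≋ ιᵇ (lookup e i)) →
                ev ρ (matrix φ σ ε) ≋ ι (mat φ s e)
    ev-matrix (lit true v) σ ε s e h k = ≋-trans (h v) (ιᵇ-bit (s v))
    ev-matrix (lit false v) σ ε s e h k = ≋-trans (1-ιᵇ (s v) (h v)) (ιᵇ-bit (not (s v)))
    ev-matrix (cst true) σ ε s e h k = ιᵇ-bit true
    ev-matrix (cst false) σ ε s e h k = ≋-refl
    ev-matrix (φ ∔ ψ) σ ε s e h k = ≋-trans
      (+ᴿ-cong (*ᴿ-cong (ev-matrix φ σ _ s _ h l) (ev-allZero (bound ψ) _ _ r))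
               (*ᴿ-cong (ev-matrix ψ σ _ s _ h r) (ev-allZero (bound φ) _ _ l)))
      (≋-sym (≋-trans (ι-+ (mat φ s _ * zeroes (bound ψ) _) _) (+ᴿ-cong (ι-* (mat φ s _) _) (ι-* (mat ψ s _) _))))
      where
      l : ∀ i → ev ρ (ε (i ↑ˡ bound ψ)) ≋ ιᵇ (lookup (leftᵛ (bound φ) e) i)
      l i = ≋-trans (k _) (≋-reflexive (cong ιᵇ (sym (lookup-left (bound φ) e i))))
      r : ∀ i → ev ρ (ε (bound φ ↑ʳ i)) ≋ ιᵇ (lookup (rightᵛ (bound φ) e) i)
      r i = ≋-trans (k _) (≋-reflexive (cong ιᵇ (sym (lookup-right (bound φ) e i))))
    ev-matrix (φ ∙ ψ) σ ε s e h k = ≋-trans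
      (*ᴿ-cong (ev-matrix φ σ _ s _ h l) (ev-matrix ψ σ _ s _ h r)) (≋-sym (ι-* (mat φ s _) _))
      where
      l : ∀ i → ev ρ (ε (i ↑ˡ bound ψ)) ≋ ιᵇ (lookup (leftᵛ (bound φ) e) i)
      l i = ≋-trans (k _) (≋-reflexive (cong ιᵇ (sym (lookup-left (bound φ) e i))))
      r : ∀ i → ev ρ (ε (bound φ ↑ʳ i)) ≋ ιᵇ (lookup (rightᵛ (bound φ) e) i)
      r i = ≋-trans (k _) (≋-reflexive (cong ιᵇ (sym (lookup-right (bound φ) e i))))
    ev-matrix (sum φ) σ ε s (b ∷ e) h k =
      ev-matrix φ _ _ (ext s b) e (λ { nothing → k zero ; (just v) → h v }) (k ∘ suc)

-- Residues of integers, quotients and remainders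

resid : ℕ → ℤ → ℕ
-- The value 0 at modulus 0 is what a sum over the remainders below the modulus gives: there are
-- none.
resid zero z = 0
resid (suc m) z = z ℤD.%ℕ suc m

infixl 7 _mod_ _div_

_mod_ _div_ : ℕ → ℕ → ℕ
a mod m = resid m (pos a)
a div zero = 0
a div suc m = a DM./ suc m

resid< : ∀ {m} z → 0 < m → resid m z < m
resid< {suc m} z _ = ℤD.n%ℕd<d z (suc m)

resid-spec : ∀ {m} z → 0 < m → ∃[ q ] z ≡ pos (resid m z) ℤ.+ q ℤ.* pos m
resid-spec {suc m} z _ = z ℤD./ℕ suc m , ℤD.a≡a%ℕn+[a/ℕn]*n z (suc m)

residue-unique : ∀ {m c r} q → c < m → r < m → pos r ≡ pos c ℤ.+ q ℤ.* pos m → c ≡ r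
residue-unique {m} {c} {r} (pos zero) lt lt′ e = sym (ℤₚ.+-injective (trans e (ℤₚ.+-identityʳ (pos c))))
residue-unique {m} {c} {r} (pos (suc q)) lt lt′ e = ⊥-elim (<⇒≱ lt′ (≤-trans (≤-trans (m≤m+n m (q * m)) (m≤n+m (m + q * m) c))
  (≤-reflexive (sym (ℤₚ.+-injective (trans e (trans (cong (λ a → pos c ℤ.+ a) (sym (ℤₚ.pos-* (suc q) m))) (sym (ℤₚ.pos-+ c (suc q * m))))))))))
residue-unique {m} {c} {r} -[1+ q ] lt lt′ e = ⊥-elim (<⇒≱ lt (≤-trans (≤-trans (m≤m+n m (q * m)) (m≤n+m (m + q * m) r)) (≤-reflexive (ℤₚ.+-injective e′))))
  where
  h : ∀ c q m → (c ℤ.+ (ℤ.- q) ℤ.* m) ℤ.+ q ℤ.* m ≡ c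
  h = ZS.solve-∀
  e′ : pos (r + suc q * m) ≡ pos c
  e′ = trans (ℤₚ.pos-+ r (suc q * m)) (trans (cong₂ ℤ._+_ e (ℤₚ.pos-* (suc q) m)) (h (pos c) (pos (suc q)) (pos m)))

resid-unique : ∀ {m c z} q → c < m → z ≡ pos c ℤ.+ q ℤ.* pos m → c ≡ resid m z
resid-unique {m} {c} {z} q lt e with resid-spec {m} z (≤-<-trans z≤n lt)
... | q′ , e′ = residue-unique (q ℤ.- q′) lt (resid< z (≤-<-trans z≤n lt))
    (trans (h₁ (pos (resid m z)) q′ (pos m)) (trans (cong (λ a → a ℤ.- q′ ℤ.* pos m) (trans (sym e′) e)) (h₂ (pos c) q q′ (pos m))))
  where
  h₁ : ∀ r q′ m → r ≡ (r ℤ.+ q′ ℤ.* m) ℤ.- q′ ℤ.* m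
  h₁ = ZS.solve-∀
  h₂ : ∀ c q q′ m → (c ℤ.+ q ℤ.* m) ℤ.- q′ ℤ.* m ≡ c ℤ.+ (q ℤ.- q′) ℤ.* m
  h₂ = ZS.solve-∀

resid-cong : ∀ {m z z′} q → z ≡ z′ ℤ.+ q ℤ.* pos m → resid m z ≡ resid m z′
resid-cong {zero} q e = refl
resid-cong {suc m} {z} {z′} q e with resid-spec {suc m} z (s≤s z≤n)
... | q′ , e′ = resid-unique {suc m} {resid (suc m) z} {z′} (q′ ℤ.- q) (resid< z (s≤s z≤n))
    (trans (h₁ z′ q (pos (suc m))) (trans (cong (λ a → a ℤ.- q ℤ.* pos (suc m)) (trans (sym e) e′)) (h₂ (pos (resid (suc m) z)) q′ q (pos (suc m)))))
  where
  h₁ : ∀ r q′ m → r ≡ (r ℤ.+ q′ ℤ.* m) ℤ.- q′ ℤ.* m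
  h₁ = ZS.solve-∀
  h₂ : ∀ c q q′ m → (c ℤ.+ q ℤ.* m) ℤ.- q′ ℤ.* m ≡ c ℤ.+ (q ℤ.- q′) ℤ.* m
  h₂ = ZS.solve-∀

resid-small : ∀ {m c} → c < m → resid m (pos c) ≡ c
resid-small {m} {c} lt = sym (resid-unique {m} {c} {pos c} 0ℤ lt (sym (ℤₚ.+-identityʳ (pos c))))

opℤ : Op → ℤ → ℤ → ℤ
opℤ plus a b = a ℤ.+ b
opℤ minus a b = a ℤ.+ (ℤ.- b)
opℤ times a b = a ℤ.* b

resid-op : ∀ m o a b → resid m (opℤ o (pos (resid m a)) (pos (resid m b))) ≡ resid m (opℤ o a b)
resid-op zero o a b = refl
resid-op m@(suc _) o a b with resid-spec {m} a (s≤s z≤n) | resid-spec {m} b (s≤s z≤n)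
... | q , e | q′ , e′ = sym (h o)
  where
  r = pos (resid m a)
  s = pos (resid m b)
  l₁ : ∀ r q s q′ m → (r ℤ.+ q ℤ.* m) ℤ.+ (s ℤ.+ q′ ℤ.* m) ≡ (r ℤ.+ s) ℤ.+ (q ℤ.+ q′) ℤ.* m
  l₁ = ZS.solve-∀
  l₂ : ∀ r q s q′ m → (r ℤ.+ q ℤ.* m) ℤ.+ (ℤ.- (s ℤ.+ q′ ℤ.* m)) ≡ (r ℤ.+ (ℤ.- s)) ℤ.+ (q ℤ.- q′) ℤ.* m
  l₂ = ZS.solve-∀
  l₃ : ∀ r q s q′ m → (r ℤ.+ q ℤ.* m) ℤ.* (s ℤ.+ q′ ℤ.* m) ≡ r ℤ.* s ℤ.+ (r ℤ.* q′ ℤ.+ q ℤ.* s ℤ.+ q ℤ.* q′ ℤ.* m) ℤ.* m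
  l₃ = ZS.solve-∀
  h : ∀ o → resid m (opℤ o a b) ≡ resid m (opℤ o r s)
  h plus = resid-cong {m} {a ℤ.+ b} {r ℤ.+ s} (q ℤ.+ q′) (trans (cong₂ ℤ._+_ e e′) (l₁ r q s q′ (pos m)))
  h minus = resid-cong {m} {a ℤ.+ (ℤ.- b)} {r ℤ.+ (ℤ.- s)} (q ℤ.- q′) (trans (cong₂ (λ a b → a ℤ.+ (ℤ.- b)) e e′) (l₂ r q s q′ (pos m)))
  h times = resid-cong {m} {a ℤ.* b} {r ℤ.* s} (r ℤ.* q′ ℤ.+ q ℤ.* s ℤ.+ q ℤ.* q′ ℤ.* pos m) (trans (cong₂ ℤ._*_ e e′) (l₃ r q s q′ (pos m)))

resid-minus⇒ : ∀ {m} a b {c} → c < m → resid m a ≡ (resid m b + c) mod m → c ≡ resid m (a ℤ.+ (ℤ.- b))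
resid-minus⇒ {m} a b {c} c<m e with resid-spec {m} (pos (resid m b + c)) (≤-<-trans z≤n c<m)
... | q , s = trans (resid-unique {m} {c} {pos (resid m a) ℤ.+ (ℤ.- pos (resid m b))} (ℤ.- q) c<m
    (l (pos (resid m a)) (pos (resid m b)) (pos c) q (pos m) (trans (sym (ℤₚ.pos-+ (resid m b) c)) (trans s (cong (λ z → pos z ℤ.+ q ℤ.* pos m) (sym e))))))
    (resid-op m minus a b)
  where
  l : ∀ r s c q m → s ℤ.+ c ≡ r ℤ.+ q ℤ.* m → r ℤ.+ (ℤ.- s) ≡ c ℤ.+ (ℤ.- q) ℤ.* m
  l r s c q m e = trans (l₁ r s q m) (trans (cong (λ z → z ℤ.+ (ℤ.- s) ℤ.+ (ℤ.- q) ℤ.* m) (sym e)) (l₂ s c q m))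
    where
    l₁ : ∀ r s q m → r ℤ.+ (ℤ.- s) ≡ (r ℤ.+ q ℤ.* m) ℤ.+ (ℤ.- s) ℤ.+ (ℤ.- q) ℤ.* m
    l₁ = ZS.solve-∀
    l₂ : ∀ s c q m → (s ℤ.+ c) ℤ.+ (ℤ.- s) ℤ.+ (ℤ.- q) ℤ.* m ≡ c ℤ.+ (ℤ.- q) ℤ.* m
    l₂ = ZS.solve-∀

resid-minus⇐ : ∀ {m} a b {c} → 0 < m → c ≡ resid m (a ℤ.+ (ℤ.- b)) → resid m a ≡ (resid m b + c) mod m
resid-minus⇐ {m} a b {c} 0<m e = trans (sym (resid-small (resid< a 0<m))) (trans (cong (resid m) (l (pos r) (pos s)))
  (trans (sym (resid-op m plus (pos s) (pos r ℤ.+ (ℤ.- pos s))))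
    (trans (cong₂ (λ y z → resid m (pos y ℤ.+ pos z)) (resid-small (resid< b 0<m)) (trans (resid-op m minus a b) (sym e)))
      (cong (resid m) (sym (ℤₚ.pos-+ s c))))))
  where
  r s : ℕ
  r = resid m a
  s = resid m b
  l : ∀ r s → r ≡ s ℤ.+ (r ℤ.+ (ℤ.- s))
  l = ZS.solve-∀

mod< : ∀ a {m} → 0 < m → a mod m < m
mod< a = resid< (pos a)

mod-+ : ∀ m a b → (a mod m + b mod m) mod m ≡ (a + b) mod m
mod-+ m a b = trans (cong (resid m) (ℤₚ.pos-+ (a mod m) (b mod m)))
  (trans (resid-op m plus (pos a) (pos b)) (cong (resid m) (sym (ℤₚ.pos-+ a b))))

mod-* : ∀ m a b → (a mod m * (b mod m)) mod m ≡ (a * b) mod m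
mod-* m a b = trans (cong (resid m) (ℤₚ.pos-* (a mod m) (b mod m)))
  (trans (resid-op m times (pos a) (pos b)) (cong (resid m) (sym (ℤₚ.pos-* a b))))

mod-mod : ∀ m a → (a mod m) mod m ≡ a mod m
mod-mod zero a = refl
mod-mod (suc m) a = resid-small (mod< a (s≤s z≤n))

mod-small : ∀ {a m} → a < m → a mod m ≡ a
mod-small = resid-small

mod-kn : ∀ m c k → (c + k * m) mod m ≡ c mod m
mod-kn m c k = resid-cong {m} {pos (c + k * m)} {pos c} (pos k) (trans (ℤₚ.pos-+ c (k * m)) (cong (λ a → pos c ℤ.+ a) (ℤₚ.pos-* k m)))

div-mod : ∀ a {m} → 0 < m → a ≡ a mod m + a div m * m
div-mod a {suc m} _ = DM.m≡m%n+[m/n]*n a (suc m)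

mod-unique : ∀ {m c a} k → c < m → a ≡ c + k * m → a mod m ≡ c
mod-unique {m} {c} k lt refl = trans (mod-kn m c k) (mod-small lt)

div-unique : ∀ {m c a} k → c < m → a ≡ c + k * m → a div m ≡ k
div-unique {m} {c} {a} k lt refl = *-cancelʳ-≡ (a div m) k m {{>-nonZero pos′}} (+-cancelˡ-≡ c _ _
  (trans (cong (_+ a div m * m) (sym (mod-unique {m} {c} {a} k lt refl))) (sym (div-mod a pos′))))
  where
  pos′ : 0 < m
  pos′ = ≤-<-trans z≤n lt

ind-⊎ : ∀ {P Q : Set} {a b} → Ind P a → Ind Q b → ¬ (P × Q) → Ind (P ⊎ Q) (a + b)
ind-⊎ (holds p) (holds q) h = ⊥-elim (h (p , q))
ind-⊎ (holds p) (fails _) h = holds (inj₁ p)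
ind-⊎ (fails _) (holds q) h = holds (inj₂ q)
ind-⊎ (fails p) (fails q) h = fails λ { (inj₁ a) → p a ; (inj₂ b) → q b }

-- Formulas for arithmetic modulo 2 ^ k on words.

table : ∀ k {V} → (Vec Bool k → Bool) → Vec (Atom V) k → Fm V
table zero P [] = cst (P [])
table (suc k) P (a ∷ as) = litᴬ true a ∙ table k (P ∘ (true ∷_)) as ∔ litᴬ false a ∙ table k (P ∘ (false ∷_)) as

⟦table⟧ : ∀ k {V} P (as : Vec (Atom V) k) ρ → ⟦ table k P as ⟧ ρ ≡ bit (P (Vec.map (atom ρ) as))
⟦table⟧ zero P [] ρ = refl
⟦table⟧ (suc k) P (a ∷ as) ρ = trans (cong₂ _+_ (cong₂ _*_ (⟦litᴬ⟧ true a ρ) (⟦table⟧ k _ as ρ)) (cong₂ _*_ (⟦litᴬ⟧ false a ρ) (⟦table⟧ k _ as ρ)))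
  (h (atom ρ a))
  where
  h : ∀ c → bit c * bit (P (true ∷ Vec.map (atom ρ) as)) + bit (not c) * bit (P (false ∷ Vec.map (atom ρ) as)) ≡ bit (P (c ∷ Vec.map (atom ρ) as))
  h true = trans (+-identityʳ _) (*-identityˡ _)
  h false = *-identityˡ _

tableSize : ℕ → ℕ
tableSize zero = 1
tableSize (suc k) = suc (suc (1 + tableSize k) + suc (1 + tableSize k))

fsize-table : ∀ k {V} P (as : Vec (Atom V) k) → fsize (table k P as) ≡ tableSize k
fsize-table zero P [] = refl
fsize-table (suc k) P (a ∷ as) = cong₂ (λ s t → suc (s + t))
  (cong₂ (λ s t → suc (s + t)) (fsize-litᴬ true a) (fsize-table k _ as))
  (cong₂ (λ s t → suc (s + t)) (fsize-litᴬ false a) (fsize-table k _ as))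

toBool : ℕ → Bool
toBool zero = false
toBool (suc _) = true

ind-toBool : ∀ {P a} → Ind P a → Ind P (bit (toBool a))
ind-toBool (holds p) = holds p
ind-toBool (fails p) = fails p

fullAdder : Vec Bool 5 → Bool
fullAdder (a ∷ b ∷ r ∷ c ∷ r′ ∷ []) = toBool (eq (bit a + bit b + bit r) (bit c + 2 * bit r′))

wk : ∀ {V : Set} → Atom V → Atom (Maybe V)
wk = mapᴬ just

wks : ∀ {k} {V : Set} → Vec (Atom V) k → Vec (Atom (Maybe V)) k
wks = Vec.map wk

-- Every outgoing carry is a summed bit with one admissible value, so the formula is 0 or 1. The
-- last carry is left free, which makes the check one modulo 2 ^ k.
addChk : ∀ {k V} (as bs cs : Vec (Atom V) k) → Atom V → Fm V
addChk [] [] [] r = cst true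
addChk (a ∷ as) (b ∷ bs) (c ∷ cs) r =
  sum (table 5 fullAdder (wk a ∷ wk b ∷ wk r ∷ wk c ∷ inj₂ nothing ∷ []) ∙ addChk (wks as) (wks bs) (wks cs) (inj₂ nothing))

abstract
  adderSize : ℕ
  adderSize = tableSize 5

  adderSize-≡ : tableSize 5 ≡ adderSize
  adderSize-≡ = refl

addSize : ℕ → ℕ
addSize k = (2 + adderSize) * k + 1

fsize-addChk : ∀ {k V} (as bs cs : Vec (Atom V) k) r → fsize (addChk as bs cs r) ≡ addSize k
fsize-addChk [] [] [] r = cong (_+ 1) (sym (*-zeroʳ (2 + adderSize)))
fsize-addChk {suc k} (a ∷ as) (b ∷ bs) (c ∷ cs) r = trans
  (cong₂ (λ s t → suc (suc (s + t))) (trans (fsize-table 5 fullAdder (wk a ∷ wk b ∷ wk r ∷ wk c ∷ inj₂ nothing ∷ [])) adderSize-≡) (fsize-addChk (wks as) (wks bs) (wks cs) (inj₂ nothing))) (h adderSize k)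
  where
  h : ∀ t k → suc (suc (t + ((2 + t) * k + 1))) ≡ (2 + t) * suc k + 1
  h = NS.solve-∀

atoms-map : ∀ {V W : Set} {k} (f : V → W) (ρ : W → Bool) (as : Vec (Atom V) k) → atoms ρ (Vec.map (mapᴬ f) as) ≡ atoms (ρ ∘ f) as
atoms-map f ρ [] = refl
atoms-map f ρ (a ∷ as) = cong₂ (λ s t → bit s + 2 * t) (atom-map f ρ a) (atoms-map f ρ as)

carry : ∀ a b r → ∃[ r′ ] bit a + bit b + bit r ≡ bit (odd (bit a + bit b + bit r)) + 2 * bit r′
carry true true true = true , refl
carry true true false = true , refl
carry true false true = true , refl
carry true false false = false , refl
carry false true true = true , refl
carry false true false = false , refl
carry false false true = false , refl
carry false false false = false , refl

ind-addChk : ∀ {k V} (as bs cs : Vec (Atom V) k) r ρ →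
             Ind (∃[ R ] atoms ρ as + atoms ρ bs + bit (atom ρ r) ≡ atoms ρ cs + R * 2 ^ k) (⟦ addChk as bs cs r ⟧ ρ)
ind-addChk [] [] [] r ρ = holds (bit (atom ρ r) , sym (*-identityʳ _))
ind-addChk {suc k} (a ∷ as) (b ∷ bs) (c ∷ cs) r ρ = ind-map to from
  (ind-⊎ (branch true) (branch false) λ { ((e , _) , (e′ , _)) → ne (trans (sym e) e′) })
  where
  S = bit (atom ρ a) + bit (atom ρ b) + bit (atom ρ r)
  c′ = atom ρ c
  A = atoms ρ as
  B = atoms ρ bs
  C = atoms ρ cs
  Branch : Bool → Set
  Branch r′ = (S ≡ bit c′ + 2 * bit r′) × ∃[ R ] A + B + bit r′ ≡ C + R * 2 ^ k
  fa : Bool → ℕ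
  fa r′ = ⟦ table 5 fullAdder (wk a ∷ wk b ∷ wk r ∷ wk c ∷ inj₂ nothing ∷ []) ⟧ (ext ρ r′)
  branch : ∀ r′ → Ind (Branch r′) (fa r′ * ⟦ addChk (wks as) (wks bs) (wks cs) (inj₂ nothing) ⟧ (ext ρ r′))
  branch r′ = ind-×
    (ind-cong (sym (trans (⟦table⟧ 5 fullAdder (wk a ∷ wk b ∷ wk r ∷ wk c ∷ inj₂ nothing ∷ []) (ext ρ r′))
       (cong bit e))) (ind-toBool (ind-eq S (bit c′ + 2 * bit r′))))
    (ind-map (λ { (R , q) → R , trans (sym w) (trans q (w′ R)) }) (λ { (R , q) → R , trans w (trans q (sym (w′ R))) })
       (ind-addChk (wks as) (wks bs) (wks cs) (inj₂ nothing) (ext ρ r′)))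
    where
    am = λ (u : Atom _) → atom-map just (ext ρ r′) u
    e : fullAdder (atom (ext ρ r′) (wk a) ∷ atom (ext ρ r′) (wk b) ∷ atom (ext ρ r′) (wk r) ∷ atom (ext ρ r′) (wk c) ∷ r′ ∷ [])
      ≡ fullAdder (atom ρ a ∷ atom ρ b ∷ atom ρ r ∷ atom ρ c ∷ r′ ∷ [])
    e rewrite am a | am b | am c | am r = refl
    w : atoms (ext ρ r′) (wks as) + atoms (ext ρ r′) (wks bs) + bit r′ ≡ A + B + bit r′
    w = cong₂ (λ s t → s + t + bit r′) (atoms-map just (ext ρ r′) as) (atoms-map just (ext ρ r′) bs)
    w′ : ∀ R → atoms (ext ρ r′) (wks cs) + R * 2 ^ k ≡ C + R * 2 ^ k
    w′ R = cong (_+ R * 2 ^ k) (atoms-map just (ext ρ r′) cs)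
  ne : bit c′ + 2 * 1 ≢ bit c′ + 2 * 0
  ne e with +-cancelˡ-≡ (bit c′) _ _ e
  ... | ()
  l₁ : ∀ a b r A B → (a + 2 * A) + (b + 2 * B) + r ≡ (a + b + r) + 2 * (A + B)
  l₁ = NS.solve-∀
  l₂ : ∀ c r A B → c + 2 * r + 2 * (A + B) ≡ c + 2 * (A + B + r)
  l₂ = NS.solve-∀
  l₃ : ∀ c C R M → c + 2 * (C + R * M) ≡ c + 2 * C + R * (2 * M)
  l₃ = NS.solve-∀
  Goal = ∃[ R ] (bit (atom ρ a) + 2 * A) + (bit (atom ρ b) + 2 * B) + bit (atom ρ r) ≡ (bit c′ + 2 * C) + R * (2 * 2 ^ k)
  mk : ∀ r′ → Branch r′ → Goal
  mk r′ (e , R , q) = R , trans (l₁ (bit (atom ρ a)) (bit (atom ρ b)) (bit (atom ρ r)) A B)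
    (trans (cong (_+ 2 * (A + B)) e) (trans (l₂ (bit c′) (bit r′) A B)
      (trans (cong (λ s → bit c′ + 2 * s) q) (l₃ (bit c′) C R (2 ^ k)))))
  to : Branch true ⊎ Branch false → Goal
  to (inj₁ p) = mk true p
  to (inj₂ p) = mk false p
  unmk : Goal → ∃[ r′ ] Branch r′
  unmk (R , q) with carry (atom ρ a) (atom ρ b) (atom ρ r)
  ... | r′ , e = r′ , trans e (cong (λ s → bit s + 2 * bit r′) oddS) , R ,
                 trans (sym (half-bit (odd S) (A + B + bit r′))) (trans (cong half q₁) (half-bit c′ (C + R * 2 ^ k)))
    where
    q₁ : bit (odd S) + 2 * (A + B + bit r′) ≡ bit c′ + 2 * (C + R * 2 ^ k)
    q₁ = trans (sym (l₂ (bit (odd S)) (bit r′) A B)) (trans (cong (_+ 2 * (A + B)) (sym e))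
      (trans (sym (l₁ (bit (atom ρ a)) (bit (atom ρ b)) (bit (atom ρ r)) A B)) (trans q (sym (l₃ (bit c′) C R (2 ^ k))))))
    oddS : odd S ≡ c′
    oddS = trans (sym (odd-bit (odd S) (A + B + bit r′))) (trans (cong odd q₁) (odd-bit c′ (C + R * 2 ^ k)))
  from : Goal → Branch true ⊎ Branch false
  from g with unmk g
  ... | true , p = inj₁ p
  ... | false , p = inj₂ p

ind-addChk-mod : ∀ {k V} (as bs cs : Vec (Atom V) k) ρ →
                 Ind (atoms ρ cs ≡ (atoms ρ as + atoms ρ bs) mod 2 ^ k) (⟦ addChk as bs cs (inj₁ false) ⟧ ρ)
ind-addChk-mod {k} as bs cs ρ = ind-map
  (λ { (R , e) → sym (mod-unique {2 ^ k} R (val< (Vec.map (atom ρ) cs)) (trans (sym (+-identityʳ _)) e)) })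
  (λ e → (atoms ρ as + atoms ρ bs) div 2 ^ k , trans (+-identityʳ _)
     (trans (div-mod (atoms ρ as + atoms ρ bs) {2 ^ k} (m^n>0 2 k)) (cong (_+ (atoms ρ as + atoms ρ bs) div 2 ^ k * 2 ^ k) (sym e))))
  (ind-addChk as bs cs (inj₁ false) ρ)

newWord : ∀ k {V : Set} → Vec (Atom (Fin k ⊎ V)) k
newWord k = tabulate (inj₂ ∘ inj₁)

wkW : ∀ {k l} {V : Set} → Vec (Atom V) l → Vec (Atom (Fin k ⊎ V)) l
wkW = Vec.map (mapᴬ inj₂)

atoms-tabulate : ∀ {k} {V : Set} (ρ : V → Bool) (g : Fin k → Atom V) (w : Vec Bool k) →
                 (∀ i → atom ρ (g i) ≡ lookup w i) → atoms ρ (tabulate g) ≡ val w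
atoms-tabulate ρ g [] h = refl
atoms-tabulate ρ g (b ∷ w) h = cong₂ (λ s t → bit s + 2 * t) (h zero) (atoms-tabulate ρ (g ∘ suc) w (h ∘ suc))

atoms-new : ∀ {k} {V : Set} (w : Vec Bool k) (ρ : V → Bool) → atoms (envW w ρ) (newWord k) ≡ val w
atoms-new w ρ = atoms-tabulate (envW w ρ) _ w (λ _ → refl)

falses : ∀ k {V : Set} → Vec (Atom V) k
falses k = replicate k (inj₁ false)

atoms-falses : ∀ k {V : Set} (ρ : V → Bool) → atoms ρ (falses k) ≡ 0
atoms-falses zero ρ = refl
atoms-falses (suc k) ρ = cong (2 *_) (atoms-falses k ρ)

-- Horner's rule in the bits of the second factor, from the top: with u the product by the higher
-- bits and v = u + u, the result is v + b a. The words of u and v are guessed, and reduction modulo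
-- 2 ^ k makes them unique.
mulChk : ∀ {j k V} (as : Vec (Atom V) k) (bs : Vec (Atom V) j) (cs : Vec (Atom V) k) → Fm V
mulChk {k = k} as [] cs = addChk (falses k) (falses k) cs (inj₁ false)
mulChk {k = k} as (b ∷ bs) cs =
  sumW k (mulChk (wkW as) (wkW bs) (newWord k) ∙
    sumW k (addChk (wkW (newWord k)) (wkW (newWord k)) (newWord k) (inj₁ false) ∙
      (litᴬ true (mapᴬ inj₂ (mapᴬ inj₂ b)) ∙ addChk (newWord k) (wkW (wkW as)) (wkW (wkW cs)) (inj₁ false) ∔
       litᴬ false (mapᴬ inj₂ (mapᴬ inj₂ b)) ∙ addChk (newWord k) (falses k) (wkW (wkW cs)) (inj₁ false))))

mulSize : ℕ → ℕ → ℕ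
mulSize j k = j * (2 * k + 3 * addSize k + 7) + addSize k

fsize-mulChk : ∀ {j k V} (as : Vec (Atom V) k) (bs : Vec (Atom V) j) cs → fsize (mulChk as bs cs) ≡ mulSize j k
fsize-mulChk {k = k} as [] cs = fsize-addChk (falses k) (falses k) cs (inj₁ false)
fsize-mulChk {suc j} {k} as (b ∷ bs) cs = trans (fsize-sumW k _) (trans (cong (k +_) (cong suc (cong₂ _+_
  (fsize-mulChk (wkW as) (wkW bs) (newWord k)) (trans (fsize-sumW k _) (cong (k +_) (cong suc (cong₂ _+_
    (fsize-addChk (wkW (newWord k)) (wkW (newWord k)) (newWord k) (inj₁ false)) (cong suc (cong₂ _+_
      (cong suc (cong₂ _+_ (fsize-litᴬ true (mapᴬ inj₂ (mapᴬ inj₂ b))) (fsize-addChk (newWord k) (wkW (wkW as)) (wkW (wkW cs)) (inj₁ false))))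
      (cong suc (cong₂ _+_ (fsize-litᴬ false (mapᴬ inj₂ (mapᴬ inj₂ b))) (fsize-addChk (newWord k) (falses k) (wkW (wkW cs)) (inj₁ false)))))))))))))
  (h j k (addSize k)))
  where
  h : ∀ j k A → k + suc ((j * (2 * k + 3 * A + 7) + A) + (k + suc (A + suc (suc (1 + A) + suc (1 + A))))) ≡ suc j * (2 * k + 3 * A + 7) + A
  h = NS.solve-∀

ind-mulChk : ∀ {j k V} (as : Vec (Atom V) k) (bs : Vec (Atom V) j) cs ρ →
             Ind (atoms ρ cs ≡ (atoms ρ as * atoms ρ bs) mod 2 ^ k) (⟦ mulChk as bs cs ⟧ ρ)
ind-mulChk {k = k} as [] cs ρ = ind-map
  (λ e → trans e (cong (_mod 2 ^ k) (trans (cong₂ _+_ (atoms-falses k ρ) (atoms-falses k ρ)) (sym (*-zeroʳ (atoms ρ as))))))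
  (λ e → trans e (cong (_mod 2 ^ k) (trans (*-zeroʳ (atoms ρ as)) (sym (cong₂ _+_ (atoms-falses k ρ) (atoms-falses k ρ))))))
  (ind-addChk-mod (falses k) (falses k) cs ρ)
ind-mulChk {suc j} {k} as (b ∷ bs) cs ρ = ind-cong (sym whole) (ind-map (λ e → trans e sem) (λ e → trans e (sym sem)) (lastInd (bits k v₀)))
  where
  M = 2 ^ k
  0<M = m^n>0 2 k
  A = atoms ρ as
  X = A * atoms ρ bs
  u₀ = X mod M
  v₀ = (u₀ + u₀) mod M
  restF : Fm (Fin k ⊎ (Fin k ⊎ _))
  restF = litᴬ true (mapᴬ inj₂ (mapᴬ inj₂ b)) ∙ addChk (newWord k) (wkW (wkW as)) (wkW (wkW cs)) (inj₁ false) ∔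
       litᴬ false (mapᴬ inj₂ (mapᴬ inj₂ b)) ∙ addChk (newWord k) (falses k) (wkW (wkW cs)) (inj₁ false)
  lastF : Vec Bool k → Vec Bool k → ℕ
  lastF u v = ⟦ restF ⟧ (envW v (envW u ρ))
  wk2 : ∀ {l} (u v : Vec Bool k) (ds : Vec (Atom _) l) → atoms (envW v (envW u ρ)) (wkW (wkW ds)) ≡ atoms ρ ds
  wk2 u v ds = trans (atoms-map inj₂ (envW v (envW u ρ)) (wkW ds)) (atoms-map inj₂ (envW u ρ) ds)
  lastInd′ : ∀ u v → Ind (atoms ρ cs ≡ (val v + bit (atom ρ b) * A) mod M) (lastF u v)
  lastInd′ u v = ind-cong (sym e) (h (atom ρ b))
    where
    ρ′ = envW v (envW u ρ)
    one′ = ⟦ addChk (newWord k) (wkW (wkW as)) (wkW (wkW cs)) (inj₁ false) ⟧ ρ′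
    zero′ = ⟦ addChk (newWord k) (falses k) (wkW (wkW cs)) (inj₁ false) ⟧ ρ′
    at : atom ρ′ (mapᴬ inj₂ (mapᴬ inj₂ b)) ≡ atom ρ b
    at = trans (atom-map inj₂ ρ′ (mapᴬ inj₂ b)) (atom-map inj₂ (envW u ρ) b)
    e : lastF u v ≡ bit (atom ρ b) * one′ + bit (not (atom ρ b)) * zero′
    e = cong₂ _+_ (cong (_* one′) (trans (⟦litᴬ⟧ true (mapᴬ inj₂ (mapᴬ inj₂ b)) ρ′) (cong bit at)))
                  (cong (_* zero′) (trans (⟦litᴬ⟧ false (mapᴬ inj₂ (mapᴬ inj₂ b)) ρ′) (cong (bit ∘ not) at)))
    h : ∀ c → Ind (atoms ρ cs ≡ (val v + bit c * A) mod M) (bit c * one′ + bit (not c) * zero′)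
    h true = ind-cong (sym (trans (+-identityʳ _) (*-identityˡ one′))) (ind-map
       (λ q → trans (sym (wk2 u v cs)) (trans q t)) (λ q → trans (wk2 u v cs) (trans q (sym t)))
       (ind-addChk-mod (newWord k) (wkW (wkW as)) (wkW (wkW cs)) ρ′))
       where
       t : (atoms ρ′ (newWord k) + atoms ρ′ (wkW (wkW as))) mod M ≡ (val v + (A + 0)) mod M
       t = cong (_mod M) (cong₂ _+_ (atoms-new v (envW u ρ)) (trans (wk2 u v as) (sym (+-identityʳ A))))
    h false = ind-cong (sym (*-identityˡ zero′)) (ind-map
       (λ q → trans (sym (wk2 u v cs)) (trans q t)) (λ q → trans (wk2 u v cs) (trans q (sym t)))
       (ind-addChk-mod (newWord k) (falses k) (wkW (wkW cs)) ρ′))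
       where
       t : (atoms ρ′ (newWord k) + atoms ρ′ (falses k)) mod M ≡ (val v + 0) mod M
       t = cong (_mod M) (cong₂ _+_ (atoms-new v (envW u ρ)) (atoms-falses k ρ′))
  lastInd : ∀ v → Ind (atoms ρ cs ≡ (val v + bit (atom ρ b) * A) mod M) (lastF (bits k u₀) v)
  lastInd = lastInd′ (bits k u₀)
  inner : ∀ u → val u ≡ u₀ → ⟦ sumW k (addChk (wkW (newWord k)) (wkW (newWord k)) (newWord k) (inj₁ false) ∙ restF) ⟧ (envW u ρ) ≡ lastF u (bits k v₀)
  inner u e = trans (⟦sumW⟧ k _ (envW u ρ)) (sumB-select k {λ z → z ≡ v₀} _ (lastF u) v₀ (mod< (u₀ + u₀) 0<M) refl (λ _ p → p)
    (λ v → ind-map (λ q → trans (sym (atoms-new v (envW u ρ))) (trans q (t v))) (λ q → trans (atoms-new v (envW u ρ)) (trans q (sym (t v))))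
       (ind-addChk-mod (wkW (newWord k)) (wkW (newWord k)) (newWord k) (envW v (envW u ρ)))))
    where
    n : ∀ v → atoms (envW v (envW u ρ)) (wkW (newWord k)) ≡ u₀
    n v = trans (atoms-map inj₂ (envW v (envW u ρ)) (newWord k)) (trans (atoms-new u ρ) e)
    t : ∀ v → (atoms (envW v (envW u ρ)) (wkW (newWord k)) + atoms (envW v (envW u ρ)) (wkW (newWord k))) mod M ≡ v₀
    t v = cong (_mod M) (cong₂ _+_ (n v) (n v))
  whole : ⟦ mulChk as (b ∷ bs) cs ⟧ ρ ≡ lastF (bits k u₀) (bits k v₀)
  whole = trans (⟦sumW⟧ k _ ρ) (trans (sumB-select k {λ z → z ≡ u₀} _ _ u₀ (mod< X 0<M) refl (λ _ p → p)
    (λ u → ind-map (λ q → trans (sym (atoms-new u ρ)) (trans q (t u))) (λ q → trans (atoms-new u ρ) (trans q (sym (t u))))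
       (ind-mulChk (wkW as) (wkW bs) (newWord k) (envW u ρ))))
    (inner (bits k u₀) (val-bits k u₀ (mod< X 0<M))))
    where
    t : ∀ u → (atoms (envW u ρ) (wkW as) * atoms (envW u ρ) (wkW bs)) mod M ≡ u₀
    t u = cong (_mod M) (cong₂ _*_ (atoms-map inj₂ (envW u ρ) as) (atoms-map inj₂ (envW u ρ) bs))
  c = bit (atom ρ b)
  l : ∀ A B c → A * B + A * B + c * A ≡ A * (c + 2 * B)
  l = NS.solve-∀
  sem : (val (bits k v₀) + c * A) mod M ≡ (A * (c + 2 * atoms ρ bs)) mod M
  sem = begin
    (val (bits k v₀) + c * A) mod M    ≡⟨ cong (λ a → (a + c * A) mod M) (val-bits k v₀ (mod< (u₀ + u₀) 0<M)) ⟩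
    (v₀ + c * A) mod M                 ≡⟨ cong (λ a → (a + c * A) mod M) (mod-+ M X X) ⟩
    ((X + X) mod M + c * A) mod M      ≡⟨ sym (mod-+ M ((X + X) mod M) (c * A)) ⟩
    (((X + X) mod M) mod M + (c * A) mod M) mod M ≡⟨ cong (λ a → (a + (c * A) mod M) mod M) (mod-mod M (X + X)) ⟩
    ((X + X) mod M + (c * A) mod M) mod M ≡⟨ mod-+ M (X + X) (c * A) ⟩
    (X + X + c * A) mod M              ≡⟨ cong (_mod M) (l A (atoms ρ bs) c) ⟩
    (A * (c + 2 * atoms ρ bs)) mod M   ∎
    where open ≡-Reasoning

module Z = Evaluation ℤₚ.+-*-commutativeRing

-- Simulation of a straight-line program: a word is summed over for every gate, and the formula chk
-- admits exactly one value of it.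

module Simulation {U : Set} {n : ℕ} (k′ : ℕ) (inp : Fin n → Atom U)
                  (chk : Op → Fm ((Fin 3 × Fin (suc k′)) ⊎ U)) where

  private
    k = suc k′

  wireWord : ∀ {j} → Wire n j → Fin k → Atom ((Fin j × Fin k) ⊎ U)
  wireWord (inj₁ (x i)) zero = mapᴬ inj₂ (inp i)
  wireWord (inj₁ (x i)) (suc _) = inj₁ false
  wireWord (inj₁ one) zero = inj₁ true
  wireWord (inj₁ one) (suc _) = inj₁ false
  wireWord (inj₂ j) i = inj₂ (inj₁ (j , i))

  operands : ∀ {j} → Wire n j → Wire n j → (Fin 3 × Fin k) ⊎ U → Atom (Fin k ⊎ ((Fin j × Fin k) ⊎ U))
  operands a b (inj₁ (zero , i)) = mapᴬ inj₂ (wireWord a i)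
  operands a b (inj₁ (suc zero , i)) = mapᴬ inj₂ (wireWord b i)
  operands a b (inj₁ (suc (suc zero) , i)) = inj₂ (inj₁ i)
  operands a b (inj₂ u) = inj₂ (inj₂ (inj₂ u))

  newest : ∀ {j} → (Fin (suc j) × Fin k) ⊎ U → Atom (Fin k ⊎ ((Fin j × Fin k) ⊎ U))
  newest (inj₁ (zero , i)) = inj₂ (inj₁ i)
  newest (inj₁ (suc j , i)) = inj₂ (inj₂ (inj₁ (j , i)))
  newest (inj₂ u) = inj₂ (inj₂ (inj₂ u))

  closed : (Fin 0 × Fin k) ⊎ U → Atom U
  closed (inj₂ u) = inj₂ u

  sim : ∀ {j} → Gates n j → Fm ((Fin j × Fin k) ⊎ U) → Fm U
  sim ∅ body = bind closed body
  sim (G ▷ gate o a b) body = sim G (sumW k (bind (operands a b) (chk o) ∙ bind newest body))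

  fsize-sim : ∀ {S} → (∀ o → fsize (chk o) ≤ S) → ∀ {j} (G : Gates n j) body →
              fsize (sim G body) ≤ fsize body + j * (suc k + S)
  fsize-sim h ∅ body = ≤-reflexive (trans (fsize-bind closed body) (sym (+-identityʳ _)))
  fsize-sim {S} h {suc j} (G ▷ gate o a b) body = begin
    fsize (sim G (sumW k (bind (operands a b) (chk o) ∙ bind newest body)))
      ≤⟨ fsize-sim h G _ ⟩
    fsize (sumW k (bind (operands a b) (chk o) ∙ bind newest body)) + j * (suc k + S)
      ≡⟨ cong (_+ j * (suc k + S)) (trans (fsize-sumW k (bind (operands a b) (chk o) ∙ bind newest body)) (cong₂ (λ s t → k + suc (s + t)) (fsize-bind (operands a b) (chk o)) (fsize-bind newest body))) ⟩
    k + suc (fsize (chk o) + fsize body) + j * (suc k + S)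
      ≤⟨ +-monoˡ-≤ (j * (suc k + S)) (+-monoʳ-≤ k (s≤s (+-monoˡ-≤ (fsize body) (h o)))) ⟩
    k + suc (S + fsize body) + j * (suc k + S)
      ≡⟨ l k S (fsize body) j ⟩
    fsize body + suc j * (suc k + S) ∎
    where
    open ≤-Reasoning
    l : ∀ k S b j → k + suc (S + b) + j * (suc k + S) ≡ b + suc j * (suc k + S)
    l = NS.solve-∀

  env₃ : Vec Bool k → Vec Bool k → Vec Bool k → (U → Bool) → (Fin 3 × Fin k) ⊎ U → Bool
  env₃ a b c ρ (inj₁ (zero , i)) = lookup a i
  env₃ a b c ρ (inj₁ (suc zero , i)) = lookup b i
  env₃ a b c ρ (inj₁ (suc (suc zero) , i)) = lookup c i
  env₃ a b c ρ (inj₂ u) = ρ u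

  envG : ∀ {j} → (Fin j → Vec Bool k) → (U → Bool) → (Fin j × Fin k) ⊎ U → Bool
  envG ws ρ (inj₁ (j , i)) = lookup (ws j) i
  envG ws ρ (inj₂ u) = ρ u

  -- The check has to single out the residue among all words of k bits, including those of value m
  -- or more. With 2 ≤ m a bit is its own residue, so input wires can be copied without reduction.
  module Semantics (ρ : U → Bool) (m : ℕ) (2≤m : 2 ≤ m) (m≤ : m ≤ 2 ^ k)
    (chk-ok : ∀ o a b c → Ind (val c ≡ resid m (opℤ o a b))
                              (⟦ chk o ⟧ (env₃ (bits k (resid m a)) (bits k (resid m b)) c ρ))) where

    value : Poly n → ℤ
    value = Z.ev (λ i → Z.ιᵇ (atom ρ (inp i)))

    word : Poly n → Vec Bool k
    word P = bits k (resid m (value P))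

    lookup-zero : ∀ l i → lookup (bits l 0) i ≡ false
    lookup-zero (suc l) zero = refl
    lookup-zero (suc l) (suc i) = lookup-zero l i

    bit-word : ∀ b → bits k (resid m (Z.ιᵇ b)) ≡ b ∷ bits k′ 0
    bit-word true = cong (bits k) (resid-small {m} 2≤m)
    bit-word false = cong (bits k) (resid-small {m} {0} (≤-trans (s≤s z≤n) 2≤m))

    words : ∀ {j} → Gates n j → Fin j → Vec Bool k
    words G j = word (gateVals G j)

    wireWord-ok : ∀ {j} (G : Gates n j) w i → atom (envG (words G) ρ) (wireWord w i) ≡ lookup (word (wireVal (gateVals G) w)) i
    wireWord-ok G (inj₁ (x i)) zero = trans (atom-map inj₂ (envG (words G) ρ) (inp i)) (sym (cong Vec.head (bit-word (atom ρ (inp i)))))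
    wireWord-ok G (inj₁ (x i)) (suc l) = sym (trans (cong (λ w → lookup w (suc l)) (bit-word (atom ρ (inp i)))) (lookup-zero k′ l))
    wireWord-ok G (inj₁ one) zero = sym (cong Vec.head (bit-word true))
    wireWord-ok G (inj₁ one) (suc l) = sym (trans (cong (λ w → lookup w (suc l)) (bit-word true)) (lookup-zero k′ l))
    wireWord-ok G (inj₂ j) i = refl

    value-op : ∀ o P Q → value (opVal o P Q) ≡ opℤ o (value P) (value Q)
    value-op plus P Q = refl
    value-op minus P Q = refl
    value-op times P Q = refl

    ⟦sim⟧ : ∀ {j} (G : Gates n j) body → ⟦ sim G body ⟧ ρ ≡ ⟦ body ⟧ (envG (words G) ρ)
    ⟦sim⟧ ∅ body = trans (⟦bind⟧ closed body ρ) (⟦⟧-cong body λ { (inj₁ ()) ; (inj₂ u) → refl })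
    ⟦sim⟧ (G ▷ gate o a b) body = begin
      ⟦ sim G step ⟧ ρ
        ≡⟨ ⟦sim⟧ G step ⟩
      ⟦ step ⟧ (envG (words G) ρ)
        ≡⟨ ⟦sumW⟧ k (bind (operands a b) (chk o) ∙ bind newest body) (envG (words G) ρ) ⟩
      sumB k (λ w → ⟦ bind (operands a b) (chk o) ⟧ (E w) * ⟦ bind newest body ⟧ (E w))
        ≡⟨ sumB-select k {λ z → z ≡ r} (λ w → ⟦ bind (operands a b) (chk o) ⟧ (E w)) (λ w → ⟦ bind newest body ⟧ (E w)) r (<-≤-trans (resid< z (≤-trans (s≤s z≤n) 2≤m)) m≤) refl (λ _ p → p)
             (λ w → ind-cong (sym (trans (⟦bind⟧ (operands a b) (chk o) (E w)) (⟦⟧-cong (chk o) (ops w)))) (chk-ok o zA zB w)) ⟩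
      ⟦ bind newest body ⟧ (E (bits k r))
        ≡⟨ trans (⟦bind⟧ newest body _) (⟦⟧-cong body new) ⟩
      ⟦ body ⟧ (envG (words (G ▷ gate o a b)) ρ) ∎
      where
      open ≡-Reasoning
      step = sumW k (bind (operands a b) (chk o) ∙ bind newest body)
      E : Vec Bool k → Fin k ⊎ ((Fin _ × Fin k) ⊎ U) → Bool
      E w = envW w (envG (words G) ρ)
      A = wireVal (gateVals G) a
      B = wireVal (gateVals G) b
      zA = value A
      zB = value B
      z = opℤ o zA zB
      r = resid m z
      ops : ∀ w v → atom (E w) (operands a b v) ≡ env₃ (word A) (word B) w ρ v
      ops w (inj₁ (zero , i)) = trans (atom-map inj₂ (E w) (wireWord a i)) (wireWord-ok G a i)
      ops w (inj₁ (suc zero , i)) = trans (atom-map inj₂ (E w) (wireWord b i)) (wireWord-ok G b i)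
      ops w (inj₁ (suc (suc zero) , i)) = refl
      ops w (inj₂ u) = refl
      new : ∀ v → atom (E (bits k r)) (newest v) ≡ envG (words (G ▷ gate o a b)) ρ v
      new (inj₁ (zero , i)) = cong (λ t → lookup (bits k (resid m t)) i) (sym (value-op o A B))
      new (inj₁ (suc j , i)) = refl
      new (inj₂ u) = refl

eqChk : ∀ {k V} → Vec (Atom V) k → Vec (Atom V) k → Fm V
eqChk [] [] = cst true
eqChk (a ∷ as) (b ∷ bs) = (litᴬ true a ∙ litᴬ true b ∔ litᴬ false a ∙ litᴬ false b) ∙ eqChk as bs

fsize-eqChk : ∀ {k V} (as bs : Vec (Atom V) k) → fsize (eqChk as bs) ≡ 8 * k + 1
fsize-eqChk [] [] = refl
fsize-eqChk {suc k} (a ∷ as) (b ∷ bs) = trans (cong₂ (λ s t → suc (suc s + t))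
  (cong₂ _+_ (cong suc (cong₂ _+_ (fsize-litᴬ true a) (fsize-litᴬ true b))) (cong suc (cong₂ _+_ (fsize-litᴬ false a) (fsize-litᴬ false b))))
  (fsize-eqChk as bs)) (h k)
  where
  h : ∀ k → suc (suc 6 + (8 * k + 1)) ≡ 8 * suc k + 1
  h = NS.solve-∀

ind-eqChk : ∀ {k V} (as bs : Vec (Atom V) k) ρ → Ind (atoms ρ as ≡ atoms ρ bs) (⟦ eqChk as bs ⟧ ρ)
ind-eqChk [] [] ρ = holds refl
ind-eqChk (a ∷ as) (b ∷ bs) ρ = ind-cong (sym (cong (_* ⟦ eqChk as bs ⟧ ρ)
  (cong₂ _+_ (cong₂ _*_ (⟦litᴬ⟧ true a ρ) (⟦litᴬ⟧ true b ρ)) (cong₂ _*_ (⟦litᴬ⟧ false a ρ) (⟦litᴬ⟧ false b ρ)))))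
  (ind-map (λ { (p , q) → cong₂ (λ s t → bit s + 2 * t) p q })
     (λ e → trans (sym (odd-bit (atom ρ a) (atoms ρ as))) (trans (cong odd e) (odd-bit (atom ρ b) (atoms ρ bs))) ,
            trans (sym (half-bit (atom ρ a) (atoms ρ as))) (trans (cong half e) (half-bit (atom ρ b) (atoms ρ bs))))
     (ind-× (h (atom ρ a) (atom ρ b)) (ind-eqChk as bs ρ)))
  where
  h : ∀ a b → Ind (a ≡ b) (bit a * bit b + bit (not a) * bit (not b))
  h true true = holds refl
  h true false = fails λ ()
  h false true = fails λ ()
  h false false = holds refl

record Enumeration (V : ℕ → Set) : Set where
  field
    card    : ℕ → ℕ
    card-pb : PB card
    enc     : ∀ n → V n → Fin (card n)
    dec     : ∀ n → Fin (card n) → Atom (V n)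
    dec-enc : ∀ n v → dec n (enc n v) ≡ inj₂ v

-- Circuit arithmetic modulo a power of two

module PowerOfTwo {U : Set} (k : ℕ) where

  pick : Fin 3 → Fin k → Atom ((Fin 3 × Fin k) ⊎ U)
  pick j i = inj₂ (inj₁ (j , i))

  word₃ : Fin 3 → Vec (Atom ((Fin 3 × Fin k) ⊎ U)) k
  word₃ j = tabulate (pick j)

  chk : Op → Fm ((Fin 3 × Fin k) ⊎ U)
  chk plus = addChk (word₃ zero) (word₃ (suc zero)) (word₃ (suc (suc zero))) (inj₁ false)
  -- A difference is checked as the sum b + c = a, which determines c modulo 2 ^ k.
  chk minus = addChk (word₃ (suc zero)) (word₃ (suc (suc zero))) (word₃ zero) (inj₁ false)
  chk times = mulChk (word₃ zero) (word₃ (suc zero)) (word₃ (suc (suc zero)))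

  fsize-chk : ∀ o → fsize (chk o) ≤ mulSize k k
  fsize-chk plus = ≤-trans (≤-reflexive (fsize-addChk (word₃ zero) (word₃ (suc zero)) (word₃ (suc (suc zero))) (inj₁ false))) (m≤n+m (addSize k) (k * (2 * k + 3 * addSize k + 7)))
  fsize-chk minus = ≤-trans (≤-reflexive (fsize-addChk (word₃ (suc zero)) (word₃ (suc (suc zero))) (word₃ zero) (inj₁ false))) (m≤n+m (addSize k) (k * (2 * k + 3 * addSize k + 7)))
  fsize-chk times = ≤-reflexive (fsize-mulChk (word₃ zero) (word₃ (suc zero)) (word₃ (suc (suc zero))))

module _ {U : Set} {n : ℕ} (k′ : ℕ) (inp : Fin n → Atom U) (ρ : U → Bool) where
  private
    k = suc k′
    M = 2 ^ k
    0<M : 0 < M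
    0<M = m^n>0 2 k
  open PowerOfTwo {U} k
  open Simulation k′ inp chk

  chk-ok : ∀ o a b c → Ind (val c ≡ resid M (opℤ o a b)) (⟦ chk o ⟧ (env₃ (bits k (resid M a)) (bits k (resid M b)) c ρ))
  chk-ok o a b c = go o
    where
    E = env₃ (bits k (resid M a)) (bits k (resid M b)) c ρ
    va : atoms E (word₃ zero) ≡ resid M a
    va = trans (atoms-tabulate E (pick zero) (bits k (resid M a)) (λ _ → refl)) (val-bits k (resid M a) (resid< a 0<M))
    vb : atoms E (word₃ (suc zero)) ≡ resid M b
    vb = trans (atoms-tabulate E (pick (suc zero)) (bits k (resid M b)) (λ _ → refl)) (val-bits k (resid M b) (resid< b 0<M))
    vc : atoms E (word₃ (suc (suc zero))) ≡ val c
    vc = atoms-tabulate E (pick (suc (suc zero))) c (λ _ → refl)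
    go : ∀ o → Ind (val c ≡ resid M (opℤ o a b)) (⟦ chk o ⟧ E)
    go plus = ind-map (λ e → trans (sym vc) (trans e t)) (λ e → trans vc (trans e (sym t)))
      (ind-addChk-mod (word₃ zero) (word₃ (suc zero)) (word₃ (suc (suc zero))) E)
      where
      t : (atoms E (word₃ zero) + atoms E (word₃ (suc zero))) mod M ≡ resid M (a ℤ.+ b)
      t = trans (cong (_mod M) (cong₂ _+_ va vb)) (trans (cong (resid M) (ℤₚ.pos-+ (resid M a) (resid M b))) (resid-op M plus a b))
    go times = ind-map (λ e → trans (sym vc) (trans e t)) (λ e → trans vc (trans e (sym t)))
      (ind-mulChk (word₃ zero) (word₃ (suc zero)) (word₃ (suc (suc zero))) E)
      where
      t : (atoms E (word₃ zero) * atoms E (word₃ (suc zero))) mod M ≡ resid M (a ℤ.* b)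
      t = trans (cong (_mod M) (cong₂ _*_ va vb)) (trans (cong (resid M) (ℤₚ.pos-* (resid M a) (resid M b))) (resid-op M times a b))
    go minus = ind-map (λ e → resid-minus⇒ a b (val< c) (trans (sym va) (trans e t))) (λ e → trans va (trans (resid-minus⇐ a b 0<M e) (sym t)))
      (ind-addChk-mod (word₃ (suc zero)) (word₃ (suc (suc zero))) (word₃ zero) E)
      where
      t : (atoms E (word₃ (suc zero)) + atoms E (word₃ (suc (suc zero)))) mod M ≡ (resid M b + val c) mod M
      t = cong (_mod M) (cong₂ _+_ vb vc)

PB-mulSize : ∀ {s t} → PB s → PB t → PB (λ n → mulSize (s n) (t n))
PB-mulSize ps pt = pb-+ (pb-* ps (pb-+ (pb-+ (pb-* (pb-const 2) pt) (pb-* (pb-const 3) pa)) (pb-const 7))) pa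
  where
  pa = pb-+ (pb-* (pb-const (2 + adderSize)) pt) (pb-const 1)

ι-ℤ : ∀ n → Z.ι n ≡ pos n
ι-ℤ zero = refl
ι-ℤ (suc n) = cong (λ a → 1ℤ ℤ.+ a) (ι-ℤ n)

-- The collapse applied to summation formulas

Circuits : (ℕ → ℕ) → Set
Circuits a = (n : ℕ) → Circuit (a n)

module Collapse (hyp : VNP0≡VP0) where

  abstract
    -- The one place where the hypothesis is applied. For expressions of polynomial tree size
    -- `computes-tree` bounds circuit size and formal degree at once, which is what membership in
    -- `VP0` asks.
    collapse : ∀ a p → PB a → PB p → (g : ∀ n → Poly (a n + p n)) → PB (treeSize ∘ g) →
               Σ (Circuits a) λ C → (∀ n → eval (C n) ≈ boolSum {a n} {p n} (g n)) × PB (size ∘ C)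
    collapse a p pa pp g pg = proj₁ (proj₂ result) , proj₁ (proj₂ (proj₂ result)) , fromPolyBounded (proj₁ (proj₂ (proj₂ (proj₂ result))))
      where
      F : Family
      F = family a (λ n → boolSum {a n} {p n} (g n))
      C : Circuits (λ n → a n + p n)
      C n = circuit _ (Computes.code (computes-tree (g n))) (Computes.out (computes-tree (g n)))
      value : ∀ n → eval (C n) ≈ g n
      value n = Computes.value (computes-tree (g n))
      size≤ : ∀ n → size (C n) ≤ 2 * treeSize (g n)
      size≤ n = Computes.size≤ (computes-tree (g n))
      deg≤ : ∀ n → formalDegree (C n) ≤ treeSize (g n)
      deg≤ n = Computes.deg≤ (computes-tree (g n))
      inVP : VP0 (family (λ n → a n + p n) g)
      inVP = toPolyBounded (pb-+ pa pp) , C , value , toPolyBounded (pb-mono size≤ (pb-* (pb-const 2) pg)) , toPolyBounded (pb-mono deg≤ pg)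
      result : VP0 F
      result = proj₁ (hyp F) (p , toPolyBounded pp , g , inVP , λ n → ≈-refl)

    -- The summation disappears, at the price of a circuit about whose inner gates nothing is
    -- recorded: they may carry negative or huge integers, although the output at a Boolean point is
    -- a count of bounded length. Hence the simulation modulo a power of two.
    formula-circuits : ∀ a → PB a → (φ : ∀ n → Fm (Fin (a n))) → PB (fsize ∘ φ) →
      Σ (Circuits a) λ C → (∀ n s → Z.ev (Z.ιᵇ ∘ s) (eval (C n)) ≡ pos (⟦ φ n ⟧ s)) × PB (size ∘ C)
    formula-circuits a pa φ pφ = proj₁ found , semantics , proj₂ (proj₂ found)
      where
      g : ∀ n → Poly (a n + bound (φ n))
      g n = matrix (φ n) (λ v → var (v ↑ˡ bound (φ n))) (λ i → var (a n ↑ʳ i))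
      found : Σ (Circuits a) λ C → (∀ n → eval (C n) ≈ boolSum {a n} {bound (φ n)} (g n)) × PB (size ∘ C)
      found = collapse a (bound ∘ φ) pa (pb-mono (bound≤fsize ∘ φ) pφ) g
        (pb-mono (λ n → treeSize-matrix (φ n) _ _ (λ _ → refl) (λ _ → refl)) (pb-* (pb-const 5) (pb-* pφ pφ)))
      C : Circuits a
      C = proj₁ found
      value : ∀ n → eval (C n) ≈ boolSum {a n} {bound (φ n)} (g n)
      value = proj₁ (proj₂ found)
      semantics : ∀ n s → Z.ev (Z.ιᵇ ∘ s) (eval (C n)) ≡ pos (⟦ φ n ⟧ s)
      semantics n s = begin
        Z.ev (Z.ιᵇ ∘ s) (eval (C n))
          ≡⟨ Z.ev-sound (Z.ιᵇ ∘ s) (value n) ⟩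
        Z.ev (Z.ιᵇ ∘ s) (boolSum {a n} {b} (g n))
          ≡⟨ Z.ev-boolSum {a n} {b} (Z.ιᵇ ∘ s) (g n) ⟩
        Z.sumR b (λ ε → Z.ev (Z.env⁺ (Z.ιᵇ ∘ s) (Z.ιᵇ ∘ lookup ε)) (g n))
          ≡⟨ Z.sumR-cong b (λ ε → MatrixEvaluation.ev-matrix ℤₚ.+-*-commutativeRing _ (φ n) _ _ s ε
               (λ v → Z.env⁺-↑ˡ (Z.ιᵇ ∘ s) (Z.ιᵇ ∘ lookup ε) v) (λ i → Z.env⁺-↑ʳ (Z.ιᵇ ∘ s) (Z.ιᵇ ∘ lookup ε) i)) ⟩
        Z.sumR b (Z.ι ∘ mat (φ n) s)
          ≡⟨ sym (Z.ι-sumB b (mat (φ n) s)) ⟩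
        Z.ι (sumB b (mat (φ n) s))
          ≡⟨ trans (ι-ℤ _) (cong pos (sum-mat (φ n) s)) ⟩
        pos (⟦ φ n ⟧ s) ∎
        where
        open ≡-Reasoning
        b : ℕ
        b = bound (φ n)

  -- A count becomes a word, whose digits can be tested and reused, while the formula itself offers
  -- only the number.
  record Graph {V : ℕ → Set} (L : ℕ → ℕ) (φ : ∀ n → Fm (V n)) : Set where
    field
      graph    : ∀ n → Fm (Fin (L n) ⊎ V n)
      graph-pb : PB (fsize ∘ graph)
      graph-ok : ∀ n ρ w → ⟦ φ n ⟧ ρ < 2 ^ L n → Ind (val w ≡ ⟦ φ n ⟧ ρ) (⟦ graph n ⟧ (envW w ρ))

  module _ {V : ℕ → Set} (enum : Enumeration V) (L′ : ℕ → ℕ) (pL : PB L′) (φ : ∀ n → Fm (V n)) (pφ : PB (fsize ∘ φ)) where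
    open Enumeration enum
    private
      flat : ∀ n → Fm (Fin (card n))
      flat n = bind (inj₂ ∘ enc n) (φ n)
      found = formula-circuits card card-pb flat (pb-mono (λ n → ≤-reflexive (fsize-bind (inj₂ ∘ enc n) (φ n))) pφ)
      C = proj₁ found
      L : ℕ → ℕ
      L n = suc (L′ n)
      U : ℕ → Set
      U n = Fin (L n) ⊎ V n
      inp : ∀ n → Fin (card n) → Atom (U n)
      inp n i = mapᴬ inj₂ (dec n i)
      module S (n : ℕ) = Simulation (L′ n) (inp n) (PowerOfTwo.chk {U n} (L n))
      target : ∀ n → Vec (Atom ((Fin (size (C n)) × Fin (L n)) ⊎ U n)) (L n)
      target n = tabulate (λ i → inj₂ (inj₂ (inj₁ i)))
      result : ∀ n → Vec (Atom ((Fin (size (C n)) × Fin (L n)) ⊎ U n)) (L n)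
      result n = tabulate (S.wireWord n (output (C n)))
      body : ∀ n → Fm ((Fin (size (C n)) × Fin (L n)) ⊎ U n)
      body n = eqChk (target n) (result n)

    -- The count is turned into a circuit, the circuit is simulated modulo 2 ^ L, and its output
    -- word is compared with the given one. As the count is below 2 ^ L, it is its own residue.
    makeGraph : Graph (λ n → suc (L′ n)) φ
    makeGraph = record
      { graph = λ n → S.sim n (gates (C n)) (body n)
      ; graph-pb = pb-mono
          (λ n → ≤-trans (S.fsize-sim n (PowerOfTwo.fsize-chk (L n)) (gates (C n)) (body n))
                   (+-monoˡ-≤ _ (≤-reflexive (fsize-eqChk (target n) (result n)))))
          (pb-+ (pb-+ (pb-* (pb-const 8) pL₁) (pb-const 1)) (pb-* (proj₂ (proj₂ found)) (pb-+ (pb-+ (pb-const 1) pL₁) (PB-mulSize pL₁ pL₁))))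
      ; graph-ok = ok }
      where
      pL₁ : PB L
      pL₁ = pb-+ (pb-const 1) pL
      ok : ∀ n ρ w → ⟦ φ n ⟧ ρ < 2 ^ L n → Ind (val w ≡ ⟦ φ n ⟧ ρ) (⟦ S.sim n (gates (C n)) (body n) ⟧ (envW w ρ))
      ok n ρ w lt = ind-cong (sym (⟦sim⟧ (gates (C n)) (body n)))
        (ind-map (λ e → trans (sym t₁) (trans e t₂)) (λ e → trans t₁ (trans e (sym t₂))) (ind-eqChk (target n) (result n) E))
        where
        M = 2 ^ L n
        open Simulation.Semantics (L′ n) (inp n) (PowerOfTwo.chk {U n} (L n)) (envW w ρ) M
               (^-monoʳ-≤ 2 {1} {L n} (s≤s z≤n)) ≤-refl (chk-ok (L′ n) (inp n) (envW w ρ))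
        E = S.envG n (words (gates (C n))) (envW w ρ)
        s : Fin (card n) → Bool
        s i = atom (envW w ρ) (inp n i)
        v : value (eval (C n)) ≡ pos (⟦ φ n ⟧ ρ)
        v = trans (proj₁ (proj₂ found) n s) (cong pos (trans (⟦bind⟧ (inj₂ ∘ enc n) (φ n) s)
          (⟦⟧-cong (φ n) (λ u → trans (atom-map inj₂ (envW w ρ) (dec n (enc n u))) (cong (atom ρ) (dec-enc n u))))))
        t₁ : atoms E (target n) ≡ val w
        t₁ = atoms-tabulate E (λ i → inj₂ (inj₂ (inj₁ i))) w (λ _ → refl)
        t₂ : atoms E (result n) ≡ ⟦ φ n ⟧ ρ
        t₂ = trans (atoms-tabulate E (S.wireWord n (output (C n))) (word (eval (C n))) (wireWord-ok (gates (C n)) (output (C n))))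
              (trans (cong (λ z → val (bits (L n) (resid M z))) v)
                (trans (cong (val ∘ bits (L n)) (resid-small lt)) (val-bits (L n) (⟦ φ n ⟧ ρ) lt)))

sumTo-select₂ : ∀ n m {P : ℕ → ℕ → Set} {g : ℕ → ℕ → ℕ} (F : ℕ → ℕ → ℕ) a b → a < n → b < m → P a b →
                (∀ c d → P c d → c ≡ a × d ≡ b) → (∀ c d → Ind (P c d) (g c d)) →
                sumTo n (λ c → sumTo m (λ d → g c d * F c d)) ≡ F a b
sumTo-select₂ n m {P} {g} F a b a< b< p u h = trans
  (sumTo-single n a a< (λ c _ ne → sumTo-zero m (λ d _ → cong (_* F c d) (ind-no (h c d) (ne ∘ proj₁ ∘ u c d)))))
  (sumTo-select m {P a} (F a) b b< p (λ d _ q → proj₂ (u a d q)) (λ d _ → h a d))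

-- Feasible functions on tuples of words

record Width : Set where
  constructor width
  field
    len    : ℕ → ℕ
    len-pb : PB len
open Width

Ctx : Set
Ctx = List Width

Bits : Ctx → ℕ → Set
Bits [] n = ⊥
Bits (k ∷ Γ) n = Fin (len k n) ⊎ Bits Γ n

nbits : Ctx → ℕ → ℕ
nbits [] n = 0
nbits (k ∷ Γ) n = len k n + nbits Γ n

encode : ∀ Γ n → Bits Γ n → Fin (nbits Γ n)
encode (k ∷ Γ) n (inj₁ i) = i ↑ˡ nbits Γ n
encode (k ∷ Γ) n (inj₂ v) = len k n ↑ʳ encode Γ n v

decode : ∀ Γ n → Fin (nbits Γ n) → Bits Γ n
decode (k ∷ Γ) n i with splitAt (len k n) i
... | inj₁ j = inj₁ j
... | inj₂ j = inj₂ (decode Γ n j)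

decode-encode : ∀ Γ n v → decode Γ n (encode Γ n v) ≡ v
decode-encode (k ∷ Γ) n (inj₁ i) rewrite splitAt-↑ˡ (len k n) i (nbits Γ n) = refl
decode-encode (k ∷ Γ) n (inj₂ v) rewrite splitAt-↑ʳ (len k n) (nbits Γ n) (encode Γ n v) = cong inj₂ (decode-encode Γ n v)

nbits-pb : ∀ Γ → PB (nbits Γ)
nbits-pb [] = pb-const 0
nbits-pb (k ∷ Γ) = pb-+ (len-pb k) (nbits-pb Γ)

enumBits : ∀ Γ → Enumeration (Bits Γ)
enumBits Γ = record
  { card = nbits Γ ; card-pb = nbits-pb Γ ; enc = encode Γ ; dec = λ n → inj₂ ∘ decode Γ n
  ; dec-enc = λ n v → cong inj₂ (decode-encode Γ n v) }

Env : Ctx → Set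
Env [] = ⊤
Env (k ∷ Γ) = ℕ × Env Γ

Agree : ∀ Γ n → (Bits Γ n → Bool) → Env Γ → Set
Agree [] n ρ e = ⊤
Agree (k ∷ Γ) n ρ (z , e) = (val (tabulate (ρ ∘ inj₁)) ≡ z) × Agree Γ n (ρ ∘ inj₂) e

envBits : ∀ Γ n → Env Γ → Bits Γ n → Bool
envBits (k ∷ Γ) n (z , e) (inj₁ i) = lookup (bits (len k n) z) i
envBits (k ∷ Γ) n (z , e) (inj₂ v) = envBits Γ n e v

agree-bits : ∀ Γ n ρ e → Agree Γ n ρ e → ∀ v → ρ v ≡ envBits Γ n e v
agree-bits (k ∷ Γ) n ρ (z , e) (refl , a) (inj₁ i) =
  sym (trans (cong (λ w → lookup w i) (bits-val (tabulate (ρ ∘ inj₁)))) (Vecₚ.lookup∘tabulate (ρ ∘ inj₁) i))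
agree-bits (k ∷ Γ) n ρ (z , e) (_ , a) (inj₂ v) = agree-bits Γ n (ρ ∘ inj₂) e a v

data Var (k : Width) : Ctx → Set where
  here  : ∀ {Γ} → Var k (k ∷ Γ)
  there : ∀ {l Γ} → Var k Γ → Var k (l ∷ Γ)

locate : ∀ {k Γ} n → Var k Γ → Fin (len k n) → Bits Γ n
locate n here i = inj₁ i
locate n (there v) i = inj₂ (locate n v i)

get : ∀ {k Γ} → Var k Γ → Env Γ → ℕ
get here (z , e) = z
get (there v) (z , e) = get v e

agree-get : ∀ {k Γ} n (v : Var k Γ) ρ e → Agree Γ n ρ e → val (tabulate (ρ ∘ locate n v)) ≡ get v e
agree-get n here ρ (z , e) (a , _) = a
agree-get n (there v) ρ (z , e) (_ , a) = agree-get n v (ρ ∘ inj₂) e a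

data Args (Γ : Ctx) : Ctx → Set where
  []  : Args Γ []
  _∷_ : ∀ {k Δ} → Var k Γ → Args Γ Δ → Args Γ (k ∷ Δ)

gets : ∀ {Γ Δ} → Args Γ Δ → Env Γ → Env Δ
gets [] e = tt
gets (v ∷ vs) e = get v e , gets vs e

locates : ∀ {Γ Δ} n → Args Γ Δ → Bits Δ n → Bits Γ n
locates n (v ∷ vs) (inj₁ i) = locate n v i
locates n (v ∷ vs) (inj₂ u) = locates n vs u

agree-gets : ∀ {Γ Δ} n (vs : Args Γ Δ) ρ e → Agree Γ n ρ e → Agree Δ n (ρ ∘ locates n vs) (gets vs e)
agree-gets n [] ρ e a = tt
agree-gets n (v ∷ vs) ρ e a = agree-get n v ρ e a , agree-gets n vs ρ e a

-- Numbers enter through `Agree`, which makes each of them the value of a word of its own width;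
-- bounds on the arguments are therefore implicit.
record Realizer (Γ : Ctx) (f : ℕ → Env Γ → ℕ) : Set where
  constructor realizer
  field
    fm : ∀ n → Fm (Bits Γ n)
    pb : PB (fsize ∘ fm)
    ok : ∀ n ρ e → Agree Γ n ρ e → ⟦ fm n ⟧ ρ ≡ f n e

-- The function is stored apart from its formula, so `fun` of a compound is the intended arithmetic
-- expression rather than the sum that realizes it.
record Feasible (Γ : Ctx) : Set where
  constructor feasible
  field
    fun  : ℕ → Env Γ → ℕ
    real : Realizer Γ fun
  open Realizer real public
open Feasible

infixl 6 _⊞_
infixl 7 _⊠_

_⊞_ _⊠_ : ∀ {Γ} → Feasible Γ → Feasible Γ → Feasible Γ
φ ⊞ ψ = feasible (λ n e → fun φ n e + fun ψ n e) (realizer (λ n → fm φ n ∔ fm ψ n)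
  (pb-+ (pb-const 1) (pb-+ (pb φ) (pb ψ))) (λ n ρ e a → cong₂ _+_ (ok φ n ρ e a) (ok ψ n ρ e a)))
φ ⊠ ψ = feasible (λ n e → fun φ n e * fun ψ n e) (realizer (λ n → fm φ n ∙ fm ψ n)
  (pb-+ (pb-const 1) (pb-+ (pb φ) (pb ψ))) (λ n ρ e a → cong₂ _*_ (ok φ n ρ e a) (ok ψ n ρ e a)))

pow2 : ∀ {Γ} (L : ℕ → ℕ) → PB L → Feasible Γ
pow2 L p = feasible (λ n e → 2 ^ L n) (realizer (λ n → pow2F (L n))
  (pb-mono (λ n → ≤-reflexive (fsize-pow2F (L n))) (pb-+ (pb-* (pb-const 4) p) (pb-const 1)))
  (λ n ρ e a → ⟦pow2F⟧ (L n) ρ))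

nil one′ : ∀ {Γ} → Feasible Γ
nil = feasible (λ n e → 0) (realizer (λ n → cst false) (pb-const 1) (λ n ρ e a → refl))
one′ = feasible (λ n e → 1) (realizer (λ n → cst true) (pb-const 1) (λ n ρ e a → refl))

vr : ∀ {k Γ} → Var k Γ → Feasible Γ
vr {k} {Γ} v = feasible (λ n e → get v e) (realizer (λ n → valF (word n))
  (pb-mono (λ n → ≤-reflexive (fsize-valF (word n))) (pb-+ (pb-* (pb-const 6) (len-pb k)) (pb-const 1)))
  (λ n ρ e a → trans (⟦valF⟧ (word n) ρ)
      (trans (cong val (sym (Vecₚ.tabulate-∘ (atom ρ) (inj₂ ∘ locate n v)))) (agree-get n v ρ e a))))
  where
  word : ∀ n → Vec (Atom (Bits Γ n)) (len k n)
  word n = tabulate (inj₂ ∘ locate n v)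

call : ∀ {Γ Δ} → Args Γ Δ → Feasible Δ → Feasible Γ
call vs φ = feasible (λ n e → fun φ n (gets vs e)) (realizer (λ n → bind (inj₂ ∘ locates n vs) (fm φ n))
  (pb-mono (λ n → ≤-reflexive (fsize-bind _ (fm φ n))) (pb φ))
  (λ n ρ e a → trans (⟦bind⟧ (inj₂ ∘ locates n vs) (fm φ n) ρ) (ok φ n _ _ (agree-gets n vs ρ e a))))

wkn : ∀ {k Γ} → Feasible Γ → Feasible (k ∷ Γ)
wkn φ = feasible (λ n e → fun φ n (proj₂ e)) (realizer (λ n → bind (inj₂ ∘ inj₂) (fm φ n))
  (pb-mono (λ n → ≤-reflexive (fsize-bind _ (fm φ n))) (pb φ))
  (λ n ρ e a → trans (⟦bind⟧ (inj₂ ∘ inj₂) (fm φ n) ρ) (ok φ n _ _ (proj₂ a))))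

Sg : ∀ {Γ} k → Feasible (k ∷ Γ) → Feasible Γ
Sg k φ = feasible (λ n e → sumTo (2 ^ len k n) (λ z → fun φ n (z , e))) (realizer (λ n → sumW (len k n) (fm φ n))
  (pb-mono (λ n → ≤-reflexive (fsize-sumW (len k n) (fm φ n))) (pb-+ (len-pb k) (pb φ)))
  (λ n ρ e a → trans (⟦sumW⟧ (len k n) (fm φ n) ρ) (trans
      (sumB-cong (len k n) (λ w → ok φ n (envW w ρ) (val w , e) (cong val (Vecₚ.tabulate∘lookup w) , a)))
      (sumB-val (len k n) (λ z → fun φ n (z , e))))))

-- By `⟦⟧<2^fsize` words of this length are long enough to guess the value of `φ`.
size-width : ∀ {Γ} → Feasible Γ → Width
size-width φ = width (fsize ∘ fm φ) (pb φ)

-- Comparison, division, and evaluation of circuits modulo a variable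

module Comparisons (hyp : VNP0≡VP0) where
  open Collapse hyp

  private
    module Equality {Γ} (φ ψ : Feasible Γ) where
      L′ L : ℕ → ℕ
      L′ n = fsize (fm φ n) + fsize (fm ψ n)
      L n = suc (L′ n)
      pL : PB L′
      pL = pb-+ (pb φ) (pb ψ)
      open Graph
      G : Graph L (fm φ)
      G = makeGraph (enumBits Γ) L′ pL (fm φ) (pb φ)
      H : Graph L (fm ψ)
      H = makeGraph (enumBits Γ) L′ pL (fm ψ) (pb ψ)
      both : ∀ n → Fm (Fin (L n) ⊎ Bits Γ n)
      both n = graph G n ∙ graph H n
      okay : ∀ n ρ e → Agree Γ n ρ e → ⟦ sumW (L n) (both n) ⟧ ρ ≡ eq (fun φ n e) (fun ψ n e)
      okay n ρ e a = trans (⟦sumW⟧ (L n) (both n) ρ) (trans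
        (sumB-select (L n) {λ z → z ≡ X} (λ w → ⟦ graph G n ⟧ (envW w ρ)) (λ w → ⟦ graph H n ⟧ (envW w ρ)) X X< refl (λ _ p → p)
          (λ w → graph-ok G n ρ w X<))
        (trans (ind-unique (ind-map (trans (sym (val-bits (L n) X X<))) (trans (val-bits (L n) X X<)) (graph-ok H n ρ (bits (L n) X) Y<)) (ind-eq X Y))
          (cong₂ eq (ok φ n ρ e a) (ok ψ n ρ e a))))
        where
        X = ⟦ fm φ n ⟧ ρ
        Y = ⟦ fm ψ n ⟧ ρ
        X< : X < 2 ^ L n
        X< = <-≤-trans (⟦⟧<2^fsize (fm φ n) ρ) (^-monoʳ-≤ 2 {fsize (fm φ n)} {L n} (m≤n⇒m≤1+n (m≤m+n (fsize (fm φ n)) (fsize (fm ψ n)))))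
        Y< : Y < 2 ^ L n
        Y< = <-≤-trans (⟦⟧<2^fsize (fm ψ n) ρ) (^-monoʳ-≤ 2 {fsize (fm ψ n)} {L n} (m≤n⇒m≤1+n (m≤n+m (fsize (fm ψ n)) (fsize (fm φ n)))))
      size-pb : PB (λ n → fsize (sumW (L n) (both n)))
      size-pb = pb-mono {t = λ n → L n + fsize (both n)} (λ n → ≤-reflexive (fsize-sumW (L n) (both n)))
        (pb-+ {L} {λ n → fsize (both n)} (pb-+ (pb-const 1) pL) (pb-+ {λ _ → 1} (pb-const 1) (pb-+ (graph-pb G) (graph-pb H))))

  abstract
    -- The graph of `φ` picks out the word of its value, and the graph of `ψ` accepts that word
    -- precisely when the two values agree.
    eqR : ∀ {Γ} (φ ψ : Feasible Γ) → Realizer Γ (λ n e → eq (fun φ n e) (fun ψ n e))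
    eqR φ ψ = realizer (λ n → sumW (L n) (both n)) size-pb okay
      where open Equality φ ψ

  eqF : ∀ {Γ} → Feasible Γ → Feasible Γ → Feasible Γ
  eqF φ ψ = feasible (λ n e → eq (fun φ n e) (fun ψ n e)) (eqR φ ψ)

  private
    module Order {Γ} (φ ψ : Feasible Γ) where
      inner : Feasible Γ
      -- At most one d satisfies X + d = Y, and then d ≤ Y fits the width of `ψ`, so the sum is
      -- already the indicator of X ≤ Y.
      inner = Sg (size-width ψ) (eqF (wkn φ ⊞ vr here) (wkn ψ))
      okay : ∀ n ρ e → Agree Γ n ρ e → ⟦ fm inner n ⟧ ρ ≡ le (fun φ n e) (fun ψ n e)
      okay n ρ e a = trans (ok inner n ρ e a) (ind-unique {X ≤ Y} value (ind-le X Y))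
        where
        X = fun φ n e
        Y = fun ψ n e
        D = 2 ^ fsize (fm ψ n)
        Y< : Y < D
        Y< = ≤-<-trans (≤-reflexive (sym (ok ψ n ρ e a))) (⟦⟧<2^fsize (fm ψ n) ρ)
        value : Ind (X ≤ Y) (sumTo D (λ d → eq (X + d) Y))
        value with X ≤? Y
        ... | no ¬p = ind-cong (sym (sumTo-zero D (λ d _ → ind-no (ind-eq (X + d) Y) (λ q → ¬p (≤-trans (m≤m+n X d) (≤-reflexive q)))))) (fails ¬p)
        ... | yes p = ind-cong (sym (trans (sumTo-cong D (λ d _ → sym (*-identityʳ _)))
                (sumTo-select D {λ d → X + d ≡ Y} (λ _ → 1) (Y ∸ X) (≤-<-trans (m∸n≤m Y X) Y<) (m+[n∸m]≡n p)
                  (λ d _ q → trans (sym (m+n∸m≡n X d)) (cong (_∸ X) q)) (λ d _ → ind-eq (X + d) Y)))) (holds p)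

  abstract
    leR : ∀ {Γ} (φ ψ : Feasible Γ) → Realizer Γ (λ n e → le (fun φ n e) (fun ψ n e))
    leR φ ψ = realizer (fm inner) (pb inner) okay
      where open Order φ ψ

  leF : ∀ {Γ} → Feasible Γ → Feasible Γ → Feasible Γ
  leF φ ψ = feasible (λ n e → le (fun φ n e) (fun ψ n e)) (leR φ ψ)

  ltF : ∀ {Γ} → Feasible Γ → Feasible Γ → Feasible Γ
  ltF φ ψ = leF (one′ ⊞ φ) ψ

  posF : ∀ {Γ} → Feasible Γ → Feasible Γ
  posF φ = leF one′ φ

  private
    module Division {Γ} (φ ψ : Feasible Γ) where
      W = size-width φ
      rel : Feasible (W ∷ W ∷ Γ)
      -- Quotient and remainder are both at most X, so words of the width of `φ` hold them. For Y =
      -- 0 no remainder passes and both results are 0, in agreement with `div` and `mod`.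
      rel = eqF (wkn (wkn φ)) (vr here ⊞ vr (there here) ⊠ wkn (wkn ψ)) ⊠ ltF (vr here) (wkn (wkn ψ))
      quotient remainder : Feasible Γ
      quotient = Sg W (Sg W (rel ⊠ vr (there here)))
      remainder = Sg W (Sg W (rel ⊠ vr here))
      module _ n ρ e (a : Agree Γ n ρ e) where
        X = fun φ n e
        Y = fun ψ n e
        D = 2 ^ fsize (fm φ n)
        X< : X < D
        X< = ≤-<-trans (≤-reflexive (sym (ok φ n ρ e a))) (⟦⟧<2^fsize (fm φ n) ρ)
        select : (F : ℕ → ℕ → ℕ) → (Y ≡ 0 → F (X div Y) (X mod Y) ≡ 0) →
                 sumTo D (λ q → sumTo D (λ c → (eq X (c + q * Y) * le (suc c) Y) * F q c)) ≡ F (X div Y) (X mod Y)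
        select F z with Y
        ... | zero = trans (sumTo-zero D (λ q _ → sumTo-zero D (λ c _ → cong (_* F q c) (*-zeroʳ (eq X (c + q * 0)))))) (sym (z refl))
        ... | suc y = sumTo-select₂ D D {λ q c → (X ≡ c + q * suc y) × c < suc y} F (X div suc y) (X mod suc y)
                (≤-<-trans (≤-trans (m≤m*n (X div suc y) (suc y)) (≤-trans (m≤n+m _ (X mod suc y)) (≤-reflexive (sym (div-mod X (s≤s z≤n)))))) X<)
                (≤-<-trans (≤-trans (m≤m+n (X mod suc y) (X div suc y * suc y)) (≤-reflexive (sym (div-mod X (s≤s z≤n))))) X<)
                (div-mod X (s≤s z≤n) , mod< X (s≤s z≤n))
                (λ { q c (p , lt) → sym (div-unique q lt p) , sym (mod-unique q lt p) })
                (λ q c → ind-× (ind-eq X (c + q * suc y)) (ind-le (suc c) (suc y)))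

  abstract
    quoR : ∀ {Γ} (φ ψ : Feasible Γ) → Realizer Γ (λ n e → fun φ n e div fun ψ n e)
    quoR φ ψ = realizer (fm quotient) (pb quotient)
      (λ n ρ e a → trans (ok quotient n ρ e a) (select n ρ e a (λ q c → q) (λ p → cong (fun φ n e div_) p)))
      where open Division φ ψ
    remR : ∀ {Γ} (φ ψ : Feasible Γ) → Realizer Γ (λ n e → fun φ n e mod fun ψ n e)
    remR φ ψ = realizer (fm remainder) (pb remainder)
      (λ n ρ e a → trans (ok remainder n ρ e a) (select n ρ e a (λ q c → c) (λ p → cong (fun φ n e mod_) p)))
      where open Division φ ψ

  quoF remF : ∀ {Γ} → Feasible Γ → Feasible Γ → Feasible Γ
  quoF φ ψ = feasible (λ n e → fun φ n e div fun ψ n e) (quoR φ ψ)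
  remF φ ψ = feasible (λ n e → fun φ n e mod fun ψ n e) (remR φ ψ)

  module ModularEvaluation (Γ : Ctx) (K′ : ℕ → ℕ) (pK : PB K′) (C : ∀ n → Circuit (nbits Γ n)) (pC : PB (size ∘ C)) where
    K : ℕ → ℕ
    K n = suc (K′ n)
    P : Width
    P = width K (pb-+ (pb-const 1) pK)

    private
      Δ : Ctx
      Δ = P ∷ P ∷ P ∷ P ∷ []
      va = vr {P} {Δ} here
      vb = vr {P} {Δ} (there here)
      vc = vr {P} {Δ} (there (there here))
      vp = vr {P} {Δ} (there (there (there here)))
      chkF : Op → Feasible Δ
      chkF plus = eqF vc (remF (va ⊞ vb) vp)
      -- The congruence alone would also accept words of value p or more that are congruent to the
      -- difference; the bound keeps one word.
      chkF minus = eqF va (remF (vb ⊞ vc) vp) ⊠ ltF vc vp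
      chkF times = eqF vc (remF (va ⊠ vb) vp)
      U : ℕ → Set
      U n = Bits (P ∷ Γ) n
      place : ∀ n → Bits Δ n → Atom ((Fin 3 × Fin (K n)) ⊎ U n)
      place n (inj₁ i) = inj₂ (inj₁ (zero , i))
      place n (inj₂ (inj₁ i)) = inj₂ (inj₁ (suc zero , i))
      place n (inj₂ (inj₂ (inj₁ i))) = inj₂ (inj₁ (suc (suc zero) , i))
      place n (inj₂ (inj₂ (inj₂ (inj₁ i)))) = inj₂ (inj₂ (inj₁ i))
      chk : ∀ n → Op → Fm ((Fin 3 × Fin (K n)) ⊎ U n)
      chk n o = bind (place n) (fm (chkF o) n)
      inp : ∀ n → Fin (nbits Γ n) → Atom (U n)
      inp n i = inj₂ (inj₂ (decode Γ n i))
      module S (n : ℕ) = Simulation (K′ n) (inp n) (chk n)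
      result : ∀ n → Vec (Atom ((Fin (size (C n)) × Fin (K n)) ⊎ U n)) (K n)
      result n = tabulate (S.wireWord n (output (C n)))
      two≤p : Feasible (P ∷ Γ)
      two≤p = leF (one′ ⊞ one′) (vr here)
      formula : ∀ n → Fm (U n)
      -- The simulation is correct for moduli from 2 on; for smaller ones the first factor is 0.
      formula n = fm two≤p n ∙ S.sim n (gates (C n)) (valF (result n))
      total : ℕ → ℕ
      total n = fsize (chk n plus) + fsize (chk n minus) + fsize (chk n times)
      fsize-chk : ∀ n o → fsize (chk n o) ≤ total n
      fsize-chk n plus = ≤-trans (m≤m+n _ (fsize (chk n minus))) (m≤m+n _ _)
      fsize-chk n minus = ≤-trans (m≤n+m _ (fsize (chk n plus))) (m≤m+n _ _)
      fsize-chk n times = m≤n+m _ _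
      pb-chk : ∀ o → PB (λ n → fsize (chk n o))
      pb-chk o = pb-mono (λ n → ≤-reflexive (fsize-bind (place n) (fm (chkF o) n))) (pb (chkF o))

    inputs : ∀ n → Env Γ → Fin (nbits Γ n) → Bool
    inputs n e i = envBits Γ n e (decode Γ n i)

    result-value : ∀ n → Env Γ → ℤ
    result-value n e = Z.ev (Z.ιᵇ ∘ inputs n e) (eval (C n))

    private
      module Correct n ρ p e (a : Agree (P ∷ Γ) n ρ (p , e)) (2≤p : 2 ≤ p) where
        k = K n
        0<p : 0 < p
        0<p = ≤-trans (s≤s z≤n) 2≤p
        p< : p < 2 ^ k
        p< = ≤-<-trans (≤-reflexive (sym (proj₁ a))) (val< (tabulate (ρ ∘ inj₁)))
        module _ (za zb : ℤ) (c : Vec Bool k) where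
          ra = resid p za
          rb = resid p zb
          E = S.env₃ n (bits k ra) (bits k rb) c ρ
          agree : Agree Δ n (atom E ∘ place n) (ra , rb , val c , p , tt)
          agree = trans (cong val (Vecₚ.tabulate∘lookup (bits k ra))) (val-bits k ra (<-trans (resid< za 0<p) p<)) ,
                  trans (cong val (Vecₚ.tabulate∘lookup (bits k rb))) (val-bits k rb (<-trans (resid< zb 0<p) p<)) ,
                  cong val (Vecₚ.tabulate∘lookup c) , proj₁ a , tt
          ra+ : ∀ o → resid p (opℤ o (pos ra) (pos rb)) ≡ resid p (opℤ o za zb)
          ra+ o = resid-op p o za zb
          funInd : ∀ o → Ind (val c ≡ resid p (opℤ o za zb)) (fun (chkF o) n (ra , rb , val c , p , tt))
          funInd plus = ind-map (λ q → trans q t) (λ q → trans q (sym t)) (ind-eq (val c) ((ra + rb) mod p))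
            where
            t : (ra + rb) mod p ≡ resid p (za ℤ.+ zb)
            t = trans (cong (resid p) (ℤₚ.pos-+ ra rb)) (ra+ plus)
          funInd times = ind-map (λ q → trans q t) (λ q → trans q (sym t)) (ind-eq (val c) ((ra * rb) mod p))
            where
            t : (ra * rb) mod p ≡ resid p (za ℤ.* zb)
            t = trans (cong (resid p) (ℤₚ.pos-* ra rb)) (ra+ times)
          funInd minus = ind-map (λ { (q , lt) → resid-minus⇒ za zb lt q })
            (λ q → resid-minus⇐ za zb 0<p q , ≤-<-trans (≤-reflexive q) (resid< (za ℤ.+ (ℤ.- zb)) 0<p))
            (ind-× (ind-eq ra ((rb + val c) mod p)) (ind-le (suc (val c)) p))
        chk-right : ∀ o za zb c → Ind (val c ≡ resid p (opℤ o za zb)) (⟦ chk n o ⟧ (S.env₃ n (bits k (resid p za)) (bits k (resid p zb)) c ρ))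
        chk-right o za zb c = ind-cong (sym (trans (⟦bind⟧ (place n) (fm (chkF o) n) (E za zb c)) (ok (chkF o) n _ _ (agree za zb c)))) (funInd za zb c o)
        open Simulation.Semantics (K′ n) (inp n) (chk n) ρ p 2≤p (<⇒≤ p<) chk-right
        simulated : ⟦ S.sim n (gates (C n)) (valF (result n)) ⟧ ρ ≡ resid p (result-value n e)
        simulated = trans (⟦sim⟧ (gates (C n)) (valF (result n))) (trans (⟦valF⟧ (result n) _)
          (trans (atoms-tabulate (S.envG n (words (gates (C n))) ρ) (S.wireWord n (output (C n))) (word (eval (C n))) (wireWord-ok (gates (C n)) (output (C n))))
            (trans (val-bits k _ (<-trans (resid< (value (eval (C n))) 0<p) p<))
              (cong (resid p) (Z.ev-cong (λ i → cong Z.ιᵇ (agree-bits Γ n (ρ ∘ inj₂) e (proj₂ a) (decode Γ n i))) (eval (C n)))))))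

    abstract
      modEvalR : Realizer (P ∷ Γ) (λ n e → le 2 (proj₁ e) * resid (proj₁ e) (result-value n (proj₂ e)))
      modEvalR = realizer formula
        (pb-+ {λ _ → 1} (pb-const 1) (pb-+ (pb two≤p) (pb-mono {t = λ n → (6 * K n + 1) + size (C n) * (suc (K n) + total n)}
          (λ n → ≤-trans (S.fsize-sim n (fsize-chk n) (gates (C n)) (valF (result n))) (+-monoˡ-≤ _ (≤-reflexive (fsize-valF (result n)))))
            (pb-+ (pb-+ (pb-* (pb-const 6) (len-pb P)) (pb-const 1)) (pb-* pC (pb-+ (pb-+ (pb-const 1) (len-pb P)) (pb-+ (pb-+ (pb-chk plus) (pb-chk minus)) (pb-chk times))))))))
        okay
        where
        okay : ∀ n ρ e → Agree (P ∷ Γ) n ρ e → ⟦ formula n ⟧ ρ ≡ le 2 (proj₁ e) * resid (proj₁ e) (result-value n (proj₂ e))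
        okay n ρ (p , e) a = trans (cong (_* ⟦ S.sim n (gates (C n)) (valF (result n)) ⟧ ρ) (ok two≤p n ρ (p , e) a)) (go (ind-le 2 p))
          where
          go : ∀ {b} → Ind (2 ≤ p) b → b * ⟦ S.sim n (gates (C n)) (valF (result n)) ⟧ ρ ≡ b * resid p (result-value n e)
          go (holds 2≤p) = cong (1 *_) (Correct.simulated n ρ p e a 2≤p)
          go (fails _) = refl

    modEval : Feasible (P ∷ Γ)
    modEval = feasible (λ n e → le 2 (proj₁ e) * resid (proj₁ e) (result-value n (proj₂ e))) modEvalR

    fun-modEval : ∀ n p e → 2 ≤ p → fun modEval n (p , e) ≡ resid p (result-value n e)
    fun-modEval n p e 2≤p = trans (cong (_* resid p (result-value n e)) (ind-yes (ind-le 2 p) 2≤p)) (*-identityˡ _)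

-- Primes: a Chebyshev type lower bound, and primitive roots

prime⇒2≤ : ∀ {p} → Prime p → 2 ≤ p
prime⇒2≤ {zero} pr = ⊥-elim (≢-nonZero⁻¹ 0 {{prime⇒nonZero pr}} refl)
prime⇒2≤ {suc zero} pr = ⊥-elim (nonTrivial⇒≢1 {{prime⇒nonTrivial pr}} refl)
prime⇒2≤ {suc (suc p)} pr = s≤s (s≤s z≤n)

prime-divisor : ∀ {n} → 2 ≤ n → ∃[ r ] (Prime r × r ∣ n)
prime-divisor {n@(suc _)} 2≤n with factorise n
... | record { factors = [] ; isFactorisation = refl } with 2≤n
...   | s≤s ()
prime-divisor {n@(suc _)} 2≤n | record { factors = r ∷ rs ; isFactorisation = e ; factorsPrime = pr ∷ _ } =
  r , pr , divides (product rs) (trans e (*-comm r (product rs)))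

quotient< : ∀ {r j′ j} → 2 ≤ r → 1 ≤ j → j ≡ j′ * r → j′ < j
quotient< {r} {j′} {j} 2≤r 1≤j refl with j′
... | suc i = m<m*n (suc i) r 2≤r

pos-factor : ∀ {a b} → 1 ≤ a * b → 1 ≤ a
pos-factor {suc a} _ = s≤s z≤n

∣-pow : ∀ {a b} r → a ∣ b → ∀ {c} → c ∣ b ^ r → a * c ∣ b ^ suc r
∣-pow {a} {b} r p {c} q = ∣-trans (*-monoʳ-∣ a q) (*-monoˡ-∣ (b ^ r) p)

choose : ℕ → ℕ → ℕ
choose n zero = 1
choose zero (suc k) = 0
choose (suc n) (suc k) = choose n k + choose n (suc k)

choose>0 : ∀ {n k} → k ≤ n → 1 ≤ choose n k
choose>0 {n} {zero} _ = ≤-refl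
choose>0 {suc n} {suc k} (s≤s p) = ≤-trans (choose>0 p) (m≤m+n _ _)

absorption : ∀ n m → suc n * choose n m ≡ suc m * choose (suc n) (suc m)
absorption zero zero = refl
absorption zero (suc m) = sym (*-zeroʳ (2 + m))
absorption (suc n) zero = trans (l (suc n)) (cong (1 *_) (cong (1 +_) (h n)))
  where
  h : ∀ n → suc n ≡ choose (suc n) 1
  h zero = refl
  h (suc n) = cong suc (h n)
  l : ∀ n → suc n * 1 ≡ 1 * (1 + n)
  l = NS.solve-∀
absorption (suc n) (suc m) = begin
  (2 + n) * (a + b)                     ≡⟨ l₁ n a b ⟩
  (a + b) + (suc n * a + suc n * b)      ≡⟨ cong₂ (λ u v → (a + b) + (u + v)) (absorption n m) (absorption n (suc m)) ⟩
  (a + b) + (suc m * choose (suc n) (suc m) + (2 + m) * choose (suc n) (2 + m))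
    ≡⟨ l₂ m (a + b) (choose (suc n) (2 + m)) ⟩
  (2 + m) * ((a + b) + choose (suc n) (2 + m)) ∎
  where
  open ≡-Reasoning
  a = choose n m
  b = choose n (suc m)
  l₁ : ∀ n a b → (2 + n) * (a + b) ≡ (a + b) + (suc n * a + suc n * b)
  l₁ = NS.solve-∀
  l₂ : ∀ m s t → s + (suc m * s + (2 + m) * t) ≡ (2 + m) * (s + t)
  l₂ = NS.solve-∀

-- Leibniz' harmonic triangle: 1/T(n,m+1) = 1/T(n-1,m) − 1/T(n,m) for T(n,m) = (n+1) C(n,m).
leibniz-∣ : ∀ {L N} → (∀ j → 1 ≤ j → j ≤ N → j ∣ L) → ∀ n m → m ≤ n → n < N → suc n * choose n m ∣ L
leibniz-∣ {L} h n zero m≤n n<N = transport (_∣ L) (sym (*-identityʳ (suc n))) (h (suc n) (s≤s z≤n) n<N)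
leibniz-∣ {L} h (suc n) (suc m) (s≤s m≤n) n<N
  with leibniz-∣ h n m m≤n (<-trans (n<1+n n) n<N) | leibniz-∣ h (suc n) m (m≤n⇒m≤1+n m≤n) n<N
... | divides a ea | divides b eb = ∣m+n∣m⇒∣n {m = b * T″} (divides a key) (divides b refl)
  where
  T T′ T″ : ℕ
  T = (2 + n) * choose (suc n) m
  T′ = suc n * choose n m
  T″ = (2 + n) * choose (suc n) (suc m)
  triangle : T * T″ ≡ T′ * T″ + T′ * T
  triangle = begin
    T * T″ ≡⟨ l₁ n (choose (suc n) m) (choose (suc n) (suc m)) ⟩
    ((2 + n) * choose (suc n) m) * (2 + n) * choose (suc n) (suc m) ≡⟨ cong (λ u → u * (2 + n) * choose (suc n) (suc m)) (absorption (suc n) m) ⟩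
    (suc m * (choose (suc n) m + choose (suc n) (suc m))) * (2 + n) * choose (suc n) (suc m)
      ≡⟨ l₂ m n (choose (suc n) m) (choose (suc n) (suc m)) ⟩
    (suc m * choose (suc n) (suc m)) * T″ + (suc m * choose (suc n) (suc m)) * T
      ≡⟨ cong (λ u → u * T″ + u * T) (sym (absorption n m)) ⟩
    T′ * T″ + T′ * T ∎
    where
    open ≡-Reasoning
    l₁ : ∀ n a b → ((2 + n) * a) * ((2 + n) * b) ≡ ((2 + n) * a) * (2 + n) * b
    l₁ = NS.solve-∀
    l₂ : ∀ m n a b → (suc m * (a + b)) * (2 + n) * b ≡ (suc m * b) * ((2 + n) * b) + (suc m * b) * ((2 + n) * a)
    l₂ = NS.solve-∀
  key : b * T″ + L ≡ a * T″
  key = *-cancelʳ-≡ (b * T″ + L) (a * T″) T {{>-nonZero (*-mono-≤ {1} {2 + n} (s≤s z≤n) (choose>0 (m≤n⇒m≤1+n m≤n)))}} (begin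
    (b * T″ + L) * T        ≡⟨ l₁ b T″ L T ⟩
    (b * T) * T″ + L * T    ≡⟨ cong₂ (λ u v → u * T″ + v * T) (sym eb) ea ⟩
    L * T″ + a * T′ * T      ≡⟨ cong (λ u → u * T″ + a * T′ * T) ea ⟩
    a * T′ * T″ + a * T′ * T  ≡⟨ l₂ a T′ T″ T ⟩
    a * (T′ * T″ + T′ * T)   ≡⟨ cong (a *_) (sym triangle) ⟩
    a * (T * T″)            ≡⟨ l₃ a T T″ ⟩
    a * T″ * T              ∎)
    where
    open ≡-Reasoning
    l₁ : ∀ b u L t → (b * u + L) * t ≡ (b * t) * u + L * t
    l₁ = NS.solve-∀
    l₂ : ∀ a v u t → a * v * u + a * v * t ≡ a * (v * u + v * t)
    l₂ = NS.solve-∀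
    l₃ : ∀ a t u → a * (t * u) ≡ a * u * t
    l₃ = NS.solve-∀

central : ∀ n → 2 ^ n ≤ choose (2 * n) n
central zero = ≤-refl
central (suc n) = transport (λ k → 2 ^ suc n ≤ choose k (suc n)) (sym (l n)) (+-mono-≤ (left n)
  (≤-trans (≤-reflexive (+-identityʳ (2 ^ n))) (≤-trans (central n) (m≤m+n _ _))))
  where
  l : ∀ n → 2 * suc n ≡ 2 + 2 * n
  l = NS.solve-∀
  left : ∀ n → 2 ^ n ≤ choose (suc (2 * n)) n
  left zero = ≤-refl
  left (suc n) = ≤-trans (central (suc n)) (m≤n+m (choose (2 * suc n) (suc n)) (choose (2 * suc n) n))

OddPrime : ℕ → Set
OddPrime p = Prime p × p ≢ 2

oddPrime? : ∀ p → Dec (OddPrime p)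
oddPrime? p = prime? p ×-dec ¬? (p ≟ 2)

countOdd : ℕ → ℕ
countOdd X = sumTo X (λ q → ι? (oddPrime? q))

select-factor : ∀ {A : Set} → Dec A → ℕ → ℕ
select-factor (yes _) z = z
select-factor (no _) z = 1

primorial : ℕ → ℕ
primorial X = prodTo X (λ q → select-factor (prime? q) q)

prodTo-factor : ∀ n f z → z < n → f z ∣ prodTo n f
prodTo-factor (suc n) f z lt with z ≟ n
... | yes refl = ∣n⇒∣m*n (prodTo n f) ∣-refl
... | no ne = ∣m⇒∣m*n (f n) (prodTo-factor n f z (≤∧≢⇒< (s≤s⁻¹ lt) ne))

prime∣primorial : ∀ X p → Prime p → p < X → p ∣ primorial X
prime∣primorial X p pr lt with prime? p | prodTo-factor X (λ q → select-factor (prime? q) q) p lt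
... | yes _ | d = d
... | no ¬p | d = ⊥-elim (¬p pr)

-- A number below 2 ^ r has fewer than r prime factors, counted with multiplicity, and each of them
-- divides the primorial. So `primorial X ^ r` serves as a common multiple in place of the least
-- one.
∣primorial-pow : ∀ X r j → 1 ≤ j → j < 2 ^ r → j < X → j ∣ primorial X ^ r
∣primorial-pow X zero (suc j) 1≤j (s≤s ()) _
∣primorial-pow X (suc r) (suc zero) _ _ _ = 1∣ _
∣primorial-pow X (suc r) j@(suc (suc _)) 1≤j j<2^ j<X with prime-divisor {j} (s≤s (s≤s z≤n))
... | p , pr , divides q e = transport (_∣ primorial X ^ suc r) (trans (*-comm p q) (sym e))
      (∣-pow r (prime∣primorial X p pr (≤-<-trans p≤j j<X)) (∣primorial-pow X r q 1≤q q<2^ (≤-<-trans (<⇒≤ q<j) j<X)))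
  where
  p≤j : p ≤ j
  p≤j = ∣⇒≤ (divides q e)
  1≤q : 1 ≤ q
  1≤q = pos-factor {q} {p} (≤-trans 1≤j (≤-reflexive e))
  q<j : q < j
  q<j = quotient< (prime⇒2≤ pr) 1≤j e
  q<2^ : q < 2 ^ r
  q<2^ = *-cancelˡ-< 2 q (2 ^ r) (≤-<-trans (≤-trans (*-monoˡ-≤ q (prime⇒2≤ pr)) (≤-reflexive (trans (*-comm p q) (sym e)))) j<2^)

primorial>0 : ∀ X → 1 ≤ primorial X
primorial>0 zero = ≤-refl
primorial>0 (suc X) with prime? X
... | yes pr = *-mono-≤ (primorial>0 X) (≤-trans (s≤s z≤n) (prime⇒2≤ pr))
... | no _ = ≤-trans (primorial>0 X) (≤-reflexive (sym (*-identityʳ _)))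

-- Each prime contributes at most k bits. The summand `ι? (2 <? X)` accounts for the prime 2, which
-- `countOdd` leaves out.
primorial≤ : ∀ k X → 2 ≤ 2 ^ k → (∀ q → q < X → q ≤ 2 ^ k) → primorial X ≤ 2 ^ (k * (ι? (2 <? X) + countOdd X))
primorial≤ k zero 2≤ h = m^n>0 2 (k * (ι? (2 <? 0) + 0))
primorial≤ k (suc X) 2≤ h with prime? X | X ≟ 2 | primorial≤ k X 2≤ (λ q lt → h q (m<n⇒m<1+n lt))
... | no _ | _ | ih = ≤-trans (≤-reflexive (*-identityʳ _)) (≤-trans ih (^-monoʳ-≤ 2 (*-monoʳ-≤ k (+-mono-≤ mono (m≤m+n _ _)))))
  where
  mono : ι? (2 <? X) ≤ ι? (2 <? suc X)
  mono with 2 <? X | 2 <? suc X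
  ... | yes _ | yes _ = ≤-refl
  ... | yes p | no ¬p = ⊥-elim (¬p (m<n⇒m<1+n p))
  ... | no _ | _ = z≤n
... | yes pr | yes refl | ih = ≤-trans (*-mono-≤ ih 2≤) (≤-reflexive (trans (sym (^-distribˡ-+-* 2 (k * (0 + countOdd 2)) k)) (cong (2 ^_) (l k (countOdd 2)))))
  where
  l : ∀ k c → k * (0 + c) + k ≡ k * (1 + (c + 0))
  l = NS.solve-∀
... | yes pr | no ne | ih = ≤-trans (*-mono-≤ (≤-trans ih (^-monoʳ-≤ 2 (*-monoʳ-≤ k (+-monoˡ-≤ (countOdd X) mono)))) (h X ≤-refl))
  (≤-reflexive (trans (sym (^-distribˡ-+-* 2 (k * (ι? (2 <? suc X) + countOdd X)) k)) (cong (2 ^_) (l k (ι? (2 <? suc X)) (countOdd X)))))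
  where
  mono : ι? (2 <? X) ≤ ι? (2 <? suc X)
  mono with 2 <? X | 2 <? suc X
  ... | yes _ | yes _ = ≤-refl
  ... | yes p | no ¬p = ⊥-elim (¬p (m<n⇒m<1+n p))
  ... | no _ | _ = z≤n
  l : ∀ k i c → k * (i + c) + k ≡ k * (i + (c + 1))
  l = NS.solve-∀

-- With X = 2 n + 2 the k-th power of the primorial is a common multiple of 1, ..., 2 n + 1, hence
-- by the harmonic triangle a multiple of (2 n + 1) C(2 n, n), which is at least 2 ^ n. It is also
-- at most 2 ^ (k k (1 + count)); comparing exponents gives the bound.
many-primes : ∀ k′ → 2 ^ k′ ∸ 1 ≤ suc k′ * (suc k′ * suc (countOdd (2 ^ suc k′)))
many-primes k′ = ≮⇒≥ λ lt → <⇒≱ (^-monoʳ-< 2 ≤-refl lt) bound′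
  where
  k X n c P : ℕ
  k = suc k′
  X = 2 ^ k
  n = 2 ^ k′ ∸ 1
  c = countOdd X
  P = primorial X
  sn : suc n ≡ 2 ^ k′
  sn = m+[n∸m]≡n (m^n>0 2 k′)
  X≡ : X ≡ 2 + 2 * n
  X≡ = trans (cong (2 *_) (sym sn)) (l n)
    where
    l : ∀ n → 2 * suc n ≡ 2 + 2 * n
    l = NS.solve-∀
  div : suc (2 * n) * choose (2 * n) n ∣ P ^ k
  div = leibniz-∣ {P ^ k} {suc (2 * n)} (λ j 1≤j j≤ → ∣primorial-pow X k j 1≤j (≤-trans (s≤s j≤) (≤-reflexive (sym X≡))) (≤-trans (s≤s j≤) (≤-reflexive (sym X≡))))
          (2 * n) n (m≤m+n n _) ≤-refl
  P^k>0 : 1 ≤ P ^ k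
  P^k>0 = ≤-trans (≤-reflexive (sym (^-zeroˡ k))) (^-monoˡ-≤ k (primorial>0 X))
  bound′ : 2 ^ n ≤ 2 ^ (k * (k * suc c))
  bound′ = begin
    2 ^ n                              ≤⟨ central n ⟩
    choose (2 * n) n                   ≤⟨ m≤m+n _ _ ⟩
    suc (2 * n) * choose (2 * n) n     ≤⟨ ∣⇒≤ {{>-nonZero P^k>0}} div ⟩
    P ^ k                              ≤⟨ ^-monoˡ-≤ k (primorial≤ k X (^-monoʳ-≤ 2 {1} {k} (s≤s z≤n)) (λ q lt → <⇒≤ lt)) ⟩
    (2 ^ (k * (ι? (2 <? X) + c))) ^ k  ≤⟨ ^-monoˡ-≤ k (^-monoʳ-≤ 2 (*-monoʳ-≤ k (+-monoˡ-≤ c ι≤1))) ⟩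
    (2 ^ (k * suc c)) ^ k              ≡⟨ ^-*-assoc 2 (k * suc c) k ⟩
    2 ^ (k * suc c * k)                ≡⟨ cong (2 ^_) (*-comm (k * suc c) k) ⟩
    2 ^ (k * (k * suc c))              ∎
    where
    open ≤-Reasoning
    ι≤1 : ι? (2 <? X) ≤ 1
    ι≤1 with 2 <? X
    ... | yes _ = ≤-refl
    ... | no _ = z≤n

n<2^n : ∀ n → n < 2 ^ n
n<2^n zero = ≤-refl
n<2^n (suc n) = ≤-trans (+-mono-≤ (m^n>0 2 n) (n<2^n n)) (≤-reflexive (cong (λ a → 2 ^ n + a) (sym (+-identityʳ _))))

-- Required are 2 ^ m blocks of 2 ^ (m + 5) odd primes. Put a = 2 ^ m and k = 4 m + 24, so that k ≤
-- 2 ^ 8 a. With too few primes, k k (1 + count) would be at most 2 ^ 21 a ^ 4; two doublings absorb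
-- the lower terms and lead to 2 ^ (4 m + 23).
primeWidth′ : ℕ → ℕ
primeWidth′ m = 4 * m + 23

private
  square-bound : ∀ k a c u w t → 1 ≤ u → 1 ≤ w → 1 ≤ a → k ≤ u * a → c < a * (w * a) → t ≡ 2 * (2 * (u * u * w)) →
                 k * (k * suc c) + 2 ≤ t * a ^ 4
  square-bound k a c u w t 1≤u 1≤w 1≤a k≤ c< refl = begin
    k * (k * suc c) + 2                                  ≤⟨ +-monoˡ-≤ 2 (*-mono-≤ k≤ (*-mono-≤ k≤ c<)) ⟩
    u * a * (u * a * (a * (w * a))) + 2                  ≡⟨ cong (_+ 2) (l₁ u w a) ⟩
    X + 2                                                ≤⟨ +-monoʳ-≤ X (*-mono-≤ {2} {2} {1} {X} ≤-refl 1≤X) ⟩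
    X + 2 * X                                            ≤⟨ ≤-slack X (l₂ X) ⟩
    2 * (2 * X)                                          ≡⟨ l₃ (u * u * w) (a ^ 4) ⟩
    2 * (2 * (u * u * w)) * a ^ 4                        ∎
    where
    open ≤-Reasoning
    X = u * u * w * a ^ 4
    1≤X : 1 ≤ X
    1≤X = *-mono-≤ {1} {u * u * w} {1} {a ^ 4} (*-mono-≤ {1} {u * u} {1} {w} (*-mono-≤ {1} {u} {1} {u} 1≤u 1≤u) 1≤w)
            (≤-trans (≤-reflexive (sym (^-zeroˡ 4))) (^-monoˡ-≤ 4 1≤a))
    l₁ : ∀ u w a → u * a * (u * a * (a * (w * a))) ≡ u * u * w * (a * (a * (a * (a * 1))))
    l₁ = NS.solve-∀
    l₂ : ∀ X → X + 2 * X + X ≡ 2 * (2 * X)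
    l₂ = NS.solve-∀
    l₃ : ∀ y z → 2 * (2 * (y * z)) ≡ 2 * (2 * y) * z
    l₃ = NS.solve-∀

primes-suffice : ∀ m → 2 ^ m * 2 ^ (m + 5) ≤ countOdd (2 ^ suc (primeWidth′ m))
primes-suffice m = ≮⇒≥ λ lt → <⇒≱ (strict lt) (many-primes k′)
  where
  k′ = primeWidth′ m
  a = 2 ^ m
  c = countOdd (2 ^ suc k′)
  pows : ∀ i j → 2 ^ (i * m + j) ≡ 2 ^ j * a ^ i
  pows i j = trans (^-distribˡ-+-* 2 (i * m) j) (trans (*-comm _ (2 ^ j)) (cong (2 ^ j *_) (trans (cong (2 ^_) (*-comm i m)) (sym (^-*-assoc 2 m i)))))
  k≤ : suc k′ ≤ 2 ^ 8 * a
  k≤ = begin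
    suc k′                  ≡⟨ l m ⟩
    4 * (m + 6)             ≤⟨ *-monoʳ-≤ 4 (<⇒≤ (n<2^n (m + 6))) ⟩
    4 * 2 ^ (m + 6)         ≡⟨ cong (4 *_) (trans (^-distribˡ-+-* 2 m 6) (*-comm a (2 ^ 6))) ⟩
    4 * (2 ^ 6 * a)         ≡⟨ sym (*-assoc 4 (2 ^ 6) a) ⟩
    2 ^ 8 * a               ∎
    where
    open ≤-Reasoning
    l : ∀ m → suc (4 * m + 23) ≡ 4 * (m + 6)
    l = NS.solve-∀
  strict : c < 2 ^ m * 2 ^ (m + 5) → suc k′ * (suc k′ * suc c) < 2 ^ k′ ∸ 1
  strict lt = m+n≤o⇒m≤o∸n (suc (suc k′ * (suc k′ * suc c))) (begin
    suc (suc k′ * (suc k′ * suc c)) + 1 ≡⟨ l₀ (suc k′ * (suc k′ * suc c)) ⟩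
    suc k′ * (suc k′ * suc c) + 2       ≤⟨ square-bound (suc k′) a c (2 ^ 8) (2 ^ 5) (2 ^ 23) (s≤s z≤n) (s≤s z≤n) (m^n>0 2 m) k≤
                                             (<-≤-trans lt (≤-reflexive (cong (a *_) (trans (^-distribˡ-+-* 2 m 5) (*-comm a (2 ^ 5)))))) refl ⟩
    2 ^ 23 * a ^ 4                      ≡⟨ sym (pows 4 23) ⟩
    2 ^ k′                              ∎)
    where
    open ≤-Reasoning
    l₀ : ∀ z → suc z + 1 ≡ z + 2
    l₀ = NS.solve-∀

search : ∀ {P : ℕ → Set} → (∀ z → Dec (P z)) → ∀ n → (∃[ z ] (z < n × P z)) ⊎ (∀ z → z < n → ¬ P z)
search P? zero = inj₂ λ z ()
search P? (suc n) with P? n | search P? n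
... | yes p | _ = inj₁ (n , ≤-refl , p)
... | no _ | inj₁ (z , lt , p) = inj₁ (z , m<n⇒m<1+n lt , p)
... | no ¬p | inj₂ h = inj₂ λ z lt → [ (λ { refl → ¬p }) , h z ]′ (Data.Sum.swap (m<1+n⇒m<n∨m≡n lt))
  where open Data.Sum using ([_,_]′)

-- The n-th difference of x ↦ x ^ n is n!, so x ^ n cannot be constant modulo p on 1, …, p − 1 for 0 < n < p − 1.

Δ : ℕ → (ℕ → ℤ) → ℕ → ℤ
Δ zero f y = f y
Δ (suc n) f y = Δ n f (suc y) ℤ.- Δ n f y

-- The Leibniz rule for the product with the identity function. By induction along it, `Δ n` kills
-- the powers below n and sends the n-th power to n!.
Δ-shift : ∀ n (g : ℕ → ℤ) y → Δ (suc n) (λ z → pos z ℤ.* g z) y ≡ pos y ℤ.* Δ (suc n) g y ℤ.+ pos (suc n) ℤ.* Δ n g (suc y)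
Δ-shift zero g y = trans (cong (λ a → a ℤ.* g (suc y) ℤ.- pos y ℤ.* g y) (ℤₚ.pos-+ 1 y)) (h (pos y) (g (suc y)) (g y))
  where
  h : ∀ y a b → (1ℤ ℤ.+ y) ℤ.* a ℤ.- y ℤ.* b ≡ y ℤ.* (a ℤ.- b) ℤ.+ 1ℤ ℤ.* a
  h = ZS.solve-∀
Δ-shift (suc n) g y = trans (cong₂ ℤ._-_ (Δ-shift n g (suc y)) (Δ-shift n g y)) (trans
  (cong (λ a → (a ℤ.* (A ℤ.- B) ℤ.+ pos (suc n) ℤ.* A) ℤ.- (pos y ℤ.* (B ℤ.- D) ℤ.+ pos (suc n) ℤ.* B)) (ℤₚ.pos-+ 1 y))
  (trans (h (pos y) (pos (suc n)) A B D) (cong (λ a → pos y ℤ.* ((A ℤ.- B) ℤ.- (B ℤ.- D)) ℤ.+ a ℤ.* (A ℤ.- B)) (sym (ℤₚ.pos-+ 1 (suc n))))))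
  where
  A = Δ n g (suc (suc y))
  B = Δ n g (suc y)
  D = Δ n g y
  h : ∀ y b A B D → ((1ℤ ℤ.+ y) ℤ.* (A ℤ.- B) ℤ.+ b ℤ.* A) ℤ.- (y ℤ.* (B ℤ.- D) ℤ.+ b ℤ.* B)
                  ≡ y ℤ.* ((A ℤ.- B) ℤ.- (B ℤ.- D)) ℤ.+ (1ℤ ℤ.+ b) ℤ.* (A ℤ.- B)
  h = ZS.solve-∀

Δ-cong : ∀ n {f g : ℕ → ℤ} → (∀ y → f y ≡ g y) → ∀ y → Δ n f y ≡ Δ n g y
Δ-cong zero h y = h y
Δ-cong (suc n) h y = cong₂ ℤ._-_ (Δ-cong n h (suc y)) (Δ-cong n h y)

power : ℕ → ℕ → ℤ
power k y = pos (y ^ k)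

power-suc : ∀ k y → power (suc k) y ≡ pos y ℤ.* power k y
power-suc k y = ℤₚ.pos-* y (y ^ k)

Δ-low : ∀ n k → k < n → ∀ y → Δ n (power k) y ≡ 0ℤ
Δ-low (suc zero) zero _ y = refl
Δ-low (suc (suc n)) zero _ y = cong₂ ℤ._-_ (Δ-low (suc n) zero (s≤s z≤n) (suc y)) (Δ-low (suc n) zero (s≤s z≤n) y)
Δ-low (suc n) (suc k) (s≤s lt) y = trans (Δ-cong (suc n) (power-suc k) y) (trans (Δ-shift n (power k) y)
  (cong₂ ℤ._+_ (trans (cong (pos y ℤ.*_) (Δ-low (suc n) k (m<n⇒m<1+n lt) y)) (ℤₚ.*-zeroʳ (pos y)))
               (trans (cong (pos (suc n) ℤ.*_) (Δ-low n k lt (suc y))) (ℤₚ.*-zeroʳ (pos (suc n))))))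

factorial : ℕ → ℕ
factorial zero = 1
factorial (suc n) = suc n * factorial n

Δ-top : ∀ n y → Δ n (power n) y ≡ pos (factorial n)
Δ-top zero y = refl
Δ-top (suc n) y = trans (Δ-cong (suc n) (power-suc n) y) (trans (Δ-shift n (power n) y)
  (trans (cong₂ ℤ._+_ (trans (cong (pos y ℤ.*_) (Δ-low (suc n) n ≤-refl y)) (ℤₚ.*-zeroʳ (pos y))) (cong (pos (suc n) ℤ.*_) (Δ-top n (suc y))))
    (trans (ℤₚ.+-identityˡ _) (sym (ℤₚ.pos-* (suc n) (factorial n))))))

Δ-congruent : ∀ p n (f : ℕ → ℤ) y → (∀ z → y ≤ z → z ≤ y + suc n → ∃[ q ] f z ≡ 1ℤ ℤ.+ q ℤ.* pos p) → ∃[ q ] Δ (suc n) f y ≡ q ℤ.* pos p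
Δ-congruent p zero f y h with h y ≤-refl (m≤m+n y 1) | h (suc y) (n≤1+n y) (≤-reflexive (+-comm 1 y))
... | q , e | q′ , e′ = q′ ℤ.- q , trans (cong₂ ℤ._-_ e′ e) (l q q′ (pos p))
  where
  l : ∀ q q′ p → (1ℤ ℤ.+ q′ ℤ.* p) ℤ.- (1ℤ ℤ.+ q ℤ.* p) ≡ (q′ ℤ.- q) ℤ.* p
  l = ZS.solve-∀
Δ-congruent p (suc n) f y h with
    Δ-congruent p n f (suc y) (λ z a b → h z (<⇒≤ a) (≤-trans b (≤-reflexive (sym (+-suc y (suc n))))))
  | Δ-congruent p n f y (λ z a b → h z a (≤-trans b (+-monoʳ-≤ y (n≤1+n (suc n)))))
... | q , e | q′ , e′ = q ℤ.- q′ , trans (cong₂ ℤ._-_ e e′) (l q q′ (pos p))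
  where
  l : ∀ q q′ p → q ℤ.* p ℤ.- q′ ℤ.* p ≡ (q ℤ.- q′) ℤ.* p
  l = ZS.solve-∀

prime∤factorial : ∀ {p} → Prime p → ∀ n → n < p → ¬ p ∣ factorial n
prime∤factorial pr zero lt d = <⇒≱ (prime⇒2≤ pr) (∣⇒≤ d)
prime∤factorial pr (suc n) lt d with euclidsLemma (suc n) (factorial n) pr d
... | inj₁ d′ = <⇒≱ lt (∣⇒≤ d′)
... | inj₂ d′ = prime∤factorial pr n (<-trans (n<1+n n) lt) d′

mod≡0⇒∣ : ∀ {p a} → 0 < p → a mod p ≡ 0 → p ∣ a
mod≡0⇒∣ {p} {a} 0<p e = divides (a div p) (trans (div-mod a 0<p) (cong (_+ a div p * p) e))

∣⇒mod≡0 : ∀ {p a} → 0 < p → p ∣ a → a mod p ≡ 0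
∣⇒mod≡0 0<p (divides q e) = mod-unique q 0<p e

mod-diff : ∀ {p} a d → 0 < p → (a + d) mod p ≡ a mod p → p ∣ d
mod-diff {p} a d 0<p e = ∣m+n∣m⇒∣n {m = a div p * p} (divides ((a + d) div p) (+-cancelˡ-≡ (a mod p) _ _ (begin
  a mod p + (a div p * p + d)     ≡⟨ sym (+-assoc (a mod p) _ d) ⟩
  a mod p + a div p * p + d       ≡⟨ cong (_+ d) (sym (div-mod a 0<p)) ⟩
  a + d                           ≡⟨ div-mod (a + d) 0<p ⟩
  (a + d) mod p + (a + d) div p * p ≡⟨ cong (_+ (a + d) div p * p) e ⟩
  a mod p + (a + d) div p * p     ∎))) (divides (a div p) refl)
  where open ≡-Reasoning

mod-add-∣ : ∀ {p} a {d} → p ∣ d → (a + d) mod p ≡ a mod p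
mod-add-∣ {p} a (divides q refl) = mod-kn p a q

mod-*-cong : ∀ p {a b c d} → a mod p ≡ b mod p → c mod p ≡ d mod p → (a * c) mod p ≡ (b * d) mod p
mod-*-cong p {a} {b} {c} {d} e f = trans (sym (mod-* p a c)) (trans (cong₂ (λ u v → (u * v) mod p) e f) (mod-* p b d))

mod-+-cong : ∀ p {a b c d} → a mod p ≡ b mod p → c mod p ≡ d mod p → (a + c) mod p ≡ (b + d) mod p
mod-+-cong p {a} {b} {c} {d} e f = trans (sym (mod-+ p a c)) (trans (cong₂ (λ u v → (u + v) mod p) e f) (mod-+ p b d))

mod-^-cong : ∀ p {a b} n → a mod p ≡ b mod p → (a ^ n) mod p ≡ (b ^ n) mod p
mod-^-cong p zero e = refl
mod-^-cong p {a} {b} (suc n) e = mod-*-cong p {a} {b} e (mod-^-cong p n e)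

cancel-∣ : ∀ {p} → Prime p → ∀ a → ¬ p ∣ a → ∀ b c → b ≤ c → (a * b) mod p ≡ (a * c) mod p → p ∣ c ∸ b
cancel-∣ {p} pr a p∤a b c b≤c e with euclidsLemma a (c ∸ b) pr (mod-diff (a * b) (a * (c ∸ b)) (≤-trans (s≤s z≤n) (prime⇒2≤ pr))
    (trans (cong (_mod p) (trans (sym (*-distribˡ-+ a b (c ∸ b))) (cong (a *_) (m+[n∸m]≡n b≤c)))) (sym e)))
... | inj₁ d = ⊥-elim (p∤a d)
... | inj₂ d = d

mod-cancel : ∀ {p} → Prime p → ∀ a b c → ¬ p ∣ a → (a * b) mod p ≡ (a * c) mod p → b mod p ≡ c mod p
mod-cancel {p} pr a b c p∤a e with ≤-total b c
... | inj₁ b≤c = sym (trans (cong (_mod p) (sym (m+[n∸m]≡n b≤c))) (mod-add-∣ b (cancel-∣ pr a p∤a b c b≤c e)))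
... | inj₂ c≤b = trans (cong (_mod p) (sym (m+[n∸m]≡n c≤b))) (mod-add-∣ c (cancel-∣ pr a p∤a c b c≤b (sym e)))

prime∤^ : ∀ {p} → Prime p → ∀ {a} n → ¬ p ∣ a → ¬ p ∣ a ^ n
prime∤^ pr zero p∤a d = <⇒≱ (prime⇒2≤ pr) (∣⇒≤ d)
prime∤^ pr {a} (suc n) p∤a d with euclidsLemma a (a ^ n) pr d
... | inj₁ d′ = p∤a d′
... | inj₂ d′ = prime∤^ pr n p∤a d′

coprime-primepower : ∀ {r m} → Prime r → ¬ r ∣ m → ∀ i → Coprime (r ^ i) m
coprime-primepower {r} {m} pr r∤m i {zero} (d∣ , d∣m) = ⊥-elim (r∤m (∣-trans (r ∣0) d∣m))
coprime-primepower {r} {m} pr r∤m i {suc zero} (d∣ , d∣m) = refl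
coprime-primepower {r} {m} pr r∤m i {suc (suc d)} (d∣ , d∣m) with prime-divisor {suc (suc d)} (s≤s (s≤s z≤n))
... | s , ps , s∣d = ⊥-elim (r∤m (∣-trans (r∣s) (∣-trans s∣d d∣m)))
  where
  s∣r : ∀ i → s ∣ r ^ i → s ∣ r
  s∣r zero e = ⊥-elim (<⇒≱ (prime⇒2≤ ps) (∣⇒≤ e))
  s∣r (suc i) e with euclidsLemma r (r ^ i) ps e
  ... | inj₁ d = d
  ... | inj₂ d = s∣r i d
  r∣s : r ∣ s
  r∣s with prime⇒irreducible pr (s∣r i (∣-trans s∣d d∣))
  ... | inj₁ refl = ⊥-elim (<⇒≱ (prime⇒2≤ ps) ≤-refl)
  ... | inj₂ refl = ∣-refl

coprime-∣ : ∀ {m n k} → Coprime m n → m ∣ k → n ∣ k → m * n ∣ k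
coprime-∣ {m} {n} c m∣k (divides q refl) = *-monoˡ-∣ n (coprime-divisor {m} {n} {q} c (transport (m ∣_) (*-comm q n) m∣k))

coprime-swap : ∀ {m n} → Coprime m n → Coprime n m
coprime-swap c (a , b) = c (b , a)

strip : ∀ {r} → Prime r → ∀ n → 1 ≤ n → ∃[ i ] ∃[ n′ ] ((n ≡ r ^ i * n′) × ¬ r ∣ n′)
strip {r} pr = <-rec _ go
  where
  go : ∀ n → (∀ {k} → k < n → 1 ≤ k → ∃[ i ] ∃[ n′ ] ((k ≡ r ^ i * n′) × ¬ r ∣ n′)) → 1 ≤ n → ∃[ i ] ∃[ n′ ] ((n ≡ r ^ i * n′) × ¬ r ∣ n′)
  go n rec 1≤n with r ∣? n
  ... | no r∤n = 0 , n , sym (*-identityˡ n) , r∤n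
  ... | yes (divides q e) with rec (quotient< (prime⇒2≤ pr) 1≤n e) (pos-factor {q} {r} (≤-trans 1≤n (≤-reflexive e)))
  ...   | i , n′ , e′ , r∤n′ = suc i , n′ , trans e (trans (*-comm q r) (trans (cong (r *_) e′) (sym (*-assoc r (r ^ i) n′)))) , r∤n′

2≤pow : ∀ {r} → 2 ≤ r → ∀ i → i ≢ 0 → 2 ≤ r ^ i
2≤pow 2≤r zero ne = ⊥-elim (ne refl)
2≤pow {r} 2≤r (suc i) ne = ≤-trans 2≤r (m≤m*n r (r ^ i) {{>-nonZero (m^n>0 r {{>-nonZero (≤-trans (s≤s z≤n) 2≤r)}} i)}})

-- Strong induction on d. For a prime r dividing d, either r occurs more often in d than in e, or
-- the r-part of d divides e; in the second case the rest of d is smaller and, by coprimality, still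
-- does not divide e.
excess : ∀ e → 1 ≤ e → ∀ d → 1 ≤ d → ¬ d ∣ e →
         ∃[ r ] ∃[ j ] ∃[ i ] ∃[ e′ ] (Prime r × j < i × (e ≡ r ^ j * e′) × (¬ r ∣ e′) × r ^ i ∣ d)
excess e 1≤e = <-rec _ go
  where
  Goal : ℕ → Set
  Goal d = ∃[ r ] ∃[ j ] ∃[ i ] ∃[ e′ ] (Prime r × j < i × (e ≡ r ^ j * e′) × (¬ r ∣ e′) × r ^ i ∣ d)
  go : ∀ d → (∀ {k} → k < d → 1 ≤ k → ¬ k ∣ e → Goal k) → 1 ≤ d → ¬ d ∣ e → Goal d
  go (suc zero) rec 1≤d d∤e = ⊥-elim (d∤e (1∣ e))
  go d@(suc (suc _)) rec 1≤d d∤e with prime-divisor {d} (s≤s (s≤s z≤n))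
  ... | r , pr , r∣d with strip pr d (s≤s z≤n) | strip pr e 1≤e
  ...   | i , d′ , ed , r∤d′ | j , e′ , ee , r∤e′ with j <? i
  ...     | yes j<i = r , j , i , e′ , pr , j<i , ee , r∤e′ , divides d′ (trans ed (*-comm (r ^ i) d′))
  ...     | no j≮i with rec d′<d 1≤d′ (λ d′∣e → d∤e (transport (_∣ e) (sym ed) (coprime-∣ (coprime-primepower pr r∤d′ i) r^i∣e d′∣e)))
    where
    r^i∣e : r ^ i ∣ e
    r^i∣e = ∣-trans (divides (r ^ (j ∸ i)) (trans (cong (r ^_) (sym (m∸n+n≡m (≮⇒≥ j≮i)))) (^-distribˡ-+-* r (j ∸ i) i)))
                    (divides e′ (trans ee (*-comm (r ^ j) e′)))
    1≤d′ : 1 ≤ d′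
    1≤d′ = pos-factor {d′} {r ^ i} (≤-trans 1≤d (≤-reflexive (trans ed (*-comm (r ^ i) d′))))
    i≢0 : i ≢ 0
    i≢0 refl = r∤d′ (transport (r ∣_) (trans ed (*-identityˡ d′)) r∣d)
    d′<d : d′ < d
    d′<d = quotient< {r ^ i} (2≤pow (prime⇒2≤ pr) i i≢0) 1≤d (trans ed (*-comm (r ^ i) d′))
  ...       | s , j′ , i′ , e″ , ps , lt , eq′ , nd , dv = s , j′ , i′ , e″ , ps , lt , eq′ , nd , ∣-trans dv (divides (r ^ i) ed)

module PrimitiveRoots {p p′ : ℕ} (p≡ : p ≡ suc p′) (pr : Prime p) where
  private
    p′<p : p′ < p
    p′<p = ≤-reflexive (sym p≡)
    0<p : 0 < p
    0<p = ≤-<-trans z≤n p′<p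
    ≤p′ : ∀ {z} → z < p → z ≤ p′
    ≤p′ lt = s≤s⁻¹ (≤-trans lt (≤-reflexive p≡))

  One : ℕ → Set
  One a = a mod p ≡ 1

  1mod : 1 mod p ≡ 1
  1mod = mod-small (prime⇒2≤ pr)

  One-* : ∀ {a b} → One a → One b → One (a * b)
  One-* {a} {b} e f = trans (mod-*-cong p {a} {1} {b} {1} (trans e (sym 1mod)) (trans f (sym 1mod))) 1mod

  One-^ : ∀ {a} n → One a → One (a ^ n)
  One-^ {a} n e = trans (mod-^-cong p {a} {1} n (trans e (sym 1mod))) (trans (cong (_mod p) (^-zeroˡ n)) 1mod)

  One-cancel : ∀ {a b} → One a → One (a * b) → One b
  One-cancel {a} {b} e f = trans (trans (cong (_mod p) (sym (*-identityˡ b))) (mod-*-cong p {1} {a} {b} {b} (trans 1mod (sym e)) refl)) f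

  unit∤ : ∀ {a} → 1 ≤ a → a < p → ¬ p ∣ a
  unit∤ {suc a} _ lt d = <⇒≱ lt (∣⇒≤ d)

  -- Phrased by divisibility rather than minimality, since this is what passes to powers and to
  -- products of elements of coprime orders.
  Ord : ℕ → ℕ → Set
  Ord a d = 1 ≤ d × One (a ^ d) × (∀ e → One (a ^ e) → d ∣ e)

  least⇒Ord : ∀ {a} d → 1 ≤ d → One (a ^ d) → (∀ e → e < d → ¬ (1 ≤ e × One (a ^ e))) → Ord a d
  least⇒Ord {a} d 1≤d h least = 1≤d , h , divide
    where
    divide : ∀ e → One (a ^ e) → d ∣ e
    divide e q with e mod d in eqr
    ... | zero = mod≡0⇒∣ 1≤d eqr
    ... | suc r = ⊥-elim (least (suc r) (<-≤-trans (≤-reflexive (cong suc (sym eqr))) (mod< e 1≤d)) (s≤s z≤n , rest))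
      where
      rest : One (a ^ suc r)
      rest = One-cancel {(a ^ d) ^ (e div d)} {a ^ suc r} (One-^ (e div d) h) (trans (cong (_mod p) (begin
        (a ^ d) ^ (e div d) * a ^ suc r   ≡⟨ cong (_* a ^ suc r) (^-*-assoc a d (e div d)) ⟩
        a ^ (d * (e div d)) * a ^ suc r   ≡⟨ sym (^-distribˡ-+-* a (d * (e div d)) (suc r)) ⟩
        a ^ (d * (e div d) + suc r)       ≡⟨ cong (a ^_) (trans (+-comm _ (suc r)) (trans (cong₂ _+_ (sym eqr) (*-comm d (e div d))) (sym (div-mod e 1≤d)))) ⟩
        a ^ e ∎)) q)
        where open ≡-Reasoning

  least : ∀ {P : ℕ → Set} → (∀ z → Dec (P z)) → ∀ n → P n → ∃[ m ] (m ≤ n × P m × (∀ z → z < m → ¬ P z))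
  least {P} P? = <-rec _ go
    where
    go : ∀ n → (∀ {k} → k < n → P k → ∃[ m ] (m ≤ k × P m × (∀ z → z < m → ¬ P z))) → P n → ∃[ m ] (m ≤ n × P m × (∀ z → z < m → ¬ P z))
    go n rec pn with search P? n
    ... | inj₂ h = n , ≤-refl , pn , h
    ... | inj₁ (z , lt , q) with rec lt q
    ...   | m , le′ , r = m , ≤-trans le′ (<⇒≤ lt) , r

  residue : ∀ {a} → ¬ p ∣ a → ∃[ k ] (k < p′ × a mod p ≡ suc k)
  residue {a} p∤a with a mod p in e | mod< a 0<p
  ... | zero | _ = ⊥-elim (p∤a (mod≡0⇒∣ 0<p e))
  ... | suc k | lt = k , ≤p′ lt , refl

  -- The p powers with exponents 0, ..., p - 1 take at most p - 1 nonzero residues, so two of them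
  -- agree. This bounds the exponent by p - 1 without Fermat's theorem.
  repeat : ∀ {a} → ¬ p ∣ a → ∃[ d ] (d ≤ p′ × 1 ≤ d × One (a ^ d))
  repeat {a} p∤a = found (pigeonhole {p′} {p} p′<p f)
    where
    r : ∀ i → ∃[ k ] (k < p′ × (a ^ i) mod p ≡ suc k)
    r i = residue (prime∤^ pr i p∤a)
    f : Fin p → Fin p′
    f i = fromℕ< (proj₁ (proj₂ (r (toℕ i))))
    found : (∃ λ i → ∃ λ j → i Data.Fin.< j × f i ≡ f j) → ∃[ d ] (d ≤ p′ × 1 ≤ d × One (a ^ d))
    found (i , j , i<j , e) = toℕ j ∸ toℕ i , ≤-trans (m∸n≤m (toℕ j) (toℕ i)) (≤p′ (toℕ<n j)) , m<n⇒0<n∸m i<j ,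
      trans (mod-cancel pr (a ^ toℕ i) (a ^ (toℕ j ∸ toℕ i)) 1 (prime∤^ pr (toℕ i) p∤a)
        (trans (cong (_mod p) (trans (sym (^-distribˡ-+-* a (toℕ i) (toℕ j ∸ toℕ i))) (cong (a ^_) (m+[n∸m]≡n (<⇒≤ i<j)))))
          (trans (proj₂ (proj₂ (r (toℕ j)))) (trans (cong suc (sym ki)) (trans (sym (proj₂ (proj₂ (r (toℕ i))))) (cong (_mod p) (sym (*-identityʳ (a ^ toℕ i))))))))) 1mod
      where
      ki : proj₁ (r (toℕ i)) ≡ proj₁ (r (toℕ j))
      ki = trans (sym (toℕ-fromℕ< (proj₁ (proj₂ (r (toℕ i)))))) (trans (cong toℕ e) (toℕ-fromℕ< (proj₁ (proj₂ (r (toℕ j))))))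

  order : ∀ {a} → ¬ p ∣ a → ∃[ d ] (d ≤ p′ × Ord a d)
  order {a} p∤a with repeat p∤a
  ... | d , d≤ , 1≤d , h with least {λ e → 1 ≤ e × One (a ^ e)} (λ e → (1 ≤? e) ×-dec ((a ^ e) mod p ≟ 1)) d (1≤d , h)
  ...   | m , m≤d , (1≤m , hm) , l = m , ≤-trans m≤d d≤ , least⇒Ord m 1≤m hm l

  Ord-pow : ∀ {a} u v → 1 ≤ u → Ord a (u * v) → Ord (a ^ u) v
  Ord-pow {a} u@(suc _) v 1≤u (1≤uv , h , div) =
    pos-factor {v} {u} (≤-trans 1≤uv (≤-reflexive (*-comm u v))) , trans (cong (_mod p) (^-*-assoc a u v)) h ,
    λ k q → *-cancelˡ-∣ u (div (u * k) (trans (cong (_mod p) (sym (^-*-assoc a u k))) q))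

  Ord-mul : ∀ {a b m n} → Coprime m n → Ord a m → Ord b n → Ord (a * b) (m * n)
  Ord-mul {a} {b} {m} {n} c (1≤m , ha , da) (1≤n , hb , db) =
    *-mono-≤ 1≤m 1≤n , trans (cong (_mod p) (prod-pow (m * n))) (One-* {a ^ (m * n)} {b ^ (m * n)} (trans (cong (_mod p) (sym (^-*-assoc a m n))) (One-^ {a ^ m} n ha))
      (trans (cong (_mod p) (trans (cong (b ^_) (*-comm m n)) (sym (^-*-assoc b n m)))) (One-^ {b ^ n} m hb))) ,
    λ k q → coprime-∣ c
      (coprime-divisor {m} {n} {k} c (da (n * k) (One-cancel {b ^ (n * k)} {a ^ (n * k)} (trans (cong (_mod p) (sym (^-*-assoc b n k))) (One-^ {b ^ n} k hb))
         (trans (cong (_mod p) (trans (*-comm (b ^ (n * k)) _) (trans (sym (prod-pow (n * k))) (trans (cong ((a * b) ^_) (*-comm n k)) (sym (^-*-assoc (a * b) k n)))))) (One-^ {(a * b) ^ k} n q)))))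
      (coprime-divisor {n} {m} {k} (coprime-swap c) (db (m * k) (One-cancel {a ^ (m * k)} {b ^ (m * k)} (trans (cong (_mod p) (sym (^-*-assoc a m k))) (One-^ {a ^ m} k ha))
         (trans (cong (_mod p) (trans (sym (prod-pow (m * k))) (trans (cong ((a * b) ^_) (*-comm m k)) (sym (^-*-assoc (a * b) k m))))) (One-^ {(a * b) ^ k} m q)))))
    where
    prod-pow : ∀ k → (a * b) ^ k ≡ a ^ k * b ^ k
    prod-pow zero = refl
    prod-pow (suc k) = trans (cong (a * b *_) (prod-pow k)) (l a b (a ^ k) (b ^ k))
      where
      l : ∀ a b c d → a * b * (c * d) ≡ a * c * (b * d)
      l = NS.solve-∀

  not-all-roots : ∀ e → 1 ≤ e → e < p′ → ∃[ b ] ((¬ p ∣ b) × ¬ One (b ^ e))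
  not-all-roots e@(suc e′) 1≤e e<p′ with search (λ z → (1 ≤? z) ×-dec ¬? ((z ^ e) mod p ≟ 1)) p
  ... | inj₁ (b , b<p , 1≤b , h) = b , unit∤ 1≤b b<p , h
  ... | inj₂ all with Δ-congruent p e′ (power e) 1 (λ z 1≤z z≤ → roots z 1≤z (≤-<-trans (≤-trans z≤ e<p′) p′<p))
    where
    one? : ∀ z → 1 ≤ z → z < p → One (z ^ e)
    one? z 1≤z z<p with (z ^ e) mod p ≟ 1
    ... | yes h = h
    ... | no h = ⊥-elim (all z z<p (1≤z , h))
    roots : ∀ z → 1 ≤ z → z < p → ∃[ q ] power e z ≡ 1ℤ ℤ.+ q ℤ.* pos p
    roots z 1≤z z<p = pos ((z ^ e) div p) , trans (cong pos (trans (div-mod (z ^ e) 0<p) (cong (_+ (z ^ e) div p * p) (one? z 1≤z z<p))))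
      (trans (ℤₚ.pos-+ 1 _) (cong (λ a → 1ℤ ℤ.+ a) (ℤₚ.pos-* ((z ^ e) div p) p)))
  ...   | q , eq′ = ⊥-elim (prime∤factorial pr e (<-trans e<p′ p′<p) (mod≡0⇒∣ 0<p
            (trans (resid-cong {p} {pos (factorial e)} {0ℤ} q (trans (sym (Δ-top e 1)) (trans eq′ (sym (ℤₚ.+-identityˡ (q ℤ.* pos p))))))
              (resid-small {p} {0} 0<p))))

  -- Stated as the absence of small exponents, so that a formula can test it by one exponential sum.
  Primitive : ℕ → Set
  Primitive g = (1 ≤ g × g < p) × (∀ e → e < p′ → ¬ (1 ≤ e × One (g ^ e)))

  One-unit : ∀ {a} d → 1 ≤ d → One (a ^ d) → ¬ p ∣ a
  One-unit {a} (suc d) _ h p∣a with trans (sym h) (∣⇒mod≡0 0<p (∣m⇒∣m*n (a ^ d) p∣a))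
  ... | ()

  Ord-≤ : ∀ {a d} → Ord a d → d ≤ p′
  Ord-≤ {a} {d} (1≤d , h , dv) = bound′ (order {a} (One-unit d 1≤d h))
    where
    bound′ : ∃[ f ] (f ≤ p′ × Ord a f) → d ≤ p′
    bound′ (f , f≤ , (1≤f , hf , _)) = ≤-trans (∣⇒≤ {{>-nonZero 1≤f}} (dv f hf)) f≤

  combine : ∀ a b r j i e′ v → Prime r → ¬ r ∣ e′ → j < i → Ord a (r ^ j * e′) → Ord b (v * r ^ i) →
            ∃[ c ] ∃[ e₂ ] (Ord c e₂ × r ^ j * e′ < e₂)
  combine a b r j i e′ v pr′ r∤e′ j<i oa ob = (a ^ (r ^ j)) * (b ^ v) , e′ * r ^ i ,
    Ord-mul {a ^ (r ^ j)} {b ^ v} (coprime-swap (coprime-primepower pr′ r∤e′ i))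
      (Ord-pow (r ^ j) e′ (m^n>0 r {{>-nonZero 0<r}} j) oa) (Ord-pow v (r ^ i) (pos-factor {v} {r ^ i} (proj₁ ob)) ob) ,
    ≤-trans (≤-reflexive (cong suc (*-comm (r ^ j) e′))) (*-monoʳ-< e′ {{>-nonZero 1≤e′}} (^-monoʳ-< r (prime⇒2≤ pr′) j<i))
    where
    0<r : 1 ≤ r
    0<r = ≤-trans (s≤s z≤n) (prime⇒2≤ pr′)
    1≤e′ : 1 ≤ e′
    1≤e′ = pos-factor {e′} {r ^ j} (≤-trans (proj₁ oa) (≤-reflexive (*-comm (r ^ j) e′)))

  -- Some b is no root of x ^ e - 1, so its order does not divide e and contains a prime power r ^ i
  -- too high for e. A power of a whose order is the part of e prime to r, times a power of b of
  -- order r ^ i, has a larger order.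
  improve : ∀ a e → Ord a e → e < p′ → ∃[ c ] ∃[ e₂ ] (Ord c e₂ × e < e₂)
  improve a e oa e< = result (not-all-roots e (proj₁ oa) e<)
    where
    result : ∃[ b ] ((¬ p ∣ b) × ¬ One (b ^ e)) → ∃[ c ] ∃[ e₂ ] (Ord c e₂ × e < e₂)
    result (b , p∤b , hb) = finish (excess e (proj₁ oa) d (proj₁ od) d∤e)
      where
      d : ℕ
      d = proj₁ (order p∤b)
      od : Ord b d
      od = proj₂ (proj₂ (order p∤b))
      d∤e : ¬ d ∣ e
      d∤e (divides q eq′) = hb (trans (cong (_mod p) (trans (cong (b ^_) (trans eq′ (*-comm q d))) (sym (^-*-assoc b d q)))) (One-^ {b ^ d} q (proj₁ (proj₂ od))))
      finish : ∃[ r ] ∃[ j ] ∃[ i ] ∃[ e′ ] (Prime r × j < i × (e ≡ r ^ j * e′) × (¬ r ∣ e′) × r ^ i ∣ d) → ∃[ c ] ∃[ e₂ ] (Ord c e₂ × e < e₂)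
      finish (r , j , i , e′ , pr′ , j<i , ee , r∤e′ , divides v ev) = proj₁ c , proj₁ (proj₂ c) , proj₁ (proj₂ (proj₂ c)) ,
        transport (_< proj₁ (proj₂ c)) (sym ee) (proj₂ (proj₂ (proj₂ c)))
        where
        c : ∃[ c ] ∃[ e₂ ] (Ord c e₂ × r ^ j * e′ < e₂)
        c = combine a b r j i e′ v pr′ r∤e′ j<i (transport (Ord a) ee oa) (transport (Ord b) ev od)

  climb : ∀ fuel a e → p′ ∸ e ≤ fuel → Ord a e → ∃[ g ] Ord g p′
  climb fuel a e le′ o with e <? p′
  climb fuel a e le′ o | no e≮ = a , transport (Ord a) (≤-antisym (Ord-≤ o) (≮⇒≥ e≮)) o
  climb zero a e le′ o | yes e< = ⊥-elim (<⇒≱ e< (m∸n≡0⇒m≤n (n≤0⇒n≡0 le′)))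
  climb (suc fuel) a e le′ o | yes e< = climb fuel (proj₁ next) (proj₁ (proj₂ next))
    (≤-trans (∸-monoʳ-≤ p′ (proj₂ (proj₂ (proj₂ next)))) (≤-trans (≤-reflexive (sym (pred[m∸n]≡m∸[1+n] p′ e))) (pred-mono-≤ le′)))
    (proj₁ (proj₂ (proj₂ next)))
    where
    next : ∃[ c ] ∃[ e₂ ] (Ord c e₂ × e < e₂)
    next = improve a e o e<

  Ord⇒Primitive : ∀ {g} → Ord g p′ → Primitive (g mod p)
  Ord⇒Primitive {g} (1≤p′ , h , dv) = (positive (residue (One-unit p′ 1≤p′ h)) , mod< g 0<p) , λ e e< q →
    <⇒≱ e< (∣⇒≤ {{>-nonZero (proj₁ q)}} (dv e (trans (mod-^-cong p {g} {g mod p} e (sym (mod-mod p g))) (proj₂ q))))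
    where
    positive : ∃[ k ] (k < p′ × g mod p ≡ suc k) → 1 ≤ g mod p
    positive (k , _ , e) = ≤-trans (s≤s z≤n) (≤-reflexive (sym e))

  primitive-root : ∃[ g ] Primitive g
  primitive-root = proj₁ top mod p , Ord⇒Primitive (proj₂ top)
    where
    start : ∃[ d ] (d ≤ p′ × Ord 1 d)
    start = order {1} (unit∤ ≤-refl (prime⇒2≤ pr))
    top : ∃[ g ] Ord g p′
    top = climb p′ 1 (proj₁ start) (m∸n≤m p′ (proj₁ start)) (proj₂ (proj₂ start))

  module _ {g : ℕ} (prim : Primitive g) where
    private
      g∤ : ¬ p ∣ g
      g∤ = unit∤ (proj₁ (proj₁ prim)) (proj₂ (proj₁ prim))

    exponent-< : ∀ i j → i < j → j < p′ → (g ^ i) mod p ≢ (g ^ j) mod p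
    exponent-< i j i<j j< e = proj₂ prim (j ∸ i) (≤-<-trans (m∸n≤m j i) j<) (m<n⇒0<n∸m i<j ,
      trans (mod-cancel pr (g ^ i) (g ^ (j ∸ i)) 1 (prime∤^ pr i g∤)
        (trans (cong (_mod p) (trans (sym (^-distribˡ-+-* g i (j ∸ i))) (cong (g ^_) (m+[n∸m]≡n (<⇒≤ i<j)))))
          (trans (sym e) (cong (_mod p) (sym (*-identityʳ (g ^ i))))))) 1mod)

    exponent-unique : ∀ i j → i < p′ → j < p′ → (g ^ i) mod p ≡ (g ^ j) mod p → i ≡ j
    exponent-unique i j i< j< e with <-cmp i j
    ... | tri< lt _ _ = ⊥-elim (exponent-< i j lt j< e)
    ... | tri≈ _ q _ = q
    ... | tri> _ _ gt = ⊥-elim (exponent-< j i gt i< (sym e))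

    logarithm : ∀ u → 1 ≤ u → u < p → ∃[ e ] (e < p′ × (g ^ e) mod p ≡ u)
    logarithm u@(suc u′) 1≤u u<p with search (λ e → (g ^ e) mod p ≟ u) p′
    ... | inj₁ found = found
    ... | inj₂ none = ⊥-elim (clash (pigeonhole {p′} {p} p′<p (λ i → f i (toℕ i <? p′))))
      where
      u< : u′ < p′
      u< = ≤p′ u<p
      r : ∀ i → ∃[ k ] (k < p′ × (g ^ i) mod p ≡ suc k)
      r i = residue (prime∤^ pr i g∤)
      -- Were u no power, the p - 1 powers and u would be p distinct nonzero residues; the index p -
      -- 1, beyond the exponents, stands for u.
      f : (i : Fin p) → Dec (toℕ i < p′) → Fin p′
      f i (yes _) = fromℕ< (proj₁ (proj₂ (r (toℕ i))))
      f i (no _) = fromℕ< u<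
      clash : (∃ λ i → ∃ λ j → i Data.Fin.< j × f i (toℕ i <? p′) ≡ f j (toℕ j <? p′)) → ⊥
      clash (i , j , i<j , e) with toℕ i <? p′ | toℕ j <? p′
      ... | no i≮ | _ = i≮ (<-≤-trans i<j (≤p′ (toℕ<n j)))
      ... | yes i< | yes j< = exponent-< (toℕ i) (toℕ j) i<j j< (trans (proj₂ (proj₂ (r (toℕ i)))) (trans (cong suc
              (trans (sym (toℕ-fromℕ< (proj₁ (proj₂ (r (toℕ i)))))) (trans (cong toℕ e) (toℕ-fromℕ< (proj₁ (proj₂ (r (toℕ j)))))))) (sym (proj₂ (proj₂ (r (toℕ j)))))))
      ... | yes i< | no _ = none (toℕ i) i< (trans (proj₂ (proj₂ (r (toℕ i)))) (cong suc
              (trans (sym (toℕ-fromℕ< (proj₁ (proj₂ (r (toℕ i)))))) (trans (cong toℕ e) (toℕ-fromℕ< u<)))))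

-- Iterated products modulo a prime, by discrete logarithms to the least primitive root

valP : ∀ {n} k → (Fin k → Poly n) → Poly n
valP zero v = 𝟘
valP (suc k) v = v zero ⊕ (𝟙 ⊕ 𝟙) ⊗ valP k (v ∘ suc)

-- Binary exponentiation in polynomial form: for a bit v the factor 1 + v (G - 1) is G or 1, and G
-- is squared from bit to bit.
powP : ∀ {n} k → (Fin k → Poly n) → Poly n → Poly n
powP zero v G = 𝟙
powP (suc k) v G = (𝟙 ⊕ v zero ⊗ (G ⊕ ⊖ 𝟙)) ⊗ powP k (v ∘ suc) (G ⊗ G)

easy-var : ∀ {n} (i : Fin n) → Easy (var i) 0
easy-var i = easy-input (x i)

easy-one : ∀ {n} → Easy {n} 𝟙 0
easy-one = easy-input one

easy-valP : ∀ {n} k (v : Fin k → Poly n) → (∀ i → Easy (v i) 0) → Easy (valP k v) (3 * k + 1)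
easy-valP zero v h = _ , computes-zero
easy-valP (suc k) v h = easy-≈ ≈-refl (≤-reflexive (l k))
  (easy-op plus (h zero) (easy-op times (easy-op plus easy-one easy-one) (easy-valP k (v ∘ suc) (h ∘ suc))))
  where
  l : ∀ k → suc (0 + suc (1 + (3 * k + 1))) ≡ 3 * suc k + 1
  l = NS.solve-∀

easy-powP : ∀ {n} k (v : Fin k → Poly n) → (∀ i → Easy (v i) 0) → ∀ {G s} → Easy G s → Easy (powP k v G) (k * (s + k + 5))
easy-powP zero v h g = easy-one
easy-powP (suc k) v h {G} {s} g = easy-≈ ≈-refl (≤-slack (2 + k) (l k s))
  (easy-op times (easy-op plus easy-one (easy-op times (h zero) (easy-op minus g easy-one)))
    (easy-powP k (v ∘ suc) (h ∘ suc) (easy-square g)))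
  where
  l : ∀ k s → suc (suc (0 + suc (0 + suc (s + 0))) + k * (suc s + k + 5)) + (2 + k) ≡ suc k * (s + suc k + 5)
  l = NS.solve-∀

ev-valP : ∀ {n} (ρ : Fin n → ℤ) k (v : Fin k → Poly n) (b : Fin k → Bool) → (∀ i → Z.ev ρ (v i) ≡ Z.ιᵇ (b i)) →
          Z.ev ρ (valP k v) ≡ pos (val (tabulate b))
ev-valP ρ zero v b h = refl
ev-valP ρ (suc k) v b h = trans (cong₂ (λ s t → s ℤ.+ pos 2 ℤ.* t) (trans (h zero) (ιᵇ-pos (b zero))) (ev-valP ρ k (v ∘ suc) (b ∘ suc) (h ∘ suc)))
  (trans (cong (λ t → pos (bit (b zero)) ℤ.+ t) (sym (ℤₚ.pos-* 2 (val (tabulate (b ∘ suc)))))) (sym (ℤₚ.pos-+ (bit (b zero)) _)))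
  where
  ιᵇ-pos : ∀ c → Z.ιᵇ c ≡ pos (bit c)
  ιᵇ-pos true = refl
  ιᵇ-pos false = refl

ev-powP : ∀ {n} (ρ : Fin n → ℤ) k (v : Fin k → Poly n) (b : Fin k → Bool) → (∀ i → Z.ev ρ (v i) ≡ Z.ιᵇ (b i)) →
          ∀ G g → Z.ev ρ G ≡ pos g → Z.ev ρ (powP k v G) ≡ pos (g ^ val (tabulate b))
ev-powP ρ zero v b h G g e = refl
ev-powP ρ (suc k) v b h G g e = trans (cong₂ ℤ._*_
    (trans (cong₂ (λ s t → 1ℤ ℤ.+ s ℤ.* (t ℤ.+ (ℤ.- 1ℤ))) (h zero) e) (digit (b zero)))
    (ev-powP ρ k (v ∘ suc) (b ∘ suc) (h ∘ suc) (G ⊗ G) (g * g) (trans (cong₂ ℤ._*_ e e) (sym (ℤₚ.pos-* g g)))))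
  (trans (sym (ℤₚ.pos-* (g ^ bit (b zero)) _)) (cong pos (trans (cong (λ t → g ^ bit (b zero) * t) (square w)) (sym (^-distribˡ-+-* g (bit (b zero)) (2 * w))))))
  where
  w = val (tabulate (b ∘ suc))
  digit : ∀ c → 1ℤ ℤ.+ Z.ιᵇ c ℤ.* (pos g ℤ.+ (ℤ.- 1ℤ)) ≡ pos (g ^ bit c)
  digit true = trans (l (pos g)) (cong pos (sym (*-identityʳ g)))
    where
    l : ∀ y → 1ℤ ℤ.+ 1ℤ ℤ.* (y ℤ.+ (ℤ.- 1ℤ)) ≡ y
    l = ZS.solve-∀
  digit false = l (pos g)
    where
    l : ∀ y → 1ℤ ℤ.+ 0ℤ ℤ.* (y ℤ.+ (ℤ.- 1ℤ)) ≡ 1ℤ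
    l = ZS.solve-∀
  square : ∀ w → (g * g) ^ w ≡ g ^ (2 * w)
  square w = trans (cong (_^ w) (cong (g *_) (sym (*-identityʳ g)))) (^-*-assoc g 2 w)

easy-circuits : ∀ a (Q : ∀ n → Poly (a n)) s → PB s → (∀ n → Easy (Q n) (s n)) →
                Σ (Circuits a) λ C → (∀ n → eval (C n) ≈ Q n) × PB (size ∘ C)
easy-circuits a Q s ps h =
  (λ n → circuit _ (Computes.code (proj₂ (h n))) (Computes.out (proj₂ (h n)))) ,
  (λ n → Computes.value (proj₂ (h n))) , pb-mono (λ n → Computes.size≤ (proj₂ (h n))) ps

under : ∀ {k l Γ} → Feasible (k ∷ Γ) → Feasible (k ∷ l ∷ Γ)
under {k} {l} {Γ} φ = feasible (λ n e → fun φ n (proj₁ e , proj₂ (proj₂ e))) (realizer (λ n → bind (f n) (fm φ n))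
  (pb-mono (λ n → ≤-reflexive (fsize-bind (f n) (fm φ n))) (pb φ))
  (λ n ρ e a → trans (⟦bind⟧ (f n) (fm φ n) ρ) (trans (⟦⟧-cong (fm φ n) (λ { (inj₁ i) → refl ; (inj₂ v) → refl }))
    (ok φ n (ρ ∘ g n) (proj₁ e , proj₂ (proj₂ e)) (proj₁ a , proj₂ (proj₂ a))))))
  where
  g : ∀ n → Bits (k ∷ Γ) n → Bits (k ∷ l ∷ Γ) n
  g n (inj₁ i) = inj₁ i
  g n (inj₂ v) = inj₂ (inj₂ v)
  f : ∀ n → Bits (k ∷ Γ) n → Atom (Bits (k ∷ l ∷ Γ) n)
  f n v = inj₂ (g n v)

prodTo-mod-cong : ∀ p n {f g : ℕ → ℕ} → (∀ t → t < n → f t mod p ≡ g t mod p) → prodTo n f mod p ≡ prodTo n g mod p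
prodTo-mod-cong p zero h = refl
prodTo-mod-cong p (suc n) {f} {g} h = mod-*-cong p {prodTo n f} {prodTo n g} (prodTo-mod-cong p n (λ t lt → h t (m<n⇒m<1+n lt))) (h n ≤-refl)

^-sumTo : ∀ g n f → g ^ sumTo n f ≡ prodTo n (λ t → g ^ f t)
^-sumTo g zero f = refl
^-sumTo g (suc n) f = trans (^-distribˡ-+-* g (sumTo n f) (f n)) (cong (_* g ^ f n) (^-sumTo g n f))

bounded-choice : ∀ N {Q : ℕ → ℕ → Set} → (∀ t → t < N → ∃[ l ] Q t l) → ∃[ f ] (∀ t → t < N → Q t (f t))
bounded-choice N {Q} h = f , ok′
  where
  f : ℕ → ℕ
  f t with t <? N
  ... | yes lt = proj₁ (h t lt)
  ... | no _ = 0
  ok′ : ∀ t → t < N → Q t (f t)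
  ok′ t lt with t <? N
  ... | yes lt′ = proj₂ (h t lt′)
  ... | no ge = ⊥-elim (ge lt)

module Products (hyp : VNP0≡VP0) (K′ : ℕ → ℕ) (pK : PB K′) where
  open Comparisons hyp

  K : ℕ → ℕ
  K n = suc (K′ n)

  P : Width
  P = width K (pb-+ (pb-const 1) pK)

  -- The number g ^ e can have exponentially many digits and is never formed: a circuit for it, with
  -- the bits of e and g as inputs, is evaluated modulo p.
  module Power (E : Width) where
    private
      Γ : Ctx
      Γ = E ∷ P ∷ []
      eBit : ∀ n → Fin (len E n) → Poly (nbits Γ n)
      eBit n i = var (encode Γ n (inj₁ i))
      gBit : ∀ n → Fin (K n) → Poly (nbits Γ n)
      gBit n i = var (encode Γ n (inj₂ (inj₁ i)))
      Q : ∀ n → Poly (nbits Γ n)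
      Q n = powP (len E n) (eBit n) (valP (K n) (gBit n))
      abstract
        found : Σ (Circuits (nbits Γ)) λ C → (∀ n → eval (C n) ≈ Q n) × PB (size ∘ C)
        found = easy-circuits (nbits Γ) Q (λ n → len E n * (3 * K n + 1 + len E n + 5))
          (pb-* (len-pb E) (pb-+ (pb-+ (pb-+ (pb-* (pb-const 3) (len-pb P)) (pb-const 1)) (len-pb E)) (pb-const 5)))
          (λ n → easy-powP (len E n) (eBit n) (λ i → easy-var _) (easy-valP (K n) (gBit n) (λ i → easy-var _)))
      module M = ModularEvaluation Γ K′ pK (proj₁ found) (proj₂ (proj₂ found))

    abstract
      pow-fun : ℕ → Env (P ∷ E ∷ P ∷ []) → ℕ
      pow-fun = fun M.modEval
      powR : Realizer (P ∷ E ∷ P ∷ []) pow-fun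
      powR = real M.modEval

    powF : Feasible (P ∷ E ∷ P ∷ [])
    powF = feasible pow-fun powR

    abstract
      fun-powF : ∀ n p e g → 2 ≤ p → e < 2 ^ len E n → g < 2 ^ K n → fun powF n (p , e , g , tt) ≡ (g ^ e) mod p
      fun-powF n p e g 2≤p e< g< = trans (M.fun-modEval n p (e , g , tt) 2≤p) (cong (resid p) (trans
        (Z.ev-sound ρ (proj₁ (proj₂ found) n))
        (trans (ev-powP ρ (len E n) (eBit n) (lookup (bits (len E n) e)) eb (valP (K n) (gBit n)) g
            (trans (ev-valP ρ (K n) (gBit n) (lookup (bits (K n) g)) gb) (cong pos (word (K n) g g<))))
          (cong (λ a → pos (g ^ a)) (word (len E n) e e<)))))
        where
        ρ : Fin (nbits Γ n) → ℤ
        ρ = Z.ιᵇ ∘ M.inputs n (e , g , tt)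
        word : ∀ k z → z < 2 ^ k → val (tabulate (lookup (bits k z))) ≡ z
        word k z lt = trans (cong val (Vecₚ.tabulate∘lookup (bits k z))) (val-bits k z lt)
        eb : ∀ i → ρ (encode Γ n (inj₁ i)) ≡ Z.ιᵇ (lookup (bits (len E n) e) i)
        eb i = cong (λ v → Z.ιᵇ (envBits Γ n (e , g , tt) v)) (decode-encode Γ n (inj₁ i))
        gb : ∀ i → ρ (encode Γ n (inj₂ (inj₁ i))) ≡ Z.ιᵇ (lookup (bits (K n) g) i)
        gb i = cong (λ v → Z.ιᵇ (envBits Γ n (e , g , tt) v)) (decode-encode Γ n (inj₂ (inj₁ i)))

  private module PowK = Power P

  private
    vp vg : Feasible (P ∷ P ∷ [])
    vp = vr here
    vg = vr (there here)
    smallOrder : Feasible (P ∷ P ∷ [])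
    -- The condition 1 + e < p expresses e < p - 1 without a subtraction.
    smallOrder = Sg P (ltF (one′ ⊞ vr here) (wkn vp) ⊠ (leF one′ (vr here) ⊠ eqF (call (there here ∷ here ∷ there (there here) ∷ []) PowK.powF) one′))

  primitiveF leastF : Feasible (P ∷ P ∷ [])
  primitiveF = (leF one′ vg ⊠ ltF vg vp) ⊠ eqF smallOrder nil
  -- There are several primitive roots in general, and a sum over all of them would count each; the
  -- least one is unique.
  leastF = primitiveF ⊠ eqF (Sg P (ltF (vr here) (wkn vg) ⊠ call (there here ∷ here ∷ []) primitiveF)) nil

  module _ (n p : ℕ) (pr : Prime p) (p< : p < 2 ^ K n) where
    p≡ : p ≡ suc (pred p)
    p≡ = sym (suc-pred p {{prime⇒nonZero pr}})
    open PrimitiveRoots p≡ pr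

    private
      2≤p : 2 ≤ p
      2≤p = prime⇒2≤ pr
      0<p : 0 < p
      0<p = ≤-trans (s≤s z≤n) 2≤p
      down : ∀ {z} → suc z < p → z < pred p
      down lt = s≤s⁻¹ (≤-trans lt (≤-reflexive p≡))
      up : ∀ {z} → z < pred p → suc z < p
      up lt = ≤-trans (s≤s lt) (≤-reflexive (sym p≡))
      pred< : ∀ {z} → z < pred p → z < 2 ^ K n
      pred< lt = <-trans (<-trans (n<1+n _) (up lt)) p<

    ind-primitive : ∀ g → g < 2 ^ K n → Ind (Primitive g) (fun primitiveF n (p , g , tt))
    ind-primitive g g< = ind-map
      (λ { (r , h) → r , λ e e<p q → h e (pred< e<p) (up e<p , q) })
      (λ { (r , h) → r , λ e _ q → h e (down (proj₁ q)) (proj₂ q) })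
      (ind-× (ind-× (ind-le 1 g) (ind-le (suc g) p))
        (ind-∄ (2 ^ K n) (λ e e< → ind-× (ind-le (suc (1 + e)) p) (ind-× (ind-le 1 e)
          (ind-map (trans (sym (PowK.fun-powF n p e g 2≤p e< g<))) (trans (PowK.fun-powF n p e g 2≤p e< g<)) (ind-eq (fun PowK.powF n (p , e , g , tt)) 1))))))

    Least : ℕ → Set
    Least g = Primitive g × (∀ z → z < 2 ^ K n → ¬ (z < g × Primitive z))

    ind-least : ∀ g → g < 2 ^ K n → Ind (Least g) (fun leastF n (p , g , tt))
    ind-least g g< = ind-× (ind-primitive g g<) (ind-∄ (2 ^ K n) (λ z z< → ind-× (ind-le (suc z) g) (ind-primitive z z<)))

    abstract
     least-root : ∃[ g ] (g < 2 ^ K n × Least g)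
     least-root = finish (least {Primitive} dec g₀ pg₀)
       where
       g₀ : ℕ
       g₀ = proj₁ primitive-root
       pg₀ : Primitive g₀
       pg₀ = proj₂ primitive-root
       small : ∀ {g} → Primitive g → g < 2 ^ K n
       small q = <-trans (proj₂ (proj₁ q)) p<
       dec : ∀ z → Dec (Primitive z)
       dec z with z <? 2 ^ K n
       ... | yes lt = ind-dec (ind-primitive z lt)
       ... | no ge = no (ge ∘ small)
       finish : ∃[ m ] (m ≤ g₀ × Primitive m × (∀ z → z < m → ¬ Primitive z)) → ∃[ g ] (g < 2 ^ K n × Least g)
       finish (m , _ , q , h) = m , small q , q , λ z _ r → h z (proj₁ r) (proj₂ r)

    least-unique : ∀ {a b} → a < 2 ^ K n → b < 2 ^ K n → Least a → Least b → a ≡ b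
    least-unique {a} {b} a< b< la lb with <-cmp a b
    ... | tri< lt _ _ = ⊥-elim (proj₂ lb a a< (lt , proj₁ la))
    ... | tri≈ _ q _ = q
    ... | tri> _ _ gt = ⊥-elim (proj₂ la b b< (gt , proj₁ lb))

  -- Modulo a prime the product becomes a sum of discrete logarithms, and exponential sums are
  -- available. A factor divisible by p has no logarithm; `zeros` counts such factors, and a single
  -- one makes the result 0.
  module IteratedProduct {Γ : Ctx} (T : Width) (u : Feasible (T ∷ Γ)) (v : Var P Γ) where
    private
      E : Width
      -- There are 2 ^ len T logarithms, each below 2 ^ K, so their sum fits into len T + K bits.
      E = width (λ n → len T n + K n) (pb-+ (len-pb T) (len-pb P))
      module PowE = Power E
      reduced : Feasible (T ∷ Γ)
      reduced = remF u (vr (there v))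
      zeros : Feasible Γ
      zeros = Sg T (eqF reduced nil)
      isLog : Feasible (P ∷ T ∷ P ∷ Γ)
      isLog = ltF (one′ ⊞ vr here) (vr (there (there (there v))))
        ⊠ eqF (call (there (there (there v)) ∷ here ∷ there (there here) ∷ []) PowK.powF) (wkn (under reduced))
      exponent : Feasible (P ∷ Γ)
      exponent = Sg T (Sg P (isLog ⊠ vr here))
      power′ : Feasible (P ∷ Γ)
      power′ = Sg E (eqF (vr here) (wkn exponent) ⊠ call (there (there v) ∷ here ∷ there here ∷ []) PowE.powF)

      rawF : Feasible Γ
      rawF = eqF zeros nil ⊠ Sg P (call (there v ∷ here ∷ []) leastF ⊠ power′)

      fun-rawF : ∀ n e → Prime (get v e) → get v e < 2 ^ K n → fun rawF n e ≡ prodTo (2 ^ len T n) (λ t → fun u n (t , e)) mod get v e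
      fun-rawF n e pr p< = cases (ind-dec (ind-∄ (2 ^ len T n) (λ t _ → ind-eq (fun reduced n (t , e)) 0)))
        where
        p = get v e
        0<p : 0 < p
        0<p = ≤-trans (s≤s z≤n) (prime⇒2≤ pr)
        NoZero : Set
        NoZero = ∀ t → t < 2 ^ len T n → ¬ fun reduced n (t , e) ≡ 0
        goal : ℕ
        goal = prodTo (2 ^ len T n) (λ t → fun u n (t , e)) mod p
        divisible : ¬ NoZero → (∃[ t ] (t < 2 ^ len T n × fun reduced n (t , e) ≡ 0)) ⊎ (∀ t → t < 2 ^ len T n → ¬ fun reduced n (t , e) ≡ 0) → p ∣ prodTo (2 ^ len T n) (λ t → fun u n (t , e))
        divisible ¬h (inj₁ (t , t< , q)) = ∣-trans (mod≡0⇒∣ 0<p q) (prodTo-factor (2 ^ len T n) (λ t → fun u n (t , e)) t t<)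
        divisible ¬h (inj₂ h) = ⊥-elim (¬h h)
        module NonZeroFactors (h : NoZero) (g : ℕ) (g< : g < 2 ^ K n) (lg : Least n p pr p< g)
            (logs : ℕ → ℕ) (logs-ok : ∀ t → t < 2 ^ len T n → logs t < pred p × (g ^ logs t) mod p ≡ fun u n (t , e) mod p) where
          open PrimitiveRoots (p≡ n p pr p<) pr
          U : ℕ → ℕ
          U t = fun u n (t , e)
          toP : ∀ {l} → l < pred p → suc l < p
          toP lt = ≤-trans (s≤s lt) (≤-reflexive (sym (p≡ n p pr p<)))
          inner : ∀ t → t < 2 ^ len T n → sumTo (2 ^ K n) (λ l → fun isLog n (l , t , g , e) * l) ≡ logs t
          inner t t< = sumTo-select (2 ^ K n) {λ l → suc l < p × (g ^ l) mod p ≡ U t mod p} (λ l → l) (logs t) (<-trans (<-trans (n<1+n _) (toP (proj₁ (logs-ok t t<)))) p<)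
            (toP (proj₁ (logs-ok t t<)) , proj₂ (logs-ok t t<))
            (λ l l< q → exponent-unique (proj₁ lg) l (logs t) (s≤s⁻¹ (≤-trans (proj₁ q) (≤-reflexive (p≡ n p pr p<)))) (proj₁ (logs-ok t t<)) (trans (proj₂ q) (sym (proj₂ (logs-ok t t<)))))
            (λ l l< → ind-× (ind-le (suc (1 + l)) p)
               (ind-map (trans (sym (PowK.fun-powF n p l g (prime⇒2≤ pr) l< g<))) (trans (PowK.fun-powF n p l g (prime⇒2≤ pr) l< g<)) (ind-eq (fun PowK.powF n (p , l , g , tt)) (U t mod p))))
          S : ℕ
          S = sumTo (2 ^ len T n) logs
          exponent≡ : fun exponent n (g , e) ≡ S
          exponent≡ = sumTo-cong (2 ^ len T n) inner
          S< : S < 2 ^ (len T n + K n)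
          S< = ≤-<-trans (sumTo-≤ (2 ^ len T n) (pred (pred p)) (λ t t< → ≤-pred-lemma (proj₁ (logs-ok t t<))))
            (<-≤-trans (*-monoʳ-< (2 ^ len T n) {{m^n≢0 2 (len T n)}} (≤-<-trans (≤-trans (pred[n]≤n {pred p}) (pred[n]≤n {p})) p<)) (≤-reflexive (sym (^-distribˡ-+-* 2 (len T n) (K n)))))
            where
            ≤-pred-lemma : ∀ {a b} → a < b → a ≤ pred b
            ≤-pred-lemma {b = suc b} lt = s≤s⁻¹ lt
          powered : fun power′ n (g , e) ≡ prodTo (2 ^ len T n) U mod p
          powered = trans (sumTo-select (2 ^ (len T n + K n)) {λ z → z ≡ S} (λ z → fun PowE.powF n (p , z , g , tt)) S S< refl (λ _ _ q → q)
              (λ z _ → ind-map (λ q → trans q exponent≡) (λ q → trans q (sym exponent≡)) (ind-eq z (fun exponent n (g , e)))))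
            (trans (PowE.fun-powF n p S g (prime⇒2≤ pr) S< g<) (trans (cong (_mod p) (^-sumTo g (2 ^ len T n) logs))
              (prodTo-mod-cong p (2 ^ len T n) (λ t t< → proj₂ (logs-ok t t<)))))
        cases : Dec NoZero → fun rawF n e ≡ goal
        cases (no ¬h) = trans (cong (_* fun (Sg P (call (there v ∷ here ∷ []) leastF ⊠ power′)) n e) (ind-no (ind-∄ (2 ^ len T n) (λ t _ → ind-eq (fun reduced n (t , e)) 0)) ¬h))
              (sym (∣⇒mod≡0 0<p (divisible ¬h (search (λ t → fun reduced n (t , e) ≟ 0) (2 ^ len T n)))))
        cases (yes h) = trans (cong (_* fun (Sg P (call (there v ∷ here ∷ []) leastF ⊠ power′)) n e) (ind-yes (ind-∄ (2 ^ len T n) (λ t _ → ind-eq (fun reduced n (t , e)) 0)) h))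
              (trans (*-identityˡ _) (trans
                (sumTo-select (2 ^ K n) {λ z → z < 2 ^ K n × Least n p pr p< z} (λ z → fun power′ n (z , e)) g g< (g< , lg)
                  (λ z z< q → least-unique n p pr p< z< g< (proj₂ q) lg)
                  (λ z z< → ind-map (λ q → z< , q) proj₂ (ind-least n p pr p< z z<)))
                (NonZeroFactors.powered h g g< lg (proj₁ logs) (proj₂ logs))))
          where
          root : ∃[ g ] (g < 2 ^ K n × Least n p pr p< g)
          root = least-root n p pr p<
          g = proj₁ root
          g< = proj₁ (proj₂ root)
          lg = proj₂ (proj₂ root)
          logs : ∃[ f ] (∀ t → t < 2 ^ len T n → f t < pred p × (g ^ f t) mod p ≡ fun u n (t , e) mod p)
          logs = bounded-choice (2 ^ len T n) (λ t t< → PrimitiveRoots.logarithm (p≡ n p pr p<) pr (proj₁ lg) (fun u n (t , e) mod p) (n≢0⇒n>0 (h t t<)) (mod< (fun u n (t , e)) 0<p))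

    abstract
      product-fun : ℕ → Env Γ → ℕ
      product-fun = fun rawF
      productR : Realizer Γ product-fun
      productR = real rawF

    productF : Feasible Γ
    productF = feasible product-fun productR

    abstract
      fun-productF : ∀ n e → Prime (get v e) → get v e < 2 ^ K n → fun productF n e ≡ prodTo (2 ^ len T n) (λ t → fun u n (t , e)) mod get v e
      fun-productF = fun-rawF

-- Recovering the binary digits of N from its residues

prodTo-one : ∀ n {f : ℕ → ℕ} → (∀ z → z < n → f z ≡ 1) → prodTo n f ≡ 1
prodTo-one zero h = refl
prodTo-one (suc n) h = cong₂ _*_ (prodTo-one n (λ z lt → h z (m<n⇒m<1+n lt))) (h n ≤-refl)

prodTo-extract : ∀ n {f g : ℕ → ℕ} a → a < n → g a ≡ 1 → (∀ z → z < n → z ≢ a → g z ≡ f z) → prodTo n f ≡ f a * prodTo n g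
prodTo-extract (suc n) {f} {g} a lt ga h with a ≟ n
... | yes refl = trans (cong (_* f n) (prodTo-cong n (λ z l → sym (h z (m<n⇒m<1+n l) (<⇒≢ l)))))
      (trans (*-comm (prodTo n g) (f n)) (cong (f n *_) (sym (trans (cong (prodTo n g *_) ga) (*-identityʳ (prodTo n g))))))
... | no ne = trans (cong₂ _*_ (prodTo-extract n a (≤∧≢⇒< (s≤s⁻¹ lt) ne) ga (λ z l → h z (m<n⇒m<1+n l))) (sym (h n ≤-refl (ne ∘ sym))))
      (*-assoc (f a) (prodTo n g) (g n))

prodTo-single : ∀ n {f : ℕ → ℕ} a → a < n → (∀ z → z < n → z ≢ a → f z ≡ 1) → prodTo n f ≡ f a
prodTo-single n {f} a lt h = trans (prodTo-extract n {f} {λ _ → 1} a lt refl (λ z l ne → sym (h z l ne)))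
  (trans (cong (f a *_) (prodTo-one n (λ _ _ → refl))) (*-identityʳ (f a)))

prodTo-exchange : ∀ a b (f : ℕ → ℕ → ℕ) → prodTo a (λ y → prodTo b (f y)) ≡ prodTo b (λ z → prodTo a (λ y → f y z))
prodTo-exchange zero b f = sym (prodTo-one b (λ _ _ → refl))
prodTo-exchange (suc a) b f = trans (cong (_* prodTo b (f a)) (prodTo-exchange a b f)) (sym (prodTo-mul b _ (f a)))

prodTo-≥1 : ∀ n {f : ℕ → ℕ} → (∀ z → z < n → 1 ≤ f z) → 1 ≤ prodTo n f
prodTo-≥1 zero h = ≤-refl
prodTo-≥1 (suc n) h = *-mono-≤ (prodTo-≥1 n (λ z lt → h z (m<n⇒m<1+n lt))) (h n ≤-refl)

sumTo-∣ : ∀ n {f : ℕ → ℕ} a → (∀ z → z < n → a ∣ f z) → a ∣ sumTo n f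
sumTo-∣ zero a h = a ∣0
sumTo-∣ (suc n) a h = ∣m∣n⇒∣m+n (sumTo-∣ n a (λ z lt → h z (m<n⇒m<1+n lt))) (h n ≤-refl)

sumTo-split : ∀ n (f : ℕ → ℕ) a → a < n → ∃[ r ] (sumTo n f ≡ f a + r × (∀ b → (∀ z → z < n → z ≢ a → b ∣ f z) → b ∣ r))
sumTo-split (suc n) f a lt with a ≟ n
... | yes refl = sumTo n f , +-comm (sumTo n f) (f n) , λ b h → sumTo-∣ n b (λ z l → h z (m<n⇒m<1+n l) (<⇒≢ l))
... | no ne with sumTo-split n f a (≤∧≢⇒< (s≤s⁻¹ lt) ne)
...   | r , e , h = r + f n , trans (cong (_+ f n) e) (+-assoc (f a) r (f n)) ,
        λ b k → ∣m∣n⇒∣m+n (h b (λ z l → k z (m<n⇒m<1+n l))) (k n ≤-refl (ne ∘ sym))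

sumTo-*ˡ : ∀ n a (f : ℕ → ℕ) → a * sumTo n f ≡ sumTo n (λ z → a * f z)
sumTo-*ˡ zero a f = *-zeroʳ a
sumTo-*ˡ (suc n) a f = trans (*-distribˡ-+ a (sumTo n f) (f n)) (cong (_+ a * f n) (sumTo-*ˡ n a f))

-- For an indicator `b` this is `q` or 1: the factor of a product restricted to a set, written with
-- operations that formulas have.
fac : ℕ → ℕ → ℕ
fac b q = b * q + eq b 0

fac-yes : ∀ {P b} q → Ind P b → P → fac b q ≡ q
fac-yes q i p = trans (cong (λ b → fac b q) (ind-yes i p)) (trans (+-identityʳ _) (*-identityˡ q))

fac-no : ∀ {P b} q → Ind P b → ¬ P → fac b q ≡ 1
fac-no q i p = cong (λ b → fac b q) (ind-no i p)

binary : (ℕ → ℕ) → ℕ → ℕ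
binary d i = sumTo i (λ w → d w * 2 ^ w)

binary< : ∀ {d} → (∀ w → d w ≤ 1) → ∀ i → binary d i < 2 ^ i
binary< d≤1 zero = ≤-refl
binary< {d} d≤1 (suc i) = begin-strict
  binary d i + d i * 2 ^ i    <⟨ +-mono-<-≤ (binary< d≤1 i) (*-monoˡ-≤ (2 ^ i) (d≤1 i)) ⟩
  2 ^ i + 1 * 2 ^ i           ≡⟨ refl ⟩
  2 * 2 ^ i                   ∎
  where open ≤-Reasoning

binary-tail : ∀ d i k → ∃[ t ] binary d (i + k) ≡ binary d i + t * 2 ^ i
binary-tail d i zero = 0 , trans (cong (binary d) (+-identityʳ i)) (sym (+-identityʳ _))
binary-tail d i (suc k) with binary-tail d i k
... | t , e = t + d (i + k) * 2 ^ k , trans (cong (binary d) (+-suc i k)) (trans (cong₂ _+_ e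
        (cong (d (i + k) *_) (^-distribˡ-+-* 2 i k))) (l (binary d i) t (2 ^ i) (d (i + k)) (2 ^ k)))
  where
  l : ∀ b t p e q → b + t * p + e * (p * q) ≡ b + (t + e * q) * p
  l = NS.solve-∀

mod-eq⇒ : ∀ {m a b} → 0 < m → a mod m ≡ b mod m → ∃[ j ] ∃[ k ] a + j * m ≡ b + k * m
mod-eq⇒ {m} {a} {b} 0<m e = b div m , a div m , (begin
  a + b div m * m                       ≡⟨ cong (_+ b div m * m) (div-mod a 0<m) ⟩
  a mod m + a div m * m + b div m * m   ≡⟨ cong (λ r → r + a div m * m + b div m * m) e ⟩
  b mod m + a div m * m + b div m * m   ≡⟨ l (b mod m) (a div m * m) (b div m * m) ⟩
  b mod m + b div m * m + a div m * m   ≡⟨ cong (_+ a div m * m) (sym (div-mod b 0<m)) ⟩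
  b + a div m * m                       ∎)
  where
  open ≡-Reasoning
  l : ∀ r s t → r + s + t ≡ r + t + s
  l = NS.solve-∀

⇒mod-eq : ∀ {m a b} j k → a + j * m ≡ b + k * m → a mod m ≡ b mod m
⇒mod-eq {m} {a} {b} j k e = trans (sym (mod-kn m a j)) (trans (cong (_mod m) e) (mod-kn m b k))

private
  unit-∣ : ∀ {q m} → Prime q → ¬ q ∣ m → Coprime q m
  unit-∣ {q} {m} pr h = transport (λ a → Coprime a m) (*-identityʳ q) (coprime-primepower pr h 1)

prime-∣-prime : ∀ {p q} → Prime p → Prime q → p ∣ q → p ≡ q
prime-∣-prime pp pq d with prime⇒irreducible pq d
... | inj₁ refl = ⊥-elim (<⇒≱ (prime⇒2≤ pp) ≤-refl)
... | inj₂ e = e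

prime∤* : ∀ {p a b} → Prime p → ¬ p ∣ a → ¬ p ∣ b → ¬ p ∣ a * b
prime∤* {p} {a} {b} pr h k d with euclidsLemma a b pr d
... | inj₁ d′ = h d′
... | inj₂ d′ = k d′

-- The odd primes below X are grouped by rank into blocks of n₀; block l has the product block l ≥ 2 ^ n₀, an odd
-- number, so that (block l − 1) / (2 · block l) approximates 1/2 and the product A / M of these H fractions
-- approximates 2 ^ −H.  As M is a product of distinct small primes, the fractional part of 2 ^ (H − i) N A / M,
-- which is close to that of N / 2 ^ i, can be computed from residues.

module Blocks (H n₀ X : ℕ) (0<n₀ : 0 < n₀) (enough : H * n₀ ≤ countOdd X) (big : 2 ^ H * 128 * H ≤ 2 ^ n₀) where

  InBlock : ℕ → ℕ → Set
  InBlock l q = OddPrime q × countOdd q div n₀ ≡ l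

  Used : ℕ → Set
  Used q = OddPrime q × countOdd q div n₀ < H

  inBlock? : ∀ l q → Dec (InBlock l q)
  inBlock? l q = oddPrime? q ×-dec (countOdd q div n₀ ≟ l)

  used? : ∀ q → Dec (Used q)
  used? q = oddPrime? q ×-dec (countOdd q div n₀ <? H)

  blockTo : ℕ → ℕ → ℕ
  blockTo l z = prodTo z (λ q → fac (ι? (inBlock? l q)) q)

  block : ℕ → ℕ
  block l = blockTo l X

  M B : ℕ
  M = prodTo H block
  B = prodTo H (λ l → block l ∸ 1)

  -- For a used prime this is M / p. As a product over all numbers below X it can be computed modulo
  -- p by `IteratedProduct`.
  cofactor : ℕ → ℕ
  cofactor p = prodTo X (λ q → fac (ι? (used? q) * eq (eq q p) 0) q)

  fac-block≥1 : ∀ l q → 1 ≤ fac (ι? (inBlock? l q)) q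
  fac-block≥1 l q with inBlock? l q
  ... | yes ((pr , _) , _) = ≤-trans (≤-trans (s≤s z≤n) (prime⇒2≤ pr)) (≤-reflexive (sym (trans (+-identityʳ _) (*-identityˡ q))))
  ... | no _ = ≤-refl

  -- The odd primes of rank l n₀, ..., l n₀ + j - 1 lie below z and in block l, and each contributes
  -- a factor of at least 2.
  block≥ : ∀ l z j → j ≤ n₀ → l * n₀ + j ≤ countOdd z → 2 ^ j ≤ blockTo l z
  block≥ l z zero _ _ = prodTo-≥1 z (λ q _ → fac-block≥1 l q)
  block≥ l zero (suc j) _ h = ⊥-elim (<⇒≱ (≤-trans (s≤s z≤n) (m≤n+m (suc j) (l * n₀))) h)
  block≥ l (suc z) (suc j) j≤ h with l * n₀ + suc j ≤? countOdd z
  ... | yes q = ≤-trans (block≥ l z (suc j) j≤ q) (≤-trans (≤-reflexive (sym (*-identityʳ (blockTo l z)))) (*-monoʳ-≤ (blockTo l z) (fac-block≥1 l z)))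
  ... | no ¬q = ≤-trans (≤-reflexive (*-comm 2 (2 ^ j))) (*-mono-≤ (block≥ l z j (<⇒≤ j≤) (≤-reflexive (sym rank))) here≥2)
    where
    step : ∀ (dq : Dec (OddPrime z)) → l * n₀ + suc j ≤ countOdd z + ι? dq → OddPrime z × countOdd z ≡ l * n₀ + j
    step (yes o) le′ = o , ≤-antisym (s≤s⁻¹ (≤-trans (≰⇒> ¬q) (≤-reflexive (+-suc (l * n₀) j))))
                             (s≤s⁻¹ (≤-trans (≤-reflexive (sym (+-suc (l * n₀) j))) (≤-trans le′ (≤-reflexive (+-comm (countOdd z) 1)))))
    step (no _) le′ = ⊥-elim (¬q (≤-trans le′ (≤-reflexive (+-identityʳ _))))
    odd′ = proj₁ (step (oddPrime? z) h)
    rank : countOdd z ≡ l * n₀ + j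
    rank = proj₂ (step (oddPrime? z) h)
    inside : InBlock l z
    inside = odd′ , div-unique {n₀} {j} l j≤ (trans rank (+-comm (l * n₀) j))
    here≥2 : 2 ≤ fac (ι? (inBlock? l z)) z
    here≥2 = ≤-trans (prime⇒2≤ (proj₁ odd′)) (≤-reflexive (sym (fac-yes z (ind-ι? (inBlock? l z)) inside)))

  block-large : ∀ l → l < H → 2 ^ n₀ ≤ block l
  block-large l l<H = block≥ l X n₀ ≤-refl (≤-trans (≤-reflexive (+-comm (l * n₀) n₀)) (≤-trans (*-monoˡ-≤ n₀ l<H) enough))

  block≥1 : ∀ l → 1 ≤ block l
  block≥1 l = prodTo-≥1 X (λ q _ → fac-block≥1 l q)

  M≡ : M ≡ prodTo X (λ q → fac (ι? (used? q)) q)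
  M≡ = trans (prodTo-exchange H X (λ l q → fac (ι? (inBlock? l q)) q)) (prodTo-cong X (λ q _ → collapse q (used? q)))
    where
    collapse : ∀ q (dq : Dec (Used q)) → prodTo H (λ l → fac (ι? (inBlock? l q)) q) ≡ fac (ι? dq) q
    collapse q (yes (o , lt)) = trans (prodTo-single H (countOdd q div n₀) lt (λ l _ ne → fac-no q (ind-ι? (inBlock? l q)) (λ r → ne (sym (proj₂ r)))))
      (trans (fac-yes q (ind-ι? (inBlock? (countOdd q div n₀) q)) (o , refl)) (sym (trans (+-identityʳ _) (*-identityˡ q))))
    collapse q (no ¬u) = prodTo-one H (λ l l< → fac-no q (ind-ι? (inBlock? l q)) (λ { (o , e) → ¬u (o , ≤-<-trans (≤-reflexive e) l<) }))

  M≥1 : 1 ≤ M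
  M≥1 = prodTo-≥1 H (λ l _ → block≥1 l)

  ind-other : ∀ p q → Ind (Used q × ¬ q ≡ p) (ι? (used? q) * eq (eq q p) 0)
  ind-other p q = ind-× (ind-ι? (used? q)) (ind-¬ (ind-eq q p))

  M≡p*cofactor : ∀ p → p < X → Used p → M ≡ p * cofactor p
  M≡p*cofactor p p<X u = trans M≡ (trans (prodTo-extract X {λ q → fac (ι? (used? q)) q} {λ q → fac (ι? (used? q) * eq (eq q p) 0) q} p p<X
      (fac-no p (ind-other p p) (λ r → proj₂ r refl))
      (λ q _ ne → cong (λ b → fac b q) (ind-unique (ind-map proj₁ (λ r → r , ne) (ind-other p q)) (ind-ι? (used? q)))))
    (cong (_* cofactor p) (fac-yes p (ind-ι? (used? p)) u)))

  ∣cofactor : ∀ p q → q < X → Used q → q ≢ p → q ∣ cofactor p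
  ∣cofactor p q q<X u ne = ∣-trans (transport (q ∣_) (sym (fac-yes q (ind-other p q) (u , ne))) ∣-refl)
    (prodTo-factor X (λ q → fac (ι? (used? q) * eq (eq q p) 0) q) q q<X)

  prime∤prod : ∀ {p} → Prime p → ∀ z → z ≤ p → ¬ p ∣ prodTo z (λ q → fac (ι? (used? q)) q)
  prime∤prod pr zero _ d = <⇒≱ (prime⇒2≤ pr) (∣⇒≤ d)
  prime∤prod {p} pr (suc z) z<p = prime∤* pr (prime∤prod pr z (<⇒≤ z<p)) (factor (used? z))
    where
    factor : (dz : Dec (Used z)) → ¬ p ∣ fac (ι? dz) z
    factor (yes ((pz , _) , _)) e = <⇒≢ z<p (sym (prime-∣-prime pr pz (transport (p ∣_) (trans (+-identityʳ _) (*-identityˡ z)) e)))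
    factor (no _) e = <⇒≱ (prime⇒2≤ pr) (∣⇒≤ e)

  prime∤cofactor : ∀ p → Prime p → ¬ p ∣ cofactor p
  prime∤cofactor p pr = go X
    where
    factor : ∀ z → Dec (Used z × ¬ z ≡ p) → ¬ p ∣ fac (ι? (used? z) * eq (eq z p) 0) z
    factor z (yes r) h = proj₂ r (sym (prime-∣-prime pr (proj₁ (proj₁ (proj₁ r))) (transport (p ∣_) (fac-yes z (ind-other p z) r) h)))
    factor z (no ¬r) h = <⇒≱ (prime⇒2≤ pr) (∣⇒≤ (transport (p ∣_) (fac-no z (ind-other p z) ¬r) h))
    go : ∀ z → ¬ p ∣ prodTo z (λ q → fac (ι? (used? q) * eq (eq q p) 0) q)
    go zero h = <⇒≱ (prime⇒2≤ pr) (∣⇒≤ h)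
    go (suc z) = prime∤* pr (go z) (factor z (ind-dec (ind-other p z)))

  M-∣ : ∀ a → (∀ q → q < X → Used q → q ∣ a) → M ∣ a
  M-∣ a h = transport (_∣ a) (sym M≡) (go X ≤-refl)
    where
    go : ∀ z → z ≤ X → prodTo z (λ q → fac (ι? (used? q)) q) ∣ a
    go zero _ = 1∣ a
    go (suc z) z< = last (used? z)
      where
      last : (dz : Dec (Used z)) → prodTo z (λ q → fac (ι? (used? q)) q) * fac (ι? dz) z ∣ a
      last (yes u) = transport (_∣ a) (cong (prodTo z (λ q → fac (ι? (used? q)) q) *_) (sym (trans (+-identityʳ _) (*-identityˡ z))))
        (coprime-∣ (coprime-swap (unit-∣ (proj₁ (proj₁ u)) (prime∤prod (proj₁ (proj₁ u)) z ≤-refl))) (go z (<⇒≤ z<)) (h z z< u))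
      last (no _) = transport (_∣ a) (sym (*-identityʳ _)) (go z (<⇒≤ z<))

  M-mod : ∀ a b → (∀ q → q < X → Used q → a mod q ≡ b mod q) → a mod M ≡ b mod M
  M-mod a b h with ≤-total a b
  ... | inj₁ a≤b = sym (trans (cong (_mod M) (sym (m+[n∸m]≡n a≤b))) (mod-add-∣ a (M-∣ (b ∸ a) (λ q q< u → mod-diff a (b ∸ a) (≤-trans (s≤s z≤n) (prime⇒2≤ (proj₁ (proj₁ u))))
                     (trans (cong (_mod q) (m+[n∸m]≡n a≤b)) (sym (h q q< u)))))))
  ... | inj₂ b≤a = trans (cong (_mod M) (sym (m+[n∸m]≡n b≤a))) (mod-add-∣ b (M-∣ (a ∸ b) (λ q q< u → mod-diff b (a ∸ b) (≤-trans (s≤s z≤n) (prime⇒2≤ (proj₁ (proj₁ u))))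
                     (trans (cong (_mod q) (m+[n∸m]≡n b≤a)) (h q q< u)))))

  odd-block : ∀ l → ∃[ t ] block l ≡ 1 + 2 * t
  odd-block l = go X
    where
    odd-factor : ∀ q → ∃[ t ] fac (ι? (inBlock? l q)) q ≡ 1 + 2 * t
    odd-factor q with inBlock? l q
    ... | no _ = 0 , refl
    ... | yes ((pr , ne) , _) = half q , trans (trans (+-identityʳ _) (*-identityˡ q)) (trans (sym (odd-half q)) (cong (λ b → bit b + 2 * half q) (odd≡ (odd q) refl)))
      where
      odd≡ : ∀ b → odd q ≡ b → odd q ≡ true
      odd≡ true e = e
      odd≡ false e = ⊥-elim (ne (sym (prime-∣-prime prime[2] pr (divides (half q) (trans (sym (odd-half q)) (trans (cong (λ b → bit b + 2 * half q) e) (*-comm 2 (half q))))))))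
    go : ∀ z → ∃[ t ] prodTo z (λ q → fac (ι? (inBlock? l q)) q) ≡ 1 + 2 * t
    go zero = 0 , refl
    go (suc z) = multiply (go z) (odd-factor z)
      where
      multiply : ∀ {a b} → ∃[ t ] a ≡ 1 + 2 * t → ∃[ t ] b ≡ 1 + 2 * t → ∃[ t ] a * b ≡ 1 + 2 * t
      multiply (s , refl) (t , refl) = s + t + 2 * (s * t) , l′ s t
        where
        l′ : ∀ s t → (1 + 2 * s) * (1 + 2 * t) ≡ 1 + 2 * (s + t + 2 * (s * t))
        l′ = NS.solve-∀

  A : ℕ
  A = prodTo H (λ l → proj₁ (odd-block l))

  B≡ : B ≡ 2 ^ H * A
  B≡ = trans (prodTo-cong H (λ l _ → cong (_∸ 1) (proj₂ (odd-block l)))) (go H)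
    where
    go : ∀ h → prodTo h (λ l → 2 * proj₁ (odd-block l)) ≡ 2 ^ h * prodTo h (λ l → proj₁ (odd-block l))
    go zero = refl
    go (suc h) = trans (cong (_* (2 * proj₁ (odd-block h))) (go h)) (l′ (2 ^ h) _ _)
      where
      l′ : ∀ a b c → a * b * (2 * c) ≡ 2 * a * (b * c)
      l′ = NS.solve-∀

  B≤M : B ≤ M
  B≤M = go H
    where
    go : ∀ h → prodTo h (λ l → block l ∸ 1) ≤ prodTo h block
    go zero = ≤-refl
    go (suc h) = *-mono-≤ (go h) (m∸n≤m (block h) 1)

  -- Cleared of denominators this is 1 - B / M ≤ H / 2 ^ n₀: each of the H factors 1 - 1 / block l
  -- falls short of 1 by at most 1 / 2 ^ n₀.
  gap : 2 ^ n₀ * M ≤ 2 ^ n₀ * B + H * M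
  gap = go H ≤-refl
    where
    go : ∀ h → h ≤ H → 2 ^ n₀ * prodTo h block ≤ 2 ^ n₀ * prodTo h (λ l → block l ∸ 1) + h * prodTo h block
    go zero _ = m≤m+n _ _
    go (suc h) h< = begin
      c * (m * b)                         ≡⟨ cong (λ z → c * (m * z)) b≡ ⟩
      c * (m * suc b′)                    ≡⟨ l₁ c m b′ ⟩
      (c * m) * b′ + c * m                ≤⟨ +-mono-≤ (*-monoˡ-≤ b′ (go h (<⇒≤ h<))) (*-monoˡ-≤ m (block-large h h<)) ⟩
      (c * B′ + h * m) * b′ + b * m       ≤⟨ +-monoˡ-≤ (b * m) (≤-trans (≤-reflexive (*-distribʳ-+ b′ (c * B′) (h * m))) (+-monoʳ-≤ (c * B′ * b′) (*-monoʳ-≤ (h * m) (≤-trans (n≤1+n b′) (≤-reflexive (sym b≡)))))) ⟩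
      c * B′ * b′ + h * m * b + b * m     ≡⟨ l₂ c B′ b′ h m b ⟩
      c * (B′ * b′) + suc h * (m * b)     ∎
      where
      open ≤-Reasoning
      c m b b′ B′ : ℕ
      c = 2 ^ n₀
      m = prodTo h block
      b = block h
      b′ = block h ∸ 1
      B′ = prodTo h (λ l → block l ∸ 1)
      b≡ : b ≡ suc b′
      b≡ = sym (m+[n∸m]≡n (block≥1 h))
      l₁ : ∀ c m b → c * (m * suc b) ≡ (c * m) * b + c * m
      l₁ = NS.solve-∀
      l₂ : ∀ c B′ b′ h m b → c * B′ * b′ + h * m * b + b * m ≡ c * (B′ * b′) + suc h * (m * b)
      l₂ = NS.solve-∀

  -- At most X roundings, each by less than one unit, make up at most 1 / 128 of W = 128 X. The
  -- error of B / M, scaled by N < 2 ^ H, makes up at most another 1 / 128. Together they stay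
  -- within U = W / 64.
  U W : ℕ
  U = 2 * X
  W = 64 * U

  -- Since a used p is odd, 2 ^ i can be divided out modulo p. The `c p` are then Chinese remainder
  -- coefficients: N B / (2 ^ i M) equals the sum of c p / p over the used p, up to an integer. `S`
  -- is W times this sum, rounded down term by term.
  module Digit (0<X : 0 < X) (0<H : 0 < H) (N : ℕ) (N< : N < 2 ^ H) (i : ℕ) (i≤H : i ≤ H) (c : ℕ → ℕ)
      (c-ok : ∀ p → p < X → Used p → (c p * 2 ^ i * cofactor p) mod p ≡ (N * B) mod p) where

    S : ℕ
    S = sumTo X (λ p → ι? (used? p) * ((W * c p) div p))

    private
      Q R : ℕ
      Q = sumTo X (λ p → ι? (used? p) * (c p * cofactor p))
      R = sumTo X (λ p → ι? (used? p) * (((W * c p) mod p) * cofactor p))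

      target : ℕ
      target = 2 ^ (H ∸ i) * (N * A)

      pows : 2 ^ (H ∸ i) * 2 ^ i ≡ 2 ^ H
      pows = trans (sym (^-distribˡ-+-* 2 (H ∸ i) i)) (cong (2 ^_) (m∸n+n≡m i≤H))

      residues : ∀ p → p < X → Used p → Q mod p ≡ target mod p
      residues p p<X u = trans Q≡ (mod-cancel pr (2 ^ H) (c p * cofactor p) target odd2 (begin
          (2 ^ H * (c p * cofactor p)) mod p              ≡⟨ cong (λ z → (z * (c p * cofactor p)) mod p) (sym pows) ⟩
          (2 ^ (H ∸ i) * 2 ^ i * (c p * cofactor p)) mod p ≡⟨ cong (_mod p) (l₁ (2 ^ (H ∸ i)) (2 ^ i) (c p) (cofactor p)) ⟩
          (2 ^ (H ∸ i) * (c p * 2 ^ i * cofactor p)) mod p ≡⟨ mod-*-cong p {2 ^ (H ∸ i)} {2 ^ (H ∸ i)} refl (c-ok p p<X u) ⟩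
          (2 ^ (H ∸ i) * (N * B)) mod p                    ≡⟨ cong (λ z → (2 ^ (H ∸ i) * (N * z)) mod p) B≡ ⟩
          (2 ^ (H ∸ i) * (N * (2 ^ H * A))) mod p          ≡⟨ cong (_mod p) (l₂ (2 ^ (H ∸ i)) N (2 ^ H) A) ⟩
          (2 ^ H * target) mod p ∎))
        where
        open ≡-Reasoning
        pr : Prime p
        pr = proj₁ (proj₁ u)
        odd2 : ¬ p ∣ 2 ^ H
        odd2 = prime∤^ pr H (λ d → proj₂ (proj₁ u) (prime-∣-prime pr prime[2] d))
        l₁ : ∀ a b c d → a * b * (c * d) ≡ a * (c * b * d)
        l₁ = NS.solve-∀
        l₂ : ∀ a b c d → a * (b * (c * d)) ≡ c * (a * (b * d))
        l₂ = NS.solve-∀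
        split : ∃[ r ] (Q ≡ ι? (used? p) * (c p * cofactor p) + r × (∀ b → (∀ z → z < X → z ≢ p → b ∣ ι? (used? z) * (c z * cofactor z)) → b ∣ r))
        split = sumTo-split X (λ p → ι? (used? p) * (c p * cofactor p)) p p<X
        Q≡ : Q mod p ≡ (c p * cofactor p) mod p
        Q≡ = trans (cong (_mod p) (proj₁ (proj₂ split))) (trans (mod-add-∣ _ (proj₂ (proj₂ split) p
               (λ z z< ne → ∣n⇒∣m*n (ι? (used? z)) (∣n⇒∣m*n (c z) (∣cofactor z p p<X u (ne ∘ sym))))))
             (cong (_mod p) (trans (cong (_* (c p * cofactor p)) (ind-yes (ind-ι? (used? p)) u)) (*-identityˡ _))))

      congruence : ∃[ j ] ∃[ k ] Q + j * M ≡ target + k * M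
      congruence = mod-eq⇒ M≥1 (M-mod Q target residues)

      SM+R : W * Q ≡ S * M + R
      SM+R = trans (sumTo-*ˡ X W _) (trans (sumTo-cong X (λ p p< → term p p< (used? p)))
        (trans (sumTo-add X _ _) (cong (_+ R) (sym (sumTo-*ʳ X (λ p → ι? (used? p) * ((W * c p) div p)) M)))))
        where
        term : ∀ p → p < X → (dp : Dec (Used p)) → W * (ι? dp * (c p * cofactor p)) ≡ ι? dp * ((W * c p) div p) * M + ι? dp * (((W * c p) mod p) * cofactor p)
        term p p< (no _) = *-zeroʳ W
        term p p< (yes u) = trans (l₁ W (c p) (cofactor p)) (trans (cong (_* cofactor p) (div-mod (W * c p) {p} (≤-trans (s≤s z≤n) (prime⇒2≤ (proj₁ (proj₁ u))))))
          (trans (l₂ ((W * c p) mod p) ((W * c p) div p) p (cofactor p)) (cong (λ z → 1 * ((W * c p) div p) * z + 1 * (((W * c p) mod p) * cofactor p)) (sym (M≡p*cofactor p p< u)))))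
          where
          l₁ : ∀ w c f → w * (1 * (c * f)) ≡ w * c * f
          l₁ = NS.solve-∀
          l₂ : ∀ r q p f → (r + q * p) * f ≡ 1 * q * (p * f) + 1 * (r * f)
          l₂ = NS.solve-∀

      R≤ : R ≤ X * M
      R≤ = sumTo-≤ X M (λ p p< → term p p< (used? p))
        where
        term : ∀ p → p < X → (dp : Dec (Used p)) → ι? dp * (((W * c p) mod p) * cofactor p) ≤ M
        term p p< (no _) = z≤n
        term p p< (yes u) = ≤-trans (≤-reflexive (+-identityʳ _)) (≤-trans (*-monoˡ-≤ (cofactor p) (<⇒≤ (mod< (W * c p) {p} (≤-trans (s≤s z≤n) (prime⇒2≤ (proj₁ (proj₁ u)))))))
          (≤-reflexive (sym (M≡p*cofactor p p< u))))

      D : ℕ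
      D = M ∸ B

      M≡B+D : B + D ≡ M
      M≡B+D = m+[n∸m]≡n B≤M

      D-small : 2 ^ H * 128 * D ≤ M
      D-small = *-cancelˡ-≤ H {{>-nonZero 0<H}} (begin
        H * (2 ^ H * 128 * D)    ≡⟨ l₁ H (2 ^ H) D ⟩
        2 ^ H * 128 * H * D      ≤⟨ *-monoˡ-≤ D big ⟩
        2 ^ n₀ * D               ≤⟨ +-cancelˡ-≤ (2 ^ n₀ * B) _ _ (≤-trans (≤-reflexive (trans (sym (*-distribˡ-+ (2 ^ n₀) B D)) (cong (2 ^ n₀ *_) M≡B+D))) gap) ⟩
        H * M                    ∎)
        where
        open ≤-Reasoning
        l₁ : ∀ h p d → h * (p * 128 * d) ≡ p * 128 * h * d
        l₁ = NS.solve-∀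

      -- The two errors, scaled by 2 ^ i M: `R` stems from rounding the quotients, `D` from the
      -- difference between B and M.
      excess′ : ℕ
      excess′ = 2 ^ i * R + W * N * D

      balance : ∃[ j ] ∃[ k ] (2 ^ i * S + j * (W * 2 ^ i)) * M + excess′ ≡ (W * N + k * (W * 2 ^ i)) * M
      balance = finish congruence
        where
        finish : ∃[ j ] ∃[ k ] Q + j * M ≡ target + k * M → ∃[ j ] ∃[ k ] (2 ^ i * S + j * (W * 2 ^ i)) * M + excess′ ≡ (W * N + k * (W * 2 ^ i)) * M
        finish (j , k , e) = j , k , (begin
          (P₂ * S + j * (W * P₂)) * M + (P₂ * R + W * N * D)   ≡⟨ l₁ P₂ S j W M R N D ⟩
          P₂ * (S * M + R) + P₂ * W * (j * M) + W * N * D      ≡⟨ cong (λ z → P₂ * z + P₂ * W * (j * M) + W * N * D) (sym SM+R) ⟩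
          P₂ * (W * Q) + P₂ * W * (j * M) + W * N * D          ≡⟨ l₂ P₂ W Q (j * M) (W * N * D) ⟩
          P₂ * W * (Q + j * M) + W * N * D                     ≡⟨ cong (λ z → P₂ * W * z + W * N * D) e ⟩
          P₂ * W * (P₁ * (N * A) + k * M) + W * N * D          ≡⟨ l₃ P₂ W P₁ N A k M D ⟩
          W * N * ((P₁ * P₂) * A + D) + k * (W * P₂) * M       ≡⟨ cong (λ z → W * N * (z * A + D) + k * (W * P₂) * M) pows ⟩
          W * N * (2 ^ H * A + D) + k * (W * P₂) * M           ≡⟨ cong (λ z → W * N * z + k * (W * P₂) * M) (trans (cong (_+ D) (sym B≡)) M≡B+D) ⟩
          W * N * M + k * (W * P₂) * M                         ≡⟨ sym (*-distribʳ-+ M (W * N) (k * (W * P₂))) ⟩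
          (W * N + k * (W * P₂)) * M                           ∎)
          where
          open ≡-Reasoning
          P₁ P₂ : ℕ
          P₁ = 2 ^ (H ∸ i)
          P₂ = 2 ^ i
          l₁ : ∀ p s j w m r n d → (p * s + j * (w * p)) * m + (p * r + w * n * d) ≡ p * (s * m + r) + p * w * (j * m) + w * n * d
          l₁ = NS.solve-∀
          l₂ : ∀ p w q z y → p * (w * q) + p * w * z + y ≡ p * w * (q + z) + y
          l₂ = NS.solve-∀
          l₃ : ∀ p w o n a k m d → p * w * (o * (n * a) + k * m) + w * n * d ≡ w * n * ((o * p) * a + d) + k * (w * p) * m
          l₃ = NS.solve-∀

      excess-small : 64 * excess′ ≤ W * 2 ^ i * M
      excess-small = *-cancelˡ-≤ 2 (begin
        2 * (64 * (P₂ * R + W * N * D))             ≡⟨ l₁ P₂ R W N D ⟩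
        P₂ * (128 * R) + W * (N * 128 * D)           ≤⟨ +-mono-≤ (*-monoʳ-≤ P₂ (*-monoʳ-≤ 128 R≤)) (*-monoʳ-≤ W (≤-trans (*-monoˡ-≤ D (*-monoˡ-≤ 128 (<⇒≤ N<))) D-small)) ⟩
        P₂ * (128 * (X * M)) + W * M                 ≤⟨ +-monoʳ-≤ _ (≤-trans (≤-reflexive (sym (*-identityˡ (W * M)))) (*-monoˡ-≤ (W * M) (m^n>0 2 i))) ⟩
        P₂ * (128 * (X * M)) + P₂ * (W * M)          ≡⟨ l₂ P₂ X M ⟩
        2 * (W * P₂ * M)                             ∎)
        where
        open ≤-Reasoning
        P₂ : ℕ
        P₂ = 2 ^ i
        l₁ : ∀ p r w n d → 2 * (64 * (p * r + w * n * d)) ≡ p * (128 * r) + w * (n * 128 * d)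
        l₁ = NS.solve-∀
        l₂ : ∀ p y m → p * (128 * (y * m)) + p * (64 * (2 * y) * m) ≡ 2 * (64 * (2 * y) * p * m)
        l₂ = NS.solve-∀

    -- This is `balance` divided by M. Multiples of the period W 2 ^ i are kept on both sides, so
    -- that the congruence can be stated in ℕ.
    approximation : ∃[ δ ] ∃[ j ] ∃[ k ] (δ ≤ U * 2 ^ i × 2 ^ i * S + δ + j * (W * 2 ^ i) ≡ W * N + k * (W * 2 ^ i))
    approximation = finish balance
      where
      finish : ∃[ j ] ∃[ k ] (2 ^ i * S + j * (W * 2 ^ i)) * M + excess′ ≡ (W * N + k * (W * 2 ^ i)) * M →
               ∃[ δ ] ∃[ j ] ∃[ k ] (δ ≤ U * 2 ^ i × 2 ^ i * S + δ + j * (W * 2 ^ i) ≡ W * N + k * (W * 2 ^ i))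
      finish (j , k , e) = b ∸ a , j , k , δ≤ , trans (l (2 ^ i * S) (b ∸ a) (j * (W * 2 ^ i))) (m+[n∸m]≡n a≤b)
        where
        a b : ℕ
        a = 2 ^ i * S + j * (W * 2 ^ i)
        b = W * N + k * (W * 2 ^ i)
        instance
          M≢0 : NonZero M
          M≢0 = >-nonZero M≥1
        a≤b : a ≤ b
        a≤b = *-cancelʳ-≤ a b M (≤-trans (m≤m+n (a * M) excess′) (≤-reflexive e))
        δM : (b ∸ a) * M ≡ excess′
        δM = trans (*-distribʳ-∸ M b a) (trans (cong (_∸ a * M) (sym e)) (m+n∸m≡n (a * M) excess′))
        δ≤ : b ∸ a ≤ U * 2 ^ i
        δ≤ = *-cancelˡ-≤ 64 (*-cancelʳ-≤ (64 * (b ∸ a)) (64 * (U * 2 ^ i)) M (begin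
          64 * (b ∸ a) * M        ≡⟨ trans (*-assoc 64 (b ∸ a) M) (cong (64 *_) δM) ⟩
          64 * excess′            ≤⟨ excess-small ⟩
          W * 2 ^ i * M           ≡⟨ cong (_* M) (*-assoc 64 U (2 ^ i)) ⟩
          64 * (U * 2 ^ i) * M    ∎))
          where open ≤-Reasoning
        l : ∀ s d j → s + d + j ≡ s + j + d
        l = NS.solve-∀

wrap : ∀ {a Y m} j k → Y < m → a < m + m → a + j * m ≡ Y + k * m → (a ≡ Y) ⊎ (a ≡ Y + m)
wrap {a} {Y} {m} j k Y< a< e with a <? m
... | yes lt = inj₁ (trans (sym (mod-small lt)) (trans (⇒mod-eq {m} {a} {Y} j k e) (mod-small Y<)))
... | no ge = inj₂ (trans (sym (m∸n+n≡m (≮⇒≥ ge))) (cong (_+ m) (trans (sym (mod-small lt′))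
        (trans (sym (trans (cong (_mod m) (trans (sym (m∸n+n≡m (≮⇒≥ ge))) (cong (a ∸ m +_) (sym (*-identityˡ m))))) (mod-kn m (a ∸ m) 1)))
          (trans (⇒mod-eq {m} {a} {Y} j k e) (mod-small Y<))))))
  where
  lt′ : a ∸ m < m
  lt′ = +-cancelʳ-< m (a ∸ m) m (≤-<-trans (≤-reflexive (m∸n+n≡m (≮⇒≥ ge))) a<)

-- An opaque copy of multiplication: numerals as multipliers would otherwise be unfolded.
infixl 7 _·_

abstract
  _·_ : ℕ → ℕ → ℕ
  a · y = a * y

  ·-def : ∀ a y → a · y ≡ a * y
  ·-def a y = refl

  ·-mono : ∀ {a b} y → a ≤ b → a · y ≤ b · y
  ·-mono y p = *-monoˡ-≤ y p

  ·-mono-< : ∀ {a b} y → 0 < y → a < b → a · y < b · y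
  ·-mono-< y 0<y p = *-monoˡ-< y {{>-nonZero 0<y}} p

  ·-suc : ∀ a y → suc a · y ≡ a · y + y
  ·-suc a y = +-comm y (a * y)

  ·-+ : ∀ a b y → (a + b) · y ≡ a · y + b · y
  ·-+ a b y = *-distribʳ-+ y a b

  ·-scale : ∀ a u p → a · (u * p) ≡ p * (a · u)
  ·-scale = l
    where
    l : ∀ a u p → a * (u * p) ≡ p * (a * u)
    l = NS.solve-∀

  ·-double : ∀ a u p → a · (u * (2 * p)) ≡ (a + a) · (u * p)
  ·-double = l
    where
    l : ∀ a u p → a * (u * (2 * p)) ≡ (a + a) * (u * p)
    l = NS.solve-∀

  ·-positive : ∀ a {y} → 0 < y → 0 < suc a · y
  ·-positive a {y} p = ≤-trans p (m≤m+n y (a * y))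

clash : ∀ {Y g} a k → (a + k) · g ≤ Y → ¬ Y < a · g
clash {Y} {g} a k p q = <⇒≱ q (≤-trans (·-mono g (m≤m+n a k)) p)

weaken : ∀ {Y g} a k → (a + k) · g ≤ Y → a · g ≤ Y
weaken {Y} {g} a k p = ≤-trans (·-mono g (m≤m+n a k)) p

plus-unit : ∀ {z δ g} a → z ≤ a · g → δ ≤ g → z + δ ≤ suc a · g
plus-unit {z} {δ} {g} a p q = ≤-trans (+-mono-≤ p q) (≤-reflexive (sym (·-suc a g)))

plus-unit-< : ∀ {z δ g} a → z < a · g → δ ≤ g → z + δ < suc a · g
plus-unit-< {z} {δ} {g} a p q = <-≤-trans (+-mono-<-≤ p q) (≤-reflexive (sym (·-suc a g)))

-- e i / 64 U lies within 1/64 below the fractional part of N / 2 ^ i, modulo 1.  Away from 0 and 1/2 (zones A and B)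
-- this determines the top digit; near 1/2 (zone C) or near 0 the digit is read off the next one below, and
-- a position of zone C is followed by one that is not in zone C.

module Decoding (U : ℕ) (0<U : 0 < U) (H : ℕ) (d : ℕ → ℕ) (d≤1 : ∀ w → d w ≤ 1) (e : ℕ → ℕ)
  (W : ℕ) (W≡ : W ≡ 64 · U) (e< : ∀ i → e i < W)
  (approx : ∀ i → i ≤ H → ∃[ δ ] ∃[ j ] ∃[ k ] (δ ≤ U * 2 ^ i × 2 ^ i * e i + δ + j * (W * 2 ^ i) ≡ W * binary d H + k * (W * 2 ^ i))) where

  -- Measured in units of `U`, a full turn being 64 units. An error of one unit cannot cross the
  -- margins of four units on either side of 0 and of 32.
  ZoneA ZoneB ZoneC : ℕ → Set
  ZoneA i = 4 · U ≤ e i × e i ≤ 28 · U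
  ZoneB i = 36 · U ≤ e i × e i < 60 · U
  ZoneC i = 28 · U < e i × e i < 36 · U

  Resolved : ℕ → Set
  Resolved i = ZoneA i ⊎ ZoneB i

  Last : ℕ → Set
  Last i = ∃[ j ] (j ≤ i × ZoneB j × (∀ l → j < l → l ≤ i → ¬ Resolved l))

  -- Close to 0 the top digit repeats the one below, so it equals the last resolved digit, or 0 if
  -- there is none; close to 1 / 2 it is the opposite of the one below. By `stepC` and `stepD` a
  -- position following zone C is resolved, so the search for the last resolved position never has
  -- to cross zone C.
  Digit : ℕ → Set
  Digit i = (ZoneC i × ¬ Last i) ⊎ (¬ ZoneC i × Last i)

  private
    A≠B : ∀ i → ZoneA i → ¬ ZoneB i
    A≠B i (_ , p) (q , _) = clash {e i} {U} 29 7 q (≤-<-trans p (·-mono-< U 0<U (n<1+n 28)))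
    A≠C : ∀ i → ZoneA i → ¬ ZoneC i
    A≠C i (_ , p) (q , _) = <⇒≱ q p
    B≠C : ∀ i → ZoneB i → ¬ ZoneC i
    B≠C i (p , _) (_ , q) = <⇒≱ q p

    g Y : ℕ → ℕ
    g i = U * 2 ^ i
    Y i = W * binary d i

    0<g : ∀ i → 0 < g i
    0<g i = *-mono-≤ 0<U (m^n>0 2 i)

    m≡ : ∀ i → W * 2 ^ i ≡ 64 · g i
    m≡ i = trans (cong (_* 2 ^ i) W≡) (trans (*-comm (64 · U) (2 ^ i)) (sym (·-scale 64 U (2 ^ i))))

    scale : ∀ i a → a · U ≤ e i → a · g i ≤ 2 ^ i * e i
    scale i a p = ≤-trans (≤-reflexive (·-scale a U (2 ^ i))) (*-monoʳ-≤ (2 ^ i) p)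

    scale′ : ∀ i a → e i ≤ a · U → 2 ^ i * e i ≤ a · g i
    scale′ i a p = ≤-trans (*-monoʳ-≤ (2 ^ i) p) (≤-reflexive (sym (·-scale a U (2 ^ i))))

    scale-< : ∀ i a → e i < a · U → 2 ^ i * e i < a · g i
    scale-< i a p = <-≤-trans (*-monoʳ-< (2 ^ i) {{m^n≢0 2 i}} p) (≤-reflexive (sym (·-scale a U (2 ^ i))))

    e<64 : ∀ i → e i < 64 · U
    e<64 i = <-≤-trans (e< i) (≤-reflexive W≡)

    Y< : ∀ i → Y i < 64 · g i
    Y< i = <-≤-trans (*-monoʳ-< W {{>-nonZero (≤-trans (·-positive 63 0<U) (≤-reflexive (sym W≡)))}} (binary< d≤1 i)) (≤-reflexive (m≡ i))

    -- The digits from position i on contribute only full turns of length 64 g i. Since `Y i` is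
    -- below one turn and `2 ^ i * e i + δ` below two, they differ by at most one turn.
    position : ∀ i → i ≤ H → ∃[ δ ] (δ ≤ g i × ((2 ^ i * e i + δ ≡ Y i) ⊎ (2 ^ i * e i + δ ≡ Y i + 64 · g i)))
    position i i≤H = go (approx i i≤H) (binary-tail d i (H ∸ i))
      where
      go : (∃[ δ ] ∃[ j ] ∃[ k ] (δ ≤ U * 2 ^ i × 2 ^ i * e i + δ + j * (W * 2 ^ i) ≡ W * binary d H + k * (W * 2 ^ i))) →
           (∃[ t ] binary d (i + (H ∸ i)) ≡ binary d i + t * 2 ^ i) →
           ∃[ δ ] (δ ≤ g i × ((2 ^ i * e i + δ ≡ Y i) ⊎ (2 ^ i * e i + δ ≡ Y i + 64 · g i)))
      go (δ , j , k , δ≤ , q) (t , r) = δ , δ≤ , wrap {2 ^ i * e i + δ} {Y i} {64 · g i} j (t + k) (Y< i)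
        (+-mono-<-≤ (scale-< i 64 (e<64 i)) (≤-trans δ≤ (≤-trans (m≤n+m (g i) (63 · g i)) (≤-reflexive (sym (·-suc 63 (g i)))))))
        (trans (cong (λ m → 2 ^ i * e i + δ + j * m) (sym (m≡ i))) (trans q (trans (cong (λ b → W * b + k * (W * 2 ^ i)) (trans (cong (binary d) (sym (m+[n∸m]≡n i≤H))) r))
          (trans (l W (binary d i) t (2 ^ i) k) (cong (λ m → Y i + (t + k) * m) (m≡ i))))))
        where
        l : ∀ w b t p k → w * (b + t * p) + k * (w * p) ≡ w * b + (t + k) * (w * p)
        l = NS.solve-∀

    far : ∀ i {z δ y} a k → z + δ ≤ a · g i → ¬ (z + δ ≡ y + (suc a + k) · g i)
    far i {z} {δ} {y} a k p q = <⇒≱ (·-mono-< (g i) (0<g i) (n<1+n a))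
      (≤-trans (·-mono (g i) (m≤m+n (suc a) k)) (≤-trans (m≤n+m _ y) (≤-trans (≤-reflexive (sym q)) p)))

    inA : ∀ i → i ≤ H → ZoneA i → (4 · g i ≤ Y i + g i) × Y i < 32 · g i
    inA i i≤H (p , q) with position i i≤H
    ... | δ , δ≤ , inj₁ e₁ = ≤-trans (scale i 4 p) (≤-trans (m≤m+n _ δ) (≤-trans (≤-reflexive e₁) (m≤m+n _ _))) ,
            ≤-<-trans (≤-trans (≤-reflexive (sym e₁)) (plus-unit 28 (scale′ i 28 q) δ≤)) (·-mono-< (g i) (0<g i) (m≤m+n 30 2))
    ... | δ , δ≤ , inj₂ e₁ = ⊥-elim (far i {2 ^ i * e i} {δ} {Y i} 29 34 (plus-unit 28 (scale′ i 28 q) δ≤) e₁)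

    inB : ∀ i → i ≤ H → ZoneB i → 32 · g i ≤ Y i
    inB i i≤H (p , q) with position i i≤H
    ... | δ , δ≤ , inj₁ e₁ = ≤-trans (weaken {2 ^ i * e i} {g i} 32 4 (scale i 36 p)) (≤-trans (m≤m+n _ δ) (≤-reflexive e₁))
    ... | δ , δ≤ , inj₂ e₁ = ⊥-elim (far i {2 ^ i * e i} {δ} {Y i} 61 2 (<⇒≤ (plus-unit-< 60 (scale-< i 60 q) δ≤)) e₁)

    inC : ∀ i → i ≤ H → ZoneC i → 28 · g i ≤ Y i × Y i < 37 · g i
    inC i i≤H (p , q) with position i i≤H
    ... | δ , δ≤ , inj₁ e₁ = ≤-trans (scale i 28 (<⇒≤ p)) (≤-trans (m≤m+n _ δ) (≤-reflexive e₁)) , ≤-<-trans (≤-reflexive (sym e₁)) (plus-unit-< 36 (scale-< i 36 q) δ≤)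
    ... | δ , δ≤ , inj₂ e₁ = ⊥-elim (far i {2 ^ i * e i} {δ} {Y i} 37 26 (<⇒≤ (plus-unit-< 36 (scale-< i 36 q) δ≤)) e₁)

    ZoneD : ℕ → Set
    ZoneD i = e i < 4 · U ⊎ 60 · U ≤ e i

    inD : ∀ i → i ≤ H → ZoneD i → Y i < 5 · g i ⊎ 60 · g i ≤ Y i
    inD i i≤H z with position i i≤H
    inD i i≤H (inj₁ p) | δ , δ≤ , inj₁ e₁ = inj₁ (≤-<-trans (≤-reflexive (sym e₁)) (plus-unit-< 4 (scale-< i 4 p) δ≤))
    inD i i≤H (inj₁ p) | δ , δ≤ , inj₂ e₁ = ⊥-elim (far i {2 ^ i * e i} {δ} {Y i} 5 58 (<⇒≤ (plus-unit-< 4 (scale-< i 4 p) δ≤)) e₁)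
    inD i i≤H (inj₂ p) | δ , δ≤ , inj₁ e₁ = inj₂ (≤-trans (scale i 60 p) (≤-trans (m≤m+n _ δ) (≤-reflexive e₁)))
    inD i i≤H (inj₂ p) | δ , δ≤ , inj₂ e₁ = inj₁ (<-≤-trans (+-cancelʳ-< (64 · g i) (Y i) (g i)
        (≤-<-trans (≤-reflexive (sym e₁)) (<-≤-trans (plus-unit-< 64 (scale-< i 64 (e<64 i)) δ≤) (≤-reflexive (trans (·-suc 64 (g i)) (+-comm _ (g i))))))) (≤-trans (m≤n+m (g i) (4 · g i)) (≤-reflexive (sym (·-suc 4 (g i))))))

    classify : ∀ i → ZoneA i ⊎ ZoneB i ⊎ ZoneC i ⊎ ZoneD i
    classify i with 4 · U ≤? e i | e i ≤? 28 · U | 36 · U ≤? e i | e i <? 60 · U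
    ... | no p | _ | _ | _ = inj₂ (inj₂ (inj₂ (inj₁ (≰⇒> p))))
    ... | yes p | yes q | _ | _ = inj₁ (p , q)
    ... | yes p | no q | no r | _ = inj₂ (inj₂ (inj₁ (≰⇒> q , ≰⇒> r)))
    ... | yes p | no q | yes r | yes s = inj₂ (inj₁ (r , s))
    ... | yes p | no q | yes r | no s = inj₂ (inj₂ (inj₂ (inj₂ (≮⇒≥ s))))

    D-unresolved : ∀ i → ZoneD i → ¬ Resolved i
    D-unresolved i (inj₁ p) (inj₁ (q , _)) = <⇒≱ p q
    D-unresolved i (inj₁ p) (inj₂ (q , _)) = clash {e i} {U} 4 32 q p
    D-unresolved i (inj₂ p) (inj₁ (_ , q)) = clash {e i} {U} 29 31 p (≤-<-trans q (·-mono-< U 0<U (n<1+n 28)))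
    D-unresolved i (inj₂ p) (inj₂ (_ , q)) = <⇒≱ q p

    D≠C : ∀ i → ZoneD i → ¬ ZoneC i
    D≠C i (inj₁ p) (q , _) = <⇒≱ (<-trans q p) (·-mono U (m≤m+n 4 24))
    D≠C i (inj₂ p) (_ , q) = clash {e i} {U} 36 24 p q

    C-unresolved : ∀ i → ZoneC i → ¬ Resolved i
    C-unresolved i c (inj₁ a) = A≠C i a c
    C-unresolved i c (inj₂ b) = B≠C i b c

    last-A : ∀ i → ZoneA i → ¬ Last i
    last-A i a (j , j≤i , b , h) with m≤n⇒m<n∨m≡n j≤i
    ... | inj₁ j<i = h i j<i ≤-refl (inj₁ a)
    ... | inj₂ refl = A≠B i a b

    last-B : ∀ i → ZoneB i → Last i
    last-B i b = i , ≤-refl , b , λ l i<l l≤i _ → <⇒≱ i<l l≤i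

    last-up : ∀ i → ¬ Resolved (suc i) → Last i → Last (suc i)
    last-up i h (j , j≤i , b , k) = j , m≤n⇒m≤1+n j≤i , b , λ l j<l l≤ → up (m≤n⇒m<n∨m≡n l≤) j<l
      where
      up : ∀ {l} → l < suc i ⊎ l ≡ suc i → j < l → ¬ Resolved l
      up (inj₁ lt) j<l = k _ j<l (s≤s⁻¹ lt)
      up (inj₂ refl) _ = h

    last-down : ∀ i → ¬ Resolved (suc i) → Last (suc i) → Last i
    last-down i h (j , j≤ , b , k) with m≤n⇒m<n∨m≡n j≤
    ... | inj₁ lt = j , s≤s⁻¹ lt , b , λ l j<l l≤i → k l j<l (m≤n⇒m≤1+n l≤i)
    ... | inj₂ refl = ⊥-elim (h (inj₂ b))

    Top : ℕ → Set
    Top i = 32 · g i ≤ Y i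

    g-suc : ∀ i a → a · g (suc i) ≡ (a + a) · g i
    g-suc i a = ·-double a U (2 ^ i)

    Y-suc : ∀ i → Y (suc i) ≡ Y i + d i * (64 · g i)
    Y-suc i = trans (l W (binary d i) (d i) (2 ^ i)) (cong (λ m → Y i + d i * m) (m≡ i))
      where
      l : ∀ w b d p → w * (b + d * p) ≡ w * b + d * (w * p)
      l = NS.solve-∀

    digit : ∀ i → (d i ≡ 0 × Y (suc i) ≡ Y i) ⊎ (d i ≡ 1 × Y (suc i) ≡ Y i + 64 · g i)
    digit i with d i | d≤1 i | Y-suc i
    ... | zero | _ | p = inj₁ (refl , trans p (+-identityʳ _))
    ... | suc zero | _ | p = inj₂ (refl , trans p (cong (Y i +_) (*-identityˡ _)))
    ... | suc (suc _) | s≤s () | _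

    below : ∀ i {y} a b → y ≡ Y (suc i) → Y (suc i) < a · g (suc i) → a + a ≡ b → y < b · g i
    below i a b refl p refl = <-≤-trans p (≤-reflexive (g-suc i a))

    above : ∀ i {y} a b → y ≡ Y (suc i) → a · g (suc i) ≤ Y (suc i) → a + a ≡ b → b · g i ≤ y
    above i a b refl p refl = ≤-trans (≤-reflexive (sym (g-suc i a))) p

    minus64 : ∀ i {y} a → y + 64 · g i < (a + 64) · g i → y < a · g i
    minus64 i {y} a p = +-cancelʳ-< (64 · g i) y (a · g i) (<-≤-trans p (≤-reflexive (·-+ a 64 (g i))))

    minus64′ : ∀ i {y} a → (a + 64) · g i ≤ y + 64 · g i → a · g i ≤ y
    minus64′ i {y} a p = +-cancelʳ-≤ (64 · g i) (a · g i) y (≤-trans (≤-reflexive (sym (·-+ a 64 (g i)))) p)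

    toTop : ∀ i → d i ≡ 1 → Top (suc i)
    toTop i p with digit i
    ... | inj₁ (q , _) with trans (sym p) q
    ...   | ()
    toTop i p | inj₂ (_ , q) = ≤-trans (≤-reflexive (g-suc i 32)) (≤-trans (m≤n+m (64 · g i) (Y i)) (≤-reflexive (sym q)))

    fromTop : ∀ i → Top (suc i) → d i ≡ 1
    fromTop i p with digit i
    ... | inj₁ (_ , q) = ⊥-elim (<⇒≱ (Y< i) (above i 32 64 (sym q) p refl))
    ... | inj₂ (q , _) = q

    -- In units of `g i` the value `Y (suc i)` lies between 56 and 74. Taking off 64 for a digit 1
    -- leaves `Y i` in [56, 64) or in [0, 10), both away from zone C, and the upper interval belongs
    -- to digit 0.
    stepC : ∀ i → suc i ≤ H → ZoneC (suc i) → (¬ ZoneC i) × (Top (suc i) → ¬ Top i) × (¬ Top i → Top (suc i))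
    stepC i i<H c with digit i | inC (suc i) i<H c
    ... | inj₁ (dz , q) | lo , hi =
          (λ c′ → clash {Y i} {g i} 37 19 (above i 28 56 (sym q) lo refl) (proj₂ (inC i (<⇒≤ i<H) c′))) ,
          (λ t _ → <⇒≱ (Y< i) (above i 32 64 (sym q) t refl)) ,
          (λ t → ⊥-elim (t (weaken {Y i} {g i} 32 24 (above i 28 56 (sym q) lo refl))))
    ... | inj₂ (dz , q) | lo , hi =
          (λ c′ → clash {Y i} {g i} 10 18 (proj₁ (inC i (<⇒≤ i<H) c′)) Y<10) ,
          (λ _ t → clash {Y i} {g i} 10 22 t Y<10) ,
          (λ _ → toTop i dz)
      where
      Y<10 : Y i < 10 · g i
      Y<10 = minus64 i 10 (below i 37 74 (sym q) hi refl)

    -- In units of `g i` the value `Y (suc i)` is below 10 or at least 120. The digit is 0 in the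
    -- first case and 1 in the second, which leaves `Y i` below 10 or at least 56, on the same side
    -- of the middle and away from zone C.
    stepD : ∀ i → suc i ≤ H → ZoneD (suc i) → (¬ ZoneC i) × (Top (suc i) → Top i) × (Top i → Top (suc i))
    stepD i i<H z with digit i | inD (suc i) i<H z
    ... | inj₁ (dz , q) | inj₁ lo =
          (λ c → clash {Y i} {g i} 10 18 (proj₁ (inC i (<⇒≤ i<H) c)) (below i 5 10 (sym q) lo refl)) ,
          (λ t → ⊥-elim (<⇒≱ (Y< i) (above i 32 64 (sym q) t refl))) ,
          (λ t → ⊥-elim (clash {Y i} {g i} 10 22 t (below i 5 10 (sym q) lo refl)))
    ... | inj₁ (dz , q) | inj₂ hi = ⊥-elim (clash {Y i} {g i} 64 56 (above i 60 120 (sym q) hi refl) (Y< i))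
    ... | inj₂ (dz , q) | inj₁ lo = ⊥-elim (<⇒≱ (below i 5 10 (sym q) lo refl) (≤-trans (·-mono (g i) (m≤m+n 10 54)) (m≤n+m (64 · g i) (Y i))))
    ... | inj₂ (dz , q) | inj₂ hi =
          (λ c → clash {Y i} {g i} 37 19 Y≥56 (proj₂ (inC i (<⇒≤ i<H) c))) ,
          (λ _ → weaken {Y i} {g i} 32 24 Y≥56) ,
          (λ _ → toTop i dz)
      where
      Y≥56 : 56 · g i ≤ Y i
      Y≥56 = minus64′ i 56 (above i 60 120 (sym q) hi refl)

    Y0 : Y 0 ≡ 0
    Y0 = *-zeroʳ W

    ¬Top0 : ¬ Top 0
    ¬Top0 t = <⇒≱ (·-positive 31 (0<g 0)) (≤-trans t (≤-reflexive Y0))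

    unresolved0 : ¬ Resolved 0 × ¬ ZoneC 0
    unresolved0 = (λ { (inj₁ a) → <⇒≱ (<-≤-trans (·-mono-< (g 0) (0<g 0) (n<1+n 3)) (proj₁ (inA 0 z≤n a))) (≤-trans (≤-reflexive (cong (_+ g 0) Y0)) (≤-trans (m≤n+m (g 0) (2 · g 0)) (≤-reflexive (sym (·-suc 2 (g 0))))))
                     ; (inj₂ b) → ¬Top0 (inB 0 z≤n b) }) ,
                  (λ c → <⇒≱ (·-positive 27 (0<g 0)) (≤-trans (proj₁ (inC 0 z≤n c)) (≤-reflexive Y0)))

    ¬Last0 : ¬ Last 0
    ¬Last0 (zero , _ , b , _) = proj₁ unresolved0 (inj₂ b)

    top⇔digit : ∀ i → i ≤ H → (Top i → Digit i) × (Digit i → Top i)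
    top⇔digit zero _ = (λ t → ⊥-elim (¬Top0 t)) , λ { (inj₁ (c , _)) → ⊥-elim (proj₂ unresolved0 c) ; (inj₂ (_ , l)) → ⊥-elim (¬Last0 l) }
    top⇔digit (suc i) i<H with classify (suc i) | top⇔digit i (<⇒≤ i<H)
    ... | inj₁ a | _ = (λ t → ⊥-elim (<⇒≱ (proj₂ (inA (suc i) i<H a)) t)) ,
          λ { (inj₁ (c , _)) → ⊥-elim (A≠C (suc i) a c) ; (inj₂ (_ , l)) → ⊥-elim (last-A (suc i) a l) }
    ... | inj₂ (inj₁ b) | _ = (λ _ → inj₂ (B≠C (suc i) b , last-B (suc i) b)) , λ _ → inB (suc i) i<H b
    ... | inj₂ (inj₂ (inj₁ c)) | to , from with stepC i i<H c
    ...   | ¬c , down , up = (λ t → inj₁ (c , λ l → down t (from (inj₂ (¬c , last-down i (C-unresolved (suc i) c) l))))) ,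
            λ { (inj₁ (_ , ¬l)) → up (λ t → ¬l (last-up i (C-unresolved (suc i) c) (lastOf (to t)))) ; (inj₂ (¬c′ , _)) → ⊥-elim (¬c′ c) }
      where
      lastOf : Digit i → Last i
      lastOf (inj₁ (c′ , _)) = ⊥-elim (¬c c′)
      lastOf (inj₂ (_ , l)) = l
    top⇔digit (suc i) i<H | inj₂ (inj₂ (inj₂ z)) | to , from with stepD i i<H z
    ...   | ¬c , down , up = (λ t → inj₂ (D≠C (suc i) z , last-up i (D-unresolved (suc i) z) (lastOf (to (down t))))) ,
            λ { (inj₁ (c , _)) → ⊥-elim (D≠C (suc i) z c) ; (inj₂ (_ , l)) → up (from (inj₂ (¬c , last-down i (D-unresolved (suc i) z) l))) }
      where
      lastOf : Digit i → Last i
      lastOf (inj₁ (c′ , _)) = ⊥-elim (¬c c′)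
      lastOf (inj₂ (_ , l)) = l

  -- `Digit i` speaks of the top one of the i lowest digits, whence the shift by one.
  decoding : ∀ i → i < H → (d i ≡ 1 → Digit (suc i)) × (Digit (suc i) → d i ≡ 1)
  decoding i i<H = proj₁ (top⇔digit (suc i) i<H) ∘ toTop i , fromTop i ∘ proj₂ (top⇔digit (suc i) i<H)

-- Digit extraction as a feasible function

constR : ∀ {Γ} a → Realizer Γ (λ _ _ → a)
constR zero = real nil
constR (suc a) = real (one′ ⊞ feasible (λ _ _ → a) (constR a))

constF : ∀ {Γ} → ℕ → Feasible Γ
constF a = feasible (λ _ _ → a) (constR a)

sumTo-restrict : ∀ N f q → q ≤ N → sumTo N (λ z → le (suc z) q * f z) ≡ sumTo q f
sumTo-restrict zero f zero _ = refl
sumTo-restrict (suc N) f q q≤ with m≤n⇒m<n∨m≡n q≤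
... | inj₁ lt = trans (cong₂ _+_ (sumTo-restrict N f q (s≤s⁻¹ lt)) (cong (_* f N) (ind-no (ind-le (suc N) q) (<⇒≱ lt)))) (+-identityʳ _)
... | inj₂ refl = sumTo-cong (suc N) (λ z z< → trans (cong (_* f z) (ind-yes (ind-le (suc z) (suc N)) z<)) (*-identityˡ (f z)))

-- The inverse of v modulo p is v ^ (d - 1), with d the order of v.
solve-linear : ∀ {p} → Prime p → ∀ v w → ¬ p ∣ v → ∃[ c ] (c < p × (c * v) mod p ≡ w mod p)
solve-linear {p} pr v w p∤v = finish (PR.order p∤v)
  where
  p≡ : p ≡ suc (pred p)
  p≡ = sym (suc-pred p {{prime⇒nonZero pr}})
  module PR = PrimitiveRoots p≡ pr
  finish : ∃[ d ] (d ≤ pred p × PR.Ord v d) → ∃[ c ] (c < p × (c * v) mod p ≡ w mod p)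
  finish (suc d , _ , _ , h , _) = (w * v ^ d) mod p , mod< (w * v ^ d) (≤-trans (s≤s z≤n) (prime⇒2≤ pr)) ,
    trans (mod-*-cong p {(w * v ^ d) mod p} {w * v ^ d} {v} {v} (mod-mod p _) refl)
      (trans (cong (_mod p) (l w (v ^ d) v)) (trans (mod-*-cong p {w} {w} {v ^ suc d} {1} refl (trans h (sym (PR.1mod)))) (cong (_mod p) (*-identityʳ w))))
    where
    l : ∀ w a v → w * a * v ≡ w * (v * a)
    l = NS.solve-∀

module Extraction (hyp : VNP0≡VP0) (m : ℕ → ℕ) (pm : PB m) where

  pK : PB (primeWidth′ ∘ m)
  pK = pb-+ (pb-* (pb-const 4) pm) (pb-const 23)

  open Comparisons hyp
  open Products hyp (primeWidth′ ∘ m) pK public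

  Mw I : Width
  Mw = width m pm
  I = width (λ n → suc (m n)) (pb-+ (pb-const 1) pm)

  -- `H` is the number of digits of N. With n₀ = 32 H the inequality 2 ^ H * 128 * H ≤ 2 ^ n₀ holds
  -- with room to spare, and n₀ is again a power of two, so it has a short formula.
  H n₀ X : ℕ → ℕ
  H n = 2 ^ m n
  n₀ n = 2 ^ (m n + 5)
  X n = 2 ^ K n

  0<H : ∀ n → 0 < H n
  0<H n = m^n>0 2 (m n)

  big : ∀ n → 2 ^ H n * 128 * H n ≤ 2 ^ n₀ n
  big n = begin
    2 ^ h * 128 * h              ≤⟨ *-monoʳ-≤ (2 ^ h * 128) (<⇒≤ (n<2^n h)) ⟩
    2 ^ h * 2 ^ 7 * 2 ^ h        ≡⟨ sym (trans (^-distribˡ-+-* 2 (h + 7) h) (cong (_* 2 ^ h) (^-distribˡ-+-* 2 h 7))) ⟩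
    2 ^ (h + 7 + h)              ≤⟨ ^-monoʳ-≤ 2 (≤-trans (+-monoˡ-≤ h (+-monoʳ-≤ h (*-mono-≤ {7} {7} ≤-refl (0<H n)))) (≤-slack (23 * h) (l h))) ⟩
    2 ^ (h * 32)                 ≡⟨ cong (2 ^_) (sym (^-distribˡ-+-* 2 (m n) 5)) ⟩
    2 ^ n₀ n                     ∎
    where
    open ≤-Reasoning
    h : ℕ
    h = H n
    l : ∀ h → h + 7 * h + h + 23 * h ≡ h * 32
    l = NS.solve-∀

  module Bl (n : ℕ) = Blocks (H n) (n₀ n) (X n) (m^n>0 2 (m n + 5)) (primes-suffice (m n)) (big n)

  abstract
    -- Numbers below X have polynomially many bits, so trial division is a single exponential sum.
    primeF : Feasible (P ∷ [])
    primeF = leF (constF 2) (vr here) ⊠ eqF (Sg P ((ltF one′ (vr here) ⊠ ltF (vr here) (vr (there here))) ⊠ eqF (remF (vr (there here)) (vr here)) nil)) nil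

    ind-primeF : ∀ n q → q < X n → Ind (Prime q) (fun primeF n (q , tt))
    ind-primeF n q q< = ind-map to from (ind-× (ind-le 2 q)
      (ind-∄ (2 ^ K n) {λ c → (2 ≤ c × suc c ≤ q) × q mod c ≡ 0} (λ c _ → ind-× (ind-× (ind-le 2 c) (ind-le (suc c) q)) (ind-eq (q mod c) 0))))
      where
      to : 2 ≤ q × (∀ c → c < 2 ^ K n → ¬ ((2 ≤ c × suc c ≤ q) × q mod c ≡ 0)) → Prime q
      to (2≤q , h) = irreducible⇒prime {{n>1⇒nonTrivial 2≤q}} irr
        where
        irr : ∀ {c} → c ∣ q → c ≡ 1 ⊎ c ≡ q
        irr {zero} (divides t e) = ⊥-elim (<⇒≱ 2≤q (≤-trans (≤-reflexive (trans e (*-zeroʳ t))) z≤n))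
        irr {suc zero} _ = inj₁ refl
        irr {c@(suc (suc _))} c∣q with m≤n⇒m<n∨m≡n (∣⇒≤ {{>-nonZero (≤-trans (s≤s z≤n) 2≤q)}} c∣q)
        ... | inj₂ e = inj₂ e
        ... | inj₁ lt = ⊥-elim (h c (<-trans lt q<) ((s≤s (s≤s z≤n) , lt) , ∣⇒mod≡0 (s≤s z≤n) c∣q))
      from : Prime q → 2 ≤ q × (∀ c → c < 2 ^ K n → ¬ ((2 ≤ c × suc c ≤ q) × q mod c ≡ 0))
      from pr = prime⇒2≤ pr , none
        where
        none : ∀ c → c < 2 ^ K n → ¬ ((2 ≤ c × suc c ≤ q) × q mod c ≡ 0)
        none c _ ((2≤c , c<q) , e) with prime⇒irreducible pr (mod≡0⇒∣ (≤-trans (s≤s z≤n) 2≤c) e)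
        ... | inj₁ refl = <⇒≱ 2≤c ≤-refl
        ... | inj₂ refl = <-irrefl refl c<q

    oddF : Feasible (P ∷ [])
    oddF = primeF ⊠ eqF (eqF (vr here) (constF 2)) nil

    ind-oddF : ∀ n q → q < X n → Ind (OddPrime q) (fun oddF n (q , tt))
    ind-oddF n q q< = ind-× (ind-primeF n q q<) (ind-¬ (ind-eq q 2))

    rankF : Feasible (P ∷ [])
    rankF = Sg P (ltF (vr here) (vr (there here)) ⊠ call (here ∷ []) oddF)

    fun-rankF : ∀ n q → q < X n → fun rankF n (q , tt) ≡ countOdd q
    fun-rankF n q q< = trans (sumTo-restrict (X n) (λ z → fun oddF n (z , tt)) q (<⇒≤ q<))
      (sumTo-cong q (λ z z< → ind-unique (ind-oddF n z (<-trans z< q<)) (ind-ι? (oddPrime? z))))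

    n₀F : ∀ {Γ} → Feasible Γ
    n₀F = pow2 (λ n → m n + 5) (pb-+ pm (pb-const 5))

    usedF : Feasible (P ∷ [])
    usedF = oddF ⊠ ltF (quoF rankF n₀F) (pow2 m pm)

    ind-usedF : ∀ n q → q < X n → Ind (Bl.Used n q) (fun usedF n (q , tt))
    ind-usedF n q q< = ind-× (ind-oddF n q q<) (transport (λ r → Ind (countOdd q div n₀ n < H n) (le (suc (r div n₀ n)) (H n))) (sym (fun-rankF n q q<)) (ind-le _ _))

    blockF : Feasible (P ∷ Mw ∷ [])
    blockF = call (here ∷ []) oddF ⊠ eqF (quoF (call (here ∷ []) rankF) n₀F) (vr (there here))

    ind-blockF : ∀ n q l → q < X n → Ind (Bl.InBlock n l q) (fun blockF n (q , l , tt))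
    ind-blockF n q l q< = ind-× (ind-oddF n q q<) (transport (λ r → Ind (countOdd q div n₀ n ≡ l) (eq (r div n₀ n) l)) (sym (fun-rankF n q q<)) (ind-eq _ l))

  facF : ∀ {Γ} → Feasible Γ → Feasible Γ → Feasible Γ
  facF b q = b ⊠ q ⊞ eqF b nil

  private
    module BlockProduct = IteratedProduct {Mw ∷ P ∷ []} P (facF (call (here ∷ there here ∷ []) blockF) (vr here)) (there here)

  -- Formulas cannot subtract, so block l - 1 is computed modulo p as block l + (p - 1).
  predF : Feasible (P ∷ [])
  predF = Sg P (eqF (one′ ⊞ vr here) (vr (there here)) ⊠ vr here)

  fun-predF : ∀ n p → Prime p → p < X n → fun predF n (p , tt) ≡ pred p
  fun-predF n p pr p< = sumTo-select (X n) {λ z → suc z ≡ p} (λ z → z) (pred p) (≤-<-trans (pred[n]≤n {p}) p<) (suc-pred p {{prime⇒nonZero pr}})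
    (λ z _ e → cong pred e) (λ z _ → ind-eq (suc z) p)

  private
    module GapProduct = IteratedProduct {P ∷ []} Mw (BlockProduct.productF ⊞ call (there here ∷ []) predF) here
    module Cofactor = IteratedProduct {P ∷ []} P (facF (call (here ∷ []) usedF ⊠ eqF (eqF (vr here) (vr (there here))) nil) (vr here)) here
    module PowI = Power I

  abstract
    gapF : Feasible (P ∷ [])
    gapF = GapProduct.productF

    fun-gapF : ∀ n p → Prime p → p < X n → fun gapF n (p , tt) ≡ Bl.B n mod p
    fun-gapF n p pr p< = trans (GapProduct.fun-productF n (p , tt) pr p<) (prodTo-mod-cong p (H n) (λ l _ → factor l))
      where
      0<p : 0 < p
      0<p = ≤-trans (s≤s z≤n) (prime⇒2≤ pr)
      b : ℕ → ℕ
      b = Bl.block n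
      blockMod : ∀ l → fun BlockProduct.productF n (l , p , tt) ≡ b l mod p
      blockMod l = trans (BlockProduct.fun-productF n (l , p , tt) pr p<) (cong (_mod p)
        (prodTo-cong (X n) (λ q q< → cong (λ i → fac i q) (ind-unique (ind-blockF n q l q<) (ind-ι? (Bl.inBlock? n l q))))))
      factor : ∀ l → (fun BlockProduct.productF n (l , p , tt) + fun predF n (p , tt)) mod p ≡ (b l ∸ 1) mod p
      factor l = trans (cong₂ (λ u v → (u + v) mod p) (blockMod l) (fun-predF n p pr p<))
        (trans (mod-+-cong p {b l mod p} {b l} {pred p} {pred p} (mod-mod p (b l)) refl)
          (trans (cong (_mod p) shift) (mod-kn p (b l ∸ 1) 1)))
        where
        shift : b l + pred p ≡ b l ∸ 1 + 1 * p
        shift = trans (cong (_+ pred p) (sym (m+[n∸m]≡n (Bl.block≥1 n l)))) (trans (l₁ (b l ∸ 1) (pred p)) (cong (λ z → b l ∸ 1 + 1 * z) (suc-pred p {{prime⇒nonZero pr}})))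
          where
          l₁ : ∀ a c → 1 + a + c ≡ a + 1 * suc c
          l₁ = NS.solve-∀

    cofactorF : Feasible (P ∷ [])
    cofactorF = Cofactor.productF

    fun-cofactorF : ∀ n p → Prime p → p < X n → fun cofactorF n (p , tt) ≡ Bl.cofactor n p mod p
    fun-cofactorF n p pr p< = trans (Cofactor.fun-productF n (p , tt) pr p<) (cong (_mod p)
      (prodTo-cong (X n) (λ q q< → cong (λ i → fac (i * eq (eq q p) 0) q) (ind-unique (ind-usedF n q q<) (ind-ι? (Bl.used? n q))))))

    power2F : Feasible (P ∷ I ∷ [])
    power2F = Sg P (eqF (vr here) (constF 2) ⊠ call (there here ∷ there (there here) ∷ here ∷ []) PowI.powF)

    fun-power2F : ∀ n p i → Prime p → p < X n → i < 2 ^ suc (m n) → fun power2F n (p , i , tt) ≡ (2 ^ i) mod p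
    fun-power2F n p i pr p< i< = trans
      (sumTo-select (X n) {λ z → z ≡ 2} (λ g → fun PowI.powF n (p , i , g , tt)) 2 2<X refl (λ _ _ e → e) (λ z _ → ind-eq z 2))
      (PowI.fun-powF n p i 2 (prime⇒2≤ pr) i< 2<X)
      where
      2<X : 2 < X n
      2<X = ≤-<-trans (prime⇒2≤ pr) p<

  module Digits (d : ℕ → ℕ → ℕ) (d≤1 : ∀ n w → d n w ≤ 1) (Res : Feasible (P ∷ []))
    (Res-ok : ∀ n p → Prime p → p < X n → fun Res n (p , tt) ≡ binary (d n) (H n) mod p) where

    N : ℕ → ℕ
    N n = binary (d n) (H n)

    abstract
      -- Division modulo p by search: 2 ^ i and the cofactor are prime to a used p, so exactly one c
      -- below p solves the congruence.
      coefficientF : Feasible (P ∷ I ∷ [])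
      coefficientF = Sg P ((ltF (vr here) (vr (there here)) ⊠
        eqF (remF ((vr here ⊠ call (there here ∷ there (there here) ∷ []) power2F) ⊠ call (there here ∷ []) cofactorF) (vr (there here)))
            (remF (call (there here ∷ []) Res ⊠ call (there here ∷ []) gapF) (vr (there here)))) ⊠ vr here)

      coefficient-ok : ∀ n i → i < 2 ^ suc (m n) → ∀ p → p < X n → Bl.Used n p →
        (fun coefficientF n (p , i , tt) * 2 ^ i * Bl.cofactor n p) mod p ≡ (N n * Bl.B n) mod p
      coefficient-ok n i i< p p< u = finish (solve-linear pr V (N n * Bl.B n) p∤V)
        where
        pr : Prime p
        pr = proj₁ (proj₁ u)
        V : ℕ
        V = 2 ^ i * Bl.cofactor n p
        p∤V : ¬ p ∣ V
        p∤V = prime∤* pr (prime∤^ pr i (λ h → proj₂ (proj₁ u) (prime-∣-prime pr prime[2] h))) (Bl.prime∤cofactor n p pr)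
        rel : ∀ c → Ind (c < p × (c * V) mod p ≡ (N n * Bl.B n) mod p)
          (le (suc c) p * eq ((c * fun power2F n (p , i , tt) * fun cofactorF n (p , tt)) mod p) ((fun Res n (p , tt) * fun gapF n (p , tt)) mod p))
        rel c = ind-× (ind-le (suc c) p) (ind-map (λ e → trans (sym left) (trans e right)) (λ e → trans left (trans e (sym right))) (ind-eq _ _))
          where
          left : (c * fun power2F n (p , i , tt) * fun cofactorF n (p , tt)) mod p ≡ (c * V) mod p
          left = trans (mod-*-cong p {c * fun power2F n (p , i , tt)} {c * 2 ^ i} {fun cofactorF n (p , tt)} {Bl.cofactor n p}
                   (mod-*-cong p {c} {c} {fun power2F n (p , i , tt)} {2 ^ i} refl (trans (cong (_mod p) (fun-power2F n p i pr p< i<)) (mod-mod p _)))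
                   (trans (cong (_mod p) (fun-cofactorF n p pr p<)) (mod-mod p _)))
                 (cong (_mod p) (*-assoc c (2 ^ i) (Bl.cofactor n p)))
          right : (fun Res n (p , tt) * fun gapF n (p , tt)) mod p ≡ (N n * Bl.B n) mod p
          right = mod-*-cong p {fun Res n (p , tt)} {N n} {fun gapF n (p , tt)} {Bl.B n}
                    (trans (cong (_mod p) (Res-ok n p pr p<)) (mod-mod p _)) (trans (cong (_mod p) (fun-gapF n p pr p<)) (mod-mod p _))
        finish : ∃[ c ] (c < p × (c * V) mod p ≡ (N n * Bl.B n) mod p) →
          (fun coefficientF n (p , i , tt) * 2 ^ i * Bl.cofactor n p) mod p ≡ (N n * Bl.B n) mod p
        finish (c , c< , e) = trans (cong (λ z → (z * 2 ^ i * Bl.cofactor n p) mod p) is-c) (trans (cong (_mod p) (*-assoc c (2 ^ i) (Bl.cofactor n p))) e)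
          where
          is-c : fun coefficientF n (p , i , tt) ≡ c
          is-c = sumTo-select (X n) {λ z → z < p × (z * V) mod p ≡ (N n * Bl.B n) mod p} (λ z → z) c (<-trans c< p<) (c< , e)
            (λ z _ q → trans (sym (mod-small (proj₁ q))) (trans (mod-cancel pr V z c p∤V
               (trans (cong (_mod p) (*-comm V z)) (trans (proj₂ q) (trans (sym e) (cong (_mod p) (*-comm c V)))))) (mod-small c<)))
            (λ z _ → rel z)

      scaleF : ∀ {Γ} → Feasible Γ
      scaleF = pow2 (λ n → 6 + (1 + K n)) (pb-+ (pb-const 6) (pb-+ (pb-const 1) (len-pb P)))

      fun-scaleF : ∀ {Γ} n e → fun (scaleF {Γ}) n e ≡ Bl.W n
      fun-scaleF n e = ^-distribˡ-+-* 2 6 (1 + K n)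

      sumF : Feasible (I ∷ [])
      sumF = Sg P (call (here ∷ []) usedF ⊠ quoF (scaleF ⊠ coefficientF) (vr here))

      approxF : Feasible (I ∷ [])
      approxF = remF sumF scaleF

      0<W : ∀ n → 0 < Bl.W n
      0<W n = ≤-trans (m^n>0 2 (6 + (1 + K n))) (≤-reflexive (^-distribˡ-+-* 2 6 (1 + K n)))

      approxF< : ∀ n i → fun approxF n (i , tt) < Bl.W n
      approxF< n i = <-≤-trans (mod< (fun sumF n (i , tt)) {fun (scaleF {I ∷ []}) n (i , tt)} (≤-trans (0<W n) (≤-reflexive (sym (fun-scaleF {I ∷ []} n (i , tt)))))) (≤-reflexive (fun-scaleF {I ∷ []} n (i , tt)))

      approx-ok : ∀ n i → i ≤ H n → ∃[ δ ] ∃[ j ] ∃[ k ] (δ ≤ Bl.U n * 2 ^ i ×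
        2 ^ i * fun approxF n (i , tt) + δ + j * (Bl.W n * 2 ^ i) ≡ Bl.W n * binary (d n) (H n) + k * (Bl.W n * 2 ^ i))
      approx-ok n i i≤H = finish D.approximation
        where
        i< : i < 2 ^ suc (m n)
        i< = ≤-<-trans i≤H (^-monoʳ-< 2 ≤-refl (n<1+n (m n)))
        c : ℕ → ℕ
        c p = fun coefficientF n (p , i , tt)
        module D = Bl.Digit n (m^n>0 2 (K n)) (0<H n) (N n) (binary< (d≤1 n) (H n)) i i≤H c (coefficient-ok n i i<)
        S≡ : fun sumF n (i , tt) ≡ D.S
        S≡ = sumTo-cong (X n) (λ p p< → cong₂ _*_ (ind-unique (ind-usedF n p p<) (ind-ι? (Bl.used? n p)))
               (cong (λ w → (w * c p) div p) (fun-scaleF {P ∷ I ∷ []} n (p , i , tt))))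
        e≡ : fun approxF n (i , tt) ≡ D.S mod Bl.W n
        e≡ = cong₂ _mod_ S≡ (fun-scaleF {I ∷ []} n (i , tt))
        finish : ∃[ δ ] ∃[ j ] ∃[ k ] (δ ≤ Bl.U n * 2 ^ i × 2 ^ i * D.S + δ + j * (Bl.W n * 2 ^ i) ≡ Bl.W n * N n + k * (Bl.W n * 2 ^ i)) →
          ∃[ δ ] ∃[ j ] ∃[ k ] (δ ≤ Bl.U n * 2 ^ i × 2 ^ i * fun approxF n (i , tt) + δ + j * (Bl.W n * 2 ^ i) ≡ Bl.W n * binary (d n) (H n) + k * (Bl.W n * 2 ^ i))
        finish (δ , j , k , δ≤ , e) = δ , D.S div Bl.W n + j , k , δ≤ ,
          trans (l (2 ^ i) (fun approxF n (i , tt)) δ (D.S div Bl.W n) j (Bl.W n)) (trans (cong (λ s → 2 ^ i * s + δ + j * (Bl.W n * 2 ^ i))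
            (trans (cong (_+ D.S div Bl.W n * Bl.W n) e≡) (sym (div-mod D.S (0<W n))))) e)
          where
          l : ∀ p a δ q j w → p * a + δ + (q + j) * (w * p) ≡ p * (a + q * w) + δ + j * (w * p)
          l = NS.solve-∀

    plainUnit : ∀ {Γ} a → Feasible Γ
    plainUnit a = constF a ⊠ pow2 (λ n → 1 + K n) (pb-+ (pb-const 1) (len-pb P))
    unit-ok : ∀ {Γ} a n (e : Env Γ) → fun (plainUnit {Γ} a) n e ≡ a · Bl.U n
    unit-ok a n e = sym (·-def a (Bl.U n))

    unitF : ∀ {Γ} a → Feasible Γ
    unitF {Γ} a = feasible (λ n _ → a · Bl.U n) (realizer (fm (plainUnit a)) (pb (plainUnit a)) (λ n ρ e ag → trans (ok (plainUnit a) n ρ e ag) (unit-ok {Γ} a n e)))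

    W≡64U : ∀ n → Bl.W n ≡ 64 · Bl.U n
    W≡64U n = sym (·-def 64 (Bl.U n))

    module Decode (n : ℕ) = Decoding (Bl.U n) (*-mono-≤ {1} {2} (s≤s z≤n) (m^n>0 2 (K n))) (H n) (d n) (d≤1 n)
      (λ i → fun approxF n (i , tt)) (Bl.W n) (W≡64U n) (approxF< n) (approx-ok n)

    zoneAF zoneBF zoneCF lastF digitF : Feasible (I ∷ [])
    zoneAF = leF (unitF 4) approxF ⊠ leF approxF (unitF 28)
    zoneBF = leF (unitF 36) approxF ⊠ ltF approxF (unitF 60)
    zoneCF = ltF (unitF 28) approxF ⊠ ltF approxF (unitF 36)
    lastF = posF (Sg I (leF (vr here) (vr (there here)) ⊠ (call (here ∷ []) zoneBF ⊠
      eqF (Sg I (ltF (vr (there here)) (vr here) ⊠ (leF (vr here) (vr (there (there here))) ⊠ posF (call (here ∷ []) zoneAF ⊞ call (here ∷ []) zoneBF)))) nil)))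
    digitF = zoneCF ⊠ eqF lastF nil ⊞ eqF zoneCF nil ⊠ lastF

    ind-A : ∀ n i → Ind (Decode.ZoneA n i) (fun zoneAF n (i , tt))
    ind-A n i = ind-× (ind-le _ _) (ind-le _ _)
    ind-B : ∀ n i → Ind (Decode.ZoneB n i) (fun zoneBF n (i , tt))
    ind-B n i = ind-× (ind-le _ _) (ind-le _ _)
    ind-C : ∀ n i → Ind (Decode.ZoneC n i) (fun zoneCF n (i , tt))
    ind-C n i = ind-× (ind-le _ _) (ind-le _ _)

    ind-or : ∀ {A B a b} → Ind A a → Ind B b → Ind (A ⊎ B) (le 1 (a + b))
    ind-or (holds p) _ = holds (inj₁ p)
    ind-or (fails p) (holds q) = holds (inj₂ q)
    ind-or (fails p) (fails q) = fails λ { (inj₁ r) → p r ; (inj₂ r) → q r }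

    ind-last : ∀ n i → i < 2 ^ suc (m n) → Ind (Decode.Last n i) (fun lastF n (i , tt))
    ind-last n i i< = ind-map
      (λ { (j , _ , j≤i , b , h) → j , j≤i , b , λ l j<l l≤i r → h l (≤-<-trans l≤i i<) (j<l , l≤i , r) })
      (λ { (j , j≤i , b , h) → j , ≤-<-trans j≤i i< , j≤i , b , λ l _ q → h l (proj₁ q) (proj₁ (proj₂ q)) (proj₂ (proj₂ q)) })
      (ind-∃ (2 ^ suc (m n)) (λ j _ → ind-× (ind-le j i) (ind-× (ind-B n j)
        (ind-∄ (2 ^ suc (m n)) (λ l _ → ind-× (ind-le (suc j) l) (ind-× (ind-le l i) (ind-or (ind-A n l) (ind-B n l))))))))

    ind-digit : ∀ n i → i < 2 ^ suc (m n) → Ind (Decode.Digit n i) (fun digitF n (i , tt))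
    ind-digit n i i< = ind-⊎ (ind-× (ind-C n i) (ind-¬ (ind-last n i i<))) (ind-× (ind-¬ (ind-C n i)) (ind-last n i i<))
      (λ { ((c , _) , (¬c , _)) → ¬c c })

    rawExtractF : Feasible (Mw ∷ [])
    -- Digit w is decoded at position w + 1, which may equal H; therefore words of `I` have one bit
    -- more than those of `Mw`.
    rawExtractF = Sg I (eqF (vr here) (one′ ⊞ vr (there here)) ⊠ call (here ∷ []) digitF)

    fun-rawExtractF : ∀ n w → w < H n → fun rawExtractF n (w , tt) ≡ d n w
    fun-rawExtractF n w w< = trans (sumTo-select (2 ^ suc (m n)) {λ z → z ≡ suc w} (λ z → fun digitF n (z , tt)) (suc w) w<′ refl (λ _ _ e → e) (λ z _ → ind-eq z (suc w)))
      (value (ind-digit n (suc w) w<′) (Decode.decoding n w w<) (d≤1 n w))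
      where
      w<′ : suc w < 2 ^ suc (m n)
      w<′ = ≤-<-trans w< (^-monoʳ-< 2 ≤-refl (n<1+n (m n)))
      value : ∀ {Q : Set} {a b} → Ind Q a → (b ≡ 1 → Q) × (Q → b ≡ 1) → b ≤ 1 → a ≡ b
      value (holds q) (_ , g) _ = sym (g q)
      value {b = zero} (fails ¬q) _ _ = refl
      value {b = suc zero} (fails ¬q) (f , _) _ = ⊥-elim (¬q (f refl))
      value {b = suc (suc _)} (fails ¬q) _ (s≤s ())

    abstract
      extractF : Feasible (Mw ∷ [])
      extractF = rawExtractF

      fun-extractF : ∀ n w → w < H n → fun extractF n (w , tt) ≡ d n w
      fun-extractF = fun-rawExtractF

-- Kronecker substitution

infixr 8 _^ᵖ_

_^ᵖ_ : ∀ {n} → Poly n → ℕ → Poly n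
P ^ᵖ zero = 𝟙
P ^ᵖ suc k = P ⊗ P ^ᵖ k

squares : ∀ {n} → ℕ → Poly n → Poly n
squares zero P = P
squares (suc j) P = squares j (P ⊗ P)

easy-squares : ∀ {n} j {P : Poly n} {s} → Easy P s → Easy (squares j P) (j + s)
easy-squares zero e = e
easy-squares (suc j) {s = s} e = easy-≈ ≈-refl (≤-reflexive (+-suc j s)) (easy-squares j (easy-square e))

prodBits : ∀ {n} k → (Fin k → Poly n) → Vec Bool k → Poly n
prodBits zero τ [] = 𝟙
prodBits (suc k) τ (c ∷ w) = (if c then τ zero else 𝟙) ⊗ prodBits k (τ ∘ suc) w

module _ {n : ℕ} where
  open Evaluation (polyRing n)

  ^ᵖ-+ : ∀ (P : Poly n) a b → P ^ᵖ (a + b) ≈ P ^ᵖ a ⊗ P ^ᵖ b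
  ^ᵖ-+ P zero b = ≈-sym (⊗-idˡ _)
  ^ᵖ-+ P (suc a) b = ≈-trans (⊗-cong ≈-refl (^ᵖ-+ P a b)) (≈-sym (⊗-assoc P _ _))

  ^ᵖ-square : ∀ (P : Poly n) k → (P ⊗ P) ^ᵖ k ≈ P ^ᵖ (2 * k)
  ^ᵖ-square P zero = ≈-refl
  ^ᵖ-square P (suc k) = ≈-trans (⊗-cong ≈-refl (^ᵖ-square P k)) (≈-trans (⊗-assoc P P _) (≡⇒≈ (cong (P ^ᵖ_) (l k))))
    where
    l : ∀ k → 2 + 2 * k ≡ 2 * suc k
    l = NS.solve-∀

  prodBits-++ : ∀ k l (τ : Fin (k + l) → Poly n) (u : Vec Bool k) (w : Vec Bool l) →
                prodBits (k + l) τ (u Vec.++ w) ≈ prodBits k (τ ∘ (_↑ˡ l)) u ⊗ prodBits l (τ ∘ (k ↑ʳ_)) w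
  prodBits-++ zero l τ [] w = ≈-sym (⊗-idˡ _)
  prodBits-++ (suc k) l τ (c ∷ u) w = ≈-trans (⊗-cong ≈-refl (prodBits-++ k l (τ ∘ suc) u w)) (≈-sym (⊗-assoc _ _ _))

  prodBits-cong : ∀ k {τ σ : Fin k → Poly n} → (∀ i → τ i ≡ σ i) → ∀ w → prodBits k τ w ≡ prodBits k σ w
  prodBits-cong zero h [] = refl
  prodBits-cong (suc k) h (true ∷ w) = cong₂ _⊗_ (h zero) (prodBits-cong k (h ∘ suc) w)
  prodBits-cong (suc k) h (false ∷ w) = cong (𝟙 ⊗_) (prodBits-cong k (h ∘ suc) w)

  prodBits-squares : ∀ k (P : Poly n) w → prodBits k (λ j → squares (toℕ j) P) w ≈ P ^ᵖ val w
  prodBits-squares zero P [] = ≈-refl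
  prodBits-squares (suc k) P (c ∷ w) = ≈-trans (⊗-cong (first c) (≈-trans (prodBits-squares k (P ⊗ P) w) (^ᵖ-square P (val w))))
    (≈-sym (^ᵖ-+ P (bit c) (2 * val w)))
    where
    first : ∀ c → (if c then P else 𝟙) ≈ P ^ᵖ bit c
    first true = ≈-sym (*ᴿ-idʳ P)
    first false = ≈-refl

  allBits : ∀ k → (Fin k → Poly n) → Poly n
  allBits zero τ = 𝟙
  allBits (suc k) τ = (τ zero ⊕ 𝟙) ⊗ allBits k (τ ∘ suc)

  sum-prodBits : ∀ k (τ : Fin k → Poly n) → sumR k (prodBits k τ) ≈ allBits k τ
  sum-prodBits zero τ = ≈-refl
  sum-prodBits (suc k) τ = ≈-trans (⊕-cong (sumR-*ˡ k _ _) (sumR-*ˡ k _ _)) (≈-trans (≈-sym (distribʳ _ _ _)) (⊗-cong ≈-refl (sum-prodBits k (τ ∘ suc))))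

  easy-allBits : ∀ k (τ : Fin k → Poly n) s → (∀ i → Easy (τ i) s) → Easy (allBits k τ) (k * (s + 2))
  easy-allBits zero τ s h = easy-one
  easy-allBits (suc k) τ s h = easy-≈ ≈-refl (≤-reflexive (l s (k * (s + 2)))) (easy-op times (easy-op plus (h zero) easy-one) (easy-allBits k (τ ∘ suc) s (h ∘ suc)))
    where
    l : ∀ s a → suc (suc (s + 0) + a) ≡ s + 2 + a
    l = NS.solve-∀

  eqB : ∀ {k} → Vec Bool k → Vec Bool k → ℕ
  eqB [] [] = 1
  eqB (true ∷ u) (true ∷ w) = eqB u w
  eqB (true ∷ u) (false ∷ w) = 0
  eqB (false ∷ u) (true ∷ w) = 0
  eqB (false ∷ u) (false ∷ w) = eqB u w

  eqB≤1 : ∀ {k} (u w : Vec Bool k) → eqB u w ≤ 1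
  eqB≤1 [] [] = ≤-refl
  eqB≤1 (true ∷ u) (true ∷ w) = eqB≤1 u w
  eqB≤1 (true ∷ u) (false ∷ w) = z≤n
  eqB≤1 (false ∷ u) (true ∷ w) = z≤n
  eqB≤1 (false ∷ u) (false ∷ w) = eqB≤1 u w

  sumR-zero : ∀ k (F : Vec Bool k → Poly n) → sumR k (λ w → ι 0 ⊗ F w) ≈ 𝟘
  sumR-zero k F = ≈-trans (sumR-*ˡ k 𝟘 F) (ᴿ-zeroˡ _)

  sumR-select : ∀ k (u : Vec Bool k) (F : Vec Bool k → Poly n) → sumR k (λ w → ι (eqB u w) ⊗ F w) ≈ F u
  sumR-select zero [] F = ≈-trans (⊗-cong (+ᴿ-idʳ 𝟙) ≈-refl) (⊗-idˡ _)
  sumR-select (suc k) (true ∷ u) F = ≈-trans (⊕-cong (sumR-select k u _) (sumR-zero k _)) (+ᴿ-idʳ _)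
  sumR-select (suc k) (false ∷ u) F = ≈-trans (⊕-cong (sumR-zero k _) (sumR-select k u _)) (⊕-idˡ _)

  -- Polynomials as lists of signed monomials

  monomial : ∀ r → (Fin r → Poly n) → (Fin r → ℕ) → Poly n
  monomial zero base e = 𝟙
  monomial (suc r) base e = base zero ^ᵖ e zero ⊗ monomial r (base ∘ suc) (e ∘ suc)

  monomial-+ : ∀ r base e e′ → monomial r base (λ i → e i + e′ i) ≈ monomial r base e ⊗ monomial r base e′
  monomial-+ zero base e e′ = ≈-sym (⊗-idˡ 𝟙)
  monomial-+ (suc r) base e e′ = ≈-trans (⊗-cong (^ᵖ-+ (base zero) (e zero) (e′ zero)) (monomial-+ r (base ∘ suc) (e ∘ suc) (e′ ∘ suc)))
    (*ᴿ-interchange _ _ _ _)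

  monomial-zero : ∀ r base → monomial r base (λ _ → 0) ≈ 𝟙
  monomial-zero zero base = ≈-refl
  monomial-zero (suc r) base = ≈-trans (⊗-idˡ _) (monomial-zero r (base ∘ suc))

  unit : ∀ {r} → Fin r → Fin r → ℕ
  unit zero zero = 1
  unit zero (suc j) = 0
  unit (suc i) zero = 0
  unit (suc i) (suc j) = unit i j

  unit≤1 : ∀ {r} (i j : Fin r) → unit i j ≤ 1
  unit≤1 zero zero = ≤-refl
  unit≤1 zero (suc j) = z≤n
  unit≤1 (suc i) zero = z≤n
  unit≤1 (suc i) (suc j) = unit≤1 i j

  monomial-unit : ∀ r base i → monomial r base (unit i) ≈ base i
  monomial-unit (suc r) base zero = ≈-trans (⊗-cong (*ᴿ-idʳ _) (monomial-zero r (base ∘ suc))) (*ᴿ-idʳ _)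
  monomial-unit (suc r) base (suc i) = ≈-trans (⊗-idˡ _) (monomial-unit r (base ∘ suc) i)

  Term : Set
  Term = Bool × (Fin n → ℕ)

  signed : Bool → Poly n → Poly n
  signed true P = P
  signed false P = ⊖ P

  term : Term → Poly n
  term (c , e) = signed c (monomial n var e)

  terms : List Term → Poly n
  terms [] = 𝟘
  terms (m ∷ ms) = term m ⊕ terms ms

  negT : Term → Term
  negT (c , e) = not c , e

  mulT : Term → Term → Term
  mulT (c , e) (c′ , e′) = xnor c c′ , λ i → e i + e′ i

  open RingProperties (CommutativeRing.ring (polyRing n)) using (-0#≈0#; -‿involutive; -‿+-comm; -‿distribˡ-*; -‿distribʳ-*)

  term-neg : ∀ m → term (negT m) ≈ ⊖ term m
  term-neg (true , e) = ≈-refl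
  term-neg (false , e) = ≈-sym (-‿involutive _)

  term-mul : ∀ m m′ → term (mulT m m′) ≈ term m ⊗ term m′
  term-mul (true , e) (true , e′) = monomial-+ n var e e′
  term-mul (true , e) (false , e′) = ≈-trans (⊖-cong (monomial-+ n var e e′)) (-‿distribʳ-* _ _)
  term-mul (false , e) (true , e′) = ≈-trans (⊖-cong (monomial-+ n var e e′)) (-‿distribˡ-* _ _)
  term-mul (false , e) (false , e′) = ≈-trans (monomial-+ n var e e′) (≈-sym (≈-trans (≈-sym (-‿distribˡ-* _ _))
    (≈-trans (⊖-cong (≈-sym (-‿distribʳ-* _ _))) (-‿involutive _))))

  terms-++ : ∀ ms ms′ → terms (ms ++ₗ ms′) ≈ terms ms ⊕ terms ms′
  terms-++ [] ms′ = ≈-sym (⊕-idˡ _)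
  terms-++ (m ∷ ms) ms′ = ≈-trans (⊕-cong ≈-refl (terms-++ ms ms′)) (≈-sym (⊕-assoc _ _ _))

  terms-neg : ∀ ms → terms (map negT ms) ≈ ⊖ terms ms
  terms-neg [] = ≈-sym -0#≈0#
  terms-neg (m ∷ ms) = ≈-trans (⊕-cong (term-neg m) (terms-neg ms)) (-‿+-comm _ _)

  terms-mulT : ∀ m ms → terms (map (mulT m) ms) ≈ term m ⊗ terms ms
  terms-mulT m [] = ≈-sym (ᴿ-zeroʳ _)
  terms-mulT m (m′ ∷ ms) = ≈-trans (⊕-cong (term-mul m m′) (terms-mulT m ms)) (≈-sym (ᴿ-distribˡ _ _ _))

  products : List Term → List Term → List Term
  products [] ms′ = []
  products (m ∷ ms) ms′ = map (mulT m) ms′ ++ₗ products ms ms′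

  terms-products : ∀ ms ms′ → terms (products ms ms′) ≈ terms ms ⊗ terms ms′
  terms-products [] ms′ = ≈-sym (ᴿ-zeroˡ _)
  terms-products (m ∷ ms) ms′ = ≈-trans (terms-++ (map (mulT m) ms′) (products ms ms′))
    (≈-trans (⊕-cong (terms-mulT m ms′) (terms-products ms ms′)) (≈-sym (distribʳ _ _ _)))

  length-products : ∀ ms ms′ → length (products ms ms′) ≡ length ms * length ms′
  length-products [] ms′ = refl
  length-products (m ∷ ms) ms′ = trans (Listₚ.length-++ (map (mulT m) ms′)) (cong₂ _+_ (Listₚ.length-map (mulT m) ms′) (length-products ms ms′))

  Degree≤ : ℕ → Term → Set
  Degree≤ D (_ , e) = ∀ i → e i ≤ D

  -- Signed monomials are repeated instead of weighted, so `number` bounds the absolute value of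
  -- every coefficient. A gate at most squares the number of terms and doubles the degrees, which
  -- raises t by one.
  record Normal (t : ℕ) (P : Poly n) : Set where
    constructor normal
    field
      support : List Term
      number  : length support ≤ 2 ^ (2 ^ t)
      degree  : All (Degree≤ (2 ^ t)) support
      equal   : P ≈ terms support

  normal-≈ : ∀ {t P Q} → P ≈ Q → Normal t P → Normal t Q
  normal-≈ h (normal ms a b e) = normal ms a b (≈-trans (≈-sym h) e)

  normal-≤ : ∀ {t u P} → t ≤ u → Normal t P → Normal u P
  normal-≤ h (normal ms a b e) = normal ms (≤-trans a (^-monoʳ-≤ 2 (^-monoʳ-≤ 2 h))) (Allₚ.map (λ p i → ≤-trans (p i) (^-monoʳ-≤ 2 h)) b) e

  normal-zero : Normal 0 𝟘
  normal-zero = normal [] z≤n [] ≈-refl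

  normal-one : Normal 0 𝟙
  normal-one = normal ((true , λ _ → 0) ∷ []) (s≤s z≤n) ((λ _ → z≤n) ∷ []) (≈-sym (≈-trans (+ᴿ-idʳ _) (monomial-zero n var)))

  normal-var : ∀ i → Normal 0 (var i)
  normal-var i = normal ((true , unit i) ∷ []) (s≤s z≤n) ((unit≤1 i) ∷ []) (≈-sym (≈-trans (+ᴿ-idʳ _) (monomial-unit n var i)))

  private
    double-≤ : ∀ t {a b} → a ≤ 2 ^ (2 ^ t) → b ≤ 2 ^ (2 ^ t) → a + b ≤ 2 ^ (2 ^ suc t)
    double-≤ t {a} {b} p q = ≤-trans (+-mono-≤ p q) (≤-trans (≤-reflexive (cong (λ z → 2 ^ (2 ^ t) + z) (sym (+-identityʳ _))))
      (^-monoʳ-≤ 2 {suc (2 ^ t)} {2 ^ suc t} (≤-trans (+-monoˡ-≤ (2 ^ t) (m^n>0 2 t)) (≤-reflexive (cong (λ z → 2 ^ t + z) (sym (+-identityʳ _)))))))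

  normal-+ : ∀ {t P Q} → Normal t P → Normal t Q → Normal (suc t) (P ⊕ Q)
  normal-+ {t} (normal ms a b e) (normal ms′ a′ b′ e′) = normal (ms ++ₗ ms′) (≤-trans (≤-reflexive (Listₚ.length-++ ms)) (double-≤ t a a′))
    (AllPₚ.++⁺ (Allₚ.map (λ {m} → up {m}) b) (Allₚ.map (λ {m} → up {m}) b′)) (≈-trans (⊕-cong e e′) (≈-sym (terms-++ ms ms′)))
    where
    up : ∀ {m} → Degree≤ (2 ^ t) m → Degree≤ (2 ^ suc t) m
    up p i = ≤-trans (p i) (m≤m+n (2 ^ t) _)

  normal-neg : ∀ {t P} → Normal t P → Normal t (⊖ P)
  normal-neg (normal ms a b e) = normal (map negT ms) (≤-trans (≤-reflexive (Listₚ.length-map negT ms)) a)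
    (AllPₚ.map⁺ (Allₚ.map (λ p → p) b)) (≈-trans (⊖-cong e) (≈-sym (terms-neg ms)))

  normal-* : ∀ {t P Q} → Normal t P → Normal t Q → Normal (suc t) (P ⊗ Q)
  normal-* {t} (normal ms a b e) (normal ms′ a′ b′ e′) = normal (products ms ms′)
    (≤-trans (≤-reflexive (length-products ms ms′)) (≤-trans (*-mono-≤ a a′) (≤-reflexive (trans (sym (^-distribˡ-+-* 2 (2 ^ t) (2 ^ t))) (cong (λ z → 2 ^ (2 ^ t + z)) (sym (+-identityʳ _)))))))
    (degrees ms b) (≈-trans (⊗-cong e e′) (≈-sym (terms-products ms ms′)))
    where
    degrees : ∀ ms → All (Degree≤ (2 ^ t)) ms → All (Degree≤ (2 ^ suc t)) (products ms ms′)
    degrees [] [] = []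
    degrees (m ∷ ms) (p ∷ ps) = AllPₚ.++⁺ (AllPₚ.map⁺ (Allₚ.map (λ q i → +-mono-≤ (p i) (≤-trans (q i) (m≤m+n (2 ^ t) 0))) b′)) (degrees ms ps)

  normal-op : ∀ o {t P Q} → Normal t P → Normal t Q → Normal (suc t) (opVal o P Q)
  normal-op plus p q = normal-+ p q
  normal-op minus p q = normal-+ p (normal-neg q)
  normal-op times p q = normal-* p q

  normal-sum : ∀ k {t} (F : Vec Bool k → Poly n) → (∀ w → Normal t (F w)) → Normal (t + k) (sumR k F)
  normal-sum zero {t} F h = normal-≤ (≤-reflexive (sym (+-identityʳ t))) (h [])
  normal-sum (suc k) {t} F h = normal-≤ (≤-reflexive (sym (+-suc t k))) (normal-+ (normal-sum k _ (λ w → h (true ∷ w))) (normal-sum k _ (λ w → h (false ∷ w))))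

  normal-prod : ∀ k {t} (F : Vec Bool k → Poly n) → (∀ w → Normal t (F w)) → Normal (t + k) (prodR k F)
  normal-prod zero {t} F h = normal-≤ (≤-reflexive (sym (+-identityʳ t))) (h [])
  normal-prod (suc k) {t} F h = normal-≤ (≤-reflexive (sym (+-suc t k))) (normal-* (normal-prod k _ (λ w → h (true ∷ w))) (normal-prod k _ (λ w → h (false ∷ w))))

  module _ {a} (σ : Fin a → Poly n) (nσ : ∀ i → Normal 0 (σ i)) where
    normal-gates : ∀ {k} (G : Gates a k) j → Normal k (subst σ (gateVals G j))
    normal-wire : ∀ {k} (G : Gates a k) w → Normal k (subst σ (wireVal (gateVals G) w))
    normal-gates (G ▷ gate plus l r) zero = normal-op plus (normal-wire G l) (normal-wire G r)
    normal-gates (G ▷ gate minus l r) zero = normal-op minus (normal-wire G l) (normal-wire G r)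
    normal-gates (G ▷ gate times l r) zero = normal-op times (normal-wire G l) (normal-wire G r)
    normal-gates {suc k} (G ▷ g) (suc j) = normal-≤ (n≤1+n k) (normal-gates G j)
    normal-wire G (inj₁ (x i)) = normal-≤ z≤n (nσ i)
    normal-wire G (inj₁ one) = normal-≤ z≤n normal-one
    normal-wire G (inj₂ j) = normal-gates G j

  -- Coefficient tables, with the offset O added to every coefficient

  module Table (b : ℕ) where

    power-table : ∀ r → (Fin r → Poly n) → Fin (r * b) → Poly n
    power-table (suc r) base j with splitAt b j
    ... | inj₁ i = squares (toℕ i) (base zero)
    ... | inj₂ i = power-table r (base ∘ suc) i

    power-table-↑ˡ : ∀ r (base : Fin (suc r) → Poly n) j → power-table (suc r) base (j ↑ˡ r * b) ≡ squares (toℕ j) (base zero)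
    power-table-↑ˡ r base j rewrite splitAt-↑ˡ b j (r * b) = refl

    power-table-↑ʳ : ∀ r (base : Fin (suc r) → Poly n) j → power-table (suc r) base (b ↑ʳ j) ≡ power-table r (base ∘ suc) j
    power-table-↑ʳ r base j rewrite splitAt-↑ʳ b (r * b) j = refl

    easy-power-table : ∀ r base s → (∀ i → Easy (base i) s) → ∀ j → Easy (power-table r base j) (b + s)
    easy-power-table (suc r) base s h j with splitAt b j
    ... | inj₁ i = easy-≈ ≈-refl (+-monoˡ-≤ s (<⇒≤ (toℕ<n i))) (easy-squares (toℕ i) (h zero))
    ... | inj₂ i = easy-power-table r (base ∘ suc) s (h ∘ suc) i

    table-step : ∀ r base (u : Vec Bool b) (w : Vec Bool (r * b)) →
                 prodBits (suc r * b) (power-table (suc r) base) (u Vec.++ w) ≈ base zero ^ᵖ val u ⊗ prodBits (r * b) (power-table r (base ∘ suc)) w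
    table-step r base u w = ≈-trans (prodBits-++ b (r * b) _ u w) (⊗-cong
      (≈-trans (≡⇒≈ (prodBits-cong b (power-table-↑ˡ r base) u)) (prodBits-squares b (base zero) u))
      (≡⇒≈ (prodBits-cong (r * b) (power-table-↑ʳ r base) w)))

    code : ∀ r → (Fin r → ℕ) → Vec Bool (r * b)
    code zero e = []
    code (suc r) e = bits b (e zero) Vec.++ code r (e ∘ suc)

    prodBits-code : ∀ r base e → (∀ i → e i < 2 ^ b) → prodBits (r * b) (power-table r base) (code r e) ≈ monomial r base e
    prodBits-code zero base e h = ≈-refl
    prodBits-code (suc r) base e h = ≈-trans (table-step r base (bits b (e zero)) (code r (e ∘ suc)))
      (⊗-cong (≡⇒≈ (cong (base zero ^ᵖ_) (val-bits b (e zero) (h zero)))) (prodBits-code r (base ∘ suc) (e ∘ suc) (h ∘ suc)))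

    W : ℕ
    W = n * b

    mon : Vec Bool W → Poly n
    mon = prodBits W (power-table n var)

    total : (Vec Bool W → ℕ) → Poly n
    total c = sumR W (λ w → ι (c w) ⊗ mon w)

    total-+ : ∀ c c′ → total (λ w → c w + c′ w) ≈ total c ⊕ total c′
    total-+ c c′ = ≈-trans (sumR-cong W (λ w → ≈-trans (⊗-cong (ι-+ (c w) (c′ w)) ≈-refl) (distribʳ _ _ _))) (sumR-+ W _ _)

    -- Starting from the constant table O, each monomial changes one entry by one. The bound
    -- `O ≤ c w + length ms` keeps entries positive whenever a negative monomial is to be
    -- subtracted, as there are at most O monomials.
    coefficients : ∀ O ms → length ms ≤ O → All (λ m → ∀ i → proj₂ m i < 2 ^ b) ms →
      ∃[ c ] ((∀ w → c w ≤ O + length ms) × (∀ w → O ≤ c w + length ms) × (terms ms ⊕ total (λ _ → O) ≈ total c))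
    coefficients O [] _ [] = (λ _ → O) , (λ w → m≤m+n O 0) , (λ w → m≤m+n O 0) , ⊕-idˡ _
    coefficients O (m ∷ ms) len≤ (p ∷ ps) = extend m p (coefficients O ms (≤-trans (n≤1+n _) len≤) ps)
      where
      Result : List Term → Set
      Result ms = ∃[ c ] ((∀ w → c w ≤ O + length ms) × (∀ w → O ≤ c w + length ms) × (terms ms ⊕ total (λ _ → O) ≈ total c))
      extend : ∀ m → (∀ i → proj₂ m i < 2 ^ b) → Result ms → Result (m ∷ ms)
      extend (s , e) h (c , hi , lo , eq′) = result s
        where
        α : Vec Bool W
        α = code n e
        δ : Vec Bool W → ℕ
        δ = eqB α
        total-δ : total δ ≈ monomial n var e
        total-δ = ≈-trans (sumR-select W α mon) (prodBits-code n var e h)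
        result : ∀ s → Result ((s , e) ∷ ms)
        result true = (λ w → c w + δ w) ,
          (λ w → ≤-trans (+-mono-≤ (hi w) (eqB≤1 α w)) (≤-reflexive (trans (+-assoc O _ 1) (cong (O +_) (+-comm _ 1))))) ,
          (λ w → ≤-trans (lo w) (+-mono-≤ (m≤m+n (c w) (δ w)) (n≤1+n _))) ,
          ≈-trans (⊕-assoc _ _ _) (≈-trans (⊕-comm _ _) (≈-trans (⊕-cong eq′ (≈-sym total-δ)) (≈-sym (total-+ c δ))))
        result false = (λ w → c w ∸ δ w) ,
          (λ w → ≤-trans (m∸n≤m (c w) (δ w)) (≤-trans (hi w) (+-monoʳ-≤ O (n≤1+n _)))) ,
          (λ w → ≤-trans (lo w) (≤-trans (+-monoˡ-≤ (length ms) (≤-reflexive (sym (back w)))) (≤-trans (≤-reflexive (+-assoc (c w ∸ δ w) (δ w) _)) (+-monoʳ-≤ (c w ∸ δ w) (+-monoˡ-≤ (length ms) (eqB≤1 α w)))))) ,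
          ≈-trans (⊕-assoc _ _ _) (≈-trans (⊕-cong (⊖-cong (≈-sym total-δ)) eq′) (≈-trans (⊕-cong ≈-refl (≈-trans (sumR-cong W (λ w → ⊗-cong (≡⇒≈ (cong ι (trans (sym (back w)) (+-comm (c w ∸ δ w) (δ w))))) ≈-refl)) (total-+ δ (λ w → c w ∸ δ w))))
            (≈-trans (≈-sym (⊕-assoc _ _ _)) (≈-trans (⊕-cong (⊖-invˡ (total δ)) ≈-refl) (⊕-idˡ _)))))
          where
          1≤c : ∀ w → 1 ≤ c w
          1≤c w = +-cancelʳ-≤ (length ms) 1 (c w) (≤-trans len≤ (lo w))
          back : ∀ w → c w ∸ δ w + δ w ≡ c w
          back w = m∸n+n≡m (≤-trans (eqB≤1 α w) (1≤c w))

-- Digits of coefficients and values at the Kronecker point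

bitAt : ℕ → ℕ → ℕ
bitAt c zero = bit (odd c)
bitAt c (suc i) = bitAt (half c) i

bitAt≤1 : ∀ c i → bitAt c i ≤ 1
bitAt≤1 c zero = bit≤1 (odd c)
bitAt≤1 c (suc i) = bitAt≤1 (half c) i

sumTo-suc : ∀ k f → sumTo (suc k) f ≡ f 0 + sumTo k (f ∘ suc)
sumTo-suc zero f = sym (+-identityʳ (f 0))
sumTo-suc (suc k) f = trans (cong (_+ f (suc k)) (sumTo-suc k f)) (+-assoc (f 0) _ _)

binary-bitAt : ∀ k c → c < 2 ^ k → binary (bitAt c) k ≡ c
binary-bitAt zero zero _ = refl
binary-bitAt zero (suc c) (s≤s ())
binary-bitAt (suc k) c lt = trans (sumTo-suc k (λ w → bitAt c w * 2 ^ w)) (trans (cong₂ _+_ (*-identityʳ (bit (odd c)))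
  (trans (sumTo-cong k (λ z _ → l (bitAt (half c) z) (2 ^ z))) (trans (sym (sumTo-*ˡ k 2 _)) (cong (2 *_) (binary-bitAt k (half c) (half-< {c} lt))))))
  (odd-half c))
  where
  l : ∀ a b → a * (2 * b) ≡ 2 * (a * b)
  l = NS.solve-∀

two : ∀ {n} → Poly n
two = 𝟙 ⊕ 𝟙

easy-two : ∀ {n} → Easy {n} two 1
easy-two = easy-op plus easy-one easy-one

module _ {n : ℕ} where
  open Evaluation (polyRing n)

  sumR-swap : ∀ a b (F : Vec Bool a → Vec Bool b → Poly n) → sumR a (λ u → sumR b (F u)) ≈ sumR b (λ w → sumR a (λ u → F u w))
  sumR-swap zero b F = ≈-refl
  sumR-swap (suc a) b F = ≈-trans (⊕-cong (sumR-swap a b _) (sumR-swap a b _)) (≈-sym (sumR-+ b _ _))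

  squares-pow : ∀ j (P : Poly n) → squares j P ≈ P ^ᵖ (2 ^ j)
  squares-pow zero P = ≈-sym (*ᴿ-idʳ P)
  squares-pow (suc j) P = ≈-trans (squares-pow j (P ⊗ P)) (^ᵖ-square P (2 ^ j))

  two-pow : ∀ k → two {n} ^ᵖ k ≈ ι (2 ^ k)
  two-pow zero = ≈-sym (+ᴿ-idʳ 𝟙)
  two-pow (suc k) = ≈-trans (⊗-cong (⊕-cong ≈-refl (≈-sym (+ᴿ-idʳ 𝟙))) (two-pow k)) (≈-sym (ι-* 2 (2 ^ k)))

  ev-sumR : ∀ (ρ : Fin n → ℤ) k (F : Vec Bool k → Poly n) → Z.ev ρ (sumR k F) ≡ Z.sumR k (Z.ev ρ ∘ F)
  ev-sumR ρ zero F = refl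
  ev-sumR ρ (suc k) F = cong₂ ℤ._+_ (ev-sumR ρ k _) (ev-sumR ρ k _)

  ev-ι : ∀ (ρ : Fin n → ℤ) k → Z.ev ρ (ι k) ≡ pos k
  ev-ι ρ zero = refl
  ev-ι ρ (suc k) = cong (λ a → 1ℤ ℤ.+ a) (ev-ι ρ k)

  ev-squares : ∀ (ρ : Fin n → ℤ) j P c → Z.ev ρ P ≡ pos c → Z.ev ρ (squares j P) ≡ pos (c ^ (2 ^ j))
  ev-squares ρ zero P c e = trans e (cong pos (sym (*-identityʳ c)))
  ev-squares ρ (suc j) P c e = trans (ev-squares ρ j (P ⊗ P) (c * c) (trans (cong₂ ℤ._*_ e e) (sym (ℤₚ.pos-* c c))))
    (cong pos (trans (cong (_^ (2 ^ j)) (cong (c *_) (sym (*-identityʳ c)))) (^-*-assoc c 2 (2 ^ j))))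

  ev-prodBits : ∀ (ρ : Fin n → ℤ) k τ c → (∀ j → Z.ev ρ (τ j) ≡ pos (c ^ (2 ^ toℕ j))) → ∀ w → Z.ev ρ (prodBits k τ w) ≡ pos (c ^ val w)
  ev-prodBits ρ zero τ c h [] = refl
  ev-prodBits ρ (suc k) τ c h (a ∷ w) = trans (cong₂ ℤ._*_ (first a) (ev-prodBits ρ k (τ ∘ suc) (c * c) (λ j → trans (h (suc j)) (cong pos (sym (sq (2 ^ toℕ j))))) w))
    (trans (sym (ℤₚ.pos-* (c ^ bit a) _)) (cong pos (trans (cong (c ^ bit a *_) (sq (val w))) (sym (^-distribˡ-+-* c (bit a) (2 * val w))))))
    where
    sq : ∀ k → (c * c) ^ k ≡ c ^ (2 * k)
    sq k = trans (cong (_^ k) (cong (c *_) (sym (*-identityʳ c)))) (^-*-assoc c 2 k)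
    first : ∀ a → Z.ev ρ (if a then τ zero else 𝟙) ≡ pos (c ^ bit a)
    first true = h zero
    first false = refl

  -- For s = 0 the j-th entry of the table becomes 2 ^ 2 ^ j, so the monomial coded by a word w
  -- turns into the positional weight 2 ^ val w. The shift s serves the induction over the fields.
  ev-power-table : ∀ (ρ : Fin n → ℤ) b r base s → (∀ i → Z.ev ρ (base i) ≡ pos (2 ^ (2 ^ (s + toℕ i * b)))) →
                   ∀ j → Z.ev ρ (Table.power-table b r base j) ≡ pos (2 ^ (2 ^ (s + toℕ j)))
  ev-power-table ρ b (suc r) base s h j with splitAt b j in eqj
  ... | inj₁ i = trans (ev-squares ρ (toℕ i) (base zero) (2 ^ (2 ^ s)) (trans (h zero) (cong (λ z → pos (2 ^ (2 ^ z))) (+-identityʳ s))))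
        (cong pos (trans (^-*-assoc 2 (2 ^ s) (2 ^ toℕ i)) (cong (2 ^_) (trans (sym (^-distribˡ-+-* 2 s (toℕ i)))
          (cong (λ z → 2 ^ (s + z)) (trans (sym (toℕ-↑ˡ i (r * b))) (cong toℕ (splitAt⁻¹-↑ˡ eqj))))))))
  ... | inj₂ i = trans (ev-power-table ρ b r (base ∘ suc) (s + b) (λ k → trans (h (suc k)) (cong (λ z → pos (2 ^ (2 ^ z))) (sym (+-assoc s b (toℕ k * b))))) i)
        (cong (λ z → pos (2 ^ (2 ^ z))) (trans (+-assoc s b (toℕ i)) (cong (s +_) (trans (sym (toℕ-↑ʳ b i)) (cong toℕ (splitAt⁻¹-↑ʳ eqj))))))

-- The product of the `t i` over the set bits of `w`. The `t i` will be variables standing for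
-- repeated squares, so the expression stays small and of low formal degree; `τ` replaces them after
-- the collapse.
selector : ∀ {n} k → (Fin k → Poly n) → (Fin k → Poly n) → Poly n
selector zero w t = 𝟙
selector (suc k) w t = (𝟙 ⊕ w zero ⊗ (t zero ⊕ ⊖ 𝟙)) ⊗ selector k (w ∘ suc) (t ∘ suc)

treeSize-selector : ∀ {n} k (w t : Fin k → Poly n) → (∀ i → treeSize (w i) ≡ 1) → (∀ i → treeSize (t i) ≡ 1) → treeSize (selector k w t) ≡ 9 * k + 1
treeSize-selector zero w t h h′ = refl
treeSize-selector (suc k) w t h h′ = trans (cong₂ (λ a b → suc (suc (1 + a) + b))
    (cong₂ (λ a b → suc (a + suc (b + 2))) (h zero) (h′ zero)) (treeSize-selector k (w ∘ suc) (t ∘ suc) (h ∘ suc) (h′ ∘ suc))) (l k)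
  where
  l : ∀ k → suc (suc (1 + suc (1 + suc (1 + 2))) + (9 * k + 1)) ≡ 9 * suc k + 1
  l = NS.solve-∀

module _ {n : ℕ} where
  open Evaluation (polyRing n)

  ev-selector : ∀ {a} (ρ : Fin a → Poly n) k w t (τ : Fin k → Poly n) (u : Vec Bool k) →
                (∀ i → ev ρ (w i) ≈ ιᵇ (lookup u i)) → (∀ i → ev ρ (t i) ≈ τ i) → ev ρ (selector k w t) ≈ prodBits k τ u
  ev-selector ρ zero w t τ [] h h′ = ≈-refl
  ev-selector ρ (suc k) w t τ (c ∷ u) h h′ = ⊗-cong (≈-trans (⊕-cong ≈-refl (⊗-cong (h zero) (⊕-cong (h′ zero) ≈-refl))) (choose′ c))
    (ev-selector ρ k (w ∘ suc) (t ∘ suc) (τ ∘ suc) u (h ∘ suc) (h′ ∘ suc))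
    where
    choose′ : ∀ c → 𝟙 ⊕ ιᵇ c ⊗ (τ zero ⊕ ⊖ 𝟙) ≈ (if c then τ zero else 𝟙)
    choose′ true = ≈-trans (⊕-cong ≈-refl (⊗-idˡ _)) (≈-trans (⊕-comm _ _) (≈-trans (⊕-assoc _ _ _) (≈-trans (⊕-cong ≈-refl (⊖-invˡ 𝟙)) (+ᴿ-idʳ _))))
    choose′ false = ≈-trans (⊕-cong ≈-refl (ᴿ-zeroˡ _)) (+ᴿ-idʳ 𝟙)

prodB : ∀ k → (Vec Bool k → ℕ) → ℕ
prodB zero F = F []
prodB (suc k) F = prodB k (λ w → F (true ∷ w)) * prodB k (λ w → F (false ∷ w))

prodTo-double : ∀ n (F : ℕ → ℕ) → prodTo (2 * n) F ≡ prodTo n (λ z → F (1 + 2 * z)) * prodTo n (λ z → F (2 * z))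
prodTo-double zero F = refl
prodTo-double (suc n) F = trans (cong (λ k → prodTo k F) (h₁ n)) (trans (cong (λ a → a * F (2 * n) * F (1 + 2 * n)) (prodTo-double n F))
  (h₂ (prodTo n (λ z → F (1 + 2 * z))) (prodTo n (λ z → F (2 * z))) (F (2 * n)) (F (1 + 2 * n))))
  where
  h₁ : ∀ n → 2 * suc n ≡ suc (suc (2 * n))
  h₁ = NS.solve-∀
  h₂ : ∀ a b c d → a * b * c * d ≡ a * d * (b * c)
  h₂ = NS.solve-∀

prodB-val : ∀ k (F : ℕ → ℕ) → prodB k (F ∘ val) ≡ prodTo (2 ^ k) F
prodB-val zero F = sym (*-identityˡ (F 0))
prodB-val (suc k) F = trans (cong₂ _*_ (prodB-val k (λ z → F (1 + 2 * z))) (prodB-val k (λ z → F (2 * z)))) (sym (prodTo-double (2 ^ k) F))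

prodB-cong : ∀ k {F G : Vec Bool k → ℕ} → (∀ w → F w ≡ G w) → prodB k F ≡ prodB k G
prodB-cong zero h = h []
prodB-cong (suc k) h = cong₂ _*_ (prodB-cong k (λ w → h (true ∷ w))) (prodB-cong k (λ w → h (false ∷ w)))

module _ {p : ℕ} (0<p : 0 < p) where

  private
    resid-mod : ∀ z → resid p z mod p ≡ resid p z
    resid-mod z = mod-small (resid< z 0<p)

  resid-+ : ∀ a b → resid p (a ℤ.+ b) ≡ (resid p a + resid p b) mod p
  resid-+ a b = sym (trans (cong (resid p) (ℤₚ.pos-+ (resid p a) (resid p b))) (resid-op p plus a b))

  resid-* : ∀ a b → resid p (a ℤ.* b) ≡ (resid p a * resid p b) mod p
  resid-* a b = sym (trans (cong (resid p) (ℤₚ.pos-* (resid p a) (resid p b))) (resid-op p times a b))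

  resid-sumB : ∀ k (F : Vec Bool k → ℤ) → resid p (Z.sumR k F) ≡ sumB k (resid p ∘ F) mod p
  resid-sumB zero F = sym (resid-mod (F []))
  resid-sumB (suc k) F = trans (resid-+ _ _) (trans (cong₂ (λ a b → (a + b) mod p) (resid-sumB k _) (resid-sumB k _)) (mod-+ p _ _))

  resid-prodB : ∀ k (F : Vec Bool k → ℤ) → resid p (Z.prodR k F) ≡ prodB k (resid p ∘ F) mod p
  resid-prodB zero F = sym (resid-mod (F []))
  resid-prodB (suc k) F = trans (resid-* _ _) (trans (cong₂ (λ a b → (a * b) mod p) (resid-prodB k _) (resid-prodB k _)) (mod-* p _ _))

  resid-sumR : ∀ k (F : Vec Bool k → ℤ) → resid p (Z.sumR k F) ≡ sumTo (2 ^ k) (λ z → resid p (F (bits k z))) mod p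
  resid-sumR k F = trans (resid-sumB k F) (cong (_mod p) (trans (sumB-cong k (λ w → cong (λ u → resid p (F u)) (sym (bits-val w)))) (sumB-val k (λ z → resid p (F (bits k z))))))

  resid-prodR : ∀ k (F : Vec Bool k → ℤ) → resid p (Z.prodR k F) ≡ prodTo (2 ^ k) (λ z → resid p (F (bits k z))) mod p
  resid-prodR k F = trans (resid-prodB k F) (cong (_mod p) (trans (prodB-cong k (λ w → cong (λ u → resid p (F u)) (sym (bits-val w)))) (prodB-val k (λ z → resid p (F (bits k z))))))

-- From the residues of one integer to a circuit for the polynomial

module Assembly (hyp : VNP0≡VP0) (v : ℕ → ℕ) (pv : PB v) (t : ℕ → ℕ) (pt : PB t)
  (b : ℕ → ℕ) (pb-b : PB b) (b-large : ∀ n → suc (2 ^ t n) < 2 ^ b n)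
  (G : ∀ n → Poly (v n)) (normalG : ∀ n → Normal (t n) (G n)) where

  -- A digit position of N is a word of v n + 1 fields of b n bits: the position within a
  -- coefficient, then one exponent per variable. `O` is the offset that makes the coefficients
  -- non-negative.
  m O : ℕ → ℕ
  m n = suc (v n) * b n
  O n = 2 ^ (2 ^ t n)

  pb-m : PB m
  pb-m = pb-* (pb-+ (pb-const 1) pv) pb-b

  open Extraction hyp m pb-m

  module _ (n : ℕ) where
    open Evaluation (polyRing (v n)) using (ι; ιᵇ; sumR; sumR-cong; sumR-++; sumR-*ˡ; sumR-*ʳ; ι-sumB; ι-*; ev; ev-boolSum; env⁺; env⁺-↑ˡ; env⁺-↑ʳ; ≋-trans; +ᴿ-idʳ)
    open Table {v n} (b n)

    shifted : ∃[ c ] ((∀ w → c w ≤ O n + length (Normal.support (normalG n))) × (∀ w → O n ≤ c w + length (Normal.support (normalG n))) ×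
                    (terms (Normal.support (normalG n)) ⊕ total (λ _ → O n) ≈ total c))
    shifted = coefficients (O n) (Normal.support (normalG n)) (Normal.number (normalG n))
      (Allₚ.map (λ p i → ≤-<-trans (p i) (<-trans (n<1+n (2 ^ t n)) (b-large n))) (Normal.degree (normalG n)))

    c : Vec Bool (v n * b n) → ℕ
    c = proj₁ shifted

    c< : ∀ α → c α < 2 ^ (2 ^ b n)
    c< α = begin-strict
      c α                     ≤⟨ ≤-trans (proj₁ (proj₂ shifted) α) (+-monoʳ-≤ (O n) (Normal.number (normalG n))) ⟩
      O n + O n               ≡⟨ cong (λ z → O n + z) (sym (+-identityʳ (O n))) ⟩
      2 ^ suc (2 ^ t n)       <⟨ ^-monoʳ-< 2 ≤-refl (b-large n) ⟩
      2 ^ (2 ^ b n)           ∎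
      where open ≤-Reasoning

    offset : Poly (v n)
    offset = total (λ _ → O n)

    -- The constant 2 is treated as a further variable, whose exponent is the position of the digit
    -- within its coefficient.
    base : Fin (suc (v n)) → Poly (v n)
    base zero = two
    base (suc i) = var i

    τ : Fin (m n) → Poly (v n)
    τ = power-table (suc (v n)) base

    dW : Vec Bool (m n) → ℕ
    dW w = bitAt (c (rightᵛ (b n) w)) (val (leftᵛ (b n) w))

    d : ℕ → ℕ
    d z = dW (bits (m n) z)

    dW≡ : ∀ w → d (val w) ≡ dW w
    dW≡ w = cong dW (bits-val w)

    d≤1 : ∀ z → d z ≤ 1
    d≤1 z = bitAt≤1 (c (rightᵛ (b n) (bits (m n) z))) (val (leftᵛ (b n) (bits (m n) z)))

    expansion : G n ⊕ offset ≈ sumR (m n) (λ w → ι (dW w) ⊗ prodBits (m n) τ w)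
    expansion = ≈-trans (⊕-cong (Normal.equal (normalG n)) ≈-refl) (≈-trans (proj₂ (proj₂ (proj₂ shifted))) (≈-sym (begin′
      (sumR-++ (b n) (v n * b n) (λ w → ι (dW w) ⊗ prodBits (m n) τ w))
      (≈-trans (sumR-cong (b n) (λ u → sumR-cong (v n * b n) (λ α → ⊗-cong
         (≡⇒≈ (cong ι (cong₂ (λ α u → bitAt (c α) (val u)) (right-++ u α) (left-++ u α))))
         (≈-trans (table-step (v n) base u α) (⊗-cong (two-pow (val u)) ≈-refl)))))
      (≈-trans (sumR-swap (b n) (v n * b n) _) (sumR-cong (v n * b n) collect))))))
      where
      begin′ : ∀ {A B C : Poly (v n)} → A ≈ B → B ≈ C → A ≈ C
      begin′ = ≈-trans
      collect : ∀ α → sumR (b n) (λ u → ι (bitAt (c α) (val u)) ⊗ (ι (2 ^ val u) ⊗ mon α)) ≈ ι (c α) ⊗ mon α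
      collect α = ≈-trans (sumR-cong (b n) (λ u → ≈-trans (≈-sym (⊗-assoc (ι (bitAt (c α) (val u))) (ι (2 ^ val u)) (mon α))) (⊗-cong (≈-sym (ι-* (bitAt (c α) (val u)) (2 ^ val u))) ≈-refl)))
        (≈-trans (sumR-*ʳ (b n) (mon α) (λ u → ι (bitAt (c α) (val u) * 2 ^ val u))) (⊗-cong (≈-trans (≈-sym (ι-sumB (b n) (λ u → bitAt (c α) (val u) * 2 ^ val u)))
          (≡⇒≈ (cong ι (trans (sumB-val (b n) (λ z → bitAt (c α) z * 2 ^ z)) (binary-bitAt (2 ^ b n) (c α) (c< α)))))) ≈-refl))

    easy-τ : ∀ j → Easy (τ j) (b n + 1)
    easy-τ = easy-power-table (suc (v n)) base 1 λ { zero → easy-two ; (suc i) → easy-≈ ≈-refl z≤n (easy-var i) }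

    -- The offset is 2 ^ 2 ^ t times the sum of all monomials with exponents below 2 ^ b, and this
    -- sum factors over the bits of the exponents; so it has a small circuit in spite of its
    -- exponentially many terms.
    offset-factors : squares (t n) two ⊗ allBits (v n * b n) (power-table (v n) var) ≈ offset
    offset-factors = ≈-trans (⊗-cong (≈-trans (squares-pow (t n) two) (two-pow (2 ^ t n))) (≈-sym (sum-prodBits (v n * b n) _))) (≈-sym (sumR-*ˡ (v n * b n) (ι (O n)) mon))

    easy-offset : Easy offset (suc (t n + 1 + v n * b n * (b n + 0 + 2)))
    easy-offset = easy-≈ offset-factors ≤-refl (easy-op times (easy-squares (t n) easy-two)
      (easy-allBits (v n * b n) _ (b n + 0) (easy-power-table (v n) var 0 easy-var)))

    -- The lowest `b n` bits of a position belong to the digit within its coefficient, so variable i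
    -- gets the weight of field i + 1.
    point : Fin (v n) → ℕ
    point i = 2 ^ (2 ^ (b n * suc (toℕ i)))

    evaluate : Poly (v n) → ℤ
    evaluate = Z.ev (pos ∘ point)

    evaluate-expansion : pos (binary d (2 ^ m n)) ≡ evaluate (G n) ℤ.+ evaluate offset
    evaluate-expansion = sym (trans (Z.ev-sound (pos ∘ point) expansion) (trans (ev-sumR (pos ∘ point) (m n) _)
      (trans (Z.sumR-cong (m n) (λ w → trans (cong₂ ℤ._*_ (ev-ι (pos ∘ point) (dW w)) (ev-prodBits (pos ∘ point) (m n) τ 2 ev-τ w))
         (trans (sym (ℤₚ.pos-* (dW w) (2 ^ val w))) (trans (cong (λ a → pos (a * 2 ^ val w)) (sym (dW≡ w))) (sym (ι-ℤ _))))))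
       (trans (sym (Z.ι-sumB (m n) (λ w → d (val w) * 2 ^ val w))) (trans (ι-ℤ _) (cong pos (sumB-val (m n) (λ z → d z * 2 ^ z))))))))
      where
      ev-base : ∀ i → evaluate (base i) ≡ pos (2 ^ (2 ^ (0 + toℕ i * b n)))
      ev-base zero = refl
      ev-base (suc i) = cong (λ z → pos (2 ^ (2 ^ z))) (*-comm (b n) (suc (toℕ i)))
      ev-τ : ∀ j → evaluate (τ j) ≡ pos (2 ^ (2 ^ toℕ j))
      ev-τ = ev-power-table (pos ∘ point) (b n) (suc (v n)) base 0 ev-base

  pointP : ∀ n {a} → Fin (v n) → Poly a
  pointP n i = squares (b n * suc (toℕ i)) two

  easy-point : ∀ n {a} i → Easy (pointP n {a} i) (b n * v n + 1)
  easy-point n i = easy-≈ ≈-refl (+-monoˡ-≤ 1 (*-monoʳ-≤ (b n) (toℕ<n i))) (easy-squares (b n * suc (toℕ i)) easy-two)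

  ev-point : ∀ n {a} (ρ : Fin a → ℤ) i → Z.ev ρ (pointP n i) ≡ pos (point n i)
  ev-point n ρ i = ev-squares ρ (b n * suc (toℕ i)) two 2 refl

  pb-point : PB (λ n → b n * v n + 1)
  pb-point = pb-+ (pb-* pb-b pv) (pb-const 1)

  offset-size : ℕ → ℕ
  offset-size n = suc (t n + 1 + v n * b n * (b n + 0 + 2))

  pb-offset : PB offset-size
  pb-offset = pb-+ {λ _ → 1} (pb-const 1) (pb-+ (pb-+ pt (pb-const 1)) (pb-* (pb-* pv pb-b) (pb-+ (pb-+ pb-b (pb-const 0)) (pb-const 2))))

  private
    abstract
      offsetC : Σ (Circuits (nbits [])) λ C → (∀ n → eval (C n) ≈ subst (pointP n) (offset n)) × PB (size ∘ C)
      offsetC = easy-circuits (nbits []) (λ n → subst (pointP n) (offset n)) (λ n → offset-size n + v n * (b n * v n + 1))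
        (pb-+ pb-offset (pb-* pv pb-point)) (λ n → easy-subst (pointP n) (easy-offset n) (easy-point n))
    module Offset = Comparisons.ModularEvaluation hyp [] (primeWidth′ ∘ m) pK (proj₁ offsetC) (proj₂ (proj₂ offsetC))

  module Finish (valueF : Feasible (P ∷ []))
    (value-ok : ∀ n p → Prime p → p < X n → fun valueF n (p , tt) ≡ resid p (evaluate n (G n))) where
    open Comparisons hyp
    open Collapse hyp

    private
      Res : Feasible (P ∷ [])
      Res = remF (valueF ⊞ Offset.modEval) (vr here)

      Res-ok : ∀ n p → Prime p → p < X n → fun Res n (p , tt) ≡ binary (d n) (H n) mod p
      Res-ok n p pr p< = trans (cong₂ (λ u w → (u + w) mod p) (value-ok n p pr p<) offset-ok)
        (trans (sym (resid-+ (≤-trans (s≤s z≤n) (prime⇒2≤ pr)) (evaluate n (G n)) (evaluate n (offset n)))) (cong (resid p) (sym (evaluate-expansion n))))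
        where
        offset-ok : fun Offset.modEval n (p , tt) ≡ resid p (evaluate n (offset n))
        offset-ok = trans (Offset.fun-modEval n p tt (prime⇒2≤ pr)) (cong (resid p) (trans (Z.ev-sound _ (proj₁ (proj₂ offsetC) n))
          (trans (Z.ev-subst _ (pointP n) (offset n)) (Z.ev-cong (ev-point n _) (offset n)))))

      module D = Digits d d≤1 Res Res-ok

      digit : ∀ n → Fm (Bits (Mw ∷ []) n)
      digit n = fm D.extractF n

      bnd : ℕ → ℕ
      bnd n = bound (digit n)

      wordVar : ∀ n → Fin (m n) → Poly (m n + (m n + bnd n))
      wordVar n j = var (m n ↑ʳ (j ↑ˡ bnd n))

      boundVar : ∀ n → Fin (bnd n) → Poly (m n + (m n + bnd n))
      boundVar n j = var (m n ↑ʳ (m n ↑ʳ j))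

      placeVar : ∀ n → Bits (Mw ∷ []) n → Poly (m n + (m n + bnd n))
      placeVar n (inj₁ j) = wordVar n j

      freeVar : ∀ n → Fin (m n) → Poly (m n + (m n + bnd n))
      freeVar n j = var (j ↑ˡ (m n + bnd n))

      -- The first m n variables are placeholders and stay free. The other m n + bnd n are summed
      -- over: the digit position and the bound variables of the digit formula.
      g : ∀ n → Poly (m n + (m n + bnd n))
      g n = matrix (digit n) (placeVar n) (boundVar n) ⊗ selector (m n) (wordVar n) (freeVar n)

      g-size : ∀ n → treeSize (g n) ≤ suc (5 * (fsize (digit n) * fsize (digit n)) + (9 * m n + 1))
      g-size n = s≤s (+-mono-≤ (treeSize-matrix (digit n) (placeVar n) (boundVar n) (λ { (inj₁ j) → refl }) (λ _ → refl))
        (≤-reflexive (treeSize-selector (m n) (wordVar n) (freeVar n) (λ _ → refl) (λ _ → refl))))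

      abstract
        found : Σ (Circuits m) λ C → (∀ n → eval (C n) ≈ boolSum {m n} {m n + bnd n} (g n)) × PB (size ∘ C)
        found = collapse m (λ n → m n + bnd n) pb-m (pb-+ pb-m (pb-mono (bound≤fsize ∘ digit) (pb D.extractF))) g
          (pb-mono g-size (pb-+ {λ _ → 1} (pb-const 1) (pb-+ (pb-* (pb-const 5) (pb-* (pb D.extractF) (pb D.extractF))) (pb-+ (pb-* (pb-const 9) pb-m) (pb-const 1)))))

      module _ (n : ℕ) where
        open Evaluation (polyRing (v n))

        summand : ∀ (u : Vec Bool (m n)) → sumR (bnd n) (λ e → ev (env⁺ (τ n) (ιᵇ ∘ lookup (u Vec.++ e))) (g n)) ≈ ι (dW n u) ⊗ prodBits (m n) (τ n) u
        summand u = ≈-trans (sumR-cong (bnd n) (λ e → ⊗-cong (matrixPart e) (selectorPart e))) (≈-trans (sumR-*ʳ (bnd n) (prodBits (m n) (τ n) u) _)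
          (⊗-cong (≈-trans (≈-sym (ι-sumB (bnd n) (mat (digit n) s))) (≡⇒≈ (cong ι value))) ≈-refl))
          where
          s : Bits (Mw ∷ []) n → Bool
          s (inj₁ j) = lookup u j
          ρ : Vec Bool (bnd n) → Fin (m n + (m n + bnd n)) → Poly (v n)
          ρ e = env⁺ (τ n) (ιᵇ ∘ lookup (u Vec.++ e))
          wordBit : ∀ e j → ρ e (m n ↑ʳ (j ↑ˡ bnd n)) ≡ ιᵇ (lookup u j)
          wordBit e j = trans (env⁺-↑ʳ (τ n) (ιᵇ ∘ lookup (u Vec.++ e)) (j ↑ˡ bnd n)) (cong ιᵇ (Vecₚ.lookup-++ˡ u e j))
          matrixPart : ∀ e → ev (ρ e) (matrix (digit n) (placeVar n) (boundVar n)) ≈ ι (mat (digit n) s e)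
          matrixPart e = MatrixEvaluation.ev-matrix (polyRing (v n)) (ρ e) (digit n) (placeVar n) (boundVar n) s e
            (λ { (inj₁ j) → ≡⇒≈ (wordBit e j) })
            (λ i → ≡⇒≈ (trans (env⁺-↑ʳ (τ n) (ιᵇ ∘ lookup (u Vec.++ e)) (m n ↑ʳ i)) (cong ιᵇ (Vecₚ.lookup-++ʳ u e i))))
          selectorPart : ∀ e → ev (ρ e) (selector (m n) (wordVar n) (freeVar n)) ≈ prodBits (m n) (τ n) u
          selectorPart e = ev-selector (ρ e) (m n) (wordVar n) (freeVar n) (τ n) u (λ j → ≡⇒≈ (wordBit e j)) (λ j → ≡⇒≈ (env⁺-↑ˡ (τ n) (ιᵇ ∘ lookup (u Vec.++ e)) j))
          value : sumB (bnd n) (mat (digit n) s) ≡ dW n u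
          value = trans (sum-mat (digit n) s) (trans (ok D.extractF n s (val u , tt) (cong val (Vecₚ.tabulate∘lookup u) , tt))
            (trans (D.fun-extractF n (val u) (val< u)) (dW≡ n u)))

        evaluated : subst (τ n) (eval (proj₁ found n)) ≈ G n ⊕ offset n
        evaluated = ≈-trans (≡⇒≈ (subst-ev (τ n) (eval (proj₁ found n)))) (≈-trans (ev-sound (τ n) (proj₁ (proj₂ found) n))
          (≈-trans (ev-boolSum {m n} {m n + bnd n} (τ n) (g n)) (≈-trans (sumR-++ (m n) (bnd n) _) (≈-trans (sumR-cong (m n) summand) (≈-sym (expansion n))))))

    final-size : ℕ → ℕ
    final-size n = suc (size (proj₁ found n) + m n * (b n + 1) + offset-size n)

    pb-final : PB final-size
    pb-final = pb-+ {λ _ → 1} (pb-const 1) (pb-+ (pb-+ (proj₂ (proj₂ found)) (pb-* pb-m (pb-+ pb-b (pb-const 1)))) pb-offset)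

    easyG : ∀ n → Easy (G n) (final-size n)
    easyG n = easy-≈ (≈-trans (⊕-cong (evaluated n) ≈-refl) (≈-trans (⊕-assoc _ _ _) (≈-trans (⊕-cong ≈-refl (≈-trans (⊕-comm _ _) (⊖-invˡ _))) (≈-trans (⊕-comm _ _) (⊕-idˡ _))))) ≤-refl
      (easy-op minus (easy-subst (τ n) (_ , computes (gates (proj₁ found n)) (output (proj₁ found n)) ≈-refl ≤-refl ≤-refl) (easy-τ n)) (easy-offset n))

-- Sums and products over the cube

module _ (v q : ℕ → ℕ) (pq : PB q) (f : ∀ n → Poly (v n + q n)) (pv : PB v)
  (C : Circuits (λ n → v n + q n)) (C-ok : ∀ n → eval (C n) ≈ f n) (pC : PB (size ∘ C)) (hyp : VNP0≡VP0) where

  -- Each gate raises the level of `Normal` by one, and so does each dimension of the cube, for a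
  -- sum as well as for a product.
  t : ℕ → ℕ
  t n = size (C n) + q n

  pt : PB t
  pt = pb-+ pC pq

  abstract
    b : ℕ → ℕ
    -- Two bits beyond t leave room in a field for degrees up to 2 ^ t, and in 2 ^ b digits for
    -- shifted coefficients up to twice 2 ^ 2 ^ t.
    b n = 2 + t n

    pb-b : PB b
    pb-b = pb-+ (pb-const 2) pt

    large : ∀ n → suc (2 ^ t n) < 2 ^ b n
    large n = ≤-trans (≤-trans (+-monoˡ-≤ (2 ^ t n) {2} {2 * 2 ^ t n} (*-monoʳ-≤ 2 (m^n>0 2 (t n)))) (m≤m+n _ (2 ^ t n))) (≤-reflexive (l (2 ^ t n)))
      where
      l : ∀ a → 2 * a + a + a ≡ 2 * (2 * a)
      l = NS.solve-∀

  Qw : Width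
  Qw = width q pq

  normal-value : ∀ n (ε : Vec Bool (q n)) → Normal (size (C n)) (Evaluation.ev (polyRing (v n)) (Evaluation.env⁺ (polyRing (v n)) var (Evaluation.ιᵇ (polyRing (v n)) ∘ lookup ε)) (f n))
  normal-value n ε = normal-≈ (≈-trans (≡⇒≈ (subst-ev σ (eval (C n)))) (ev-sound σ (C-ok n))) (normal-wire σ small (gates (C n)) (output (C n)))
    where
    open Evaluation (polyRing (v n)) using (ιᵇ; env⁺; ev-sound)
    σ : Fin (v n + q n) → Poly (v n)
    σ = env⁺ var (ιᵇ ∘ lookup ε)
    constant : ∀ c → Normal 0 (ιᵇ c)
    constant true = normal-one
    constant false = normal-zero
    small : ∀ i → Normal 0 (σ i)
    small i with splitAt (v n) i
    ... | inj₁ j = normal-var j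
    ... | inj₂ j = constant (lookup ε j)

  ev-var : ∀ n (P : Poly (v n)) → Evaluation.ev (polyRing (v n)) var P ≡ P
  ev-var n P = trans (sym (subst-ev var P)) (subst-var P)

  normal-boolSum : ∀ n → Normal (t n) (boolSum {v n} {q n} (f n))
  normal-boolSum n = normal-≈ (≈-sym (≈-trans (≡⇒≈ (sym (ev-var n _))) (ev-boolSum {v n} {q n} var (f n)))) (normal-sum (q n) _ (normal-value n))
    where open Evaluation (polyRing (v n)) using (ev-boolSum)

  normal-boolProd : ∀ n → Normal (t n) (boolProd {v n} {q n} (f n))
  normal-boolProd n = normal-≈ (≈-sym (≈-trans (≡⇒≈ (sym (ev-var n _))) (ev-boolProd {v n} {q n} var (f n)))) (normal-prod (q n) _ (normal-value n))
    where open Evaluation (polyRing (v n)) using (ev-boolProd)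

  module Values (G : ∀ n → Poly (v n)) (normalG : ∀ n → Normal (t n) (G n)) where
    open Assembly hyp v pv t pt b pb-b large G normalG public
    open Extraction hyp m pb-m public

    private
      inputP : ∀ n → Fin (q n) → Poly (nbits (Qw ∷ []) n)
      inputP n j = var (encode (Qw ∷ []) n (inj₁ j))

      σ : ∀ n → Fin (v n + q n) → Poly (nbits (Qw ∷ []) n)
      σ n i with splitAt (v n) i
      ... | inj₁ j = pointP n j
      ... | inj₂ j = inputP n j

      easy-σ : ∀ n i → Easy (σ n i) (b n * v n + 1)
      easy-σ n i with splitAt (v n) i
      ... | inj₁ j = easy-point n j
      ... | inj₂ j = easy-≈ ≈-refl z≤n (easy-var _)

      abstract
        pointC : Σ (Circuits (nbits (Qw ∷ []))) λ C → (∀ n → eval (C n) ≈ subst (σ n) (f n)) × PB (size ∘ C)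
        pointC = easy-circuits (nbits (Qw ∷ [])) (λ n → subst (σ n) (f n)) (λ n → size (C n) + (v n + q n) * (b n * v n + 1))
          (pb-+ pC (pb-* (pb-+ pv pq) pb-point)) (λ n → easy-subst (σ n) (_ , computes (gates (C n)) (output (C n)) (C-ok n) ≤-refl ≤-refl) (easy-σ n))

      module M = Comparisons.ModularEvaluation hyp (Qw ∷ []) (primeWidth′ ∘ m) pK (proj₁ pointC) (proj₂ (proj₂ pointC))

    at : ∀ n → Vec Bool (q n) → ℤ
    at n ε = Z.ev (Z.env⁺ (pos ∘ point n) (Z.ιᵇ ∘ lookup ε)) (f n)

    -- The Kronecker point turns the variables of f into constants with small circuits, which leaves
    -- a circuit in the bits of ε alone, to be evaluated modulo p.
    termF : Feasible (Qw ∷ P ∷ [])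
    termF = call (there here ∷ here ∷ []) M.modEval

    fun-termF : ∀ n p z → Prime p → fun termF n (z , p , tt) ≡ resid p (at n (bits (q n) z))
    fun-termF n p z pr = trans (M.fun-modEval n p (z , tt) (prime⇒2≤ pr)) (cong (resid p) (trans (Z.ev-sound ρ (proj₁ (proj₂ pointC) n))
      (trans (Z.ev-subst ρ (σ n) (f n)) (Z.ev-cong same (f n)))))
      where
      ρ : Fin (nbits (Qw ∷ []) n) → ℤ
      ρ = Z.ιᵇ ∘ M.inputs n (z , tt)
      same : ∀ i → Z.ev ρ (σ n i) ≡ Z.env⁺ (pos ∘ point n) (Z.ιᵇ ∘ lookup (bits (q n) z)) i
      same i with splitAt (v n) i
      ... | inj₁ j = ev-point n ρ j
      ... | inj₂ j = cong (λ u → Z.ιᵇ (envBits (Qw ∷ []) n (z , tt) u)) (decode-encode (Qw ∷ []) n (inj₁ j))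

  module CubeSums where
    open Values (λ n → boolSum {v n} {q n} (f n)) normal-boolSum

    valueF : Feasible (P ∷ [])
    valueF = Comparisons.remF hyp (Sg Qw termF) (vr here)

    value-ok : ∀ n p → Prime p → p < X n → fun valueF n (p , tt) ≡ resid p (evaluate n (boolSum {v n} {q n} (f n)))
    value-ok n p pr p< = trans (cong (_mod p) (sumTo-cong (2 ^ q n) (λ z _ → fun-termF n p z pr)))
      (trans (sym (resid-sumR (≤-trans (s≤s z≤n) (prime⇒2≤ pr)) (q n) (at n))) (cong (resid p) (sym (Z.ev-boolSum {v n} {q n} (pos ∘ point n) (f n)))))

    open Finish valueF value-ok public

  module CubeProducts where
    open Values (λ n → boolProd {v n} {q n} (f n)) normal-boolProd

    -- The values of f over the cube are multiplied modulo p by means of discrete logarithms, where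
    -- `CubeSums` adds them directly.
    module I = IteratedProduct {P ∷ []} Qw termF here

    value-ok : ∀ n p → Prime p → p < X n → fun I.productF n (p , tt) ≡ resid p (evaluate n (boolProd {v n} {q n} (f n)))
    value-ok n p pr p< = trans (I.fun-productF n (p , tt) pr p<) (trans (prodTo-mod-cong p (2 ^ q n) (λ z _ → cong (_mod p) (fun-termF n p z pr)))
      (trans (sym (resid-prodR (≤-trans (s≤s z≤n) (prime⇒2≤ pr)) (q n) (at n))) (cong (resid p) (sym (Z.ev-boolProd {v n} {q n} (pos ∘ point n) (f n))))))

    open Finish I.productF value-ok public

  easy-family : (G : ∀ n → Poly (v n)) (s : ℕ → ℕ) → PB s → (∀ n → Easy (G n) (s n)) → VP0nb (family v G)
  easy-family G s ps h = toPolyBounded pv , proj₁ found , proj₁ (proj₂ found) , toPolyBounded (proj₂ (proj₂ found))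
    where
    found : Σ (Circuits v) λ C → (∀ n → eval (C n) ≈ G n) × PB (size ∘ C)
    found = easy-circuits v G s ps h

  conclusion : VP0nb (family v (λ n → boolSum {v n} {q n} (f n))) × VP0nb (family v (λ n → boolProd {v n} {q n} (f n)))
  conclusion = easy-family _ CubeSums.final-size CubeSums.pb-final CubeSums.easyG , easy-family _ CubeProducts.final-size CubeProducts.pb-final CubeProducts.easyG

theorem4 : (v q : ℕ → ℕ) → PolyBounded q →
    (f : (n : ℕ) → Poly (v n + q n)) →
    VP0nb (family (λ n → v n + q n) f) →
    VNP0≡VP0 →
    VP0nb (family v (λ n → boolSum {v n} {q n} (f n)))
    × VP0nb (family v (λ n → boolProd {v n} {q n} (f n)))
theorem4 v q pq f (pvq , C , C-ok , pC) hyp =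
  conclusion v q (fromPolyBounded pq) f (pb-mono (λ n → m≤m+n (v n) (q n)) (fromPolyBounded pvq)) C C-ok (fromPolyBounded pC) hyp
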